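{- Let $\mathcal F(x,y,w,h)=\sum_{m\ge1,n\ge1}K_{m,n}(x,y)w^mh^n$. Then $$\mathcal F(x,y,w,h)=\frac{(1-xy)\big(hw-P(x;w,h)P(y;w,h)\big)}{(1-x)(1-y)\big(1-h-w-P(x;w,h)-P(y;w,h)\big)}.$$
   Context: Let $m,n\ge 1$. $K_{m,n}$ is the complete bipartite graph with vertex set $V=A_m\sqcup B_n$, $A_m=\{a_1,\dots,a_m\}$, $B_n=\{b_1,\dots,b_n\}$, one edge $\{a_i,b_j\}$ for every $i,j$; $a_m$ is the sink. A configuration is $u:V\to\mathbb Z$, $\mathrm{degree}(u)=\sum_cu_c$. $\Delta^{(c)}=d_c e_c-\sum_{c'\text{ adjacent to }c}e_{c'}$ ($d_c$ the graph degree, $e_c$ the indicator of $c$), $\Delta^{(C)}=\sum_{c\in C}\Delta^{(c)}$. Toppling equivalence: difference in the integer span of the $\Delta^{(c)}$; effective: toppling equivalent to a non-negative configuration; $\mathrm{rank}(u)=-1+\min\{\mathrm{degree}(f): f\ge0,\ u-f\text{ not effective}\}$. $u$ is parking if $u_c\ge0$ for $c\ne a_m$ and for every non-empty $C\subseteq V\setminus\{a_m\}$, $u-\Delta^{(C)}$ has a negative value at a vertex other than $a_m$; sorted if $u_{a_1}\le\dots\le u_{a_{m-1}}$ and $u_{b_1}\le\dots\le u_{b_n}$ (no condition at the sink). $K_{m,n}(x,y)=\sum_u x^{(m-1)(n-1)+\mathrm{rank}(u)-\mathrm{degree}(u)}y^{\mathrm{rank}(u)+1}$, summed over all parking sorted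 configurations $u$ on $K_{m,n}$ (all sink values), a formal power series; equivalently $K_{m,n}(x,y)=x^{(m-1)(n-1)}y\,\widetilde K_{m,n}(x^{ -1},xy)$ with $\widetilde K_{m,n}(d,r)=\sum_u d^{\mathrm{degree}(u)}r^{\mathrm{rank}(u)}$. A parallelogram polyomino is a non-empty union of unit cells enclosed between two north/east lattice paths with common start and end points meeting only there; area = number of cells, width/height = those of the bounding box. $P(q;w,h)=\sum_{\mathcal P}q^{\mathrm{area}}w^{\mathrm{width}}h^{\mathrm{height}}$ over all parallelogram polyominoes. -}

module Defs where

open import Algebra.Bundles.Raw using (RawRing)
import Algebra.Definitions
import Algebra.Definitions.RawMonoid as RawMonoidDefinitions
open import Data.Bool.Base using (Bool; true; false; if_then_else_)
open import Data.Fin.Base as Fin using (Fin; toℕ; fromℕ)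
import Data.Fin.Properties as Fin
open import Data.Integer.Base as ℤ using (ℤ; +_; 0ℤ; 1ℤ)
open import Data.List.Base using (List; []; _∷_; length; filter; cartesianProduct; upTo)
import Data.List.Membership.Propositional as ≡-Membership
import Data.List.Membership.Setoid as Membership
open import Data.List.Relation.Unary.Any using (Any; any?)
import Data.List.Relation.Unary.Unique.Setoid as UniqueSetoid
open import Data.Nat.Base as ℕ using (ℕ; zero; suc; _∸_)
import Data.Nat.Properties as ℕ
open import Data.Product.Base using (_×_; _,_; ∃-syntax; Σ-syntax; proj₁; proj₂)
open import Data.Sum.Base using (_⊎_; inj₁; inj₂)
import Data.Sum.Properties as Sum
open import Function.Bundles using (_⇔_)
open import Level using (Level; 0ℓ)
open import Relation.Binary.Bundles using (Setoid)
open import Relation.Binary.Definitions using (DecidableEquality)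
open import Relation.Binary.PropositionalEquality using (_≡_; _≢_; setoid; _→-setoid_)
open import Relation.Nullary using (¬_; does)
open import Relation.Nullary.Decidable using (_×-dec_)
open import Relation.Unary using (Pred; Decidable)

------------------------------------------------------------------------
-- Counting

HasCardinality : {a ℓ p : Level} (S : Setoid a ℓ) → Pred (Setoid.Carrier S) p → ℕ → Set _
HasCardinality S P k =
  ∃[ xs ] Unique xs × (∀ s → s ∈ xs ⇔ P s) × length xs ≡ k
  where
  open UniqueSetoid S using (Unique)
  open Membership S using (_∈_)

------------------------------------------------------------------------
-- Formal power series

-- R ⟦t⟧, a series being given by its sequence of coefficients.
_⟦t⟧ : RawRing 0ℓ 0ℓ → RawRing 0ℓ 0ℓ
R ⟦t⟧ = record
  { Carrier = ℕ → Carrier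
  ; _≈_     = λ f g → ∀ k → f k ≈ g k
  ; _+_     = λ f g k → f k + g k
  ; _*_     = λ f g k → sum {suc k} (λ i → f (toℕ i) * g (k ∸ toℕ i))
  ; -_      = λ f k → - f k
  ; 0#      = λ _ → 0#
  ; 1#      = λ { zero → 1# ; (suc _) → 0# }
  }
  where
  open RawRing R
  open RawMonoidDefinitions +-rawMonoid using (sum)

module _ (R : RawRing 0ℓ 0ℓ) where
  open RawRing R

  var : ℕ → Carrier
  var 1 = 1#
  var _ = 0#

  const : Carrier → ℕ → Carrier
  const r zero    = r
  const r (suc _) = 0#

ℤ⟦y⟧ ℤ⟦x,y⟧ ℤ⟦h,x,y⟧ ℤ⟦w,h,x,y⟧ : RawRing 0ℓ 0ℓ
ℤ⟦y⟧       = ℤ.+-*-rawRing ⟦t⟧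
ℤ⟦x,y⟧     = ℤ⟦y⟧ ⟦t⟧
ℤ⟦h,x,y⟧   = ℤ⟦x,y⟧ ⟦t⟧
ℤ⟦w,h,x,y⟧ = ℤ⟦h,x,y⟧ ⟦t⟧

-- For F : Series, F i j a b is the coefficient of wⁱ hʲ xᵃ yᵇ.
Series : Set
Series = RawRing.Carrier ℤ⟦w,h,x,y⟧

open RawRing ℤ⟦w,h,x,y⟧ public
  using (_≈_; _+_; _*_; -_; 0#; 1#)

infixl 6 _-_
_-_ : Series → Series → Series
f - g = f + (- g)

x y w h : Series
w = var ℤ⟦h,x,y⟧
h = const ℤ⟦h,x,y⟧ (var ℤ⟦x,y⟧)
x = const ℤ⟦h,x,y⟧ (const ℤ⟦x,y⟧ (var ℤ⟦y⟧))
y = const ℤ⟦h,x,y⟧ (const ℤ⟦x,y⟧ (const ℤ⟦y⟧ (var ℤ.+-*-rawRing)))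

-- F = N / D in the ring of formal power series: D is a unit, and F is N
-- times its inverse.
infix 4 _≈_/_
_≈_/_ : Series → Series → Series → Set
F ≈ N / D = Σ[ D⁻¹ ∈ Invertible 1# _*_ D ] F ≈ N * proj₁ D⁻¹
  where open Algebra.Definitions _≈_ using (Invertible)

------------------------------------------------------------------------
-- The sandpile model on the complete bipartite graph K_{m,n}

module CompleteBipartite (m n : ℕ) where

  -- inj₁ i is the vertex a_{i+1} and inj₂ j is b_{j+1}.
  V : Set
  V = Fin m ⊎ Fin n

  _≟_ : DecidableEquality V
  _≟_ = Sum.≡-dec Fin._≟_ Fin._≟_

  adjacent : V → V → Bool
  adjacent (inj₁ _) (inj₂ _) = true
  adjacent (inj₂ _) (inj₁ _) = true
  adjacent _        _        = false

  Config : Set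
  Config = V → ℤ

  ∑ : (V → ℤ) → ℤ
  ∑ f = sum (λ i → f (inj₁ i)) ℤ.+ sum (λ j → f (inj₂ j))
    where open RawMonoidDefinitions ℤ.+-0-rawMonoid using (sum)

  [_] : Bool → ℤ
  [ b ] = if b then 1ℤ else 0ℤ

  e : V → Config
  e c c′ = [ does (c ≟ c′) ]

  deg : V → ℤ
  deg c = ∑ (λ c′ → [ adjacent c c′ ])

  _⊖_ : Config → Config → Config
  (u ⊖ v) c = u c ℤ.- v c

  degree : Config → ℤ
  degree u = ∑ u

  Δ : V → Config
  Δ c = (λ v → deg c ℤ.* e c v) ⊖ (λ v → ∑ (λ c′ → [ adjacent c c′ ] ℤ.* e c′ v))

  ΔSet : (V → Bool) → Config
  ΔSet C v = ∑ (λ c → [ C c ] ℤ.* Δ c v)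

  NonNegative : Config → Set
  NonNegative u = ∀ c → 0ℤ ℤ.≤ u c

  _∼_ : Config → Config → Set
  u ∼ v = Σ[ k ∈ (V → ℤ) ] ∀ c → (u ⊖ v) c ≡ ∑ (λ c′ → k c′ ℤ.* Δ c′ c)

  Effective : Config → Set
  Effective u = ∃[ v ] NonNegative v × u ∼ v

  BreaksEffectiveness : Config → Config → Set
  BreaksEffectiveness u f = NonNegative f × ¬ Effective (u ⊖ f)

  -- r is the rank of u: 1 + r is the least degree of an f ≥ 0 for which
  -- u - f is not effective.
  HasRank : Config → ℤ → Set
  HasRank u r =
    (∃[ f ] BreaksEffectiveness u f × degree f ≡ 1ℤ ℤ.+ r) ×
    (∀ f → BreaksEffectiveness u f → 1ℤ ℤ.+ r ℤ.≤ degree f)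

-- K_{m,n} for m = 1 + m₁ and n = 1 + n₁.
module ParkingSorted (m₁ n₁ : ℕ) where
  open CompleteBipartite (suc m₁) (suc n₁) public

  sink : V
  sink = inj₁ (fromℕ m₁)

  Parking : Config → Set
  Parking u =
    (∀ c → c ≢ sink → 0ℤ ℤ.≤ u c) ×
    (∀ (C : V → Bool) → C sink ≡ false → (∃[ c ] C c ≡ true) →
      ∃[ c ] c ≢ sink × (u ⊖ ΔSet C) c ℤ.< 0ℤ)

  Sorted : Config → Set
  Sorted u =
    (∀ i j → inj₁ i ≢ sink → inj₁ j ≢ sink → i Fin.≤ j → u (inj₁ i) ℤ.≤ u (inj₁ j)) ×
    (∀ i j → i Fin.≤ j → u (inj₂ i) ℤ.≤ u (inj₂ j))

  ParkingSorted : Config → Set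
  ParkingSorted u = Parking u × Sorted u

  -- u contributes the monomial xᵃ yᵇ to K_{m,n}(x,y).
  HasMonomial : Config → ℕ → ℕ → Set
  HasMonomial u a b = ∃[ r ] HasRank u r
    × + a ≡ + (m₁ ℕ.* n₁) ℤ.+ r ℤ.- degree u
    × + b ≡ r ℤ.+ 1ℤ

  -- k a b is the coefficient of xᵃ yᵇ in K_{m,n}(x,y).  The first component
  -- says that every term of the sum has natural number exponents, so that
  -- no configuration is dropped by indexing the coefficients by ℕ.
  IsK : (ℕ → ℕ → ℕ) → Set
  IsK k =
    (∀ u → ParkingSorted u → ∃[ a ] ∃[ b ] HasMonomial u a b) ×
    (∀ a b → HasCardinality (V →-setoid ℤ)
               (λ u → ParkingSorted u × HasMonomial u a b) (k a b))

-- K p q a b is the coefficient of xᵃ yᵇ in K_{p+1,q+1}(x,y).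
IsKFamily : (ℕ → ℕ → ℕ → ℕ → ℕ) → Set
IsKFamily K = ∀ p q → ParkingSorted.IsK p q (K p q)

-- Σ_{m,n≥1} K_{m,n}(x,y) wᵐ hⁿ
𝓕[_] : (ℕ → ℕ → ℕ → ℕ → ℕ) → Series
𝓕[ K ] (suc p) (suc q) a b = + K p q a b
𝓕[ K ] _       _       _ _ = 0ℤ

------------------------------------------------------------------------
-- Parallelogram polyominoes

data Step : Set where
  N E : Step

Path : Set
Path = List Step

Point : Set
Point = ℕ × ℕ

origin : Point
origin = 0 , 0

step : Step → Point → Point
step N (i , j) = i , suc j
step E (i , j) = suc i , j

pointsFrom : Point → Path → List Point
pointsFrom P []      = P ∷ []
pointsFrom P (s ∷ p) = P ∷ pointsFrom (step s P) p

points : Path → List Point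
points = pointsFrom origin

endFrom : Point → Path → Point
endFrom P []      = P
endFrom P (s ∷ p) = endFrom (step s P) p

end : Path → Point
end = endFrom origin

-- The cell (i , j) is the square [i , i+1] × [j , j+1].  A path passes above
-- it when it visits a point weakly north-west of the corner (i , j+1), and
-- below it when it visits a point weakly south-east of the corner (i+1 , j).
PassesAbove PassesBelow : Path → Point → Set
PassesAbove p (i , j) = Any (λ P → proj₁ P ℕ.≤ i × suc j ℕ.≤ proj₂ P) (points p)
PassesBelow p (i , j) = Any (λ P → suc i ℕ.≤ proj₁ P × proj₂ P ℕ.≤ j) (points p)

Enclosed : Path → Path → Pred Point 0ℓ
Enclosed upper lower c = PassesAbove upper c × PassesBelow lower c

enclosed? : ∀ upper lower → Decidable (Enclosed upper lower)
enclosed? upper lower (i , j) =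
  any? (λ P → (proj₁ P ℕ.≤? i) ×-dec (suc j ℕ.≤? proj₂ P)) (points upper) ×-dec
  any? (λ P → (suc i ℕ.≤? proj₁ P) ×-dec (proj₂ P ℕ.≤? j)) (points lower)

-- Enclosed cells lie in the bounding box [0 , i] × [0 , j] of the upper path,
-- where (i , j) is its end point, so these are all of them.
cells : Path → Path → List Point
cells upper lower = filter (enclosed? upper lower)
  (cartesianProduct (upTo (proj₁ (end upper))) (upTo (proj₂ (end upper))))

area : Path × Path → ℕ
area (upper , lower) = length (cells upper lower)

width height : Path × Path → ℕ
width  (upper , _) = proj₁ (end upper)
height (upper , _) = proj₂ (end upper)

-- A parallelogram polyomino, up to translation, is given by its pair of
-- boundary paths.  Non-emptiness also forces the first path to be the upper
-- one, since otherwise no cell is enclosed.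
IsParallelogramPolyomino : Path × Path → Set
IsParallelogramPolyomino (upper , lower) =
  end upper ≡ end lower ×
  (∀ P → P ∈ points upper → P ∈ points lower → P ≡ origin ⊎ P ≡ end upper) ×
  cells upper lower ≢ []
  where open ≡-Membership using (_∈_)

-- π a i j is the coefficient of qᵃ wⁱ hʲ in P(q;w,h).
IsP : (ℕ → ℕ → ℕ → ℕ) → Set
IsP π = ∀ a i j → HasCardinality (setoid (Path × Path))
  (λ 𝓟 → IsParallelogramPolyomino 𝓟 × area 𝓟 ≡ a × width 𝓟 ≡ i × height 𝓟 ≡ j)
  (π a i j)

-- P(x;w,h) and P(y;w,h) as series in all four variables.
P⟨x⟩[_] P⟨y⟩[_] : (ℕ → ℕ → ℕ → ℕ) → Series
P⟨x⟩[ π ] i j a zero    = + π a i j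
P⟨x⟩[ π ] i j a (suc _) = 0ℤ
P⟨y⟩[ π ] i j zero    b = + π b i j
P⟨y⟩[ π ] i j (suc _) b = 0ℤ

module Submission where

-- A configuration is read as two periodic staircases, A(S) = Σᵢ ⌊(aᵢ + S)/n⌋ and
-- B(T) = Σⱼ ⌊(bⱼ + T)/m⌋.  Toppling shifts them, so the configuration is effective iff the
-- regions {T ≤ A S} and {S ≤ B T} overlap; rank + 1 is the number of overlap points in one
-- period, and the exponent of x is the number of points of the gap between the regions.
-- Followed simultaneously, antidiagonal by antidiagonal, from the corner of the sink, the
-- two boundary paths become a closed walk of their level difference, and this is a bijection
-- on parking sorted configurations.  The walks are counted by a transfer operator.
-- Moving the marked corner by one level multiplies a walk by x or y, which telescopes to the
-- factor (1 - xy)/((1 - x)(1 - y)); the excursions of the walk on either side of level 0 are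
-- the parallelogram polyominoes, their area being that of the polyomino.

-- The levels of a period add up to degree(u) + m + n - mn, by Hermite's identity and summation by
-- parts; so once the overlap is known to be rank + 1, the gap is the exponent of x. Removing chips
-- lowers the levels, in total by the number of chips, so a chip costs at most one point of overlap;
-- taken at a suitable corner of the first path inside the overlap it costs at least one.
--
-- In a period S advances n times (step N, weight h) and T advances m times (step E, weight w). The
-- floor of the sink jumps at S = -u(sink), so there the first path arrives by E and leaves by N.
-- Toppling translates both paths and this corner alike; parking selects the translate in which the
-- paths without the sink meet last at the origin.
--
-- Decompositions of walks are proved by recursion, not by cutting words: both sides satisfy the
-- same first-letter recursion, which has one solution since every letter carries w or h. The marked
-- corner may lie at any level, so the sum over levels is infinite; it is evaluated up to level N,
-- with errors of order N in x and y.

-- The ring of formal power series over a commutative ring.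

module FormalSeries where
  open import Defs using (_⟦t⟧; var; const)
  open import Algebra.Bundles using (CommutativeRing)
  open import Algebra.Bundles.Raw using (RawRing)
  open import Data.Integer.Base as ℤ using (ℤ)
  import Data.Integer.Properties as ℤ
  open import Data.Nat.Base as ℕ using (zero; suc)
  open import Data.Product.Base using (_,_)
  open import Function.Base using (_∘_)
  open import Level using (0ℓ)
  open import Relation.Binary.PropositionalEquality.Core using () renaming (refl to ≡-refl)
  open import Algebra.Solver.Ring.AlmostCommutativeRing using (_-Raw-AlmostCommutative⟶_; fromCommutativeRing)

  module Series (R : CommutativeRing 0ℓ 0ℓ) where
    open CommutativeRing R
    open import Relation.Binary.Reasoning.Setoid setoid
    open import Algebra.Properties.Ring ring using (-0#≈0#)
    open import Algebra.Properties.CommutativeSemigroup +-commutativeSemigroup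
      using (interchange)

    private module T = RawRing (rawRing ⟦t⟧)

    ∗-zero : ∀ f g → (f T.* g) 0 ≈ f 0 * g 0
    ∗-zero f g = +-identityʳ _

    ∗-cong : ∀ {f f′ g g′} → f T.≈ f′ → g T.≈ g′ → (f T.* g) T.≈ (f′ T.* g′)
    ∗-cong p q zero    = +-congʳ (*-cong (p 0) (q 0))
    ∗-cong p q (suc k) = +-cong (*-cong (p 0) (q (suc k))) (∗-cong (p ∘ suc) q k)

    ∗-zeroˡ : ∀ g → (T.0# T.* g) T.≈ T.0#
    ∗-zeroˡ g zero    = trans (+-identityʳ _) (zeroˡ _)
    ∗-zeroˡ g (suc k) = trans (+-cong (zeroˡ _) (∗-zeroˡ g k)) (+-identityˡ _)

    ∗-distribʳ : ∀ g f f′ → ((f T.+ f′) T.* g) T.≈ ((f T.* g) T.+ (f′ T.* g))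
    ∗-distribʳ g f f′ zero = begin
      (f 0 + f′ 0) * g 0 + 0#                 ≈⟨ +-identityʳ _ ⟩
      (f 0 + f′ 0) * g 0                      ≈⟨ distribʳ _ _ _ ⟩
      f 0 * g 0 + f′ 0 * g 0                  ≈⟨ +-cong (∗-zero f g) (∗-zero f′ g) ⟨
      (f T.* g) 0 + (f′ T.* g) 0              ∎
    ∗-distribʳ g f f′ (suc k) = begin
      (f 0 + f′ 0) * g (suc k) + (((f ∘ suc) T.+ (f′ ∘ suc)) T.* g) k
        ≈⟨ +-cong (distribʳ _ _ _) (∗-distribʳ g (f ∘ suc) (f′ ∘ suc) k) ⟩
      _ ≈⟨ interchange _ _ _ _ ⟩
      _ ∎

    ∗-scaleˡ : ∀ c f g k → ((λ i → c * f i) T.* g) k ≈ c * (f T.* g) k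
    ∗-scaleˡ c f g zero = begin
      c * f 0 * g 0 + 0#   ≈⟨ +-identityʳ _ ⟩
      c * f 0 * g 0        ≈⟨ *-assoc _ _ _ ⟩
      c * (f 0 * g 0)      ≈⟨ *-congˡ (∗-zero f g) ⟨
      c * (f T.* g) 0      ∎
    ∗-scaleˡ c f g (suc k) = begin
      c * f 0 * g (suc k) + ((λ i → c * f (suc i)) T.* g) k
        ≈⟨ +-cong (*-assoc _ _ _) (∗-scaleˡ c (f ∘ suc) g k) ⟩
      c * (f 0 * g (suc k)) + c * ((f ∘ suc) T.* g) k
        ≈⟨ distribˡ _ _ _ ⟨
      c * (f T.* g) (suc k) ∎

    -- The product unfolds by splitting off `f 0`; commutativity also needs the term at the other
    -- end.
    ∗-snoc : ∀ f g k → (f T.* g) (suc k) ≈ (f T.* (g ∘ suc)) k + f (suc k) * g 0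
    ∗-snoc f g zero = begin
      f 0 * g 1 + (f 1 * g 0 + 0#)   ≈⟨ +-cong (sym (+-identityʳ _)) (+-identityʳ _) ⟩
      (f 0 * g 1 + 0#) + f 1 * g 0   ∎
    ∗-snoc f g (suc k) = begin
      f 0 * g (suc (suc k)) + ((f ∘ suc) T.* g) (suc k)
        ≈⟨ +-congˡ (∗-snoc (f ∘ suc) g k) ⟩
      f 0 * g (suc (suc k)) + (((f ∘ suc) T.* (g ∘ suc)) k + f (suc (suc k)) * g 0)
        ≈⟨ +-assoc _ _ _ ⟨
      _ ∎

    ∗-comm : ∀ f g → (f T.* g) T.≈ (g T.* f)
    ∗-comm f g zero    = +-congʳ (*-comm _ _)
    ∗-comm f g (suc k) = begin
      f 0 * g (suc k) + ((f ∘ suc) T.* g) k  ≈⟨ +-cong (*-comm _ _) (∗-comm (f ∘ suc) g k) ⟩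
      g (suc k) * f 0 + (g T.* (f ∘ suc)) k  ≈⟨ +-comm _ _ ⟩
      (g T.* (f ∘ suc)) k + g (suc k) * f 0  ≈⟨ ∗-snoc g f k ⟨
      (g T.* f) (suc k)                      ∎

    ∗-assoc : ∀ f g h → ((f T.* g) T.* h) T.≈ (f T.* (g T.* h))
    ∗-assoc f g h zero = begin
      (f T.* g) 0 * h 0 + 0#   ≈⟨ +-identityʳ _ ⟩
      (f T.* g) 0 * h 0        ≈⟨ *-congʳ (∗-zero f g) ⟩
      f 0 * g 0 * h 0          ≈⟨ *-assoc _ _ _ ⟩
      f 0 * (g 0 * h 0)        ≈⟨ *-congˡ (∗-zero g h) ⟨
      f 0 * (g T.* h) 0        ≈⟨ ∗-zero f (g T.* h) ⟨
      (f T.* (g T.* h)) 0      ∎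
    ∗-assoc f g h (suc k) = begin
      (f T.* g) 0 * h (suc k) + (((λ i → f 0 * g (suc i)) T.+ ((f ∘ suc) T.* g)) T.* h) k
        ≈⟨ +-cong (*-congʳ (∗-zero f g)) (∗-distribʳ h (λ i → f 0 * g (suc i)) ((f ∘ suc) T.* g) k) ⟩
      f 0 * g 0 * h (suc k) + (((λ i → f 0 * g (suc i)) T.* h) k + (((f ∘ suc) T.* g) T.* h) k)
        ≈⟨ +-cong (*-assoc _ _ _) (+-cong (∗-scaleˡ (f 0) (g ∘ suc) h k) (∗-assoc (f ∘ suc) g h k)) ⟩
      f 0 * (g 0 * h (suc k)) + (f 0 * ((g ∘ suc) T.* h) k + ((f ∘ suc) T.* (g T.* h)) k)
        ≈⟨ +-assoc _ _ _ ⟨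
      f 0 * (g 0 * h (suc k)) + f 0 * ((g ∘ suc) T.* h) k + ((f ∘ suc) T.* (g T.* h)) k
        ≈⟨ +-congʳ (distribˡ _ _ _) ⟨
      (f T.* (g T.* h)) (suc k) ∎

    ∗-identityˡ : ∀ f → (T.1# T.* f) T.≈ f
    ∗-identityˡ f zero    = trans (+-identityʳ _) (*-identityˡ _)
    ∗-identityˡ f (suc k) = trans (+-cong (*-identityˡ _) (∗-zeroˡ f k)) (+-identityʳ _)

    seriesRing : CommutativeRing 0ℓ 0ℓ
    seriesRing = record
      { Carrier = T.Carrier ; _≈_ = T._≈_ ; _+_ = T._+_ ; _*_ = T._*_ ; -_ = T.-_
      ; 0# = T.0# ; 1# = T.1#
      ; isCommutativeRing = record
        { isRing = record
          { +-isAbelianGroup = record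
            { isGroup = record
              { isMonoid = record
                { isSemigroup = record
                  { isMagma = record
                    { isEquivalence = record
                      { refl  = λ _ → refl
                      ; sym   = λ p k → sym (p k)
                      ; trans = λ p q k → trans (p k) (q k) }
                    ; ∙-cong = λ p q k → +-cong (p k) (q k) }
                  ; assoc = λ f g h k → +-assoc _ _ _ }
                ; identity = (λ f k → +-identityˡ _) , (λ f k → +-identityʳ _) }
              ; inverse = (λ f k → -‿inverseˡ _) , (λ f k → -‿inverseʳ _)
              ; ⁻¹-cong = λ p k → -‿cong (p k) }
            ; comm = λ f g k → +-comm _ _ }
          ; *-cong = ∗-cong
          ; *-assoc = ∗-assoc
          ; *-identity = ∗-identityˡ , λ f k → trans (∗-comm f T.1# k) (∗-identityˡ f k)
          ; distrib = (λ f g h k → trans (∗-comm f (g T.+ h) k) (trans (∗-distribʳ f g h k)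
                         (+-cong (∗-comm g f k) (∗-comm h f k))))
                    , ∗-distribʳ }
        ; *-comm = ∗-comm } }

    const-* : ∀ c f k → (const rawRing c T.* f) k ≈ c * f k
    const-* c f zero    = +-identityʳ _
    const-* c f (suc k) = trans (+-congˡ (∗-zeroˡ f k)) (+-identityʳ _)

    var-*-zero : ∀ f → (var rawRing T.* f) 0 ≈ 0#
    var-*-zero f = trans (+-identityʳ _) (zeroˡ _)

    var-*-suc : ∀ f k → (var rawRing T.* f) (suc k) ≈ f k
    var-*-suc f k = begin
      0# * f (suc k) + ((var rawRing ∘ suc) T.* f) k  ≈⟨ +-cong (zeroˡ _) (∗-cong {g = f} eq (λ _ → refl) k) ⟩
      0# + (T.1# T.* f) k                             ≈⟨ +-identityˡ _ ⟩
      (T.1# T.* f) k                                  ≈⟨ ∗-identityˡ f k ⟩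
      f k                                             ∎
      where
      eq : (var rawRing ∘ suc) T.≈ T.1#
      eq zero    = refl
      eq (suc _) = refl

    -- Carries integer constants through one more variable; four applications provide the integer
    -- coefficients of the ring solver over `𝕊`.
    const-hom : (ℤ.+-*-rawRing -Raw-AlmostCommutative⟶ fromCommutativeRing R)
              → ℤ.+-*-rawRing -Raw-AlmostCommutative⟶ fromCommutativeRing seriesRing
    const-hom φ = record
      { ⟦_⟧    = λ c → const rawRing ⟦ c ⟧
      ; +-homo = λ { a b zero → +-homo a b ; a b (suc k) → sym (+-identityˡ _) }
      ; *-homo = λ { a b zero → trans (*-homo a b) (sym (const-* ⟦ a ⟧ (const rawRing ⟦ b ⟧) 0))
                   ; a b (suc k) → sym (trans (const-* ⟦ a ⟧ (const rawRing ⟦ b ⟧) (suc k)) (zeroʳ _)) }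
      ; -‿homo = λ { a zero → -‿homo a ; a (suc k) → sym -0#≈0# }
      ; 0-homo = λ { zero → 0-homo ; (suc k) → refl }
      ; 1-homo = λ { zero → 1-homo ; (suc k) → refl }
      }
      where open _-Raw-AlmostCommutative⟶_ φ

-- Coefficients in four variables, weights of letters, and order in x and y.

module Coefficients where
  open FormalSeries using (module Series)
  open import Defs using (Series; x; y; w; h; var; const; ℤ⟦y⟧; ℤ⟦x,y⟧)
  open import Algebra.Bundles using (CommutativeRing)
  open import Data.Integer.Base as ℤ using (ℤ; +_; -[1+_]; 0ℤ)
  import Data.Integer.Properties as ℤ
  open import Data.Nat.Base as ℕ using (ℕ; zero; suc; _≤_; _<_; s≤s)
  import Data.Nat.Properties as ℕ
  open import Data.Sum.Base using (_⊎_; inj₁; inj₂)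
  open import Level using (0ℓ)
  open import Relation.Binary.PropositionalEquality using (_≡_; refl; sym; trans; cong; cong₂)
  open import Algebra.Solver.Ring.AlmostCommutativeRing using (_-Raw-AlmostCommutative⟶_; fromCommutativeRing; -raw-almostCommutative⟶)

  private
    module S₁ = Series ℤ.+-*-commutativeRing
    module S₂ = Series S₁.seriesRing
    module S₃ = Series S₂.seriesRing
    module S₄ = Series S₃.seriesRing

  𝕊 : CommutativeRing 0ℓ 0ℓ
  𝕊 = S₄.seriesRing

  constants : ℤ.+-*-rawRing -Raw-AlmostCommutative⟶ fromCommutativeRing 𝕊
  constants = S₄.const-hom (S₃.const-hom (S₂.const-hom (S₁.const-hom
    (-raw-almostCommutative⟶ (fromCommutativeRing ℤ.+-*-commutativeRing)))))

  open CommutativeRing 𝕊 using (_≈_; _+_; _*_; -_; 0#; 1#)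

  private
    X₂ : CommutativeRing.Carrier S₂.seriesRing
    X₂ = var ℤ⟦y⟧
    X₃ Y₃ H₃ : CommutativeRing.Carrier S₃.seriesRing
    Y₁ : CommutativeRing.Carrier S₁.seriesRing
    Y₁ = var ℤ.+-*-rawRing
    Y₂ : CommutativeRing.Carrier S₂.seriesRing
    Y₂ = const ℤ⟦y⟧ Y₁
    X₃ = const ℤ⟦x,y⟧ X₂
    Y₃ = const ℤ⟦x,y⟧ Y₂
    H₃ = var ℤ⟦x,y⟧

  w*-zero : ∀ f j a b → (w * f) 0 j a b ≡ 0ℤ
  w*-zero f = S₄.var-*-zero f

  w*-suc : ∀ f i j a b → (w * f) (suc i) j a b ≡ f i j a b
  w*-suc f i = S₄.var-*-suc f i

  h*-zero : ∀ f i a b → (h * f) i 0 a b ≡ 0ℤ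
  h*-zero f i a b = trans (S₄.const-* H₃ f i 0 a b) (S₃.var-*-zero (f i) a b)

  h*-suc : ∀ f i j a b → (h * f) i (suc j) a b ≡ f i j a b
  h*-suc f i j a b = trans (S₄.const-* H₃ f i (suc j) a b) (S₃.var-*-suc (f i) j a b)

  x*-zero : ∀ f i j b → (x * f) i j 0 b ≡ 0ℤ
  x*-zero f i j b = trans (S₄.const-* X₃ f i j 0 b) (trans (S₃.const-* X₂ (f i) j 0 b)
    (S₂.var-*-zero (f i j) b))

  x*-suc : ∀ f i j a b → (x * f) i j (suc a) b ≡ f i j a b
  x*-suc f i j a b = trans (S₄.const-* X₃ f i j (suc a) b) (trans (S₃.const-* X₂ (f i) j (suc a) b)
    (S₂.var-*-suc (f i j) a b))

  y*-zero : ∀ f i j a → (y * f) i j a 0 ≡ 0ℤ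
  y*-zero f i j a = trans (S₄.const-* Y₃ f i j a 0) (trans (S₃.const-* Y₂ (f i) j a 0)
    (trans (S₂.const-* Y₁ (f i j) a 0) (S₁.var-*-zero (f i j a))))

  y*-suc : ∀ f i j a b → (y * f) i j a (suc b) ≡ f i j a b
  y*-suc f i j a b = trans (S₄.const-* Y₃ f i j a (suc b)) (trans (S₃.const-* Y₂ (f i) j a (suc b))
    (trans (S₂.const-* Y₁ (f i j) a (suc b)) (S₁.var-*-suc (f i j a) b)))

  x^ y^ : ℕ → Series
  x^ zero    = 1#
  x^ (suc n) = x * x^ n
  y^ zero    = 1#
  y^ (suc n) = y * y^ n

  -- The weight of a letter read at level d: a factor y for each point of the overlap on its
  -- antidiagonal, or a factor x for each point of the gap.
  q : ℤ → Series
  q (+ n)    = y^ n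
  q -[1+ n ] = x^ (suc n)

  open CommutativeRing 𝕊 using (*-identityˡ; *-assoc)

  private
    Vanishes : (i j : ℕ) → Series → Set
    Vanishes i j f = ∀ a b → f i j a b ≡ 0ℤ

    x*-vanishes : ∀ i j f → Vanishes i j f → Vanishes i j (x * f)
    x*-vanishes i j f p zero    b = x*-zero f i j b
    x*-vanishes i j f p (suc a) b = trans (x*-suc f i j a b) (p a b)

    y*-vanishes : ∀ i j f → Vanishes i j f → Vanishes i j (y * f)
    y*-vanishes i j f p a zero    = y*-zero f i j a
    y*-vanishes i j f p a (suc b) = trans (y*-suc f i j a b) (p a b)

    x^*-vanishes : ∀ i j n f → Vanishes i j f → Vanishes i j (x^ n * f)
    x^*-vanishes i j zero    f p a b = trans (*-identityˡ f i j a b) (p a b)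
    x^*-vanishes i j (suc n) f p a b =
      trans (*-assoc x (x^ n) f i j a b) (x*-vanishes i j (x^ n * f) (x^*-vanishes i j n f p) a b)

    y^*-vanishes : ∀ i j n f → Vanishes i j f → Vanishes i j (y^ n * f)
    y^*-vanishes i j zero    f p a b = trans (*-identityˡ f i j a b) (p a b)
    y^*-vanishes i j (suc n) f p a b =
      trans (*-assoc y (y^ n) f i j a b) (y*-vanishes i j (y^ n * f) (y^*-vanishes i j n f p) a b)

    q*-vanishes : ∀ i j d f → Vanishes i j f → Vanishes i j (q d * f)
    q*-vanishes i j (+ n)    = y^*-vanishes i j n
    q*-vanishes i j -[1+ n ] = x^*-vanishes i j (suc n)

    w*-vanishes : ∀ i j f → (∀ i′ → i ≡ suc i′ → Vanishes i′ j f) → Vanishes i j (w * f)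
    w*-vanishes zero    j f p = w*-zero f j
    w*-vanishes (suc i) j f p a b = trans (w*-suc f i j a b) (p i refl a b)

    h*-vanishes : ∀ i j f → (∀ j′ → j ≡ suc j′ → Vanishes i j′ f) → Vanishes i j (h * f)
    h*-vanishes i zero    f p = h*-zero f i
    h*-vanishes i (suc j) f p a b = trans (h*-suc f i j a b) (p j refl a b)

    +-vanishes : ∀ i j f g → Vanishes i j f → Vanishes i j g → Vanishes i j (f + g)
    +-vanishes i j f g p r a b = cong₂ ℤ._+_ (p a b) (r a b)

  -- One letter read at level d: f continues after a step E of the first path, g after a step N.
  transfer : ℤ → Series → Series → Series
  transfer d f g = q d * (w * f + h * g)

  private
    transfer-vanishes : ∀ i j d f g →
      (∀ i′ → i ≡ suc i′ → Vanishes i′ j f) → (∀ j′ → j ≡ suc j′ → Vanishes i j′ g) →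
      Vanishes i j (transfer d f g)
    transfer-vanishes i j d f g p r = q*-vanishes i j d (w * f + h * g)
      (+-vanishes i j (w * f) (h * g) (w*-vanishes i j f p) (h*-vanishes i j g r))

  -- A step of a walk carries a factor w or h, so that the transfer operator is a
  -- contraction.
  walk-unique : ∀ (Y : ℤ → Series) →
    (∀ d → Y d ≈ 0# ⊎ Y d ≈ transfer d (Y d + Y (ℤ.suc d)) (Y d + Y (ℤ.pred d))) →
    ∀ d → Y d ≈ 0#
  walk-unique Y eq d i j = go (i ℕ.+ j) d i j ℕ.≤-refl
    where
    -- The levels reached are unbounded, so all d are treated at once and n bounds the total
    -- exponent of w and h.
    go : ∀ n d i j → i ℕ.+ j ≤ n → Vanishes i j (Y d)
    both : ∀ n d d′ i j → suc (i ℕ.+ j) ≤ n → Vanishes i j (Y d + Y d′)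
    both (suc n) d d′ i j (s≤s le) =
      +-vanishes i j (Y d) (Y d′) (go n d i j le) (go n d′ i j le)
    case : ∀ n d i j → i ℕ.+ j ≤ n →
      Y d ≈ 0# ⊎ Y d ≈ transfer d (Y d + Y (ℤ.suc d)) (Y d + Y (ℤ.pred d)) → Vanishes i j (Y d)
    case n d i j le (inj₁ p) = p i j
    case n d i j le (inj₂ p) a b = trans (p i j a b)
      (transfer-vanishes i j d (Y d + Y (ℤ.suc d)) (Y d + Y (ℤ.pred d))
        (λ { i′ refl → both n d (ℤ.suc d) i′ j le })
        (λ { j′ refl → both n d (ℤ.pred d) i j′
                         (ℕ.≤-trans (ℕ.≤-reflexive (sym (ℕ.+-suc i j′))) le) }) a b)
    go n d i j le = case n d i j le (eq d)

  -- f is divisible by all monomials of degree N in x and y.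
  Small : ℕ → Series → Set
  Small N f = ∀ i j a b → a ℕ.+ b < N → f i j a b ≡ 0ℤ

  small-+ : ∀ {N} f g → Small N f → Small N g → Small N (f + g)
  small-+ f g p r i j a b lt = cong₂ ℤ._+_ (p i j a b lt) (r i j a b lt)

  small-neg : ∀ {N} f → Small N f → Small N (- f)
  small-neg f p i j a b lt = cong (ℤ.-_) (p i j a b lt)

  small-x* : ∀ {N} f → Small N f → Small (suc N) (x * f)
  small-x* f p i j zero    b lt = x*-zero f i j b
  small-x* f p i j (suc a) b (s≤s lt) = trans (x*-suc f i j a b) (p i j a b lt)

  small-y* : ∀ {N} f → Small N f → Small (suc N) (y * f)
  small-y* f p i j a zero    lt = y*-zero f i j a
  small-y* f p i j a (suc b) lt = trans (y*-suc f i j a b)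
    (p i j a b (ℕ.≤-pred (ℕ.≤-trans (ℕ.≤-reflexive (cong suc (sym (ℕ.+-suc a b)))) lt)))

  small-weaken : ∀ {M N} f → M ≤ N → Small N f → Small M f
  small-weaken f M≤N p i j a b lt = p i j a b (ℕ.≤-trans lt M≤N)

  small-≈ : ∀ {N} f g → f ≈ g → Small N g → Small N f
  small-≈ f g eq p i j a b lt = trans (eq i j a b) (p i j a b lt)

  small-y^* : ∀ N f → Small N (y^ N * f)
  small-y^* zero    f i j a b ()
  small-y^* (suc N) f = small-≈ (y^ (suc N) * f) (y * (y^ N * f)) (*-assoc y (y^ N) f) (small-y* (y^ N * f) (small-y^* N f))

  small-x^* : ∀ N f → Small N (x^ N * f)
  small-x^* zero    f i j a b ()
  small-x^* (suc N) f = small-≈ (x^ (suc N) * f) (x * (x^ N * f)) (*-assoc x (x^ N) f) (small-x* (x^ N * f) (small-x^* N f))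

  small-q* : ∀ d f → Small ℤ.∣ d ∣ (q d * f)
  small-q* (+ n)    = small-y^* n
  small-q* -[1+ n ] = small-x^* (suc n)

  small-all : ∀ f → (∀ N → Small N f) → f ≈ 0#
  small-all f p i j a b = p (suc (a ℕ.+ b)) i j a b ℕ.≤-refl

-- The transfer operator: telescoping over the level of the corner, and excursions.

module TransferOperator where
  open import Algebra.Bundles using (CommutativeRing)
  open import Data.Bool.Base using (if_then_else_)
  open import Data.Empty using (⊥-elim)
  open import Data.Integer.Base as ℤ using (ℤ; +_; -[1+_]; +[1+_]; 0ℤ; 1ℤ; -1ℤ)
  import Data.Integer.Properties as ℤ
  open import Data.Maybe.Base as Maybe using (Maybe)
  open import Data.Nat.Base as ℕ using (ℕ; zero; suc)
  open import Data.Sum.Base using (_⊎_; inj₁; inj₂)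
  open import Level using (0ℓ)
  open import Relation.Binary.PropositionalEquality as ≡ using (_≡_; _≢_)
  open import Relation.Nullary using (does; yes; no)
  open import Relation.Nullary.Decidable using (dec⇒maybe)
  open import Algebra.Solver.Ring.AlmostCommutativeRing using (_-Raw-AlmostCommutative⟶_; fromCommutativeRing)
  import Algebra.Solver.Ring

  module _ (R : CommutativeRing 0ℓ 0ℓ) where
    open CommutativeRing R

    transferBy : (ℤ → Carrier) → Carrier → Carrier → ℤ → Carrier → Carrier → Carrier
    transferBy q w h d f g = q d * (w * f + h * g)

    -- The recursion is solved over an arbitrary commutative ring; of the power series only the laws
    -- of `q` and the uniqueness of solutions enter.
    module Transfer
      (φ : ℤ.+-*-rawRing -Raw-AlmostCommutative⟶ fromCommutativeRing R)
      (w h x y : Carrier)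
      (q : ℤ → Carrier)
      (q₀ : q 0ℤ ≈ 1#)
      (q-suc : ∀ n → q +[1+ n ] ≈ y * q (+ n))
      (q-pred : ∀ n → q -[1+ n ] ≈ x * q (ℤ.- (+ n)))
      (unique : ∀ (Y : ℤ → Carrier) →
         (∀ d → Y d ≈ 0# ⊎ Y d ≈ transferBy q w h d (Y d + Y (ℤ.suc d)) (Y d + Y (ℤ.pred d))) →
         ∀ d → Y d ≈ 0#)
      where

      private
        tr : ℤ → Carrier → Carrier → Carrier
        tr = transferBy q w h

      private
        module φ = _-Raw-AlmostCommutative⟶_ φ

        -- φ, but with the coefficients 0 and 1 denoting 0# and 1# on the nose.
        ⟦_⟧ : ℤ → Carrier
        ⟦ + 0 ⟧ = 0#
        ⟦ + 1 ⟧ = 1#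
        ⟦ i ⟧   = φ.⟦ i ⟧

        ⟦⟧≈φ : ∀ i → ⟦ i ⟧ ≈ φ.⟦ i ⟧
        ⟦⟧≈φ (+ 0)           = sym φ.0-homo
        ⟦⟧≈φ (+ 1)           = sym φ.1-homo
        ⟦⟧≈φ (+ suc (suc _)) = refl
        ⟦⟧≈φ -[1+ _ ]        = refl

        coefficients : ℤ.+-*-rawRing -Raw-AlmostCommutative⟶ fromCommutativeRing R
        coefficients = record
          { ⟦_⟧    = ⟦_⟧
          ; +-homo = λ i j → trans (⟦⟧≈φ (i ℤ.+ j)) (trans (φ.+-homo i j)
                       (sym (+-cong (⟦⟧≈φ i) (⟦⟧≈φ j))))
          ; *-homo = λ i j → trans (⟦⟧≈φ (i ℤ.* j)) (trans (φ.*-homo i j)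
                       (sym (*-cong (⟦⟧≈φ i) (⟦⟧≈φ j))))
          ; -‿homo = λ i → trans (⟦⟧≈φ (ℤ.- i)) (trans (φ.-‿homo i) (sym (-‿cong (⟦⟧≈φ i))))
          ; 0-homo = refl
          ; 1-homo = refl
          }

      open Algebra.Solver.Ring ℤ.+-*-rawRing (fromCommutativeRing R) coefficients
        (λ a b → Maybe.map (λ a≡b → reflexive (≡.cong ⟦_⟧ a≡b)) (dec⇒maybe (a ℤ.≟ b)))
        using (solve; _:=_; _:+_; _:*_; _:-_; :-_; con)

      -- The first-letter recursion of a family of walks indexed by the starting level; b collects
      -- the walks that are not a letter followed by a walk of the same family.
      Solution : (ℤ → Carrier) → (ℤ → Carrier) → Set
      Solution b Y = ∀ d → Y d ≈ b d + tr d (Y d + Y (ℤ.suc d)) (Y d + Y (ℤ.pred d))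

      -- A ≈ B follows from L ≈ R once A - B = L - R identically.
      linear : ∀ {A B L R} → L ≈ R → A + R ≈ B + L → A ≈ B
      linear {A} {B} {L} {R} L≈R eq = +-cancelʳ-≈ (trans eq (+-congˡ L≈R))
        where
        open import Algebra.Properties.Group +-group using () renaming (∙-cancelʳ to cancelʳ)
        +-cancelʳ-≈ : A + R ≈ B + R → A ≈ B
        +-cancelʳ-≈ = cancelʳ R A B

      minus-eq : ∀ A B → A + 0# ≈ B + (A - B)
      minus-eq = solve 2 (λ a b → a :+ con 0ℤ := b :+ (a :- b)) refl

      δ : ℤ → ℤ → Carrier
      δ e d = if does (e ℤ.≟ d) then 1# else 0#

      δ-refl : ∀ d → δ d d ≈ 1#
      δ-refl d with d ℤ.≟ d
      ... | yes _ = refl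
      ... | no d≢d = ⊥-elim (d≢d ≡.refl)

      δ-≢ : ∀ {e d} → e ≢ d → δ e d ≈ 0#
      δ-≢ {e} {d} e≢d with e ℤ.≟ d
      ... | yes e≡d = ⊥-elim (e≢d e≡d)
      ... | no _    = refl

      δ-q : ∀ e d → δ e d * q e ≈ δ e d * q d
      δ-q e d with e ℤ.≟ d
      ... | yes ≡.refl = refl
      ... | no _       = trans (zeroˡ _) (sym (zeroˡ _))

      δ-suc : ∀ e d → δ (ℤ.suc e) d ≈ δ e (ℤ.pred d)
      δ-suc e d with ℤ.suc e ℤ.≟ d | e ℤ.≟ ℤ.pred d
      ... | yes _ | yes _ = refl
      ... | no _  | no _  = refl
      ... | yes ≡.refl | no ≢ = ⊥-elim (≢ (≡.sym (ℤ.pred-suc e)))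
      ... | no ≢ | yes ≡.refl = ⊥-elim (≢ (ℤ.suc-pred d))

      δ-pred : ∀ e d → δ (ℤ.pred e) d ≈ δ e (ℤ.suc d)
      δ-pred e d with ℤ.pred e ℤ.≟ d | e ℤ.≟ ℤ.suc d
      ... | yes _ | yes _ = refl
      ... | no _  | no _  = refl
      ... | yes ≡.refl | no ≢ = ⊥-elim (≢ (≡.sym (ℤ.suc-pred e)))
      ... | no ≢ | yes ≡.refl = ⊥-elim (≢ (ℤ.pred-suc d))

      -- The difference of two solutions satisfies the homogeneous recursion, so `unique` makes it
      -- vanish.
      solution-unique : ∀ {b Y Z} → Solution b Y → Solution b Z → ∀ d → Y d ≈ Z d
      solution-unique {b} {Y} {Z} sY sZ d =
        linear (unique (λ d → Y d - Z d) (λ d → inj₂ (step d)) d)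
          (solve 2 (λ a b → a :+ con 0ℤ := b :+ (a :- b)) refl (Y d) (Z d))
        where
        step : ∀ d → Y d - Z d ≈ tr d ((Y d - Z d) + (Y (ℤ.suc d) - Z (ℤ.suc d)))
                                      ((Y d - Z d) + (Y (ℤ.pred d) - Z (ℤ.pred d)))
        step d = linear (+-cong (sY d) (-‿cong (sZ d)))
          (solve 10 (λ q w h b a₀ a₁ a₂ b₀ b₁ b₂ →
             (a₀ :- b₀) :+ ((b :+ q :* (w :* (a₀ :+ a₁) :+ h :* (a₀ :+ a₂)))
                         :- (b :+ q :* (w :* (b₀ :+ b₁) :+ h :* (b₀ :+ b₂))))
             := q :* (w :* ((a₀ :- b₀) :+ (a₁ :- b₁)) :+ h :* ((a₀ :- b₀) :+ (a₂ :- b₂)))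
                :+ (a₀ :- b₀))
           refl (q d) w h (b d) (Y d) (Y (ℤ.suc d)) (Y (ℤ.pred d)) (Z d) (Z (ℤ.suc d)) (Z (ℤ.pred d)))

      -- `W e d` stands for the walks from level e to level d, `P d` for those from d that stop on
      -- first reaching 0.
      module Walks
        (W : ℤ → ℤ → Carrier)
        (W-step : ∀ d → Solution (λ e → δ e d) (λ e → W e d))
        (P : ℤ → Carrier)
        (P₀ : P 0ℤ ≈ 1#)
        (P-step : ∀ d → d ≢ 0ℤ → P d ≈ tr d (P d + P (ℤ.suc d)) (P d + P (ℤ.pred d)))
        where

        -- Walks ending at c, the last step of the first path being V, respectively H.
        endV endH : ℤ → ℤ → Carrier
        endV c e = W e c * (q c * w) + W e (ℤ.pred c) * (q (ℤ.pred c) * w)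
        endH c e = W e c * (q c * h) + W e (ℤ.suc c) * (q (ℤ.suc c) * h)

        -- The walks of a single letter: a step V of the first path has weight w and keeps the level
        -- or raises it by one.
        endV-base : ℤ → ℤ → Carrier
        endV-base c e = δ e c * (q c * w) + δ e (ℤ.pred c) * (q (ℤ.pred c) * w)

        -- The last letter is a factor that does not depend on the start e, so `endV c` is a
        -- combination of two columns of W and inherits their recursion.
        endV-step : ∀ c → Solution (endV-base c) (endV c)
        endV-step c e = linear
          (+-cong (*-congʳ (W-step c e)) (*-congʳ (W-step (ℤ.pred c) e)))
          (solve 13 (λ q w h u v d₀ d₁ a₀ a₁ a₂ b₀ b₁ b₂ →
            (a₀ :* u :+ b₀ :* v) :+
              ((d₀ :+ q :* (w :* (a₀ :+ a₁) :+ h :* (a₀ :+ a₂))) :* u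
               :+ (d₁ :+ q :* (w :* (b₀ :+ b₁) :+ h :* (b₀ :+ b₂))) :* v)
            := ((d₀ :* u :+ d₁ :* v) :+ q :*
                 (w :* ((a₀ :* u :+ b₀ :* v) :+ (a₁ :* u :+ b₁ :* v))
                  :+ h :* ((a₀ :* u :+ b₀ :* v) :+ (a₂ :* u :+ b₂ :* v))))
               :+ (a₀ :* u :+ b₀ :* v))
          refl (q e) w h (q c * w) (q (ℤ.pred c) * w) (δ e c) (δ e (ℤ.pred c))
          (W e c) (W (ℤ.suc e) c) (W (ℤ.pred e) c)
          (W e (ℤ.pred c)) (W (ℤ.suc e) (ℤ.pred c)) (W (ℤ.pred e) (ℤ.pred c)))

        endH-base : ℤ → ℤ → Carrier
        endH-base c e = δ e c * (q c * h) + δ e (ℤ.suc c) * (q (ℤ.suc c) * h)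

        endH-step : ∀ c → Solution (endH-base c) (endH c)
        endH-step c e = linear
          (+-cong (*-congʳ (W-step c e)) (*-congʳ (W-step (ℤ.suc c) e)))
          (solve 13 (λ q w h u v d₀ d₁ a₀ a₁ a₂ b₀ b₁ b₂ →
            (a₀ :* u :+ b₀ :* v) :+
              ((d₀ :+ q :* (w :* (a₀ :+ a₁) :+ h :* (a₀ :+ a₂))) :* u
               :+ (d₁ :+ q :* (w :* (b₀ :+ b₁) :+ h :* (b₀ :+ b₂))) :* v)
            := ((d₀ :* u :+ d₁ :* v) :+ q :*
                 (w :* ((a₀ :* u :+ b₀ :* v) :+ (a₁ :* u :+ b₁ :* v))
                  :+ h :* ((a₀ :* u :+ b₀ :* v) :+ (a₂ :* u :+ b₂ :* v))))
               :+ (a₀ :* u :+ b₀ :* v))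
          refl (q e) w h (q c * h) (q (ℤ.suc c) * h) (δ e c) (δ e (ℤ.suc c))
          (W e c) (W (ℤ.suc e) c) (W (ℤ.pred e) c)
          (W e (ℤ.suc c)) (W (ℤ.suc e) (ℤ.suc c)) (W (ℤ.pred e) (ℤ.suc c)))

        -- The decomposition by the last step, which both sides satisfy the same
        -- first-step recursion.
        W-last : ∀ d e → W e d ≈ δ e d + (endV d e + endH d e)
        W-last d = solution-unique {b = λ e → δ e d} (W-step d) sol
          where
          -- The walks of a single letter, weighed at the level before the last letter on the left
          -- and at the starting level on the right; `δ-q` identifies the two.
          base : ∀ e → endV-base d e + endH-base d e
                     ≈ tr e (δ e d + δ (ℤ.suc e) d) (δ e d + δ (ℤ.pred e) d)
          base e = begin
            endV-base d e + endH-base d e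
              ≈⟨ solve 8 (λ w h a b c d₀ d₁ d₂ →
                   (d₀ :* (a :* w) :+ d₁ :* (b :* w)) :+ (d₀ :* (a :* h) :+ d₂ :* (c :* h))
                   := w :* (d₀ :* a :+ d₁ :* b) :+ h :* (d₀ :* a :+ d₂ :* c)) refl
                 w h (q d) (q (ℤ.pred d)) (q (ℤ.suc d)) (δ e d) (δ e (ℤ.pred d)) (δ e (ℤ.suc d)) ⟩
            w * (δ e d * q d + δ e (ℤ.pred d) * q (ℤ.pred d))
              + h * (δ e d * q d + δ e (ℤ.suc d) * q (ℤ.suc d))
              ≈⟨ +-cong (*-congˡ (+-cong (δ-q e d) (δ-q e (ℤ.pred d))))
                        (*-congˡ (+-cong (δ-q e d) (δ-q e (ℤ.suc d)))) ⟨
            w * (δ e d * q e + δ e (ℤ.pred d) * q e)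
              + h * (δ e d * q e + δ e (ℤ.suc d) * q e)
              ≈⟨ +-cong (*-congˡ (+-congˡ (*-congʳ (δ-suc e d))))
                        (*-congˡ (+-congˡ (*-congʳ (δ-pred e d)))) ⟨
            w * (δ e d * q e + δ (ℤ.suc e) d * q e)
              + h * (δ e d * q e + δ (ℤ.pred e) d * q e)
              ≈⟨ solve 6 (λ w h a d₀ d₁ d₂ →
                   w :* (d₀ :* a :+ d₁ :* a) :+ h :* (d₀ :* a :+ d₂ :* a)
                   := a :* (w :* (d₀ :+ d₁) :+ h :* (d₀ :+ d₂))) refl
                 w h (q e) (δ e d) (δ (ℤ.suc e) d) (δ (ℤ.pred e) d) ⟩
            tr e (δ e d + δ (ℤ.suc e) d) (δ e d + δ (ℤ.pred e) d) ∎
            where open import Relation.Binary.Reasoning.Setoid setoid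
          sol : Solution (λ e → δ e d) (λ e → δ e d + (endV d e + endH d e))
          sol e = linear (+-cong (+-cong (endV-step d e) (endH-step d e)) (base e))
            (solve 14 (λ q w h d₀ d₁ d₂ bV bH a₀ a₁ a₂ b₀ b₁ b₂ →
              (d₀ :+ (a₀ :+ b₀)) :+
                (((bV :+ q :* (w :* (a₀ :+ a₁) :+ h :* (a₀ :+ a₂)))
                :+ (bH :+ q :* (w :* (b₀ :+ b₁) :+ h :* (b₀ :+ b₂))))
                :+ q :* (w :* (d₀ :+ d₁) :+ h :* (d₀ :+ d₂)))
              := (d₀ :+ q :* (w :* ((d₀ :+ (a₀ :+ b₀)) :+ (d₁ :+ (a₁ :+ b₁)))
                           :+ h :* ((d₀ :+ (a₀ :+ b₀)) :+ (d₂ :+ (a₂ :+ b₂)))))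
                 :+ ((a₀ :+ b₀) :+ (bV :+ bH)))
            refl (q e) w h (δ e d) (δ (ℤ.suc e) d) (δ (ℤ.pred e) d) (endV-base d e) (endH-base d e)
            (endV d e) (endV d (ℤ.suc e)) (endV d (ℤ.pred e))
            (endH d e) (endH d (ℤ.suc e)) (endH d (ℤ.pred e)))

        -- Closed walks from c, sorted by the first and last steps of the first path.
        HV VH VV : ℤ → Carrier
        HV c = q c * (h * (endV c c + endV c (ℤ.pred c)))
        VH c = q c * (w * (endH c c + endH c (ℤ.suc c)))
        VV c = q c * (w * (endV c c + endV c (ℤ.suc c)))

        private
          -- What `VH c` and `HV (suc c)` have in common: everything except the weight of the level
          -- at the marked corner.
          K : ℤ → Carrier
          K c = w * h * (W c c * q c + W c (ℤ.suc c) * q (ℤ.suc c)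
                         + W (ℤ.suc c) c * q c + W (ℤ.suc c) (ℤ.suc c) * q (ℤ.suc c))

          VH-K : ∀ c → VH c ≈ q c * K c
          VH-K c = solve 9 (λ w h q₀ q₁ qc a b c d →
            qc :* (w :* ((a :* (q₀ :* h) :+ b :* (q₁ :* h)) :+ (c :* (q₀ :* h) :+ d :* (q₁ :* h))))
            := qc :* (w :* h :* (a :* q₀ :+ b :* q₁ :+ c :* q₀ :+ d :* q₁))) refl
            w h (q c) (q (ℤ.suc c)) (q c) (W c c) (W c (ℤ.suc c)) (W (ℤ.suc c) c) (W (ℤ.suc c) (ℤ.suc c))

          HV-K : ∀ c → HV (ℤ.suc c) ≈ q (ℤ.suc c) * K c
          HV-K c rewrite ℤ.pred-suc c = solve 9 (λ w h q₀ q₁ qc a b c d →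
            qc :* (h :* ((d :* (q₁ :* w) :+ c :* (q₀ :* w)) :+ (b :* (q₁ :* w) :+ a :* (q₀ :* w))))
            := qc :* (w :* h :* (a :* q₀ :+ b :* q₁ :+ c :* q₀ :+ d :* q₁))) refl
            w h (q c) (q (ℤ.suc c)) (q (ℤ.suc c)) (W c c) (W c (ℤ.suc c)) (W (ℤ.suc c) c) (W (ℤ.suc c) (ℤ.suc c))

        -- Exchanging the two letters of the first path at the marked corner moves
        -- the corner by one level.
        HV-suc : ∀ n → HV +[1+ n ] ≈ y * VH (+ n)
        HV-suc n = trans (HV-K (+ n)) (trans (*-congʳ (q-suc n))
          (trans (*-assoc _ _ _) (*-congˡ (sym (VH-K (+ n))))))

        -- At the levels up to 0, lowering the corner by one adds a point to the gap, hence the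
        -- factor x.
        VH-pred : ∀ n → VH -[1+ n ] ≈ x * HV (ℤ.- (+ n))
        VH-pred n = trans (VH-K -[1+ n ]) (trans (*-congʳ (q-pred n))
          (trans (*-assoc _ _ _) (*-congˡ (sym HV-K′))))
          where
          eq : ∀ n → ℤ.suc -[1+ n ] ≡ ℤ.- (+ n)
          eq zero    = ≡.refl
          eq (suc n) = ≡.refl
          HV-K′ : HV (ℤ.- (+ n)) ≈ q (ℤ.- (+ n)) * K -[1+ n ]
          HV-K′ = ≡.subst (λ d → HV d ≈ q d * K -[1+ n ]) (eq n) (HV-K -[1+ n ])

        -- Closed walks with a marked V step of the first path, from d to d′.
        markV : ℤ → ℤ → Carrier
        markV d d′ = q d * w * W d′ d

        -- Closed walks from c whose first path opens with V, sorted by its last step: H, or V, or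
        -- the opening step itself when the walk has one letter. On the right the opening step is
        -- the marked one.
        VH-mark : ∀ c → VH c + VV c + q c * w ≈ markV c c + markV c (ℤ.suc c)
        VH-mark c = sym (linear
          (*-congˡ {q c * w} (+-cong (trans (W-last c c) (+-congʳ (δ-refl c)))
            (trans (W-last c (ℤ.suc c)) (+-congʳ (δ-≢ {ℤ.suc c} {c} (λ eq → ℤ.i≢suc[i] (≡.sym eq)))))))
          (solve 8 (λ q w a b aV aH bV bH →
            (q :* w :* a :+ q :* w :* b) :+ q :* w :* ((con 1ℤ :+ (aV :+ aH)) :+ (con 0ℤ :+ (bV :+ bH)))
            := (q :* (w :* (aH :+ bH)) :+ q :* (w :* (aV :+ bV)) :+ q :* w) :+ (q :* w) :* (a :+ b))
          refl (q c) w (W c c) (W (ℤ.suc c) c) (endV c c) (endH c c) (endV c (ℤ.suc c)) (endH c (ℤ.suc c))))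

        -- Now the closing step V is the marked one, arriving at c from c or from `pred c`; the
        -- opening step is H, or V, or the closing step itself.
        HV-mark : ∀ c → HV c + VV c + q c * w ≈ markV c c + markV (ℤ.pred c) c
        HV-mark c = sym (linear
          (trans (endV-step c c) (+-congʳ (+-cong (*-congʳ (δ-refl c))
             (*-congʳ (δ-≢ (λ eq → ℤ.i≢suc[i] (≡.trans (≡.sym eq) (≡.sym (ℤ.suc-pred c)))))))))
          (solve 10 (λ q q′ w h a b V₀ V₁ V₂ o →
            (q :* w :* a :+ q′ :* w :* b)
              :+ ((con 1ℤ :* (q :* w) :+ con 0ℤ :* (q′ :* w)) :+ q :* (w :* (V₀ :+ V₁) :+ h :* (V₀ :+ V₂)))
            := (q :* (h :* (V₀ :+ V₂)) :+ q :* (w :* (V₀ :+ V₁)) :+ q :* w)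
               :+ (a :* (q :* w) :+ b :* (q′ :* w)))
          refl (q c) (q (ℤ.pred c)) w h (W c c) (W c (ℤ.pred c)) (endV c c) (endV c (ℤ.suc c))
            (endV c (ℤ.pred c)) 1#))

        -- Closed walks with a marked V step climbing from c to `suc c`. Only these terms
        -- distinguish the right sides of `VH-mark` and `HV-mark`, and they telescope.
        ε : ℤ → Carrier
        ε c = markV c (ℤ.suc c)

        ε-pred : ∀ c → markV (ℤ.pred c) c ≈ ε (ℤ.pred c)
        ε-pred c = reflexive (≡.cong (markV (ℤ.pred c)) (≡.sym (ℤ.suc-pred c)))

        balance : ∀ c → HV c + ε c ≈ VH c + ε (ℤ.pred c)
        balance c = linear
          (+-cong (trans (HV-mark c) (+-congˡ (ε-pred c))) (sym (VH-mark c)))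
          (solve 7 (λ HV VH VV q m e e′ →
            (HV :+ e) :+ ((m :+ e′) :+ (VH :+ VV :+ q))
            := (VH :+ e′) :+ ((HV :+ VV :+ q) :+ (m :+ e)))
          refl (HV c) (VH c) (VV c) (q c * w) (markV c c) (ε c) (ε (ℤ.pred c)))

        -- The common initial value of the two telescoping sums, which `G-eq` evaluates by
        -- excursions.
        G : Carrier
        G = markV 0ℤ 0ℤ - VV 0ℤ - q 0ℤ * w

        ΣVH ΣHV : ℕ → Carrier
        ΣVH zero    = 0#
        ΣVH (suc N) = ΣVH N + VH (+ N)
        ΣHV zero    = 0#
        ΣHV (suc N) = ΣHV N + HV (ℤ.- (+ N))

        errVH errHV : ℕ → Carrier
        errVH N = ε (+ N) - VH (+ N)
        errHV N = ε -[1+ N ] - HV (ℤ.- (+ N))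

        -- Since `y * VH (+ N)` is `HV` one level higher, `balance` writes 1 - y times a summand as
        -- the difference of two consecutive errors.
        ΣVH-telescope : ∀ N → (1# - y) * ΣVH N ≈ G + errVH N
        ΣVH-telescope zero = linear (VH-mark 0ℤ)
          (solve 6 (λ y VH VV q m e →
            (con 1ℤ :- y) :* con 0ℤ :+ (m :+ e)
            := ((m :- VV :- q) :+ (e :- VH)) :+ (VH :+ VV :+ q))
          refl y (VH 0ℤ) (VV 0ℤ) (q 0ℤ * w) (markV 0ℤ 0ℤ) (ε 0ℤ))
        ΣVH-telescope (suc N) = linear
          (+-cong (ΣVH-telescope N) (sym (trans (+-congʳ (sym (HV-suc N))) (balance +[1+ N ]))))
          (solve 7 (λ y A v v′ e e′ G →
            (con 1ℤ :- y) :* (A :+ v) :+ ((G :+ (e :- v)) :+ (y :* v :+ e′))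
            := (G :+ (e′ :- v′)) :+ ((con 1ℤ :- y) :* A :+ (v′ :+ e)))
          refl y (ΣVH N) (VH (+ N)) (VH +[1+ N ]) (ε (+ N)) (ε +[1+ N ]) G)

        ΣHV-telescope : ∀ N → (1# - x) * ΣHV N ≈ G + errHV N
        ΣHV-telescope zero = linear (HV-mark 0ℤ)
          (solve 6 (λ x HV VV q m e →
            (con 1ℤ :- x) :* con 0ℤ :+ (m :+ e)
            := ((m :- VV :- q) :+ (e :- HV)) :+ (HV :+ VV :+ q))
          refl x (HV 0ℤ) (VV 0ℤ) (q 0ℤ * w) (markV 0ℤ 0ℤ) (ε -1ℤ))
        ΣHV-telescope (suc N) = linear
          (+-cong (ΣHV-telescope N) (trans (balance -[1+ N ]) (+-congʳ (VH-pred N))))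
          (solve 7 (λ x A v v′ e e′ G →
            (con 1ℤ :- x) :* (A :+ v) :+ ((G :+ (e :- v)) :+ (x :* v :+ e′))
            := (G :+ (e′ :- v′)) :+ ((con 1ℤ :- x) :* A :+ (v′ :+ e)))
          refl x (ΣHV N) (HV (ℤ.- (+ N))) (HV -[1+ N ]) (ε -[1+ N ]) (ε -[1+ suc N ]) G)

        -- G occurs with the factor y(1 - x) from the one sum and 1 - y from the other, and these
        -- add up to 1 - xy.
        partialSum : ∀ N → (1# - x) * (1# - y) * (y * ΣVH N + ΣHV N)
          ≈ (1# - x * y) * G + (y * (errVH N - x * errVH N) + (errHV N - y * errHV N))
        partialSum N = linear
          (+-cong (*-congˡ {(1# - x) * y} (ΣVH-telescope N)) (*-congˡ {1# - y} (ΣHV-telescope N)))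
          (solve 7 (λ x y A B G s t →
            (con 1ℤ :- x) :* (con 1ℤ :- y) :* (y :* A :+ B)
              :+ ((con 1ℤ :- x) :* y :* (G :+ s) :+ (con 1ℤ :- y) :* (G :+ t))
            := ((con 1ℤ :- x :* y) :* G :+ (y :* (s :- x :* s) :+ (t :- y :* t)))
               :+ ((con 1ℤ :- x) :* y :* ((con 1ℤ :- y) :* A) :+ (con 1ℤ :- y) :* ((con 1ℤ :- x) :* B)))
          refl x y (ΣVH N) (ΣHV N) G (errVH N) (errHV N))

        S PV PH D : Carrier
        S  = W 0ℤ 0ℤ
        PV = w * P 1ℤ
        PH = h * P -1ℤ
        D  = 1# - h - w - PH - PV

        -- A walk from d to 0 is cut at its first visit to 0. The difference of the two sides is
        -- zero at d = 0, because P is 1 there, and satisfies the recursion elsewhere.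
        W-return : ∀ d → W d 0ℤ ≈ P d * S
        W-return d = linear (unique (λ d → W d 0ℤ - P d * S) case d)
          (solve 2 (λ a b → a :+ con 0ℤ := b :+ (a :- b)) refl (W d 0ℤ) (P d * S))
          where
          step : ∀ d → d ≢ 0ℤ → W d 0ℤ - P d * S
               ≈ tr d ((W d 0ℤ - P d * S) + (W (ℤ.suc d) 0ℤ - P (ℤ.suc d) * S))
                      ((W d 0ℤ - P d * S) + (W (ℤ.pred d) 0ℤ - P (ℤ.pred d) * S))
          step d d≢0 = linear
            (+-cong (trans (W-step 0ℤ d) (+-congʳ (δ-≢ d≢0))) (*-congʳ { - S} (P-step d d≢0)))
            (solve 10 (λ q w h S a₀ a₁ a₂ b₀ b₁ b₂ →
              (a₀ :- b₀ :* S) :+ ((con 0ℤ :+ q :* (w :* (a₀ :+ a₁) :+ h :* (a₀ :+ a₂)))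
                  :+ q :* (w :* (b₀ :+ b₁) :+ h :* (b₀ :+ b₂)) :* (:- S))
              := q :* (w :* ((a₀ :- b₀ :* S) :+ (a₁ :- b₁ :* S)) :+ h :* ((a₀ :- b₀ :* S) :+ (a₂ :- b₂ :* S)))
                 :+ (a₀ :+ b₀ :* (:- S)))
            refl (q d) w h S (W d 0ℤ) (W (ℤ.suc d) 0ℤ) (W (ℤ.pred d) 0ℤ) (P d) (P (ℤ.suc d)) (P (ℤ.pred d)))
          case : ∀ d → (W d 0ℤ - P d * S) ≈ 0# ⊎ W d 0ℤ - P d * S
               ≈ tr d ((W d 0ℤ - P d * S) + (W (ℤ.suc d) 0ℤ - P (ℤ.suc d) * S))
                      ((W d 0ℤ - P d * S) + (W (ℤ.pred d) 0ℤ - P (ℤ.pred d) * S))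
          case (+ 0)      = inj₁ (trans (+-congˡ (-‿cong (trans (*-congʳ P₀) (*-identityˡ S)))) (-‿inverseʳ S))
          case +[1+ n ]   = inj₂ (step _ λ ())
          case -[1+ n ]   = inj₂ (step _ λ ())

        -- S counts sequences of common steps and of excursions on either side.
        S-inverse : S * D ≈ 1#
        S-inverse = linear
          (trans (W-step 0ℤ 0ℤ) (+-congˡ (*-cong q₀ (+-cong
            (*-congˡ (+-congˡ (W-return 1ℤ))) (*-congˡ (+-congˡ (W-return -1ℤ)))))))
          (solve 5 (λ w h S a b →
            S :* (con 1ℤ :- h :- w :- h :* b :- w :* a) :+ (con 1ℤ :+ con 1ℤ :* (w :* (S :+ a :* S) :+ h :* (S :+ b :* S)))
            := con 1ℤ :+ S)
          refl w h S (P 1ℤ) (P -1ℤ))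

        private
          U : Carrier
          U = endV 0ℤ 0ℤ

          -- Records whether the first visit to 0 is made by a V step: from below the arriving
          -- letter climbs, from above it descends.
          neg : ℤ → Carrier
          neg (+ _)    = 0#
          neg -[1+ _ ] = 1#

        -- After its first visit to 0 a walk ending in V either goes on, and U counts the rest, or
        -- it stops there, and then the arriving step must be V.
        endV-return : ∀ d → endV 0ℤ d ≈ P d * (U + neg d)
        endV-return d = linear (unique Y case d)
          (solve 2 (λ a b → a :+ con 0ℤ := b :+ (a :- b)) refl (endV 0ℤ d) (P d * (U + neg d)))
          where
          Y : ℤ → Carrier
          Y d = endV 0ℤ d - P d * (U + neg d)
          -- The boundary term compensates for the jump of neg next to the origin.
          step : ∀ d → d ≢ 0ℤ → ∀ s → neg (ℤ.suc d) ≈ neg d - s → neg (ℤ.pred d) ≈ neg d →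
            endV-base 0ℤ d ≈ q d * (w * (P (ℤ.suc d) * s)) →
            Y d ≈ tr d (Y d + Y (ℤ.suc d)) (Y d + Y (ℤ.pred d))
          step d d≢0 s n₁ n₂ base = begin
            Y d ≈⟨ linear (+-cong (trans (endV-step 0ℤ d) (+-congʳ base)) (*-congʳ { - (U + neg d)} (P-step d d≢0)))
              (solve 12 (λ q w h U n s a₀ a₁ a₂ b₀ b₁ b₂ →
              (a₀ :- b₀ :* (U :+ n)) :+ ((q :* (w :* (b₁ :* s)) :+ q :* (w :* (a₀ :+ a₁) :+ h :* (a₀ :+ a₂)))
                  :+ q :* (w :* (b₀ :+ b₁) :+ h :* (b₀ :+ b₂)) :* (:- (U :+ n)))
              := q :* (w :* ((a₀ :- b₀ :* (U :+ n)) :+ (a₁ :- b₁ :* (U :+ (n :- s))))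
                    :+ h :* ((a₀ :- b₀ :* (U :+ n)) :+ (a₂ :- b₂ :* (U :+ n))))
                 :+ (a₀ :+ b₀ :* (:- (U :+ n))))
              refl (q d) w h U (neg d) s (endV 0ℤ d) (endV 0ℤ (ℤ.suc d)) (endV 0ℤ (ℤ.pred d))
                   (P d) (P (ℤ.suc d)) (P (ℤ.pred d))) ⟩
            tr d (Y d + (endV 0ℤ (ℤ.suc d) - P (ℤ.suc d) * (U + (neg d - s))))
                 (Y d + (endV 0ℤ (ℤ.pred d) - P (ℤ.pred d) * (U + neg d)))
              ≈⟨ *-congˡ (+-cong (*-congˡ (+-congˡ (+-congˡ (-‿cong (*-congˡ (+-congˡ (sym n₁)))))))
                                 (*-congˡ (+-congˡ (+-congˡ (-‿cong (*-congˡ (+-congˡ (sym n₂)))))))) ⟩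
            tr d (Y d + Y (ℤ.suc d)) (Y d + Y (ℤ.pred d)) ∎
            where open import Relation.Binary.Reasoning.Setoid setoid
          no-base : ∀ d → d ≢ 0ℤ → d ≢ -1ℤ → endV-base 0ℤ d ≈ q d * (w * (P (ℤ.suc d) * 0#))
          no-base d d≢0 d≢-1 = trans (+-cong (*-congʳ (δ-≢ d≢0)) (*-congʳ (δ-≢ d≢-1)))
            (solve 5 (λ a b q w p → con 0ℤ :* a :+ con 0ℤ :* b := q :* (w :* (p :* con 0ℤ)))
              refl (q 0ℤ * w) (q -1ℤ * w) (q d) w (P (ℤ.suc d)))
          minus-zero : ∀ a → a ≈ a - 0#
          minus-zero = solve 1 (λ a → a := a :- con 0ℤ) refl
          case : ∀ d → Y d ≈ 0# ⊎ Y d ≈ tr d (Y d + Y (ℤ.suc d)) (Y d + Y (ℤ.pred d))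
          case (+ 0) = inj₁ (trans (+-congˡ (-‿cong (*-congʳ P₀)))
            (solve 1 (λ U → U :- con 1ℤ :* (U :+ con 0ℤ) := con 0ℤ) refl U))
          case +[1+ n ] = inj₂ (step _ (λ ()) 0# (minus-zero 0#) refl (no-base _ (λ ()) (λ ())))
          -- Among the levels other than 0 only -1 reaches 0 by a single V step, so only here is
          -- there a boundary term.
          case -[1+ 0 ] = inj₂ (step _ (λ ()) 1# (sym (-‿inverseʳ 1#)) refl
            (trans (+-cong (*-congʳ (δ-≢ { -1ℤ} {0ℤ} λ ())) (*-congʳ (δ-refl -1ℤ)))
              (trans (solve 3 (λ a q w → con 0ℤ :* a :+ con 1ℤ :* (q :* w) := q :* (w :* (con 1ℤ :* con 1ℤ)))
                       refl (q 0ℤ * w) (q -1ℤ) w)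
                     (*-congˡ (*-congˡ (*-congʳ (sym P₀)))))))
          case -[1+ suc n ] = inj₂ (step _ (λ ()) 0# (minus-zero 1#) refl (no-base _ (λ ()) (λ ())))

        -- The last block of a walk counted by U is a common step V or an excursion below 0, whose
        -- last letter climbs back by V.
        U-eq : U * D ≈ w + PH
        U-eq = linear
          (trans (endV-step 0ℤ 0ℤ) (+-cong
            (+-cong (*-cong (δ-refl 0ℤ) (*-congʳ q₀)) (*-congʳ (δ-≢ {0ℤ} { -1ℤ} λ ())))
            (*-cong q₀ (+-cong (*-congˡ (+-congˡ (endV-return 1ℤ))) (*-congˡ (+-congˡ (endV-return -1ℤ)))))))
          (solve 6 (λ w h U a b z →
            U :* (con 1ℤ :- h :- w :- h :* b :- w :* a)
              :+ ((con 1ℤ :* (con 1ℤ :* w) :+ con 0ℤ :* z)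
                 :+ con 1ℤ :* (w :* (U :+ a :* (U :+ con 0ℤ)) :+ h :* (U :+ b :* (U :+ con 1ℤ))))
            := (w :+ h :* b) :+ U)
          refl w h U (P 1ℤ) (P -1ℤ) (q -1ℤ * w))

        -- Multiplied by D, all of G but `h * w - PH * PV` cancels. Instead of dividing by D, the
        -- equations for `S * D` and `U * D` are substituted.
        G-eq : G ≈ (h * w - PH * PV) * S
        G-eq = begin
          G                                          ≈⟨ +-cong (+-cong
              (*-congʳ (*-congʳ q₀))
              (-‿cong (*-cong q₀ (*-congˡ (+-congˡ (endV-return 1ℤ))))))
              (-‿cong (*-congʳ q₀)) ⟩
          1# * w * S - 1# * (w * (U + P 1ℤ * (U + 0#))) - 1# * w
            ≈⟨ linear (+-cong (*-congˡ {(w + w * P 1ℤ) * U + w} S-inverse)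
                              (*-congˡ { - ((w + w * P 1ℤ) * S)} U-eq))
               (solve 6 (λ w h S U a b →
                 let D = con 1ℤ :- h :- w :- h :* b :- w :* a in
                 (con 1ℤ :* w :* S :- con 1ℤ :* (w :* (U :+ a :* (U :+ con 0ℤ))) :- con 1ℤ :* w)
                   :+ (((w :+ w :* a) :* U :+ w) :* con 1ℤ :+ (:- ((w :+ w :* a) :* S)) :* (w :+ h :* b))
                 := (h :* w :- h :* b :* (w :* a)) :* S
                   :+ (((w :+ w :* a) :* U :+ w) :* (S :* D) :+ (:- ((w :+ w :* a) :* S)) :* (U :* D)))
                refl w h S U (P 1ℤ) (P -1ℤ)) ⟩
          (h * w - PH * PV) * S ∎
          where open import Relation.Binary.Reasoning.Setoid setoid

        -- Displays the factor w of the closing V step, so that coefficients free of w vanish;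
        -- `HV-h` does this for h and the opening H step.
        HV-w : ∀ c → HV c ≈ w * (q c * (h * ((W c c * q c + W c (ℤ.pred c) * q (ℤ.pred c))
            + (W (ℤ.pred c) c * q c + W (ℤ.pred c) (ℤ.pred c) * q (ℤ.pred c)))))
        HV-w c = solve 8 (λ w h q q′ a b c d →
          q :* (h :* ((a :* (q :* w) :+ b :* (q′ :* w)) :+ (c :* (q :* w) :+ d :* (q′ :* w))))
          := w :* (q :* (h :* ((a :* q :+ b :* q′) :+ (c :* q :+ d :* q′))))) refl
          w h (q c) (q (ℤ.pred c)) (W c c) (W c (ℤ.pred c)) (W (ℤ.pred c) c) (W (ℤ.pred c) (ℤ.pred c))

        HV-h : ∀ c → HV c ≈ h * (q c * (endV c c + endV c (ℤ.pred c)))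
        HV-h c = solve 3 (λ h q z → q :* (h :* z) := h :* (q :* z)) refl h (q c)
          (endV c c + endV c (ℤ.pred c))

        module Quotient (gx gy : Carrier) (gx-inv : (1# - x) * gx ≈ 1#) (gy-inv : (1# - y) * gy ≈ 1#) where

          quotient : ∀ F PX PY → PX ≈ PH → PY ≈ PV →
            (1# - x) * (1# - y) * F ≈ (1# - x * y) * G →
            F ≈ (1# - x * y) * (h * w - PX * PY) * (gx * gy * S)
          quotient F PX PY PX≈ PY≈ eq = trans (linear
            (+-cong (+-cong (*-congˡ {gx * gy} eq) (*-congˡ {gx * gy * (1# - x * y)} G-eq))
              (sym (trans (*-congʳ {F} (trans (*-cong gx-inv gy-inv) (*-identityˡ 1#))) (*-identityˡ F))))
            (solve 8 (λ x y gx gy F G M S →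
              F :+ (gx :* gy :* ((con 1ℤ :- x :* y) :* G) :+ gx :* gy :* (con 1ℤ :- x :* y) :* (M :* S)
                     :+ (con 1ℤ :- x) :* gx :* ((con 1ℤ :- y) :* gy) :* F)
              := (con 1ℤ :- x :* y) :* M :* (gx :* gy :* S)
                 :+ (gx :* gy :* ((con 1ℤ :- x) :* (con 1ℤ :- y) :* F)
                     :+ gx :* gy :* (con 1ℤ :- x :* y) :* G :+ F))
            refl x y gx gy F G (h * w - PH * PV) S))
            (*-congʳ (*-congˡ (+-congˡ (-‿cong (sym (*-cong PX≈ PY≈))))))

          inverse : ∀ PX PY → PX ≈ PH → PY ≈ PV →
            (gx * gy * S) * ((1# - x) * (1# - y) * (1# - h - w - PX - PY)) ≈ 1#
          inverse PX PY PX≈ PY≈ = trans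
            (trans (*-congˡ (*-congˡ (+-cong (+-congˡ (-‿cong PX≈)) (-‿cong PY≈))))
              (solve 6 (λ x y gx gy S D → (gx :* gy :* S) :* ((con 1ℤ :- x) :* (con 1ℤ :- y) :* D)
                 := ((con 1ℤ :- x) :* gx) :* ((con 1ℤ :- y) :* gy) :* (S :* D)) refl x y gx gy S D))
            (trans (*-cong (trans (*-cong gx-inv gy-inv) (*-identityˡ 1#)) S-inverse) (*-identityˡ 1#))

        small-expand : ∀ f → (1# - x) * (1# - y) * f ≈ (f - x * f) - y * (f - x * f)
        small-expand f = solve 3 (λ x y f → (con 1ℤ :- x) :* (con 1ℤ :- y) :* f
          := (f :- x :* f) :- y :* (f :- x :* f)) refl x y f

        difference : ∀ F T s →  (1# - x) * (1# - y) * T ≈ (1# - x * y) * G + s →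
          (1# - x) * (1# - y) * F - (1# - x * y) * G ≈ (1# - x) * (1# - y) * (F - T) + s
        difference F T s eq = linear eq
          (solve 5 (λ u v F T s → (u :* F :- v) :+ (v :+ s) := (u :* (F :- T) :+ s) :+ u :* T)
            refl ((1# - x) * (1# - y)) ((1# - x * y) * G) F T s)

        -- The levels from 1 - N to N. The asymmetry comes from `HV-suc`: the levels 1 to N are y
        -- times `VH` at 0 to N - 1.
        total : ℕ → Carrier
        total zero    = 0#
        total (suc N) = total N + (HV +[1+ N ] + HV (ℤ.- (+ N)))

        total-split : ∀ N → total N ≈ y * ΣVH N + ΣHV N
        total-split zero    = solve 1 (λ y → con 0ℤ := y :* con 0ℤ :+ con 0ℤ) refl y
        total-split (suc N) = trans (+-cong (total-split N) (+-congʳ (HV-suc N)))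
          (solve 5 (λ y a b c d → y :* a :+ b :+ (y :* c :+ d) := y :* (a :+ c) :+ (b :+ d)) refl
            y (ΣVH N) (ΣHV N) (VH (+ N)) (HV (ℤ.- (+ N))))

        -- In the recursion read off from words the δ terms stand for stopping right after a V step;
        -- they add up to `endV-base`.
        endV-unique : ∀ c (U : ℤ → Carrier) →
          (∀ d → U d ≈ tr d ((δ d c + U d) + (δ (ℤ.suc d) c + U (ℤ.suc d))) (U d + U (ℤ.pred d))) →
          ∀ d → U d ≈ endV c d
        endV-unique c U U-step = solution-unique {b = endV-base c} sol (endV-step c)
          where
          base : ∀ d → endV-base c d ≈ q d * (w * (δ d c + δ (ℤ.suc d) c))
          base d = trans
            (solve 5 (λ w a b d₀ d₁ → d₀ :* (a :* w) :+ d₁ :* (b :* w) := w :* (d₀ :* a :+ d₁ :* b)) refl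
              w (q c) (q (ℤ.pred c)) (δ d c) (δ d (ℤ.pred c)))
            (trans (*-congˡ (sym (+-cong (δ-q d c)
                (trans (*-congʳ {q d} (δ-suc d c)) (δ-q d (ℤ.pred c))))))
              (solve 4 (λ w a d₀ d₁ → w :* (d₀ :* a :+ d₁ :* a) := a :* (w :* (d₀ :+ d₁))) refl
                w (q d) (δ d c) (δ (ℤ.suc d) c)))
          sol : Solution (endV-base c) U
          sol d = linear (+-cong (U-step d) (sym (base d)))
            (solve 9 (λ q w h d₀ d₁ u₀ u₁ u₂ b →
              u₀ :+ (q :* (w :* ((d₀ :+ u₀) :+ (d₁ :+ u₁)) :+ h :* (u₀ :+ u₂)) :+ b)
              := (b :+ q :* (w :* (u₀ :+ u₁) :+ h :* (u₀ :+ u₂))) :+ (u₀ :+ q :* (w :* (d₀ :+ d₁))))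
            refl (q d) w h (δ d c) (δ (ℤ.suc d) c) (U d) (U (ℤ.suc d)) (U (ℤ.pred d)) (endV-base c d))

        HV-unique : ∀ c (U : ℤ → Carrier) F → (∀ d → U d ≈ endV c d) →
          F ≈ 0# + q c * (w * (0# + 0#) + h * (U c + U (ℤ.pred c))) → HV c ≈ F
        HV-unique c U F U≈ F≈ = sym (trans F≈ (trans
          (solve 5 (λ q w h a b → con 0ℤ :+ q :* (w :* (con 0ℤ :+ con 0ℤ) :+ h :* (a :+ b)) := q :* (h :* (a :+ b)))
            refl (q c) w h (U c) (U (ℤ.pred c)))
          (*-congˡ {q c} (*-congˡ {h} (+-cong (U≈ c) (U≈ (ℤ.pred c)))))))

        PV-unique : ∀ F → F ≈ 0# + q 0ℤ * (w * (0# + P 1ℤ) + h * (0# + 0#)) → PV ≈ F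
        PV-unique F F≈ = sym (trans F≈ (trans (+-congˡ {0#} (*-congʳ q₀))
          (solve 3 (λ w h a → con 0ℤ :+ con 1ℤ :* (w :* (con 0ℤ :+ a) :+ h :* (con 0ℤ :+ con 0ℤ)) := w :* a)
            refl w h (P 1ℤ))))

        PH-unique : ∀ F → F ≈ 0# + q 0ℤ * (w * (0# + 0#) + h * (0# + P -1ℤ)) → PH ≈ F
        PH-unique F F≈ = sym (trans F≈ (trans (+-congˡ {0#} (*-congʳ q₀))
          (solve 3 (λ w h a → con 0ℤ :+ con 1ℤ :* (w :* (con 0ℤ :+ con 0ℤ) :+ h :* (con 0ℤ :+ a)) := h :* a)
            refl w h (P -1ℤ))))

        module Limit
          (Small : ℕ → Carrier → Set)
          (small-≈ : ∀ {n} f g → f ≈ g → Small n g → Small n f)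
          (small-+ : ∀ {n} f g → Small n f → Small n g → Small n (f + g))
          (small-neg : ∀ {n} f → Small n f → Small n (- f))
          (small-weaken : ∀ {n} f → Small (suc n) f → Small n f)
          (small-x* : ∀ {n} f → Small n f → Small (suc n) (x * f))
          (small-y* : ∀ {n} f → Small n f → Small (suc n) (y * f))
          (small-q* : ∀ d f → Small ℤ.∣ d ∣ (q d * f))
          (small-all : ∀ f → (∀ n → Small n f) → f ≈ 0#)
          where

          private
            small-minus : ∀ {n} f g → Small n f → Small n g → Small n (f - g)
            small-minus f g p r = small-+ f (- g) p (small-neg g r)

            small-1-x : ∀ {n} f → Small n f → Small n (f - x * f)
            small-1-x f p = small-minus f (x * f) p (small-weaken (x * f) (small-x* f p))

            small-1-y : ∀ {n} f → Small n f → Small n (f - y * f)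
            small-1-y f p = small-minus f (y * f) p (small-weaken (y * f) (small-y* f p))

            ε-small : ∀ c → Small ℤ.∣ c ∣ (ε c)
            ε-small c = small-≈ (ε c) (q c * (w * W (ℤ.suc c) c)) (*-assoc _ _ _) (small-q* c _)

          HV-small : ∀ c → Small ℤ.∣ c ∣ (HV c)
          HV-small c = small-q* c _

          HV⁻-small : ∀ n → Small n (HV (ℤ.- (+ n)))
          HV⁻-small n = ≡.subst (λ k → Small k (HV (ℤ.- (+ n)))) (ℤ.∣-i∣≡∣i∣ (+ n)) (HV-small (ℤ.- (+ n)))

          private
            err : ℕ → Carrier
            err n = y * (errVH n - x * errVH n) + (errHV n - y * errHV n)

            err-small : ∀ n → Small n (err n)
            err-small n = small-+ _ _
              (small-weaken _ (small-y* _ (small-1-x _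
                (small-minus _ _ (ε-small (+ n)) (small-q* (+ n) _)))))
              (small-1-y _ (small-minus _ _ (small-weaken _ (ε-small -[1+ n ])) (HV⁻-small n)))

          -- Multiplication by 1 - x and 1 - y preserves the order, and both the tail of F and the
          -- errors of `partialSum` have arbitrarily high order, so the difference of the two sides
          -- is zero.
          limit : ∀ F → (∀ n → Small n (F - total n)) → (1# - x) * (1# - y) * F ≈ (1# - x * y) * G
          limit F F-small = linear {R = 0#} (small-all _ Z-small) (minus-eq _ _)
            where
            Z-small : ∀ n → Small n ((1# - x) * (1# - y) * F - (1# - x * y) * G)
            Z-small n = small-≈ _ _
              (difference F (total n) (err n) (trans (*-congˡ (total-split n)) (partialSum n)))
              (small-+ _ _ (small-≈ _ _ (small-expand (F - total n))
                  (small-1-y _ (small-1-x _ (F-small n)))) (err-small n))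

      one-minus : ∀ a b → (1# - a) * b ≈ b - a * b
      one-minus = solve 2 (λ a b → (con 1ℤ :- a) :* b := b :- a :* b) refl

-- Words in pairs of steps and their generating functions.

module Words where
  open Coefficients
  open import Defs using (Series; x; y; w; h; Step; N; E)
  open import Algebra.Bundles using (CommutativeRing)
  open import Data.Bool.Base using (Bool; true; false; _∧_; if_then_else_)
  import Data.Bool.Properties as Bool
  open import Data.Integer.Base as ℤ using (ℤ; +_; -[1+_]; 0ℤ)
  import Data.Integer.Properties as ℤ
  open import Data.List.Base using (List; []; _∷_; _++_; map; length)
  open import Data.List.Membership.Propositional using (_∈_)
  open import Data.List.Membership.Propositional.Properties using (∈-map⁺; ∈-map⁻; ∈-++⁺ˡ; ∈-++⁺ʳ; ∈-++⁻)
  open import Data.List.Properties using (length-++; length-map; ∷-injectiveʳ; ∷-injectiveˡ)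
  open import Data.List.Relation.Unary.Any using (here)
  open import Data.List.Relation.Unary.All using ([])
  open import Data.List.Relation.Unary.AllPairs using ([]; _∷_)
  open import Data.List.Relation.Unary.Unique.Propositional using (Unique)
  import Data.List.Relation.Unary.Unique.Propositional.Properties as Unique
  open import Data.Nat.Base as ℕ using (ℕ; zero; suc; _≡ᵇ_; _≤ᵇ_; _∸_)
  import Data.Nat.Properties as ℕ
  open import Data.Product.Base using (_×_; _,_)
  open import Data.Sum.Base using (_⊎_; inj₁; inj₂; [_,_]′)
  open import Function.Base using (_∘_; _∋_)
  open import Relation.Binary.PropositionalEquality using (_≡_; _≢_; refl; sym; trans; cong; cong₂; module ≡-Reasoning)
  open import Relation.Nullary using (¬_)

  -- The steps of the two paths at the same time.
  Letter : Set
  Letter = Step × Step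

  Word : Set
  Word = List Letter

  move : Letter → ℤ → ℤ
  move (E , N) = ℤ.suc
  move (N , E) = ℤ.pred
  move (E , E) d = d
  move (N , N) d = d

  pos neg : ℤ → ℕ
  pos (+ n)    = n
  pos -[1+ _ ] = 0
  neg (+ _)    = 0
  neg -[1+ n ] = suc n

  #E #N : Word → ℕ
  #E []             = 0
  #E ((E , _) ∷ ws) = suc (#E ws)
  #E ((N , _) ∷ ws) = #E ws
  #N []             = 0
  #N ((N , _) ∷ ws) = suc (#N ws)
  #N ((E , _) ∷ ws) = #N ws

  area⁻ area⁺ : ℤ → Word → ℕ
  area⁻ d []       = 0
  area⁻ d (ℓ ∷ ws) = neg d ℕ.+ area⁻ (move ℓ d) ws
  area⁺ d []       = 0
  area⁺ d (ℓ ∷ ws) = pos d ℕ.+ area⁺ (move ℓ d) ws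

  matches : ℤ → (i j a b : ℕ) → Word → Bool
  matches d i j a b ws = (#E ws ≡ᵇ i) ∧ ((#N ws ≡ᵇ j) ∧ ((area⁻ d ws ≡ᵇ a) ∧ (area⁺ d ws ≡ᵇ b)))

  -- The predicate is passed on through the letters, so the list splits into four blocks in the same
  -- way as the first-letter recursion.
  words : (Word → Bool) → ℕ → List Word
  words p zero    = if p [] then [] ∷ [] else []
  words p (suc L) =
    (map ((E , E) ∷_) (words (p ∘ ((E , E) ∷_)) L) ++ map ((E , N) ∷_) (words (p ∘ ((E , N) ∷_)) L)) ++
    (map ((N , N) ∷_) (words (p ∘ ((N , N) ∷_)) L) ++ map ((N , E) ∷_) (words (p ∘ ((N , E) ∷_)) L))

  count : (Word → Bool) → ℕ → ℕ
  count p L = length (words p L)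

  count-suc : ∀ p L → count p (suc L) ≡
    (count (p ∘ ((E , E) ∷_)) L ℕ.+ count (p ∘ ((E , N) ∷_)) L) ℕ.+
    (count (p ∘ ((N , N) ∷_)) L ℕ.+ count (p ∘ ((N , E) ∷_)) L)
  count-suc p L = trans (length-++ (map _ (ws (E , E)) ++ map _ (ws (E , N)))) (cong₂ ℕ._+_
    (trans (length-++ (map _ (ws (E , E)))) (cong₂ ℕ._+_ (length-map _ (ws (E , E))) (length-map _ (ws (E , N)))))
    (trans (length-++ (map _ (ws (N , N)))) (cong₂ ℕ._+_ (length-map _ (ws (N , N))) (length-map _ (ws (N , E))))))
    where
    ws : Letter → List Word
    ws ℓ = words (p ∘ (ℓ ∷_)) L

  words-cong : ∀ {p r} → (∀ ws → p ws ≡ r ws) → ∀ L → words p L ≡ words r L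
  words-cong p≗r zero    rewrite p≗r [] = refl
  words-cong p≗r (suc L)
    rewrite words-cong (p≗r ∘ ((E , E) ∷_)) L | words-cong (p≗r ∘ ((E , N) ∷_)) L
          | words-cong (p≗r ∘ ((N , N) ∷_)) L | words-cong (p≗r ∘ ((N , E) ∷_)) L = refl

  count-cong : ∀ {p r} → (∀ ws → p ws ≡ r ws) → ∀ L → count p L ≡ count r L
  count-cong p≗r L = cong length (words-cong p≗r L)

  words-false : ∀ L → words (λ _ → false) L ≡ []
  words-false zero    = refl
  words-false (suc L) rewrite words-false L = refl

  count-false : ∀ L → count (λ _ → false) L ≡ 0
  count-false L = cong length (words-false L)

  count-∧ : ∀ c p L → count (λ ws → c ∧ p ws) L ≡ (if c then count p L else 0)
  count-∧ true  p L = refl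
  count-∧ false p L = count-false L

  ∈-words⁺ : ∀ p ws → p ws ≡ true → ws ∈ words p (length ws)
  ∈-words⁺ p [] eq rewrite eq = here refl
  ∈-words⁺ p (ℓ ∷ ws) eq = block ℓ (∈-map⁺ (ℓ ∷_) (∈-words⁺ (p ∘ (ℓ ∷_)) ws eq))
    where
    B : Letter → List Word
    B ℓ = map (ℓ ∷_) (words (p ∘ (ℓ ∷_)) (length ws))
    block : ∀ ℓ {v} → v ∈ B ℓ → v ∈ words p (suc (length ws))
    block (E , E) v∈ = ∈-++⁺ˡ (∈-++⁺ˡ v∈)
    block (E , N) v∈ = ∈-++⁺ˡ (∈-++⁺ʳ (B (E , E)) v∈)
    block (N , N) v∈ = ∈-++⁺ʳ (B (E , E) ++ B (E , N)) (∈-++⁺ˡ v∈)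
    block (N , E) v∈ = ∈-++⁺ʳ (B (E , E) ++ B (E , N)) (∈-++⁺ʳ (B (N , N)) v∈)

  ∈-words⁻ : ∀ p L {ws} → ws ∈ words p L → length ws ≡ L × p ws ≡ true
  ∈-words⁻ p zero ws∈ with p [] in eq
  ∈-words⁻ p zero (here refl) | true = refl , eq
  ∈-words⁻ p (suc L) ws∈ =
    [ [ cons (E , E) , cons (E , N) ]′ ∘ ∈-++⁻ (map _ (words _ L))
    , [ cons (N , N) , cons (N , E) ]′ ∘ ∈-++⁻ (map _ (words _ L)) ]′
    (∈-++⁻ (map _ (words _ L) ++ map _ (words _ L)) ws∈)
    where
    cons : ∀ ℓ {ws} → ws ∈ map (ℓ ∷_) (words (p ∘ (ℓ ∷_)) L) → length ws ≡ suc L × p ws ≡ true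
    cons ℓ ws∈ with _ , v∈ , refl ← ∈-map⁻ _ ws∈ =
      let l , e = ∈-words⁻ (p ∘ (ℓ ∷_)) L v∈ in cong suc l , e

  words-unique : ∀ p L → Unique (words p L)
  words-unique p zero with p []
  ... | true  = [] ∷ []
  ... | false = []
  words-unique p (suc L) = Unique.++⁺
    (Unique.++⁺ (consU _) (consU _) (disjoint λ ()))
    (Unique.++⁺ (consU _) (consU _) (disjoint λ ()))
    λ { (∈₁ , ∈₂) → outer (∈-++⁻ (map _ (words _ L)) ∈₁) (∈-++⁻ (map _ (words _ L)) ∈₂) }
    where
    consU : ∀ ℓ → Unique (map (ℓ ∷_) (words (p ∘ (ℓ ∷_)) L))
    consU ℓ = Unique.map⁺ ∷-injectiveʳ (words-unique (p ∘ (ℓ ∷_)) L)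
    disjoint : ∀ {ℓ ℓ′ vs vs′} → ℓ ≢ ℓ′ → ∀ {ws : Word} → ¬ (ws ∈ map (ℓ ∷_) vs × ws ∈ map (ℓ′ ∷_) vs′)
    disjoint ℓ≢ℓ′ (∈₁ , ∈₂) with _ , _ , refl ← ∈-map⁻ _ ∈₁ | _ , _ , eq ← ∈-map⁻ _ ∈₂ =
      ℓ≢ℓ′ (∷-injectiveˡ eq)
    outer : ∀ {ws as bs cs ds} →
      (ws ∈ map ((E , E) ∷_) as ⊎ ws ∈ map ((E , N) ∷_) bs) →
      ¬ (ws ∈ map ((N , N) ∷_) cs ⊎ ws ∈ map ((N , E) ∷_) ds)
    outer (inj₁ p) (inj₁ q) = disjoint (λ ()) (p , q)
    outer (inj₁ p) (inj₂ q) = disjoint (λ ()) (p , q)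
    outer (inj₂ p) (inj₁ q) = disjoint (λ ()) (p , q)
    outer (inj₂ p) (inj₂ q) = disjoint (λ ()) (p , q)

  -- The generating function of the words satisfying Q, read as walks from level d.
  C : ℤ → (Word → Bool) → Series
  C d Q i j a b = + count (λ ws → matches d i j a b ws ∧ Q ws) (i ℕ.+ j)

  open CommutativeRing 𝕊 using (_≈_; _+_; _*_; -_; 0#; 1#; *-identityˡ; *-assoc)

  C-cong : ∀ d {Q Q′} → (∀ ws → Q ws ≡ Q′ ws) → C d Q ≈ C d Q′
  C-cong d Q≗Q′ i j a b = cong +_ (count-cong (λ ws → cong (matches d i j a b ws ∧_) (Q≗Q′ ws)) (i ℕ.+ j))

  private
    y^-coef : ∀ n f i j a b → (y^ n * f) i j a b ≡ (if n ≤ᵇ b then f i j a (b ∸ n) else 0ℤ)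
    y^-coef zero    f i j a b = *-identityˡ f i j a b
    y^-coef (suc n) f i j a zero    = trans (*-assoc y (y^ n) f i j a 0) (y*-zero (y^ n * f) i j a)
    y^-coef (suc n) f i j a (suc b) = trans (*-assoc y (y^ n) f i j a (suc b))
      (trans (y*-suc (y^ n * f) i j a b) (trans (y^-coef n f i j a b) (eq n)))
      where
      eq : ∀ n → (if n ≤ᵇ b then f i j a (b ∸ n) else 0ℤ) ≡ (if suc n ≤ᵇ suc b then f i j a (b ∸ n) else 0ℤ)
      eq zero    = refl
      eq (suc n) = refl

    x^-coef : ∀ n f i j a b → (x^ n * f) i j a b ≡ (if n ≤ᵇ a then f i j (a ∸ n) b else 0ℤ)
    x^-coef zero    f i j a b = *-identityˡ f i j a b
    x^-coef (suc n) f i j zero    b = trans (*-assoc x (x^ n) f i j 0 b) (x*-zero (x^ n * f) i j b)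
    x^-coef (suc n) f i j (suc a) b = trans (*-assoc x (x^ n) f i j (suc a) b)
      (trans (x*-suc (x^ n * f) i j a b) (trans (x^-coef n f i j a b) (eq n)))
      where
      eq : ∀ n → (if n ≤ᵇ a then f i j (a ∸ n) b else 0ℤ) ≡ (if suc n ≤ᵇ suc a then f i j (a ∸ n) b else 0ℤ)
      eq zero    = refl
      eq (suc n) = refl

    fits : ℤ → ℕ → ℕ → Bool
    fits d a b = (neg d ≤ᵇ a) ∧ (pos d ≤ᵇ b)

    q-coef : ∀ d f i j a b →
      (q d * f) i j a b ≡ (if fits d a b then f i j (a ∸ neg d) (b ∸ pos d) else 0ℤ)
    q-coef (+ n)    f i j a b = y^-coef n f i j a b
    q-coef -[1+ n ] f i j a b rewrite Bool.∧-identityʳ (n ℕ.<ᵇ a) = x^-coef (suc n) f i j a b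

    +-≡ᵇ : ∀ k m a → (k ℕ.+ m ≡ᵇ a) ≡ (k ≤ᵇ a) ∧ (m ≡ᵇ a ∸ k)
    +-≡ᵇ zero          m a       = refl
    +-≡ᵇ (suc k)       m zero    = refl
    +-≡ᵇ (suc zero)    m (suc a) = refl
    +-≡ᵇ (suc (suc k)) m (suc a) = +-≡ᵇ (suc k) m a

    pull : ∀ p r g₁ s g₂ t Q → (p ∧ (r ∧ ((g₁ ∧ s) ∧ (g₂ ∧ t)))) ∧ Q
                            ≡ (g₁ ∧ g₂) ∧ ((p ∧ (r ∧ (s ∧ t))) ∧ Q)
    pull p     r     true  s     true  t Q = refl
    pull false r     true  s     false t Q = refl
    pull true  false true  s     false t Q = refl
    pull true  true  true  false false t Q = refl
    pull true  true  true  true  false t Q = refl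
    pull false r     false s     g₂    t Q = refl
    pull true  false false s     g₂    t Q = refl
    pull true  true  false s     g₂    t Q = refl

    -- The contribution of the first letter to the areas is moved to the prescribed values, where
    -- truncated subtraction needs the guard `fits`.
    shift-count : ∀ d d′ i j a b (Q : Word → Bool) L →
      count (λ ws → ((#E ws ≡ᵇ i) ∧ ((#N ws ≡ᵇ j) ∧ ((neg d ℕ.+ area⁻ d′ ws ≡ᵇ a) ∧
        (pos d ℕ.+ area⁺ d′ ws ≡ᵇ b)))) ∧ Q ws) L
      ≡ (if fits d a b
         then count (λ ws → matches d′ i j (a ∸ neg d) (b ∸ pos d) ws ∧ Q ws) L else 0)
    shift-count d d′ i j a b Q L = trans
      (count-cong (λ ws → trans
        (cong₂ (λ s t → ((#E ws ≡ᵇ i) ∧ ((#N ws ≡ᵇ j) ∧ (s ∧ t))) ∧ Q ws)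
          (+-≡ᵇ (neg d) (area⁻ d′ ws) a) (+-≡ᵇ (pos d) (area⁺ d′ ws) b))
        (pull (#E ws ≡ᵇ i) (#N ws ≡ᵇ j) (neg d ≤ᵇ a) _ (pos d ≤ᵇ b) _ (Q ws))) L)
      (count-∧ (fits d a b) _ L)

    no-letter : ∀ (p r : Word → Bool) L → count (λ ws → (p ws ∧ false) ∧ r ws) L ≡ 0
    no-letter p r L = trans (count-cong (λ ws → cong (_∧ r ws) (Bool.∧-zeroʳ (p ws))) L) (count-false L)

    if-+ : ∀ c k l → ((if c then k else 0) ℕ.+ (if c then l else 0)) ≡ (if c then k ℕ.+ l else 0)
    if-+ true  k l = refl
    if-+ false k l = refl

    if-pos : ∀ c k → + (if c then k else 0) ≡ (if c then + k else 0ℤ)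
    if-pos true  k = refl
    if-pos false k = refl

    base : Bool → Series
    base c = if c then 1# else 0#

    base-suc₁ : ∀ c i j a b → base c (suc i) j a b ≡ 0ℤ
    base-suc₁ true  i j a b = refl
    base-suc₁ false i j a b = refl

    base-suc₂ : ∀ c j a b → base c 0 (suc j) a b ≡ 0ℤ
    base-suc₂ true  j a b = refl
    base-suc₂ false j a b = refl

  module _ (d : ℤ) (Q : Word → Bool) where
    private
      Qᵉᵉ = Q ∘ ((E , E) ∷_)
      Qᵉⁿ = Q ∘ ((E , N) ∷_)
      Qⁿⁿ = Q ∘ ((N , N) ∷_)
      Qⁿᵉ = Q ∘ ((N , E) ∷_)
      A B : Series
      A = C d Qᵉᵉ + C (ℤ.suc d) Qᵉⁿ
      B = C d Qⁿⁿ + C (ℤ.pred d) Qⁿᵉ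

      nE : ∀ i j a b L → ℕ
      nE i j a b L = count (λ ws → matches d i j a b ws ∧ Qᵉᵉ ws) L
                 ℕ.+ count (λ ws → matches (ℤ.suc d) i j a b ws ∧ Qᵉⁿ ws) L
      nN : ∀ i j a b L → ℕ
      nN i j a b L = count (λ ws → matches d i j a b ws ∧ Qⁿⁿ ws) L
                 ℕ.+ count (λ ws → matches (ℤ.pred d) i j a b ws ∧ Qⁿᵉ ws) L

      firstE firstN : (i j a b L : ℕ) → ℕ
      firstE i j a b L = count (λ ws → matches d i j a b ((E , E) ∷ ws) ∧ Qᵉᵉ ws) L
                     ℕ.+ count (λ ws → matches d i j a b ((E , N) ∷ ws) ∧ Qᵉⁿ ws) L
      firstN i j a b L = count (λ ws → matches d i j a b ((N , N) ∷ ws) ∧ Qⁿⁿ ws) L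
                     ℕ.+ count (λ ws → matches d i j a b ((N , E) ∷ ws) ∧ Qⁿᵉ ws) L

      firstE-zero : ∀ j a b L → firstE 0 j a b L ≡ 0
      firstE-zero j a b L = cong₂ ℕ._+_ (count-false L) (count-false L)

      firstE-suc : ∀ i j a b L → firstE (suc i) j a b L
        ≡ (if fits d a b then nE i j (a ∸ neg d) (b ∸ pos d) L else 0)
      firstE-suc i j a b L = trans
        (cong₂ ℕ._+_ (shift-count d d i j a b Qᵉᵉ L) (shift-count d (ℤ.suc d) i j a b Qᵉⁿ L))
        (if-+ (fits d a b) _ _)

      firstN-zero : ∀ i a b L → firstN i 0 a b L ≡ 0
      firstN-zero i a b L = cong₂ ℕ._+_
        (no-letter (λ ws → #E ws ≡ᵇ i) Qⁿⁿ L) (no-letter (λ ws → #E ws ≡ᵇ i) Qⁿᵉ L)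

      firstN-suc : ∀ i j a b L → firstN i (suc j) a b L
        ≡ (if fits d a b then nN i j (a ∸ neg d) (b ∸ pos d) L else 0)
      firstN-suc i j a b L = trans
        (cong₂ ℕ._+_ (shift-count d d i j a b Qⁿⁿ L) (shift-count d (ℤ.pred d) i j a b Qⁿᵉ L))
        (if-+ (fits d a b) _ _)

      wA-coef : ∀ i j a b → + firstE (suc i) j a b (i ℕ.+ j) ≡
        (if fits d a b then (w * A) (suc i) j (a ∸ neg d) (b ∸ pos d) else 0ℤ)
      wA-coef i j a b = trans (cong +_ (firstE-suc i j a b (i ℕ.+ j)))
        (trans (if-pos (fits d a b) _)
          (cong (λ z → if fits d a b then z else 0ℤ) (sym (w*-suc A i j (a ∸ neg d) (b ∸ pos d)))))

      hB-coef : ∀ i j a b L → L ≡ i ℕ.+ j → + firstN i (suc j) a b L ≡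
        (if fits d a b then (h * B) i (suc j) (a ∸ neg d) (b ∸ pos d) else 0ℤ)
      hB-coef i j a b L refl = trans (cong +_ (firstN-suc i j a b (i ℕ.+ j)))
        (trans (if-pos (fits d a b) _)
          (cong (λ z → if fits d a b then z else 0ℤ) (sym (h*-suc B i j (a ∸ neg d) (b ∸ pos d)))))

      if-same : ∀ c {z : ℤ} → z ≡ 0ℤ → (if c then z else 0ℤ) ≡ 0ℤ
      if-same true  eq = eq
      if-same false eq = refl

      if-ℤ+ : ∀ c k l → ((if c then k else 0ℤ) ℤ.+ (if c then l else 0ℤ)) ≡ (if c then k ℤ.+ l else 0ℤ)
      if-ℤ+ true  k l = refl
      if-ℤ+ false k l = refl

      assemble : ∀ i j a b {z z′ r r′ : ℤ} → z ≡ (if fits d a b then r else 0ℤ) →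
        z′ ≡ (if fits d a b then r′ else 0ℤ) →
        r ≡ (w * A) i j (a ∸ neg d) (b ∸ pos d) → r′ ≡ (h * B) i j (a ∸ neg d) (b ∸ pos d) →
        z ℤ.+ z′ ≡ (q d * (w * A + h * B)) i j a b
      assemble i j a b refl refl refl refl = trans (if-ℤ+ (fits d a b) _ _) (sym (q-coef d (w * A + h * B) i j a b))

      if-zero : ∀ {z} c → z ≡ 0 → + z ≡ (if c then 0ℤ else 0ℤ)
      if-zero true  refl = refl
      if-zero false refl = refl

    -- Removing the first letter lowers the exponent of w or of h by one and those of x and y by
    -- `neg d` and `pos d`; that is multiplication by `q d` and by w or h. Every series of walks
    -- below gets its recursion from this.
    C-step : C d Q ≈ base (Q []) + q d * (w * A + h * B)
    C-step zero zero a b = trans (empty (Q []) a b)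
      (trans (sym (ℤ.+-identityʳ _)) (cong (λ z → base (Q []) 0 0 a b ℤ.+ z)
        (assemble 0 0 a b {0ℤ} {0ℤ} (sym (if-same (fits d a b) refl)) (sym (if-same (fits d a b) refl))
          (sym (w*-zero A 0 (a ∸ neg d) (b ∸ pos d))) (sym (h*-zero B 0 (a ∸ neg d) (b ∸ pos d))))))
      where
      empty : ∀ c a b → + length (if ((0 ≡ᵇ a) ∧ (0 ≡ᵇ b)) ∧ c then (List Word ∋ [] ∷ []) else []) ≡ base c 0 0 a b
      empty true  zero    zero    = refl
      empty true  zero    (suc b) = refl
      empty true  (suc a) b       = refl
      empty false zero    zero    = refl
      empty false zero    (suc b) = refl
      empty false (suc a) b       = refl
    C-step zero (suc j) a b = begin
      + count (λ ws → matches d 0 (suc j) a b ws ∧ Q ws) (suc j)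
        ≡⟨ cong +_ (count-suc (λ ws → matches d 0 (suc j) a b ws ∧ Q ws) j) ⟩
      + firstE 0 (suc j) a b j ℤ.+ + firstN 0 (suc j) a b j
        ≡⟨ assemble 0 (suc j) a b (if-zero (fits d a b) (firstE-zero (suc j) a b j))
             (hB-coef 0 j a b j refl) (sym (w*-zero A (suc j) (a ∸ neg d) (b ∸ pos d))) refl ⟩
      (q d * (w * A + h * B)) 0 (suc j) a b
        ≡⟨ ℤ.+-identityˡ _ ⟨
      0ℤ ℤ.+ (q d * (w * A + h * B)) 0 (suc j) a b
        ≡⟨ cong (ℤ._+ (q d * (w * A + h * B)) 0 (suc j) a b) (base-suc₂ (Q []) j a b) ⟨
      (base (Q []) + q d * (w * A + h * B)) 0 (suc j) a b ∎
      where open ≡-Reasoning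
    C-step (suc i) j a b = begin
      + count (λ ws → matches d (suc i) j a b ws ∧ Q ws) (suc (i ℕ.+ j))
        ≡⟨ cong +_ (count-suc (λ ws → matches d (suc i) j a b ws ∧ Q ws) (i ℕ.+ j)) ⟩
      + firstE (suc i) j a b (i ℕ.+ j) ℤ.+ + firstN (suc i) j a b (i ℕ.+ j)
        ≡⟨ lemma j ⟩
      (q d * (w * A + h * B)) (suc i) j a b
        ≡⟨ ℤ.+-identityˡ _ ⟨
      0ℤ ℤ.+ (q d * (w * A + h * B)) (suc i) j a b
        ≡⟨ cong (ℤ._+ (q d * (w * A + h * B)) (suc i) j a b) (base-suc₁ (Q []) i j a b) ⟨
      (base (Q []) + q d * (w * A + h * B)) (suc i) j a b ∎
      where
      open ≡-Reasoning
      lemma : ∀ j → + firstE (suc i) j a b (i ℕ.+ j) ℤ.+ + firstN (suc i) j a b (i ℕ.+ j)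
                  ≡ (q d * (w * A + h * B)) (suc i) j a b
      lemma zero = assemble (suc i) 0 a b (wA-coef i 0 a b)
        (if-zero (fits d a b) (firstN-zero (suc i) a b (i ℕ.+ 0))) refl
        (sym (h*-zero B (suc i) (a ∸ neg d) (b ∸ pos d)))
      lemma (suc j) = assemble (suc i) (suc j) a b (wA-coef i (suc j) a b)
        (hB-coef (suc i) j a b (i ℕ.+ suc j) (ℕ.+-suc i j)) refl refl

-- The series of walks as solutions of the transfer recursion.

module Walks where
  open Coefficients
  open TransferOperator using (module Transfer)
  open Words
  open import Defs using (Series; x; y; w; h; N; E; P⟨x⟩[_]; P⟨y⟩[_])
  import Defs
  open import Algebra.Bundles using (CommutativeRing)
  open import Data.Bool.Base using (Bool; true; false; _∧_; not; if_then_else_)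
  import Data.Bool.Properties as Bool
  open import Data.Integer.Base as ℤ using (ℤ; +_; -[1+_]; +[1+_]; 0ℤ; 1ℤ; -1ℤ)
  import Data.Integer.Properties as ℤ
  open import Data.List.Base using ([]; _∷_)
  open import Data.Nat.Base as ℕ using (ℕ; zero; suc; _<_)
  import Data.Nat.Properties as ℕ
  open import Data.Product.Base using (_,_)
  open import Relation.Binary.PropositionalEquality using (_≡_; _≢_; refl; sym; trans; cong; cong₂)
  open import Relation.Nullary using (does)
  open import Relation.Nullary.Decidable using (dec-false)

  open CommutativeRing 𝕊 using (_≈_; _+_; _*_; -_; _-_; 0#; 1#; *-congˡ; +-congˡ; +-cong; +-congʳ;
    +-identityˡ; +-identityʳ; zeroʳ)
    renaming (refl to ≈-refl; sym to ≈-sym; trans to ≈-trans)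

  finish : ℤ → Word → ℤ
  finish d []       = d
  finish d (ℓ ∷ ws) = finish (move ℓ d) ws

  ends : ℤ → ℤ → Word → Bool
  ends c d ws = does (finish d ws ℤ.≟ c)

  isE : Letter → Bool
  isE (E , _) = true
  isE (N , _) = false

  -- The walk from d ends at c, and the last step of the first path is E; the
  -- Boolean says whether the step before is.
  endsE : ℤ → Bool → ℤ → Word → Bool
  endsE c b d []       = b ∧ does (d ℤ.≟ c)
  endsE c b d (ℓ ∷ ws) = endsE c (isE ℓ) (move ℓ d) ws

  -- The words counted by `HV`: back at level c, the first path opening with N and closing with E,
  -- as it does at the corner of the sink.
  closed : ℤ → Word → Bool
  closed c []             = false
  closed c ((E , _) ∷ ws) = false
  closed c ((N , β) ∷ ws) = endsE c false (move (N , β) c) ws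

  hits : ℤ → Word → Bool
  hits d []       = does (d ℤ.≟ 0ℤ)
  hits d (ℓ ∷ ws) = not (does (d ℤ.≟ 0ℤ)) ∧ hits (move ℓ d) ws

  excursion⁺ excursion⁻ : Word → Bool
  excursion⁺ ((E , N) ∷ ws) = hits 1ℤ ws
  excursion⁺ _              = false
  excursion⁻ ((N , E) ∷ ws) = hits -1ℤ ws
  excursion⁻ _              = false

  walks : ℤ → ℤ → Series
  walks e d = C e (ends d e)

  hitting : ℤ → Series
  hitting d = C d (hits d)

  C-false : ∀ d → C d (λ _ → false) ≈ 0#
  C-false d i j a b = cong +_ (trans
    (count-cong (λ ws → Bool.∧-zeroʳ (matches d i j a b ws)) (i ℕ.+ j)) (count-false (i ℕ.+ j)))

  hitting₀ : hitting 0ℤ ≈ 1#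
  hitting₀ = ≈-trans (C-step 0ℤ (hits 0ℤ)) (≈-trans
    (+-congˡ {1#} (*-congˡ {q 0ℤ} (+-cong
      (*-congˡ {w} (+-cong (C-false 0ℤ) (C-false 1ℤ)))
      (*-congˡ {h} (+-cong (C-false 0ℤ) (C-false -1ℤ))))))
    (≈-trans (+-congˡ {1#} (*-congˡ {q 0ℤ} (+-cong (≈-trans (*-congˡ {w} (+-identityˡ 0#)) (zeroʳ w))
       (≈-trans (*-congˡ {h} (+-identityˡ 0#)) (zeroʳ h)))))
    (≈-trans (+-congˡ {1#} (≈-trans (*-congˡ {q 0ℤ} (+-identityˡ 0#)) (zeroʳ (q 0ℤ)))) (+-identityʳ 1#))))

  hitting-step : ∀ d → d ≢ 0ℤ → hitting d ≈
    transfer d (hitting d + hitting (ℤ.suc d)) (hitting d + hitting (ℤ.pred d))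
  hitting-step d d≢0 = ≈-trans (C-step d (hits d)) (≈-trans
    (+-cong (no-base (does (d ℤ.≟ 0ℤ)) (dec-false (d ℤ.≟ 0ℤ) d≢0)) (*-congˡ {q d} (+-cong
      (*-congˡ {w} (+-cong (later d) (later (ℤ.suc d))))
      (*-congˡ {h} (+-cong (later d) (later (ℤ.pred d)))))))
    (+-identityˡ (transfer d (hitting d + hitting (ℤ.suc d)) (hitting d + hitting (ℤ.pred d)))))
    where
    no-base : ∀ c → c ≡ false → (if c then 1# else 0#) ≈ 0#
    no-base false refl = ≈-refl
    later : ∀ e → C e (λ ws → not (does (d ℤ.≟ 0ℤ)) ∧ hits e ws) ≈ hitting e
    later e = C-cong e (λ ws → cong (λ c → not c ∧ hits e ws) (dec-false (d ℤ.≟ 0ℤ) d≢0))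

  private
    q-pred : ∀ n → q -[1+ n ] ≈ x * q (ℤ.- (+ n))
    q-pred zero    = ≈-refl
    q-pred (suc n) = ≈-refl

  module T = Transfer 𝕊 constants w h x y q ≈-refl (λ n → ≈-refl) q-pred walk-unique

  module G = T.Walks walks (λ d e → C-step e (ends d e)) hitting hitting₀ hitting-step

  endings : ℤ → ℤ → Series
  endings c d = C d (endsE c false d)

  closedWalks : ℤ → Series
  closedWalks c = C c (closed c)

  private
    -- The Boolean of `endsE` matters only for the empty word: after an E the walk may also stop,
    -- which is the δ term.
    endings-step : ∀ c d → endings c d ≈
      transfer d ((T.δ d c + endings c d) + (T.δ (ℤ.suc d) c + endings c (ℤ.suc d)))
                 (endings c d + endings c (ℤ.pred d))
    endings-step c d = ≈-trans (C-step d (endsE c false d)) (≈-trans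
      (+-identityˡ (transfer d (C d (endsE c true d) + C (ℤ.suc d) (endsE c true (ℤ.suc d)))
                               (endings c d + endings c (ℤ.pred d))))
      (*-congˡ {q d} (+-congʳ {h * (endings c d + endings c (ℤ.pred d))}
        (*-congˡ {w} (+-cong (after-E d) (after-E (ℤ.suc d)))))))
      where
      after-E : ∀ d → C d (endsE c true d) ≈ T.δ d c + endings c d
      after-E d = ≈-trans (C-step d (endsE c true d)) (+-congˡ {T.δ d c}
        (≈-sym (≈-trans (C-step d (endsE c false d)) (+-identityˡ _))))



  HV-counts : ∀ c → G.HV c ≈ closedWalks c
  HV-counts c = G.HV-unique c (endings c) (closedWalks c) (G.endV-unique c (endings c) (endings-step c))
    (≈-trans (C-step c (closed c)) (+-congˡ {0#} (*-congˡ {q c}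
      (+-congʳ {h * (endings c c + endings c (ℤ.pred c))} (*-congˡ {w}
        (+-cong (C-false c) (C-false (ℤ.suc c))))))))

  PV-counts : G.PV ≈ C 0ℤ excursion⁺
  PV-counts = G.PV-unique (C 0ℤ excursion⁺) (≈-trans (C-step 0ℤ excursion⁺) (+-congˡ {0#} (*-congˡ {q 0ℤ}
    (+-cong (*-congˡ {w} (+-congʳ {hitting 1ℤ} (C-false 0ℤ))) (*-congˡ {h} (+-cong (C-false 0ℤ) (C-false -1ℤ)))))))

  PH-counts : G.PH ≈ C 0ℤ excursion⁻
  PH-counts = G.PH-unique (C 0ℤ excursion⁻) (≈-trans (C-step 0ℤ excursion⁻) (+-congˡ {0#} (*-congˡ {q 0ℤ}
    (+-cong (*-congˡ {w} (+-cong (C-false 0ℤ) (C-false 1ℤ))) (*-congˡ {h} (+-congʳ {hitting -1ℤ} (C-false 0ℤ)))))))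

  countClosed : ℕ → (i j a b : ℕ) → ℕ
  countClosed zero    i j a b = 0
  countClosed (suc M) i j a b = countClosed M i j a b ℕ.+
    (at +[1+ M ] ℕ.+ at (ℤ.- (+ M)))
    where
    at : ℤ → ℕ
    at c = count (λ ws → matches c i j a b ws ∧ closed c ws) (i ℕ.+ j)

  total-counts : ∀ M i j a b → G.total M i j a b ≡ + countClosed M i j a b
  total-counts zero    i j a b = refl
  total-counts (suc M) i j a b = cong₂ ℤ._+_ (total-counts M i j a b)
    (cong₂ ℤ._+_ (HV-counts +[1+ M ] i j a b) (HV-counts (ℤ.- (+ M)) i j a b))

  -- A walk from level c has area at least ∣ c ∣, so all levels that matter are covered.
  countConfigs : (p q a b : ℕ) → ℕ
  countConfigs p q a b = countClosed (suc (a ℕ.+ b)) (suc p) (suc q) a b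

  countPolyominoes : (a i j : ℕ) → ℕ
  countPolyominoes a i j = count (λ ws → matches 0ℤ i j 0 a ws ∧ excursion⁺ ws) (i ℕ.+ j)

  𝔽 Px Py : Series
  𝔽  = Defs.𝓕[ countConfigs ]
  Px = P⟨x⟩[ countPolyominoes ]
  Py = P⟨y⟩[ countPolyominoes ]

  module L = G.Limit Small small-≈ small-+ small-neg (λ f → small-weaken f (ℕ.n≤1+n _))
    small-x* small-y* small-q* small-all

  private
    total-zero₁ : ∀ M j a b → G.total M 0 j a b ≡ 0ℤ
    total-zero₁ zero    j a b = refl
    total-zero₁ (suc M) j a b = cong₂ ℤ._+_ (total-zero₁ M j a b) (cong₂ ℤ._+_ (z +[1+ M ]) (z (ℤ.- (+ M))))
      where
      z : ∀ c → G.HV c 0 j a b ≡ 0ℤ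
      z c = trans (G.HV-w c 0 j a b) (w*-zero (q c * (h * ((walks c c * q c + walks c (ℤ.pred c) * q (ℤ.pred c))
          + (walks (ℤ.pred c) c * q c + walks (ℤ.pred c) (ℤ.pred c) * q (ℤ.pred c))))) j a b)

    total-zero₂ : ∀ M i a b → G.total M i 0 a b ≡ 0ℤ
    total-zero₂ zero    i a b = refl
    total-zero₂ (suc M) i a b = cong₂ ℤ._+_ (total-zero₂ M i a b) (cong₂ ℤ._+_ (z +[1+ M ]) (z (ℤ.- (+ M))))
      where
      z : ∀ c → G.HV c i 0 a b ≡ 0ℤ
      z c = trans (G.HV-h c i 0 a b) (h*-zero (q c * (G.endV c c + G.endV c (ℤ.pred c))) i a b)

    -- `HV c` is divisible by `q c`, so levels beyond a + b do not reach the coefficient of x^a y^b.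
    total-stable : ∀ {a b} {M} → suc (a ℕ.+ b) ℕ.≤′ M → ∀ i j →
      G.total M i j a b ≡ G.total (suc (a ℕ.+ b)) i j a b
    total-stable ℕ.≤′-refl i j = refl
    total-stable {a} {b} {suc M} (ℕ.≤′-step le) i j = trans
      (cong₂ ℤ._+_ (total-stable le i j)
        (cong₂ ℤ._+_ (L.HV-small +[1+ M ] i j a b (ℕ.≤-trans lt (ℕ.n≤1+n M))) (L.HV⁻-small M i j a b lt)))
      (ℤ.+-identityʳ _)
      where
      lt : a ℕ.+ b < M
      lt = ℕ.≤′⇒≤ le

    𝔽-total : ∀ i j a b → 𝔽 i j a b ≡ G.total (suc (a ℕ.+ b)) i j a b
    𝔽-total zero    j       a b = sym (total-zero₁ (suc (a ℕ.+ b)) j a b)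
    𝔽-total (suc i) zero    a b = sym (total-zero₂ (suc (a ℕ.+ b)) (suc i) a b)
    𝔽-total (suc i) (suc j) a b = sym (total-counts (suc (a ℕ.+ b)) (suc i) (suc j) a b)

    𝔽-small : ∀ M → Small M (𝔽 - G.total M)
    𝔽-small M i j a b lt = trans (cong (λ s → s ℤ.- G.total M i j a b)
        (trans (𝔽-total i j a b) (sym (total-stable (ℕ.≤⇒≤′ lt) i j))))
      (ℤ.+-inverseʳ (G.total M i j a b))

  𝔽-eq : (1# - x) * (1# - y) * 𝔽 ≈ (1# - x * y) * G.G
  𝔽-eq = L.limit 𝔽 𝔽-small

-- Exchange of the two paths, and the closed formula.

module SeriesIdentity where
  open Coefficients
  open Words
  open Walks
  open import Defs using (Series; x; y; w; h; N; E; _≈_/_)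
  import Defs
  open import Algebra.Bundles using (CommutativeRing)
  open import Data.Bool.Base using (Bool; true; false; _∧_; not)
  import Data.Bool.Properties as Bool
  open import Data.Integer.Base as ℤ using (ℤ; +_; -[1+_]; +[1+_]; 0ℤ; 1ℤ; -1ℤ)
  import Data.Integer.Properties as ℤ
  import Data.Integer.Tactic.RingSolver as ℤ-Solver
  open import Algebra.Properties.AbelianGroup ℤ.+-0-abelianGroup using () renaming (∙-cancelˡ to +-cancelˡ)
  open import Data.List.Base using ([]; _∷_; map; length)
  open import Data.List.Properties using (length-map)
  open import Data.Nat.Base as ℕ using (ℕ; zero; suc; _≡ᵇ_)
  import Data.Nat.Properties as ℕ
  import Data.Nat.Tactic.RingSolver as ℕ-Solver
  open import Data.Product.Base using (_,_; swap)
  open import Function.Base using (_∘_)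
  open import Relation.Binary.PropositionalEquality using (_≡_; refl; sym; trans; cong; cong₂)
  open import Relation.Nullary using (does; yes; no)

  open CommutativeRing 𝕊 using (_≈_; _+_; _*_; -_; _-_; 1#; *-congˡ; *-cong; *-congʳ; *-comm; +-cong;
    -‿cong)
    renaming (refl to ≈-refl; sym to ≈-sym; trans to ≈-trans)

  -- Exchanging the paths reflects the levels at 0 and thereby exchanges x and y.
  swapped : Word → Word
  swapped = map swap

  -- The exchange permutes the four letters, so only the order of the blocks in the enumeration
  -- changes.
  count-swapped : ∀ L p → count p L ≡ count (p ∘ swapped) L
  count-swapped zero    p = refl
  count-swapped (suc L) p = trans (count-suc p L) (trans
    (cong₂ ℕ._+_ (cong₂ ℕ._+_ (count-swapped L _) (count-swapped L _))
                 (cong₂ ℕ._+_ (count-swapped L _) (count-swapped L _)))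
    (trans (cong₂ ℕ._+_ (ℕ.+-comm (count (λ ws → p (swapped ((E , E) ∷ ws))) L) _)
                        (ℕ.+-comm (count (λ ws → p (swapped ((N , N) ∷ ws))) L) _))
    (trans (exchange (count (λ ws → p (swapped ((N , E) ∷ ws))) L) _ _ _) (sym (count-suc (p ∘ swapped) L)))))
    where
    exchange : ∀ a b c d → (a ℕ.+ b) ℕ.+ (c ℕ.+ d) ≡ (b ℕ.+ c) ℕ.+ (d ℕ.+ a)
    exchange = ℕ-Solver.solve-∀

  private
    neg-swap : ∀ ℓ d → move (swap ℓ) (ℤ.- d) ≡ ℤ.- move ℓ d
    neg-swap (E , E) d = refl
    neg-swap (N , N) d = refl
    neg-swap (E , N) d = flip-suc d
      where
      flip-suc : ∀ d → -1ℤ ℤ.+ ℤ.- d ≡ ℤ.- (1ℤ ℤ.+ d)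
      flip-suc = ℤ-Solver.solve-∀
    neg-swap (N , E) d = flip-pred d
      where
      flip-pred : ∀ d → 1ℤ ℤ.+ ℤ.- d ≡ ℤ.- (-1ℤ ℤ.+ d)
      flip-pred = ℤ-Solver.solve-∀

    pos-neg : ∀ d → pos (ℤ.- d) ≡ neg d
    pos-neg (+ 0)    = refl
    pos-neg +[1+ n ] = refl
    pos-neg -[1+ n ] = refl

    neg-neg : ∀ d → neg (ℤ.- d) ≡ pos d
    neg-neg (+ 0)    = refl
    neg-neg +[1+ n ] = refl
    neg-neg -[1+ n ] = refl

    zero-neg : ∀ d → does (ℤ.- d ℤ.≟ 0ℤ) ≡ does (d ℤ.≟ 0ℤ)
    zero-neg (+ 0)    = refl
    zero-neg +[1+ n ] = refl
    zero-neg -[1+ n ] = refl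

    area⁻-swapped : ∀ d ws → area⁻ (ℤ.- d) (swapped ws) ≡ area⁺ d ws
    area⁻-swapped d []       = refl
    area⁻-swapped d (ℓ ∷ ws) = cong₂ ℕ._+_ (neg-neg d)
      (trans (cong (λ e → area⁻ e (swapped ws)) (neg-swap ℓ d)) (area⁻-swapped (move ℓ d) ws))

    area⁺-swapped : ∀ d ws → area⁺ (ℤ.- d) (swapped ws) ≡ area⁻ d ws
    area⁺-swapped d []       = refl
    area⁺-swapped d (ℓ ∷ ws) = cong₂ ℕ._+_ (pos-neg d)
      (trans (cong (λ e → area⁺ e (swapped ws)) (neg-swap ℓ d)) (area⁺-swapped (move ℓ d) ws))

    hits-swapped : ∀ d ws → hits (ℤ.- d) (swapped ws) ≡ hits d ws
    hits-swapped d []       = zero-neg d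
    hits-swapped d (ℓ ∷ ws) = cong₂ (λ c r → not c ∧ r) (zero-neg d)
      (trans (cong (λ e → hits e (swapped ws)) (neg-swap ℓ d)) (hits-swapped (move ℓ d) ws))

    hits⇒finish : ∀ d ws → hits d ws ≡ true → finish d ws ≡ 0ℤ
    hits⇒finish d [] eq with d ℤ.≟ 0ℤ
    ... | yes d≡0 = d≡0
    hits⇒finish d (ℓ ∷ ws) eq with d ℤ.≟ 0ℤ
    ... | no _ = hits⇒finish (move ℓ d) ws eq

  -- The level is the number of E steps by which the first path is ahead.
  finish-#E : ∀ d ws → finish d ws ℤ.+ + #E (swapped ws) ≡ d ℤ.+ + #E ws
  finish-#E d []             = refl
  finish-#E d ((E , E) ∷ ws) = trans (shift (finish d ws) (+ #E (swapped ws)))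
    (trans (cong ℤ.suc (finish-#E d ws)) (sym (shift d (+ #E ws))))
    where
    shift : ∀ i n → i ℤ.+ (1ℤ ℤ.+ n) ≡ 1ℤ ℤ.+ (i ℤ.+ n)
    shift = ℤ-Solver.solve-∀
  finish-#E d ((N , N) ∷ ws) = finish-#E d ws
  finish-#E d ((E , N) ∷ ws) = trans (finish-#E (ℤ.suc d) ws) (shift d (+ #E ws))
    where
    shift : ∀ i n → (1ℤ ℤ.+ i) ℤ.+ n ≡ i ℤ.+ (1ℤ ℤ.+ n)
    shift = ℤ-Solver.solve-∀
  finish-#E d ((N , E) ∷ ws) = trans (shift (finish (ℤ.pred d) ws) (+ #E (swapped ws)))
    (trans (cong ℤ.suc (finish-#E (ℤ.pred d) ws)) (shift′ d (+ #E ws)))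
    where
    shift : ∀ i n → i ℤ.+ (1ℤ ℤ.+ n) ≡ 1ℤ ℤ.+ (i ℤ.+ n)
    shift = ℤ-Solver.solve-∀
    shift′ : ∀ i n → 1ℤ ℤ.+ ((-1ℤ ℤ.+ i) ℤ.+ n) ≡ i ℤ.+ n
    shift′ = ℤ-Solver.solve-∀

  #E+#N : ∀ ws → #E ws ℕ.+ #N ws ≡ length ws
  #E+#N []             = refl
  #E+#N ((E , _) ∷ ws) = cong suc (#E+#N ws)
  #E+#N ((N , _) ∷ ws) = trans (ℕ.+-suc (#E ws) (#N ws)) (cong suc (#E+#N ws))

  -- Without a net change of level the first path has gained no E step on the second.
  closed-#E : ∀ d ws → finish d ws ≡ d → #E (swapped ws) ≡ #E ws
  closed-#E d ws eq = ℤ.+-injective (+-cancelˡ d _ _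
    (trans (cong (ℤ._+ + #E (swapped ws)) (sym eq)) (finish-#E d ws)))

  closed-#N : ∀ d ws → finish d ws ≡ d → #N (swapped ws) ≡ #N ws
  closed-#N d ws eq = ℕ.+-cancelˡ-≡ (#E ws) _ _ (trans
    (cong (ℕ._+ #N (swapped ws)) (sym (closed-#E d ws eq)))
    (trans (#E+#N (swapped ws)) (trans (length-map swap ws) (sym (#E+#N ws)))))

  excursion⁺⇒closed : ∀ ws → excursion⁺ ws ≡ true → finish 0ℤ ws ≡ 0ℤ
  excursion⁺⇒closed ((E , N) ∷ ws) eq = hits⇒finish 1ℤ ws eq

  excursion-swapped : ∀ ws → excursion⁻ (swapped ws) ≡ excursion⁺ ws
  excursion-swapped []             = refl
  excursion-swapped ((E , E) ∷ ws) = refl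
  excursion-swapped ((N , N) ∷ ws) = refl
  excursion-swapped ((E , N) ∷ ws) = hits-swapped 1ℤ ws
  excursion-swapped ((N , E) ∷ ws) = refl

  -- Levels change by at most one, so a walk from 1 stays positive until its first visit to 0.
  excursion⁺-area : ∀ ws → excursion⁺ ws ≡ true → area⁻ 0ℤ ws ≡ 0
  excursion⁺-area ((E , N) ∷ ws) eq = go 1 ws eq
    where
    go : ∀ n ws → hits (+ n) ws ≡ true → area⁻ (+ n) ws ≡ 0
    go n [] eq = refl
    go (suc n) ((E , E) ∷ ws) eq = go (suc n) ws eq
    go (suc n) ((N , N) ∷ ws) eq = go (suc n) ws eq
    go (suc n) ((E , N) ∷ ws) eq = go (suc (suc n)) ws eq
    go (suc n) ((N , E) ∷ ws) eq = go n ws eq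

  private
    ∧-congʳ : ∀ {p r} c → (c ≡ true → p ≡ r) → p ∧ c ≡ r ∧ c
    ∧-congʳ {p} {r} true  eq = cong (_∧ true) (eq refl)
    ∧-congʳ {p} {r} false eq = trans (Bool.∧-zeroʳ p) (sym (Bool.∧-zeroʳ r))

  Py-counts : Py ≈ G.PV
  Py-counts i j zero    b = sym (PV-counts i j 0 b)
  Py-counts i j (suc a) b = sym (trans (PV-counts i j (suc a) b) (cong +_ (trans
    (count-cong (λ ws → ∧-congʳ (excursion⁺ ws) (λ eq → impossible ws (excursion⁺-area ws eq))) (i ℕ.+ j))
    (count-false (i ℕ.+ j)))))
    where
    impossible : ∀ ws → area⁻ 0ℤ ws ≡ 0 → matches 0ℤ i j (suc a) b ws ≡ false
    impossible ws eq rewrite eq = trans (cong ((#E ws ≡ᵇ i) ∧_) (Bool.∧-zeroʳ (#N ws ≡ᵇ j))) (Bool.∧-zeroʳ (#E ws ≡ᵇ i))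

  -- Excursions below 0 are reflected to excursions above 0. This exchanges the two areas but keeps
  -- the numbers of steps, since both paths of a closed walk have equally many of each kind.
  Px-counts : Px ≈ G.PH
  Px-counts i j a b = sym (trans (PH-counts i j a b) (trans (cong +_ (trans
      (count-swapped (i ℕ.+ j) (λ ws → matches 0ℤ i j a b ws ∧ excursion⁻ ws))
      (count-cong flip (i ℕ.+ j))))
    (only b)))
    where
    flip : ∀ ws → matches 0ℤ i j a b (swapped ws) ∧ excursion⁻ (swapped ws)
                ≡ matches 0ℤ i j b a ws ∧ excursion⁺ ws
    flip ws = trans (cong (matches 0ℤ i j a b (swapped ws) ∧_) (excursion-swapped ws))
      (∧-congʳ (excursion⁺ ws) λ eq → let c = excursion⁺⇒closed ws eq in
        cong₂ _∧_ (cong (_≡ᵇ i) (closed-#E 0ℤ ws c)) (cong₂ _∧_ (cong (_≡ᵇ j) (closed-#N 0ℤ ws c))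
          (trans (cong₂ _∧_ (cong (_≡ᵇ a) (area⁻-swapped 0ℤ ws)) (cong (_≡ᵇ b) (area⁺-swapped 0ℤ ws)))
            (Bool.∧-comm (area⁺ 0ℤ ws ≡ᵇ a) (area⁻ 0ℤ ws ≡ᵇ b)))))
    only : ∀ b → + count (λ ws → matches 0ℤ i j b a ws ∧ excursion⁺ ws) (i ℕ.+ j) ≡ Px i j a b
    only zero    = refl
    only (suc b) = trans (sym (PV-counts i j (suc b) a)) (sym (Py-counts i j (suc b) a))

  gx gy : Series
  gx 0 0 a 0 = 1ℤ
  gx _ _ _ _ = 0ℤ
  gy 0 0 0 b = 1ℤ
  gy _ _ _ _ = 0ℤ

  private
    gx-inv : (1# - x) * gx ≈ 1#
    gx-inv i j a b = trans (T.one-minus x gx i j a b) (cases i j a b)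
      where
      cases : ∀ i j a b → gx i j a b ℤ.- (x * gx) i j a b ≡ 1# i j a b
      cases 0 0 0 0 = cong (ℤ._-_ 1ℤ) (x*-zero gx 0 0 0)
      cases 0 0 (suc a) 0 = cong (ℤ._-_ 1ℤ) (x*-suc gx 0 0 a 0)
      cases 0 0 0 (suc b) = cong (ℤ._-_ 0ℤ) (x*-zero gx 0 0 (suc b))
      cases 0 0 (suc a) (suc b) = cong (ℤ._-_ 0ℤ) (x*-suc gx 0 0 a (suc b))
      cases 0 (suc j) 0 b = cong (ℤ._-_ 0ℤ) (x*-zero gx 0 (suc j) b)
      cases 0 (suc j) (suc a) b = cong (ℤ._-_ 0ℤ) (x*-suc gx 0 (suc j) a b)
      cases (suc i) j 0 b = cong (ℤ._-_ 0ℤ) (x*-zero gx (suc i) j b)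
      cases (suc i) j (suc a) b = cong (ℤ._-_ 0ℤ) (x*-suc gx (suc i) j a b)

    gy-inv : (1# - y) * gy ≈ 1#
    gy-inv i j a b = trans (T.one-minus y gy i j a b) (cases i j a b)
      where
      cases : ∀ i j a b → gy i j a b ℤ.- (y * gy) i j a b ≡ 1# i j a b
      cases 0 0 0 0 = cong (ℤ._-_ 1ℤ) (y*-zero gy 0 0 0)
      cases 0 0 0 (suc b) = cong (ℤ._-_ 1ℤ) (y*-suc gy 0 0 0 b)
      cases 0 0 (suc a) 0 = cong (ℤ._-_ 0ℤ) (y*-zero gy 0 0 (suc a))
      cases 0 0 (suc a) (suc b) = cong (ℤ._-_ 0ℤ) (y*-suc gy 0 0 (suc a) b)
      cases 0 (suc j) a 0 = cong (ℤ._-_ 0ℤ) (y*-zero gy 0 (suc j) a)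
      cases 0 (suc j) a (suc b) = cong (ℤ._-_ 0ℤ) (y*-suc gy 0 (suc j) a b)
      cases (suc i) j a 0 = cong (ℤ._-_ 0ℤ) (y*-zero gy (suc i) j a)
      cases (suc i) j a (suc b) = cong (ℤ._-_ 0ℤ) (y*-suc gy (suc i) j a b)

  module Q = G.Quotient gx gy gx-inv gy-inv

  private
    ∗-def : ∀ a a′ b b′ → a ≈ a′ → b ≈ b′ → (a Defs.* b) ≈ (a′ * b′)
    ∗-def a a′ b b′ = *-cong {a} {a′} {b} {b′}

    minus-def : ∀ a a′ b b′ → a ≈ a′ → b ≈ b′ → (a Defs.- b) ≈ (a′ - b′)
    minus-def a a′ b b′ p r = +-cong {a} {a′} { - b} { - b′} p (-‿cong {b} {b′} r)

    quotient-def : ∀ F X M M′ D D′ → M ≈ M′ → D ≈ D′ → X * D′ ≈ 1# → F ≈ M′ * X → F ≈ M / D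
    quotient-def F X M M′ D D′ M≈ D≈ inv eq =
      (X , XD , ≈-trans (*-comm D X) XD) , ≈-trans eq (*-congʳ {X} {M′} {M} (≈-sym M≈))
      where
      XD : X * D ≈ 1#
      XD = ≈-trans (*-congˡ {X} {D} {D′} D≈) inv

    -- The operations of the theorem and those of the ring 𝕊 agree by definition, but
    -- comparing whole expressions unfolds all the convolutions.
    numerator : ((Defs.1# Defs.- x Defs.* y) Defs.* (h Defs.* w Defs.- Px Defs.* Py))
              ≈ ((1# - x * y) * (h * w - Px * Py))
    numerator = ∗-def (Defs.1# Defs.- x Defs.* y) (1# - x * y) (h Defs.* w Defs.- Px Defs.* Py) (h * w - Px * Py)
      (minus-def Defs.1# 1# (x Defs.* y) (x * y) ≈-refl (∗-def x x y y ≈-refl ≈-refl))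
      (minus-def (h Defs.* w) (h * w) (Px Defs.* Py) (Px * Py) (∗-def h h w w ≈-refl ≈-refl)
        (∗-def Px Px Py Py ≈-refl ≈-refl))

    denominator : ((Defs.1# Defs.- x) Defs.* (Defs.1# Defs.- y) Defs.* (Defs.1# Defs.- h Defs.- w Defs.- Px Defs.- Py))
                ≈ ((1# - x) * (1# - y) * (1# - h - w - Px - Py))
    denominator = ∗-def ((Defs.1# Defs.- x) Defs.* (Defs.1# Defs.- y)) ((1# - x) * (1# - y))
        (Defs.1# Defs.- h Defs.- w Defs.- Px Defs.- Py) (1# - h - w - Px - Py)
      (∗-def (Defs.1# Defs.- x) (1# - x) (Defs.1# Defs.- y) (1# - y)
        (minus-def Defs.1# 1# x x ≈-refl ≈-refl) (minus-def Defs.1# 1# y y ≈-refl ≈-refl))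
      (minus-def (Defs.1# Defs.- h Defs.- w Defs.- Px) (1# - h - w - Px) Py Py
        (minus-def (Defs.1# Defs.- h Defs.- w) (1# - h - w) Px Px
          (minus-def (Defs.1# Defs.- h) (1# - h) w w
            (minus-def Defs.1# 1# h h ≈-refl ≈-refl) ≈-refl) ≈-refl) ≈-refl)

  generatingFunction : 𝔽 ≈ (Defs.1# Defs.- x Defs.* y) Defs.* (h Defs.* w Defs.- Px Defs.* Py)
    / (Defs.1# Defs.- x) Defs.* (Defs.1# Defs.- y) Defs.* (Defs.1# Defs.- h Defs.- w Defs.- Px Defs.- Py)
  generatingFunction = quotient-def 𝔽 (gx * gy * G.S)
    ((Defs.1# Defs.- x Defs.* y) Defs.* (h Defs.* w Defs.- Px Defs.* Py))
    ((1# - x * y) * (h * w - Px * Py))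
    ((Defs.1# Defs.- x) Defs.* (Defs.1# Defs.- y) Defs.* (Defs.1# Defs.- h Defs.- w Defs.- Px Defs.- Py))
    ((1# - x) * (1# - y) * (1# - h - w - Px - Py))
    numerator denominator (Q.inverse Px Py Px-counts Py-counts)
    (Q.quotient 𝔽 Px Py Px-counts Py-counts 𝔽-eq)

-- Parallelogram polyominoes as excursions.

module Polyominoes where
  open Words
  open Walks using (hits; excursion⁺; countPolyominoes)
  open SeriesIdentity using (swapped; closed-#E; closed-#N; excursion⁺⇒closed; excursion⁺-area; #E+#N)
  open import Defs hiding (_≈_; _+_; _*_; -_; 0#; 1#; _-_; w; h; x; y)
  open import Data.Bool.Base using (Bool; true; false; _∧_)
  open import Data.Bool.Properties using (T-≡)
  open import Data.Empty using (⊥-elim)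
  open import Data.Integer.Base as ℤ using (+_; +[1+_]; 0ℤ; 1ℤ)
  open import Data.List.Base as List using (List; []; _∷_; _++_; map; length; filter; upTo; cartesianProduct; _∷ʳ_)
  open import Data.Nat.ListAction using (sum)
  open import Data.List.Membership.Propositional using (_∈_)
  open import Data.List.Membership.Propositional.Properties using (∈-map⁺; ∈-map⁻; ∈-upTo⁻)
  import Data.List.Properties as List
  open import Data.List.Relation.Unary.Any using (Any; here; there)
  import Data.List.Relation.Unary.Unique.Propositional.Properties as Unique
  open import Data.Nat.Base as ℕ using (ℕ; zero; suc; _+_; _∸_; _⊓_; _≡ᵇ_; _≤_; _<_; z≤n)
  import Data.Nat.Properties as ℕ
  import Data.Nat.Tactic.RingSolver as ℕ-Solver
  open import Data.Product.Base using (_×_; _,_; proj₁; proj₂; ∃-syntax)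
  open import Data.Sum.Base using (_⊎_; inj₁; inj₂)
  open import Function.Base using (_∘_)
  open import Function.Bundles using (mk⇔; Equivalence)
  open import Relation.Binary.PropositionalEquality hiding ([_])
  open import Relation.Nullary using (¬_; does; yes; no)
  open import Relation.Nullary.Decidable using (_×-dec_; dec-true; dec-false)
  open import Relation.Unary using (Decidable; Pred)
  open import Level using (0ℓ)

  -- `hits` for walks from a non-negative level, as an inductive family: each letter is read at a
  -- positive level, so the next level is again a natural number.
  data FirstHit : ℕ → Word → Set where
    []  : FirstHit 0 []
    _∷_ : ∀ {d d′ ws} ℓ ⦃ eq : move ℓ +[1+ d ] ≡ + d′ ⦄ → FirstHit d′ ws → FirstHit (suc d) (ℓ ∷ ws)

  hits⇒FirstHit : ∀ d ws → hits (+ d) ws ≡ true → FirstHit d ws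
  hits⇒FirstHit zero    []             eq = []
  hits⇒FirstHit (suc d) ((E , E) ∷ ws) eq = _∷_ (E , E) ⦃ refl ⦄ (hits⇒FirstHit (suc d) ws eq)
  hits⇒FirstHit (suc d) ((N , N) ∷ ws) eq = _∷_ (N , N) ⦃ refl ⦄ (hits⇒FirstHit (suc d) ws eq)
  hits⇒FirstHit (suc d) ((E , N) ∷ ws) eq = _∷_ (E , N) ⦃ refl ⦄ (hits⇒FirstHit (suc (suc d)) ws eq)
  hits⇒FirstHit (suc d) ((N , E) ∷ ws) eq = _∷_ (N , E) ⦃ refl ⦄ (hits⇒FirstHit d ws eq)

  -- At a positive level the first path is ahead to the east, so the second one is the upper
  -- boundary.
  upper lower : Word → Path
  upper = map proj₂
  lower = map proj₁

  -- The index of the antidiagonal: two paths from the origin reach a common point after equally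
  -- many steps.
  size : Point → ℕ
  size (x , y) = x + y

  step-size : ∀ s P → size (step s P) ≡ suc (size P)
  step-size N (x , y) = ℕ.+-suc x y
  step-size E (x , y) = refl

  points-size : ∀ {P} Q p → P ∈ pointsFrom Q p → size Q ≤ size P
  points-size Q []      (here refl) = ℕ.≤-refl
  points-size Q (s ∷ p) (here refl) = ℕ.≤-refl
  points-size Q (s ∷ p) (there P∈)  = ℕ.≤-trans (ℕ.n≤1+n (size Q))
    (ℕ.≤-trans (ℕ.≤-reflexive (sym (step-size s Q))) (points-size (step s Q) p P∈))

  points-later : ∀ {P} Q s p → P ∈ pointsFrom (step s Q) p → size Q < size P
  points-later Q s p P∈ = ℕ.≤-trans (ℕ.≤-reflexive (sym (step-size s Q))) (points-size (step s Q) p P∈)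

  end-size : ∀ P p → size (endFrom P p) ≡ size P + length p
  end-size P []      = sym (ℕ.+-identityʳ (size P))
  end-size P (s ∷ p) = trans (end-size (step s P) p)
    (trans (cong (_+ length p) (step-size s P)) (sym (ℕ.+-suc (size P) (length p))))

  -- The second point is d steps to the south-east of the first.
  record Apart (d : ℕ) (U L : Point) : Set where
    constructor apart
    field
      ahead : proj₁ L ≡ d + proj₁ U
      below : proj₂ U ≡ d + proj₂ L

  apart-size : ∀ {d U L} → Apart d U L → size U ≡ size L
  apart-size {d} {x , y} {x′ , y′} (apart refl refl) = eq d x y′
    where
    eq : ∀ d x y → x + (d + y) ≡ (d + x) + y
    eq = ℕ-Solver.solve-∀

  apart-step : ∀ {d d′ U L} ℓ → move ℓ (+ d) ≡ + d′ → Apart d U L →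
    Apart d′ (step (proj₂ ℓ) U) (step (proj₁ ℓ) L)
  apart-step {d} {U = U} (E , E) refl (apart a b) = apart (trans (cong suc a) (sym (ℕ.+-suc d (proj₁ U)))) b
  apart-step {d} {L = L} (N , N) refl (apart a b) = apart a (trans (cong suc b) (sym (ℕ.+-suc d (proj₂ L))))
  apart-step {d}     (E , N) refl (apart a b) = apart (cong suc a) (cong suc b)
  apart-step {suc d} {U = U} {L} (N , E) refl (apart a b) =
    apart (trans a (sym (ℕ.+-suc d (proj₁ U)))) (trans b (sym (ℕ.+-suc d (proj₂ L))))

  apart-≡ : ∀ {d U} → Apart d U U → d ≡ 0
  apart-≡ {zero}  _ = refl
  apart-≡ {suc d} {x , y} (apart a _) with () ← ℕ.m≢1+n+m x a

  apart₀ : ∀ {U L} → Apart 0 U L → U ≡ L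
  apart₀ (apart a b) = cong₂ _,_ (sym a) b

  module _ where
    private
      clash : ∀ {P U L : Point} {s} (p : Path) → size U ≡ size L → P ≡ U → P ∈ pointsFrom (step s L) p → {A : Set} → A
      clash {L = L} {s} p eq refl P∈ = ⊥-elim (ℕ.<-irrefl (sym eq) (points-later L s p P∈))

    -- A common point is reached by both paths at the same time, and at that time they are `Apart`
    -- by the level, which is positive before the end.
    FirstHit⇒meet : ∀ {d ws U L P} → Apart d U L → FirstHit d ws →
      P ∈ pointsFrom U (upper ws) → P ∈ pointsFrom L (lower ws) → P ≡ endFrom U (upper ws)
    FirstHit⇒meet ap [] (here refl) _ = refl
    FirstHit⇒meet ap (ℓ ∷ hit) (here refl) (here refl) with () ← apart-≡ ap
    FirstHit⇒meet {ws = ℓ ∷ ws} {L = L} ap (_ ∷ hit) (here P≡U) (there P∈) = clash {L = L} {s = proj₁ ℓ} (lower ws) (apart-size ap) P≡U P∈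
    FirstHit⇒meet {ws = ℓ ∷ ws} {U = U} ap (_ ∷ hit) (there P∈) (here P≡L) = clash {L = U} {s = proj₂ ℓ} (upper ws) (sym (apart-size ap)) P≡L P∈
    FirstHit⇒meet ap (_∷_ ℓ ⦃ eq ⦄ hit) (there P∈) (there P∈′) =
      FirstHit⇒meet (apart-step ℓ eq ap) hit P∈ P∈′

    meet⇒FirstHit : ∀ d {U L} ws → Apart d U L → endFrom U (upper ws) ≡ endFrom L (lower ws) →
      (∀ P → P ∈ pointsFrom U (upper ws) → P ∈ pointsFrom L (lower ws) → P ≡ endFrom U (upper ws)) →
      FirstHit d ws
    meet⇒FirstHit d [] ap refl meet with refl ← apart-≡ ap = []
    -- At level 0 the paths meet here, so this point would be the end, yet letters remain.
    meet⇒FirstHit zero {U} (ℓ ∷ ws) ap eq meet with refl ← apart₀ ap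
      with () ← ℕ.m≢1+m+n (size U) (trans (cong size (meet U (here refl) (here refl)))
        (trans (end-size U (upper (ℓ ∷ ws))) (ℕ.+-suc (size U) _)))
    meet⇒FirstHit (suc d) (ℓ ∷ ws) ap eq meet = cons ℓ refl
      where
      rest : ∀ d′ ℓ′ → ℓ′ ≡ ℓ → move ℓ′ +[1+ d ] ≡ + d′ → FirstHit d′ ws
      rest d′ ℓ′ refl mv = meet⇒FirstHit d′ ws (apart-step ℓ mv ap) eq
        (λ P P∈ P∈′ → meet P (there P∈) (there P∈′))
      cons : ∀ ℓ′ → ℓ′ ≡ ℓ → FirstHit (suc d) (ℓ′ ∷ ws)
      cons (E , E) p = _∷_ (E , E) ⦃ refl ⦄ (rest (suc d) (E , E) p refl)
      cons (N , N) p = _∷_ (N , N) ⦃ refl ⦄ (rest (suc d) (N , N) p refl)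
      cons (E , N) p = _∷_ (E , N) ⦃ refl ⦄ (rest (suc (suc d)) (E , N) p refl)
      cons (N , E) p = _∷_ (N , E) ⦃ refl ⦄ (rest d (N , E) p refl)

  FirstHit⇒hits : ∀ {d ws} → FirstHit d ws → hits (+ d) ws ≡ true
  FirstHit⇒hits [] = refl
  FirstHit⇒hits {ws = _ ∷ ws} (_∷_ ℓ ⦃ eq ⦄ hit) = trans (cong (λ e → hits e ws) eq) (FirstHit⇒hits hit)

  -- The height of the k-th E step, or the final height if there is none.
  column : ℕ → Path → ℕ → ℕ
  column y []      k       = y
  column y (N ∷ p) k       = column (suc y) p k
  column y (E ∷ p) zero    = y
  column y (E ∷ p) (suc k) = column y p k

  column-≥ : ∀ y p k → y ≤ column y p k
  column-≥ y []      k       = ℕ.≤-refl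
  column-≥ y (N ∷ p) k       = ℕ.≤-trans (ℕ.n≤1+n y) (column-≥ (suc y) p k)
  column-≥ y (E ∷ p) zero    = ℕ.≤-refl
  column-≥ y (E ∷ p) (suc k) = column-≥ y p k

  endE endN : Path → ℕ
  endE p = proj₁ (end p)
  endN p = proj₂ (end p)

  column-≤ : ∀ x y p k → column y p k ≤ proj₂ (endFrom (x , y) p)
  column-≤ x y []      k       = ℕ.≤-refl
  column-≤ x y (N ∷ p) k       = column-≤ x (suc y) p k
  column-≤ x y (E ∷ p) zero    = ℕ.≤-trans (column-≥ y p 0) (column-≤ (suc x) y p 0)
  column-≤ x y (E ∷ p) (suc k) = column-≤ (suc x) y p k

  Above Below : Point → Pred Point _
  Above (i , j) P = proj₁ P ≤ i × suc j ≤ proj₂ P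
  Below (i , j) P = suc i ≤ proj₁ P × proj₂ P ≤ j

  private
    far : ∀ {i j} x y p → i < x → ¬ Any (Above (i , j)) (pointsFrom (x , y) p)
    far x y []      i<x (here (x≤i , _)) = ℕ.<⇒≱ i<x x≤i
    far x y (s ∷ p) i<x (here (x≤i , _)) = ℕ.<⇒≱ i<x x≤i
    far x y (N ∷ p) i<x (there any) = far x (suc y) p i<x any
    far x y (E ∷ p) i<x (there any) = far (suc x) y p (ℕ.m≤n⇒m≤1+n i<x) any

    -- Points before the k-th E step are not higher than it, and points after it are too far east,
    -- by `far`.
    above⁺ : ∀ x y p k j → Any (Above (k + x , j)) (pointsFrom (x , y) p) → j < column y p k
    above⁺ x y []      k j (here (_ , j<y)) = j<y
    above⁺ x y (N ∷ p) k j (here (_ , j<y)) = ℕ.≤-trans j<y (column-≥ y (N ∷ p) k)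
    above⁺ x y (N ∷ p) k j (there any) = above⁺ x (suc y) p k j any
    above⁺ x y (E ∷ p) zero j (here (_ , j<y)) = j<y
    above⁺ x y (E ∷ p) zero j (there any) = ⊥-elim (far (suc x) y p ℕ.≤-refl any)
    above⁺ x y (E ∷ p) (suc k) j (here (_ , j<y)) = ℕ.≤-trans j<y (column-≥ y p k)
    above⁺ x y (E ∷ p) (suc k) j (there any) = above⁺ (suc x) y p k j
      (subst (λ i → Any (Above (i , j)) (pointsFrom (suc x , y) p)) (sym (ℕ.+-suc k x)) any)

    above⁻ : ∀ x y p k j → j < column y p k → Any (Above (k + x , j)) (pointsFrom (x , y) p)
    above⁻ x y []      k j lt = here (ℕ.m≤n+m x k , lt)
    above⁻ x y (N ∷ p) k j lt = there (above⁻ x (suc y) p k j lt)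
    above⁻ x y (E ∷ p) zero j lt = here (ℕ.≤-refl , lt)
    above⁻ x y (E ∷ p) (suc k) j lt = there
      (subst (λ i → Any (Above (i , j)) (pointsFrom (suc x , y) p)) (ℕ.+-suc k x) (above⁻ (suc x) y p k j lt))

    low : ∀ {i j} x y p → Any (Below (i , j)) (pointsFrom (x , y) p) → y ≤ j
    low x y []      (here (_ , le)) = le
    low x y (s ∷ p) (here (_ , le)) = le
    low x y (N ∷ p) (there any) = ℕ.≤-trans (ℕ.n≤1+n y) (low x (suc y) p any)
    low x y (E ∷ p) (there any) = low (suc x) y p any

    below⁺ : ∀ x y p k j → Any (Below (k + x , j)) (pointsFrom (x , y) p) → column y p k ≤ j
    below⁺ x y []      k j (here (lt , _)) = ⊥-elim (ℕ.m+n≮n k x lt)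
    below⁺ x y (s ∷ p) k j (here (lt , _)) = ⊥-elim (ℕ.m+n≮n k x lt)
    below⁺ x y (N ∷ p) k j (there any) = below⁺ x (suc y) p k j any
    below⁺ x y (E ∷ p) zero j (there any) = low (suc x) y p any
    below⁺ x y (E ∷ p) (suc k) j (there any) = below⁺ (suc x) y p k j
      (subst (λ i → Any (Below (i , j)) (pointsFrom (suc x , y) p)) (sym (ℕ.+-suc k x)) any)

    -- The bound on k ensures that there is a k-th E step, whose right end is the witness; otherwise
    -- `column` would return its default.
    below⁻ : ∀ x y p k j → k + x < proj₁ (endFrom (x , y) p) → column y p k ≤ j →
      Any (Below (k + x , j)) (pointsFrom (x , y) p)
    below⁻ x y []      k j lt le = ⊥-elim (ℕ.m+n≮n k x lt)
    below⁻ x y (N ∷ p) k j lt le = there (below⁻ x (suc y) p k j lt le)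
    below⁻ x y (E ∷ p) zero j lt le = there (first p)
      where
      first : ∀ p → Any (Below (x , j)) (pointsFrom (suc x , y) p)
      first []      = here (ℕ.≤-refl , le)
      first (_ ∷ _) = here (ℕ.≤-refl , le)
    below⁻ x y (E ∷ p) (suc k) j lt le = there
      (subst (λ i → Any (Below (i , j)) (pointsFrom (suc x , y) p)) (ℕ.+-suc k x)
        (below⁻ (suc x) y p k j (subst (_< proj₁ (endFrom (suc x , y) p)) (sym (ℕ.+-suc k x)) lt) le))

  FirstHit⇒ends : ∀ {d ws U L} → Apart d U L → FirstHit d ws → endFrom U (upper ws) ≡ endFrom L (lower ws)
  FirstHit⇒ends ap []                  = apart₀ ap
  FirstHit⇒ends ap (_∷_ ℓ ⦃ eq ⦄ hit) = FirstHit⇒ends (apart-step ℓ eq ap) hit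

  stepsE stepsN : Path → ℕ
  stepsE []      = 0
  stepsE (E ∷ p) = suc (stepsE p)
  stepsE (N ∷ p) = stepsE p
  stepsN []      = 0
  stepsN (E ∷ p) = stepsN p
  stepsN (N ∷ p) = suc (stepsN p)

  end-steps : ∀ x y p → endFrom (x , y) p ≡ (stepsE p + x , stepsN p + y)
  end-steps x y []      = refl
  end-steps x y (E ∷ p) = trans (end-steps (suc x) y p) (cong (_, stepsN p + y) (ℕ.+-suc (stepsE p) x))
  end-steps x y (N ∷ p) = trans (end-steps x (suc y) p) (cong (stepsE p + x ,_) (ℕ.+-suc (stepsN p) y))

  end-origin : ∀ p → end p ≡ (stepsE p , stepsN p)
  end-origin p = trans (end-steps 0 0 p) (cong₂ _,_ (ℕ.+-identityʳ _) (ℕ.+-identityʳ _))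

  module _ {A : Set} where
    length-filter-map : ∀ {B : Set} {P : Pred B 0ℓ} (P? : Decidable P) (f : A → B) xs →
      length (filter P? (map f xs)) ≡ length (filter (P? ∘ f) xs)
    length-filter-map P? f [] = refl
    length-filter-map P? f (x ∷ xs) with does (P? (f x))
    ... | true  = cong suc (length-filter-map P? f xs)
    ... | false = length-filter-map P? f xs

    length-filter-⇔ : ∀ {P Q : Pred A 0ℓ} (P? : Decidable P) (Q? : Decidable Q) →
      (∀ x → P x → Q x) → (∀ x → Q x → P x) → ∀ xs → length (filter P? xs) ≡ length (filter Q? xs)
    length-filter-⇔ P? Q? P⇒Q Q⇒P [] = refl
    length-filter-⇔ P? Q? P⇒Q Q⇒P (x ∷ xs) with P? x | Q? x
    ... | yes _ | yes _ = cong suc (length-filter-⇔ P? Q? P⇒Q Q⇒P xs)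
    ... | no _  | no _  = length-filter-⇔ P? Q? P⇒Q Q⇒P xs
    ... | yes p | no ¬q = ⊥-elim (¬q (P⇒Q x p))
    ... | no ¬p | yes q = ⊥-elim (¬p (Q⇒P x q))

    length-filter-× : ∀ {B : Set} {P : Pred (A × B) 0ℓ} (P? : Decidable P) (f : A → ℕ) xs (ys : List B) →
      (∀ {x} → x ∈ xs → length (filter P? (map (x ,_) ys)) ≡ f x) →
      length (filter P? (cartesianProduct xs ys)) ≡ sum (map f xs)
    length-filter-× P? f []       ys eq = refl
    length-filter-× P? f (x ∷ xs) ys eq = begin
      length (filter P? (map (x ,_) ys ++ cartesianProduct xs ys))
        ≡⟨ cong length (List.filter-++ P? (map (x ,_) ys) _) ⟩
      length (filter P? (map (x ,_) ys) ++ filter P? (cartesianProduct xs ys))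
        ≡⟨ List.length-++ (filter P? (map (x ,_) ys)) ⟩
      length (filter P? (map (x ,_) ys)) + length (filter P? (cartesianProduct xs ys))
        ≡⟨ cong₂ _+_ (eq (here refl)) (length-filter-× P? f xs ys (eq ∘ there)) ⟩
      f x + sum (map f xs) ∎
      where open ≡-Reasoning

  interval : ∀ L U H → length (filter (λ j → (suc j ℕ.≤? U) ×-dec (L ℕ.≤? j)) (upTo H)) ≡ (U ⊓ H) ∸ L
  interval L U zero = sym (trans (cong (_∸ L) (ℕ.⊓-zeroʳ U)) (ℕ.0∸n≡0 L))
  interval L U (suc H) = begin
    length (filter P? (upTo (suc H)))                  ≡⟨ cong (length ∘ filter P?) (sym (List.upTo-∷ʳ H)) ⟩
    length (filter P? (upTo H ∷ʳ H))                   ≡⟨ cong length (List.filter-++ P? (upTo H) (H ∷ [])) ⟩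
    length (filter P? (upTo H) ++ filter P? (H ∷ []))  ≡⟨ List.length-++ (filter P? (upTo H)) ⟩
    length (filter P? (upTo H)) + length (filter P? (H ∷ []))
      ≡⟨ cong (_+ length (filter P? (H ∷ []))) (interval L U H) ⟩
    (U ⊓ H) ∸ L + length (filter P? (H ∷ []))          ≡⟨ last (suc H ℕ.≤? U) (L ℕ.≤? H) ⟩
    (U ⊓ suc H) ∸ L                                    ∎
    where
    open ≡-Reasoning
    P? : Decidable (λ j → suc j ≤ U × L ≤ j)
    P? = λ j → (suc j ℕ.≤? U) ×-dec (L ℕ.≤? j)
    one : ∀ {b} → b ≡ does (P? H) → length (filter P? (H ∷ [])) ≡ (Data.Bool.Base.if b then 1 else 0)
    one refl with does (P? H)
    ... | true  = refl
    ... | false = refl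
    last : _ → _ → (U ⊓ H) ∸ L + length (filter P? (H ∷ [])) ≡ (U ⊓ suc H) ∸ L
    last (yes p) (yes r) rewrite one {true} (sym (dec-true (P? H) (p , r)))
      | ℕ.m≥n⇒m⊓n≡n p | ℕ.m≥n⇒m⊓n≡n (ℕ.<⇒≤ p) = trans (ℕ.+-comm _ 1) (sym (ℕ.+-∸-assoc 1 r))
    last (yes p) (no ¬r) rewrite one {false} (sym (dec-false (P? H) (¬r ∘ proj₂)))
      | ℕ.m≥n⇒m⊓n≡n p | ℕ.m≥n⇒m⊓n≡n (ℕ.<⇒≤ p) = trans (ℕ.+-identityʳ _)
        (trans (ℕ.m≤n⇒m∸n≡0 (ℕ.<⇒≤ (ℕ.≰⇒> ¬r))) (sym (ℕ.m≤n⇒m∸n≡0 (ℕ.≰⇒> ¬r))))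
    last (no ¬p) r rewrite one {false} (sym (dec-false (P? H) (¬p ∘ proj₁)))
      | ℕ.m≤n⇒m⊓n≡m (ℕ.≤-pred (ℕ.≰⇒> ¬p)) | ℕ.m≤n⇒m⊓n≡m (ℕ.m≤n⇒m≤1+n (ℕ.≤-pred (ℕ.≰⇒> ¬p))) = ℕ.+-identityʳ _

  Σ< : (ℕ → ℕ) → ℕ → ℕ
  Σ< f n = sum (List.applyUpTo f n)

  -- Column by column, a cell is enclosed when it lies above the E step of the lower path and under
  -- that of the upper one; by `column-≤` the bounding box cuts nothing off.
  cells-columns : ∀ u l → end u ≡ end l → length (cells u l) ≡ Σ< (λ i → column 0 u i ∸ column 0 l i) (stepsE u)
  cells-columns u l ends = begin
    length (cells u l)
      ≡⟨ length-filter-× (enclosed? u l) f (upTo (endE u)) (upTo (endN u)) column-cells ⟩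
    sum (map f (upTo (endE u)))    ≡⟨ cong sum (List.map-upTo f (endE u)) ⟩
    Σ< f (endE u)                  ≡⟨ cong (Σ< f ∘ proj₁) (end-origin u) ⟩
    Σ< f (stepsE u)                ∎
    where
    open ≡-Reasoning
    f : ℕ → ℕ
    f i = column 0 u i ∸ column 0 l i
    shift : ∀ {P : Point → Point → Set} {p} i j → Any (P (i , j)) p → Any (P (i + 0 , j)) p
    shift {P} {p} i j = subst (λ i → Any (P (i , j)) p) (sym (ℕ.+-identityʳ i))
    unshift : ∀ {P : Point → Point → Set} {p} i j → Any (P (i + 0 , j)) p → Any (P (i , j)) p
    unshift {P} {p} i j = subst (λ i → Any (P (i , j)) p) (ℕ.+-identityʳ i)
    column-cells : ∀ {i} → i ∈ upTo (endE u) → length (filter (enclosed? u l) (map (i ,_) (upTo (endN u)))) ≡ f i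
    column-cells {i} i∈ = begin
      length (filter (enclosed? u l) (map (i ,_) (upTo (endN u))))
        ≡⟨ length-filter-map (enclosed? u l) (i ,_) (upTo (endN u)) ⟩
      length (filter (enclosed? u l ∘ (i ,_)) (upTo (endN u)))
        ≡⟨ length-filter-⇔ (enclosed? u l ∘ (i ,_))
             (λ j → (suc j ℕ.≤? column 0 u i) ×-dec (column 0 l i ℕ.≤? j)) to from (upTo (endN u)) ⟩
      length (filter (λ j → (suc j ℕ.≤? column 0 u i) ×-dec (column 0 l i ℕ.≤? j)) (upTo (endN u)))
        ≡⟨ interval (column 0 l i) (column 0 u i) (endN u) ⟩
      (column 0 u i ⊓ endN u) ∸ column 0 l i
        ≡⟨ cong (_∸ column 0 l i) (ℕ.m≤n⇒m⊓n≡m (column-≤ 0 0 u i)) ⟩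
      f i ∎
      where
      i< : i < proj₁ (end l)
      i< = subst (i <_) (cong proj₁ ends) (∈-upTo⁻ i∈)
      to : ∀ j → Enclosed u l (i , j) → suc j ≤ column 0 u i × column 0 l i ≤ j
      to j (a , b) = above⁺ 0 0 u i j (shift {Above} i j a) , below⁺ 0 0 l i j (shift {Below} i j b)
      from : ∀ j → suc j ≤ column 0 u i × column 0 l i ≤ j → Enclosed u l (i , j)
      from j (a , b) = unshift {Above} i j (above⁻ 0 0 u i j a) ,
        unshift {Below} i j (below⁻ 0 0 l i j (subst (_< proj₁ (end l)) (sym (ℕ.+-identityʳ i)) i<) b)

  columnSum : ℕ → Path → ℕ
  columnSum y []      = 0
  columnSum y (N ∷ p) = columnSum (suc y) p
  columnSum y (E ∷ p) = y + columnSum y p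

  Σ<-column : ∀ y p → Σ< (column y p) (stepsE p) ≡ columnSum y p
  Σ<-column y []      = refl
  Σ<-column y (N ∷ p) = Σ<-column (suc y) p
  Σ<-column y (E ∷ p) = cong (ℕ._+_ y) (Σ<-column y p)

  Σ<-∸ : ∀ f g n → (∀ k → g k ≤ f k) → Σ< (λ k → f k ∸ g k) n + Σ< g n ≡ Σ< f n
  Σ<-∸ f g zero    g≤f = refl
  Σ<-∸ f g (suc n) g≤f = trans (interchange (f 0 ∸ g 0) _ (g 0) _)
    (cong₂ _+_ (ℕ.m∸n+n≡m (g≤f 0)) (Σ<-∸ (f ∘ suc) (g ∘ suc) n (g≤f ∘ suc)))
    where
    interchange : ∀ a b c d → (a + b) + (c + d) ≡ (a + c) + (b + d)
    interchange = ℕ-Solver.solve-∀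

  Σ<-∸-zero : ∀ f g n → (∀ k → f k ≤ g k) → Σ< (λ k → f k ∸ g k) n ≡ 0
  Σ<-∸-zero f g zero    f≤g = refl
  Σ<-∸-zero f g (suc n) f≤g = cong₂ _+_ (ℕ.m≤n⇒m∸n≡0 (f≤g 0)) (Σ<-∸-zero (f ∘ suc) (g ∘ suc) n (f≤g ∘ suc))

  triangle : ℕ → ℕ
  triangle zero    = 0
  triangle (suc n) = triangle n + n

  -- The first path is d columns ahead, so its columns are to be compared with later ones of the other.
  column-order : ∀ {d ws} y k → FirstHit d ws → column y (lower ws) k ≤ column (d + y) (upper ws) (d + k)
  column-order y k [] = ℕ.≤-refl
  column-order {suc d} y zero    (_∷_ {ws = ws} (E , β) hit) =
    ℕ.≤-trans (ℕ.m≤n+m y (suc d)) (column-≥ (suc d + y) (β ∷ upper ws) (suc d + 0))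
  column-order {suc d} y (suc k) (_∷_ {ws = ws} (E , E) ⦃ refl ⦄ hit) =
    subst (λ z → column y (lower ws) k ≤ column (suc d + y) (upper ws) z) (sym (ℕ.+-suc d k)) (column-order y k hit)
  column-order {suc d} y (suc k) (_∷_ {ws = ws} (E , N) ⦃ refl ⦄ hit) =
    subst (λ z → column y (lower ws) k ≤ column (suc (suc d) + y) (upper ws) z) (sym (ℕ.+-suc (suc d) k)) (column-order y k hit)
  column-order {suc d} y k (_∷_ {ws = ws} (N , N) ⦃ refl ⦄ hit) =
    subst (λ z → column (suc y) (lower ws) k ≤ column z (upper ws) (suc d + k)) (ℕ.+-suc (suc d) y) (column-order (suc y) k hit)
  column-order {suc d} y k (_∷_ {ws = ws} (N , E) ⦃ refl ⦄ hit) =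
    subst (λ z → column (suc y) (lower ws) k ≤ column z (upper ws) (d + k)) (ℕ.+-suc d y) (column-order (suc y) k hit)

  -- Along a diagonal the level is the height difference; summing the heights over the N steps
  -- gives triangular numbers, which leaves the heights of the E steps.
  columnSum-area : ∀ {d ws} y → FirstHit d ws →
    columnSum (d + y) (upper ws) + triangle y ≡ (columnSum y (lower ws) + area⁺ (+ d) ws) + triangle (d + y)
  columnSum-area y [] = refl
  columnSum-area {suc d} y (_∷_ {ws = ws} (E , E) ⦃ refl ⦄ hit) = trans (ℕ.+-assoc (suc d + y) (columnSum (suc d + y) (upper ws)) _)
    (trans (cong (ℕ._+_ (suc d + y)) (columnSum-area y hit))
      (eq (suc d) y (columnSum y (lower ws)) (area⁺ +[1+ d ] ws) (triangle (suc d + y))))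
    where
    eq : ∀ d y s a t → d + y + (s + a + t) ≡ y + s + (d + a) + t
    eq = ℕ-Solver.solve-∀
  columnSum-area {suc d} y (_∷_ {ws = ws} (N , N) ⦃ refl ⦄ hit) = ℕ.+-cancelʳ-≡ y _ _ (trans (ℕ.+-assoc _ (triangle y) y)
    (trans (subst (λ z → columnSum z (upper ws) + triangle (suc y) ≡ (columnSum (suc y) (lower ws) + area⁺ +[1+ d ] ws) + triangle z)
        (ℕ.+-suc (suc d) y) (columnSum-area (suc y) hit))
      (eq (suc d) y (columnSum (suc y) (lower ws)) (area⁺ +[1+ d ] ws) (triangle (suc d + y)))))
    where
    eq : ∀ d y s a t → s + a + (t + (d + y)) ≡ s + (d + a) + t + y
    eq = ℕ-Solver.solve-∀
  columnSum-area {suc d} y (_∷_ {ws = ws} (E , N) ⦃ refl ⦄ hit) = trans (columnSum-area y hit)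
    (eq (suc d) y (columnSum y (lower ws)) (area⁺ +[1+ suc d ] ws) (triangle (suc d + y)))
    where
    eq : ∀ d y s a t → s + a + (t + (d + y)) ≡ y + s + (d + a) + t
    eq = ℕ-Solver.solve-∀
  columnSum-area {suc d} y (_∷_ {ws = ws} (N , E) ⦃ refl ⦄ hit) = ℕ.+-cancelʳ-≡ y _ _
    (trans (eq₁ (suc d + y) (columnSum (suc d + y) (upper ws)) (triangle y) y)
    (trans (cong (ℕ._+_ (suc d + y)) (subst (λ z → columnSum z (upper ws) + triangle (suc y) ≡ (columnSum (suc y) (lower ws) + area⁺ (+ d) ws) + triangle z)
        (ℕ.+-suc d y) (columnSum-area (suc y) hit)))
      (eq (suc d) y (columnSum (suc y) (lower ws)) (area⁺ (+ d) ws) (triangle (suc d + y)))))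
    where
    eq₁ : ∀ a b c y → a + b + c + y ≡ a + (b + (c + y))
    eq₁ = ℕ-Solver.solve-∀
    eq : ∀ d y s a t → d + y + (s + a + t) ≡ s + (d + a) + t + y
    eq = ℕ-Solver.solve-∀

  polyomino : Word → Path × Path
  polyomino ws = upper ws , lower ws

  private
    Above₁ : Apart 1 (step N origin) (step E origin)
    Above₁ = apart refl refl

    column-order₁ : ∀ {ws} k → FirstHit 1 ws → column 0 (E ∷ lower ws) k ≤ column 0 (N ∷ upper ws) k
    column-order₁ {ws} zero    hit = z≤n
    column-order₁ {ws} (suc k) hit = column-order 0 k hit

  module Excursion {ws : Word} (hit : FirstHit 1 ws) where
    ends : end (N ∷ upper ws) ≡ end (E ∷ lower ws)
    ends = FirstHit⇒ends Above₁ hit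

    meet : ∀ P → P ∈ points (N ∷ upper ws) → P ∈ points (E ∷ lower ws) →
      P ≡ origin ⊎ P ≡ end (N ∷ upper ws)
    meet P (here P≡O) _ = inj₁ P≡O
    meet P (there _) (here P≡O) = inj₁ P≡O
    meet P (there P∈) (there P∈′) = inj₂ (FirstHit⇒meet Above₁ hit P∈ P∈′)

    steps : stepsE (E ∷ lower ws) ≡ stepsE (N ∷ upper ws)
    steps = cong proj₁ (trans (sym (end-origin (E ∷ lower ws))) (trans (sym ends) (end-origin (N ∷ upper ws))))

    area-level : length (cells (N ∷ upper ws) (E ∷ lower ws)) ≡ area⁺ 1ℤ ws
    area-level = trans (cells-columns (N ∷ upper ws) (E ∷ lower ws) ends) (ℕ.+-cancelʳ-≡ (columnSum 0 (lower ws)) _ _ (begin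
      Σ< (λ i → f i ∸ g i) n + columnSum 0 (lower ws)  ≡⟨ cong (ℕ._+_ (Σ< (λ i → f i ∸ g i) n)) (trans (sym (Σ<-column 0 (E ∷ lower ws))) (cong (Σ< g) steps)) ⟩
      Σ< (λ i → f i ∸ g i) n + Σ< g n                  ≡⟨ Σ<-∸ f g n (λ k → column-order₁ k hit) ⟩
      Σ< f n                                           ≡⟨ Σ<-column 0 (N ∷ upper ws) ⟩
      columnSum 1 (upper ws)                           ≡⟨ ℕ.+-identityʳ _ ⟨
      columnSum 1 (upper ws) + 0                       ≡⟨ columnSum-area 0 hit ⟩
      columnSum 0 (lower ws) + area⁺ 1ℤ ws + 0         ≡⟨ ℕ.+-identityʳ _ ⟩
      columnSum 0 (lower ws) + area⁺ 1ℤ ws             ≡⟨ ℕ.+-comm (columnSum 0 (lower ws)) _ ⟩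
      area⁺ 1ℤ ws + columnSum 0 (lower ws)             ∎))
      where
      open ≡-Reasoning
      f g : ℕ → ℕ
      f = column 0 (N ∷ upper ws)
      g = column 0 (E ∷ lower ws)
      n : ℕ
      n = stepsE (N ∷ upper ws)

    -- With the boundaries exchanged each truncated column difference is 0; this excludes pairs
    -- given in the wrong order.
    no-cells : length (cells (E ∷ lower ws) (N ∷ upper ws)) ≡ 0
    no-cells = trans (cells-columns (E ∷ lower ws) (N ∷ upper ws) (sym ends))
      (Σ<-∸-zero (column 0 (E ∷ lower ws)) (column 0 (N ∷ upper ws)) (stepsE (E ∷ lower ws)) (λ k → column-order₁ k hit))

  area⁺-positive : ∀ {d ws} → FirstHit (suc d) ws → ∃[ a ] area⁺ +[1+ d ] ws ≡ suc a
  area⁺-positive (ℓ ∷ _) = _ , refl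

  zipped : ∀ u l → length u ≡ length l → ∃[ ws ] upper ws ≡ u × lower ws ≡ l
  zipped []      []      eq = [] , refl , refl
  zipped (β ∷ u) (α ∷ l) eq with ws , refl , refl ← zipped u l (ℕ.suc-injective eq) = (α , β) ∷ ws , refl , refl

  polyomino-injective : ∀ {vs ws} → polyomino vs ≡ polyomino ws → vs ≡ ws
  polyomino-injective {[]} {[]} eq = refl
  polyomino-injective {v ∷ vs} {w ∷ ws} eq = cong₂ _∷_
    (cong₂ _,_ (List.∷-injectiveˡ (cong proj₂ eq)) (List.∷-injectiveˡ (cong proj₁ eq)))
    (polyomino-injective (cong₂ _,_ (List.∷-injectiveʳ (cong proj₁ eq)) (List.∷-injectiveʳ (cong proj₂ eq))))
  polyomino-injective {[]} {_ ∷ _} eq with () ← cong proj₁ eq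
  polyomino-injective {_ ∷ _} {[]} eq with () ← cong proj₁ eq

  module _ where
    private
      rest : ∀ s p {P} → P ∈ pointsFrom (step s origin) p → ¬ (P ≡ origin)
      rest s p P∈ refl with () ← ℕ.≤-trans (ℕ.≤-reflexive (sym (step-size s origin))) (points-size (step s origin) p P∈)

      strip : ∀ {s p P} {Q : Point} → P ∈ pointsFrom (step s origin) p → P ≡ origin ⊎ P ≡ Q → P ≡ Q
      strip {s} {p} P∈ (inj₁ P≡O) = ⊥-elim (rest s p P∈ P≡O)
      strip         P∈ (inj₂ P≡Q) = P≡Q

      lower-swapped : ∀ ws → lower (swapped ws) ≡ upper ws
      lower-swapped ws = sym (List.map-∘ ws)
      upper-swapped : ∀ ws → upper (swapped ws) ≡ lower ws
      upper-swapped ws = sym (List.map-∘ ws)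

      length-zero : ∀ {A : Set} (xs : List A) → length xs ≡ 0 → xs ≡ []
      length-zero [] refl = refl

      -- After equal first steps the paths meet again; a meeting point other than the origin is the
      -- end, so nothing follows.
      together : ∀ s ws → end (upper ((s , s) ∷ ws)) ≡ end (lower ((s , s) ∷ ws)) →
        (∀ P → P ∈ points (s ∷ upper ws) → P ∈ points (s ∷ lower ws) → P ≡ origin ⊎ P ≡ end (s ∷ upper ws)) →
        ws ≡ []
      together s []       eq meet = refl
      together s (ℓ ∷ ws) eq meet = ⊥-elim (ℕ.m≢1+m+n 1 {length (upper ws)} (trans (sym (step-size s origin))
        (trans (cong size P≡end) (trans (end-size (step s origin) (upper (ℓ ∷ ws)))
          (trans (cong (_+ suc (length (upper ws))) (step-size s origin)) refl)))))
        where
        P≡end : step s origin ≡ end (s ∷ upper (ℓ ∷ ws))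
        P≡end = strip {s} {upper (ℓ ∷ ws)} (here refl) (meet (step s origin) (there (here refl)) (there (here refl)))

    -- The first letter decides: equal steps leave only one segment, and `(N , E)` puts the upper
    -- path below, both without a cell; after `(E , N)` the paths are `Apart` by 1.
    polyomino⇒excursion : ∀ ws → IsParallelogramPolyomino (polyomino ws) → excursion⁺ ws ≡ true
    polyomino⇒excursion [] (_ , _ , nonempty) = ⊥-elim (nonempty refl)
    polyomino⇒excursion ((E , E) ∷ ws) (eq , meet , nonempty) with refl ← together E ws eq meet = ⊥-elim (nonempty refl)
    polyomino⇒excursion ((N , N) ∷ ws) (eq , meet , nonempty) with refl ← together N ws eq meet = ⊥-elim (nonempty refl)
    polyomino⇒excursion ((E , N) ∷ ws) (eq , meet , nonempty) = FirstHit⇒hits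
      (meet⇒FirstHit 1 ws Above₁ eq (λ P P∈ P∈′ → strip {N} {upper ws} P∈ (meet P (there P∈) (there P∈′))))
    polyomino⇒excursion ((N , E) ∷ ws) (eq , meet , nonempty) = ⊥-elim (nonempty (length-zero _
      (subst₂ (λ u l → length (cells (E ∷ u) (N ∷ l)) ≡ 0) (lower-swapped ws) (upper-swapped ws)
        (Excursion.no-cells hit))))
      where
      hit : FirstHit 1 (swapped ws)
      hit = meet⇒FirstHit 1 (swapped ws) Above₁
        (subst₂ (λ u l → end (N ∷ u) ≡ end (E ∷ l)) (sym (upper-swapped ws)) (sym (lower-swapped ws)) (sym eq))
        (subst₂ (λ u l → ∀ P → P ∈ pointsFrom (step N origin) u → P ∈ pointsFrom (step E origin) l → P ≡ end (N ∷ u))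
          (sym (upper-swapped ws)) (sym (lower-swapped ws))
          (λ P P∈ P∈′ → trans (strip {N} {lower ws} P∈ (meet P (there P∈′) (there P∈))) eq))

    excursion⇒polyomino : ∀ ws → excursion⁺ ws ≡ true →
      IsParallelogramPolyomino (polyomino ws) × area (polyomino ws) ≡ area⁺ 0ℤ ws
    excursion⇒polyomino ((E , N) ∷ ws) eq = (ends , meet , nonempty) , area-level
      where
      hit : FirstHit 1 ws
      hit = hits⇒FirstHit 1 ws eq
      open Excursion hit
      nonempty : cells (N ∷ upper ws) (E ∷ lower ws) ≢ []
      nonempty none with _ , pos ← area⁺-positive hit
        with () ← trans (sym pos) (trans (sym area-level) (cong length none))

  ∧-true⁻ : ∀ {a b} → a ∧ b ≡ true → a ≡ true × b ≡ true
  ∧-true⁻ {true} {true} refl = refl , refl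

  ∧-true⁺ : ∀ {a b} → a ≡ true → b ≡ true → a ∧ b ≡ true
  ∧-true⁺ refl refl = refl

  ≡ᵇ-true⁻ : ∀ m n → (m ≡ᵇ n) ≡ true → m ≡ n
  ≡ᵇ-true⁻ m n eq = ℕ.≡ᵇ⇒≡ m n (Equivalence.from T-≡ eq)

  ≡ᵇ-true⁺ : ∀ m n → m ≡ n → (m ≡ᵇ n) ≡ true
  ≡ᵇ-true⁺ m n eq = Equivalence.to T-≡ (ℕ.≡⇒≡ᵇ m n eq)

  matches⁻ : ∀ d i j a b ws → matches d i j a b ws ≡ true →
    #E ws ≡ i × #N ws ≡ j × area⁻ d ws ≡ a × area⁺ d ws ≡ b
  matches⁻ d i j a b ws eq with p , eq ← ∧-true⁻ eq with r , eq ← ∧-true⁻ eq with s , t ← ∧-true⁻ eq =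
    ≡ᵇ-true⁻ _ _ p , ≡ᵇ-true⁻ _ _ r , ≡ᵇ-true⁻ _ _ s , ≡ᵇ-true⁻ _ _ t

  matches⁺ : ∀ d i j a b ws → #E ws ≡ i → #N ws ≡ j → area⁻ d ws ≡ a → area⁺ d ws ≡ b →
    matches d i j a b ws ≡ true
  matches⁺ d i j a b ws p r s t = ∧-true⁺ (≡ᵇ-true⁺ _ _ p) (∧-true⁺ (≡ᵇ-true⁺ _ _ r)
    (∧-true⁺ (≡ᵇ-true⁺ _ _ s) (≡ᵇ-true⁺ _ _ t)))

  private
    stepsE-upper : ∀ ws → stepsE (upper ws) ≡ #E (swapped ws)
    stepsE-upper []             = refl
    stepsE-upper ((_ , E) ∷ ws) = cong suc (stepsE-upper ws)
    stepsE-upper ((_ , N) ∷ ws) = stepsE-upper ws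

    stepsN-upper : ∀ ws → stepsN (upper ws) ≡ #N (swapped ws)
    stepsN-upper []             = refl
    stepsN-upper ((_ , E) ∷ ws) = stepsN-upper ws
    stepsN-upper ((_ , N) ∷ ws) = cong suc (stepsN-upper ws)

    widths : ∀ ws → excursion⁺ ws ≡ true → width (polyomino ws) ≡ #E ws
    widths ws ex = trans (cong proj₁ (end-origin (upper ws)))
      (trans (stepsE-upper ws) (closed-#E 0ℤ ws (excursion⁺⇒closed ws ex)))

    heights : ∀ ws → excursion⁺ ws ≡ true → height (polyomino ws) ≡ #N ws
    heights ws ex = trans (cong proj₂ (end-origin (upper ws)))
      (trans (stepsN-upper ws) (closed-#N 0ℤ ws (excursion⁺⇒closed ws ex)))

  polyominoes-counted : IsP countPolyominoes
  polyominoes-counted a i j =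
    map polyomino (words good (i + j)) ,
    Unique.map⁺ polyomino-injective (words-unique good (i + j)) ,
    (λ 𝓟 → mk⇔ (sound 𝓟) (complete 𝓟)) ,
    List.length-map polyomino (words good (i + j))
    where
    good : Word → Bool
    good ws = matches 0ℤ i j 0 a ws ∧ excursion⁺ ws
    sound : ∀ 𝓟 → 𝓟 ∈ map polyomino (words good (i + j)) →
      IsParallelogramPolyomino 𝓟 × area 𝓟 ≡ a × width 𝓟 ≡ i × height 𝓟 ≡ j
    sound 𝓟 𝓟∈ with ws , ws∈ , refl ← ∈-map⁻ polyomino 𝓟∈
      with m , ex ← ∧-true⁻ (proj₂ (∈-words⁻ good (i + j) ws∈))
      with e , n , _ , ar ← matches⁻ 0ℤ i j 0 a ws m =
      let is , is-area = excursion⇒polyomino ws ex in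
      is , trans is-area ar , trans (widths ws ex) e , trans (heights ws ex) n
    complete : ∀ 𝓟 → IsParallelogramPolyomino 𝓟 × area 𝓟 ≡ a × width 𝓟 ≡ i × height 𝓟 ≡ j →
      𝓟 ∈ map polyomino (words good (i + j))
    complete (u , l) (is@(ends , _) , ar , wd , ht)
      -- Paths with a common end point have equal lengths, so they combine into a word.
      with ws , refl , refl ← zipped u l (trans (sym (end-size origin u)) (trans (cong size ends) (end-size origin l))) =
      ∈-map⁺ polyomino (subst (λ k → ws ∈ words good k) len (∈-words⁺ good ws (∧-true⁺ m ex)))
      where
      ex : excursion⁺ ws ≡ true
      ex = polyomino⇒excursion ws is
      e : #E ws ≡ i
      e = trans (sym (widths ws ex)) wd
      n : #N ws ≡ j
      n = trans (sym (heights ws ex)) ht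
      len : length ws ≡ i + j
      len = trans (sym (#E+#N ws)) (cong₂ _+_ e n)
      m : matches 0ℤ i j 0 a ws ≡ true
      m = matches⁺ 0ℤ i j 0 a ws e n (excursion⁺-area ws ex) (trans (sym (proj₂ (excursion⇒polyomino ws ex))) ar)

-- Floors, staircase functions and their boundary paths.

module Staircases where
  open import Data.Bool.Base using (if_then_else_)
  open import Data.Empty using (⊥-elim)
  open import Data.Fin.Base as Fin using (Fin; zero; suc)
  import Data.Fin.Properties as Fin
  open import Data.Integer.Base hiding (suc; pred)
  open import Data.Integer.DivMod using ([n/ℕd]*d≤n; n<s[n/ℕd]*d)
  open import Data.Integer.Properties
  open import Data.Integer.Tactic.RingSolver using (solve-∀)
  open import Data.Nat.Base as ℕ using (ℕ; zero; suc; z≤n)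
  import Data.Nat.Properties as ℕ
  open import Data.Product.Base using (_×_; _,_; ∃-syntax)
  open import Function.Base using (_∘_; case_of_)
  open import Relation.Binary.PropositionalEquality hiding ([_])
  open import Relation.Nullary using (¬_; Dec; yes; no; does)
  open import Relation.Unary using (Pred; Decidable)
  open import Algebra.Properties.CommutativeMonoid.Sum +-0-commutativeMonoid public using (sum; sum-cong-≗; sum-init-last; ∑-distrib-+)

  -- Inequalities are reduced to identities of differences, which the ring solver proves.
  ≤-by : ∀ {a b c d} → a ≤ b → d - c ≡ b - a → c ≤ d
  ≤-by a≤b eq = 0≤i-j⇒j≤i (subst (0ℤ ≤_) (sym eq) (i≤j⇒0≤j-i a≤b))

  ≤-by₂ : ∀ {a b a′ b′ c d} → a ≤ b → a′ ≤ b′ → d - c ≡ (b - a) + (b′ - a′) → c ≤ d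
  ≤-by₂ p r eq = 0≤i-j⇒j≤i (subst (0ℤ ≤_) (sym eq) (+-mono-≤ (i≤j⇒0≤j-i p) (i≤j⇒0≤j-i r)))

  <⇒1+≤ : ∀ {a b} → a < b → 1ℤ + a ≤ b
  <⇒1+≤ = i<j⇒suc[i]≤j

  1+≤⇒< : ∀ {a b} → 1ℤ + a ≤ b → a < b
  1+≤⇒< = suc[i]≤j⇒i<j

  ≰⇒1+≤ : ∀ {a b} → ¬ a ≤ b → 1ℤ + b ≤ a
  ≰⇒1+≤ a≰b = <⇒1+≤ (≰⇒> a≰b)

  1+≤⇒≰ : ∀ {a b} → 1ℤ + b ≤ a → ¬ a ≤ b
  1+≤⇒≰ p a≤b = <-irrefl refl (<-≤-trans (1+≤⇒< p) a≤b)

  0≤+ : ∀ k → 0ℤ ≤ + k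
  0≤+ k = +≤+ z≤n

  -- The two sides of a Galois connection determine each other.
  ≤-ext : ∀ {a b} → (∀ z → z ≤ a → z ≤ b) → (∀ z → z ≤ b → z ≤ a) → a ≡ b
  ≤-ext f g = ≤-antisym (f _ ≤-refl) (g _ ≤-refl)

  ≥-ext : ∀ {a b} → (∀ z → a ≤ z → b ≤ z) → (∀ z → b ≤ z → a ≤ z) → a ≡ b
  ≥-ext f g = ≤-antisym (g _ ≤-refl) (f _ ≤-refl)

  record First (P : Pred ℤ _) (lo hi : ℤ) : Set where
    constructor first
    field
      at     : ℤ
      holds  : P at
      fails  : ¬ P (at - 1ℤ)
      above  : 1ℤ + lo ≤ at
      upto   : at ≤ hi

  find : ∀ {P} → Decidable P → ∀ lo k → ¬ P lo → P (lo + + k) → First P lo (lo + + k)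
  find {P} P? lo zero    ¬p p = ⊥-elim (¬p (subst P (+-identityʳ lo) p))
  find {P} P? lo (suc k) ¬p p with P? (1ℤ + lo)
  ... | yes p′ = first (1ℤ + lo) p′ (¬p ∘ subst P (back lo)) ≤-refl (≤-by (0≤+ k) (gap lo (+ k)))
    where
    back : ∀ lo → 1ℤ + lo - 1ℤ ≡ lo
    back = solve-∀
    gap : ∀ lo k → lo + (1ℤ + k) - (1ℤ + lo) ≡ k - 0ℤ
    gap = solve-∀
  ... | no ¬p′ = case find P? (1ℤ + lo) k ¬p′ (subst P (move lo (+ k)) p) of λ where
        (first s h f a u) → first s h f (≤-trans (i≤j+i (1ℤ + lo) 1ℤ) a) (≤-trans u (≤-reflexive (sym (move lo (+ k)))))
    where
    move : ∀ lo k → lo + (1ℤ + k) ≡ 1ℤ + lo + k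
    move = solve-∀

  module Floor (n₁ : ℕ) where
    n : ℕ
    n = suc n₁

    abstract
      ⌊_⌋ : ℤ → ℤ
      ⌊ z ⌋ = z /ℕ n

      -- One half of the adjunction between multiplication by n and division by n; later facts about
      -- floors rest on it and on `⌊⌋⇐`.
      ⌊⌋⇒ : ∀ p z → p ≤ ⌊ z ⌋ → p * + n ≤ z
      ⌊⌋⇒ p z le = ≤-trans (*-monoʳ-≤-nonNeg (+ n) le) ([n/ℕd]*d≤n z n)

      ⌊⌋⇐ : ∀ p z → p * + n ≤ z → p ≤ ⌊ z ⌋
      ⌊⌋⇐ p z le = ≮⇒≥ λ lt → <-irrefl refl (≤-<-trans le (<-≤-trans (n<s[n/ℕd]*d z n)
        (*-monoʳ-≤-nonNeg (+ n) (i<j⇒suc[i]≤j lt))))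

    ⌊⌋-mono : ∀ {y z} → y ≤ z → ⌊ y ⌋ ≤ ⌊ z ⌋
    ⌊⌋-mono {y} {z} y≤z = ⌊⌋⇐ ⌊ y ⌋ z (≤-trans (⌊⌋⇒ ⌊ y ⌋ y ≤-refl) y≤z)

    ⌊⌋-period : ∀ z → ⌊ z + + n ⌋ ≡ ⌊ z ⌋ + 1ℤ
    ⌊⌋-period z = ≤-ext
      (λ p le → ≤-by (⌊⌋⇐ (p - 1ℤ) z (≤-by (⌊⌋⇒ p (z + + n) le) (e₁ p z (+ n)))) (e₂ p ⌊ z ⌋))
      (λ p le → ⌊⌋⇐ p (z + + n) (≤-by (⌊⌋⇒ (p - 1ℤ) z (≤-by le (sym (e₂ p ⌊ z ⌋)))) (sym (e₁ p z (+ n)))))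
      where
      e₁ : ∀ p z n → z - (p - 1ℤ) * n ≡ (z + n) - p * n
      e₁ = solve-∀
      e₂ : ∀ p f → f + 1ℤ - p ≡ f - (p - 1ℤ)
      e₂ = solve-∀

    ⌊⌋-unique : ∀ p z → p * + n ≤ z → 1ℤ + z ≤ (1ℤ + p) * + n → ⌊ z ⌋ ≡ p
    ⌊⌋-unique p z lo hi = ≤-antisym
      (≮⇒≥ λ lt → 1+≤⇒≰ hi (⌊⌋⇒ (1ℤ + p) z (<⇒1+≤ lt)))
      (⌊⌋⇐ p z lo)

  sum-mono : ∀ {k} {f g : Fin k → ℤ} → (∀ i → f i ≤ g i) → sum f ≤ sum g
  sum-mono {zero}  f≤g = ≤-refl
  sum-mono {suc k} f≤g = +-mono-≤ (f≤g zero) (sum-mono (f≤g ∘ suc))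

  sum-const : ∀ k c → sum {k} (λ _ → c) ≡ + k * c
  sum-const zero    c = refl
  sum-const (suc k) c = trans (cong (_+_ c) (sum-const k c)) (eq (+ k) c)
    where
    eq : ∀ k c → c + k * c ≡ (1ℤ + k) * c
    eq = solve-∀

  sum-zero : ∀ k → sum {k} (λ _ → 0ℤ) ≡ 0ℤ
  sum-zero k = trans (sum-const k 0ℤ) (*-zeroʳ (+ k))

  sum-minus : ∀ {k} (f g : Fin k → ℤ) → sum (λ i → f i - g i) ≡ sum f - sum g
  sum-minus {zero}  f g = refl
  sum-minus {suc k} f g = trans (cong (_+_ (f zero - g zero)) (sum-minus (f ∘ suc) (g ∘ suc)))
    (eq (f zero) (g zero) (sum (f ∘ suc)) (sum (g ∘ suc)))
    where
    eq : ∀ a b c d → a - b + (c - d) ≡ a + c - (b + d)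
    eq = solve-∀

  sum-< : ∀ {k} (f g : Fin k → ℤ) → sum f < sum g → ∃[ i ] f i < g i
  sum-< {zero}  f g lt = ⊥-elim (<-irrefl refl lt)
  sum-< {suc k} f g lt with f zero <? g zero
  ... | yes p = zero , p
  ... | no ¬p = let i , p = sum-< (f ∘ suc) (g ∘ suc) (≰⇒> λ le → <-irrefl refl (<-≤-trans lt (+-mono-≤ (≮⇒≥ ¬p) le)))
                in suc i , p

  Σ : (ℕ → ℤ) → ℕ → ℤ
  Σ f zero    = 0ℤ
  Σ f (suc k) = Σ f k + f k

  Σ-cong : ∀ {f g} → (∀ k → f k ≡ g k) → ∀ K → Σ f K ≡ Σ g K
  Σ-cong eq zero    = refl
  Σ-cong eq (suc K) = cong₂ _+_ (Σ-cong eq K) (eq K)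

  Σ-mono : ∀ {f g} → (∀ k → f k ≤ g k) → ∀ K → Σ f K ≤ Σ g K
  Σ-mono f≤g zero    = ≤-refl
  Σ-mono f≤g (suc K) = +-mono-≤ (Σ-mono f≤g K) (f≤g K)

  Σ-+ : ∀ f g K → Σ (λ k → f k + g k) K ≡ Σ f K + Σ g K
  Σ-+ f g zero    = refl
  Σ-+ f g (suc K) = trans (cong (_+ (f K + g K)) (Σ-+ f g K)) (eq (Σ f K) (Σ g K) (f K) (g K))
    where
    eq : ∀ a b c d → a + b + (c + d) ≡ a + c + (b + d)
    eq = solve-∀

  Σ-minus : ∀ f g K → Σ (λ k → f k - g k) K ≡ Σ f K - Σ g K
  Σ-minus f g zero    = refl
  Σ-minus f g (suc K) = trans (cong (_+ (f K - g K)) (Σ-minus f g K)) (eq (Σ f K) (Σ g K) (f K) (g K))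
    where
    eq : ∀ a b c d → a - b + (c - d) ≡ a + c - (b + d)
    eq = solve-∀

  Σ-const : ∀ c K → Σ (λ _ → c) K ≡ + K * c
  Σ-const c zero    = refl
  Σ-const c (suc K) = trans (cong (_+ c) (Σ-const c K)) (eq (+ K) c)
    where
    eq : ∀ k c → k * c + c ≡ (1ℤ + k) * c
    eq = solve-∀

  Σ-head : ∀ f K → Σ f (suc K) ≡ f 0 + Σ (f ∘ suc) K
  Σ-head f zero    = +-comm 0ℤ (f 0)
  Σ-head f (suc K) = trans (cong (_+ f (suc K)) (Σ-head f K)) (+-assoc (f 0) (Σ (f ∘ suc) K) (f (suc K)))

  Σ-sum : ∀ {k} (f : Fin k → ℕ → ℤ) K → Σ (λ j → sum (λ i → f i j)) K ≡ sum (λ i → Σ (f i) K)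
  Σ-sum {k} f zero    = sym (sum-zero k)
  Σ-sum {k} f (suc K) = trans (cong (_+ sum (λ i → f i K)) (Σ-sum f K)) (sym (∑-distrib-+ (λ i → Σ (f i) K) (λ i → f i K)))

  ℤ-induction : ∀ {P : ℤ → Set} → P 0ℤ → (∀ z → P z → P (1ℤ + z)) → (∀ z → P (1ℤ + z) → P z) → ∀ z → P z
  ℤ-induction p₀ up down (+ zero)         = p₀
  ℤ-induction p₀ up down +[1+ k ]         = up (+ k) (ℤ-induction p₀ up down (+ k))
  ℤ-induction p₀ up down -[1+ zero ]      = down _ p₀
  ℤ-induction p₀ up down -[1+ suc k ]     = down _ (ℤ-induction p₀ up down -[1+ k ])

  -- Moving the window by one place replaces `f s` by `f (s + K)`, which is c more.
  window : ∀ f K {c} → (∀ z → f (z + + K) ≡ f z + c) → ∀ s →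
    Σ (λ k → f (s + + k)) K ≡ Σ (λ k → f (+ k)) K + s * c
  window f K {c} per = ℤ-induction
    (trans (Σ-cong (λ k → cong f (+-identityˡ (+ k))) K) (e₀ (Σ (λ k → f (+ k)) K) c))
    (λ s eq → trans (step s) (trans (cong (_+ c) eq) (e₁ (Σ (λ k → f (+ k)) K) s c)))
    (λ s eq → +-cancelʳ-≡′ c (trans (sym (step s)) (trans eq (sym (e₁ (Σ (λ k → f (+ k)) K) s c)))))
    where
    open import Algebra.Properties.AbelianGroup +-0-abelianGroup using () renaming (∙-cancelʳ to cancelʳ)
    +-cancelʳ-≡′ : ∀ c {a b} → a + c ≡ b + c → a ≡ b
    +-cancelʳ-≡′ c {a} {b} = cancelʳ c a b
    e₀ : ∀ x c → x ≡ x + 0ℤ * c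
    e₀ = solve-∀
    e₁ : ∀ x s c → x + s * c + c ≡ x + (1ℤ + s) * c
    e₁ = solve-∀
    e₂ : ∀ a b c → b + (a + c) ≡ a + b + c
    e₂ = solve-∀
    shift : ∀ s k → 1ℤ + s + k ≡ s + (1ℤ + k)
    shift = solve-∀
    step : ∀ s → Σ (λ k → f (1ℤ + s + + k)) K ≡ Σ (λ k → f (s + + k)) K + c
    step s = cancelʳ (f (s + + 0)) _ _ (begin
      Σ (λ k → f (1ℤ + s + + k)) K + f (s + + 0)    ≡⟨ cong (_+ f (s + + 0)) (Σ-cong (λ k → cong f (shift s (+ k))) K) ⟩
      Σ (λ k → f (s + + suc k)) K + f (s + + 0)     ≡⟨ +-comm _ (f (s + + 0)) ⟩
      f (s + + 0) + Σ (λ k → f (s + + suc k)) K     ≡⟨ Σ-head (λ k → f (s + + k)) K ⟨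
      Σ (λ k → f (s + + k)) K + f (s + + K)         ≡⟨ cong (_+_ (Σ (λ k → f (s + + k)) K)) (trans (per s) (cong (λ z → f z + c) (sym (+-identityʳ s)))) ⟩
      Σ (λ k → f (s + + k)) K + (f (s + + 0) + c)   ≡⟨ e₂ (f (s + + 0)) _ c ⟩
      f (s + + 0) + Σ (λ k → f (s + + k)) K + c     ≡⟨ e₃ (f (s + + 0)) (Σ (λ k → f (s + + k)) K) c ⟩
      Σ (λ k → f (s + + k)) K + c + f (s + + 0)     ∎)
      where
      open ≡-Reasoning
      e₃ : ∀ a b c → a + b + c ≡ b + c + a
      e₃ = solve-∀

  triangle : ℕ → ℤ
  triangle = Σ (λ k → + k)

  triangle-+ : ∀ k → triangle k + triangle k ≡ + k * + k - + k
  triangle-+ zero    = refl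
  triangle-+ (suc k) = trans (e₁ (triangle k) (+ k)) (trans (cong (_+ (+ k + + k)) (triangle-+ k)) (e₂ (+ k)))
    where
    e₁ : ∀ t k → t + k + (t + k) ≡ t + t + (k + k)
    e₁ = solve-∀
    e₂ : ∀ k → k * k - k + (k + k) ≡ (1ℤ + k) * (1ℤ + k) - (1ℤ + k)
    e₂ = solve-∀

  -- A monotone staircase function, and the path along its boundary: inv t is the abscissa of the
  -- path on the antidiagonal t.
  record Staircase (n k : ℕ) (A : ℤ → ℤ) : Set where
    field
      mono   : ∀ {s t} → s ≤ t → A s ≤ A t
      period : ∀ s → A (s + + n) ≡ A s + + k

    σ : ℤ → ℤ
    σ s = s + A s

    σ-mono : ∀ {s t} → s ≤ t → σ s ≤ σ t
    σ-mono le = +-mono-≤ le (mono le)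

    σ-period : ∀ s → σ (s + + n) ≡ σ s + + (n ℕ.+ k)
    σ-period s = trans (cong (_+_ (s + + n)) (period s)) (eq s (+ n) (A s) (+ k))
      where
      eq : ∀ s n a k → s + n + (a + k) ≡ s + a + (n + k)
      eq = solve-∀

    private
      -- As A is monotone, σ grows by at least one per place, so the threshold t is crossed within
      -- distance 1 + |t - σ(0)| of 0.
      located : ∀ t → First (λ s → t ≤ σ s) (- + suc ∣ t - σ 0ℤ ∣)
                            (- + suc ∣ t - σ 0ℤ ∣ + + (suc ∣ t - σ 0ℤ ∣ ℕ.+ suc ∣ t - σ 0ℤ ∣))
      located t = find (λ s → t ≤? σ s) (- + suc D) (suc D ℕ.+ suc D)
        (1+≤⇒≰ {t} {σ (- + suc D)} (≤-by₂ (σ-low) (-∣∣≤ (t - σ 0ℤ)) (e₁ t (A 0ℤ) (A (- + suc D)) (+ D))))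
        (≤-by₂ (mono 0≤hi) (≤-trans (≤∣∣ (t - σ 0ℤ)) (i≤j+i (+ D) 1ℤ)) (e₂ t (A 0ℤ) (A hi) (+ D)))
        where
        D : ℕ
        D = ∣ t - σ 0ℤ ∣
        hi : ℤ
        hi = - + suc D + + (suc D ℕ.+ suc D)
        0≤hi : 0ℤ ≤ hi
        0≤hi = ≤-by (0≤+ (suc D)) (e₃ (+ suc D))
          where
          e₃ : ∀ d → - d + (d + d) - 0ℤ ≡ d - 0ℤ
          e₃ = solve-∀
        σ-low : A (- + suc D) ≤ A 0ℤ
        σ-low = mono -≤+
        ≤∣∣ : ∀ z → z ≤ + ∣ z ∣
        ≤∣∣ (+ k)    = ≤-refl
        ≤∣∣ -[1+ k ] = -≤+
        -∣∣≤ : ∀ z → - + ∣ z ∣ ≤ z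
        -∣∣≤ (+ k)    = ≤-trans (neg-mono-≤ (0≤+ k)) (0≤+ k)
        -∣∣≤ -[1+ k ] = ≤-refl
        e₁ : ∀ t a₀ a d → t - (1ℤ + (- (1ℤ + d) + a)) ≡ (a₀ - a) + (t - (0ℤ + a₀) - - d)
        e₁ = solve-∀
        e₂ : ∀ t a₀ a d → - (1ℤ + d) + (1ℤ + d + (1ℤ + d)) + a - t ≡ (a - a₀) + (1ℤ + d - (t - (0ℤ + a₀)))
        e₂ = solve-∀

    abstract
      inv : ℤ → ℤ
      inv t = First.at (located t)

      -- Together with `inv⇐` this makes `inv` the left adjoint of σ, and nothing else about the
      -- search is used afterwards.
      inv⇒ : ∀ {t s} → inv t ≤ s → t ≤ σ s
      inv⇒ {t} {s} le = ≤-trans (First.holds (located t)) (σ-mono {inv t} {s} le)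

      inv⇐ : ∀ {t s} → t ≤ σ s → inv t ≤ s
      inv⇐ {t} {s} le = ≮⇒≥ λ lt → First.fails (located t)
        (≤-trans le (σ-mono {s} {inv t - 1ℤ} (≤-by (<⇒1+≤ lt) (eq (inv t) s))))
        where
        eq : ∀ i s → i - 1ℤ - s ≡ i - (1ℤ + s)
        eq = solve-∀

    inv-σ : ∀ s → inv (σ s) ≡ s
    inv-σ s = ≥-ext
      (λ z le → ≮⇒≥ λ lt → 1+≤⇒≰ {σ s} {σ z} (≤-by₂ (mono {z} {s} (≤-trans (i≤j+i z 1ℤ) (<⇒1+≤ lt))) (<⇒1+≤ lt) (eq s z (A s) (A z))) (inv⇒ {σ s} {z} le))
      (λ z le → inv⇐ {σ s} {z} (σ-mono {s} {z} le))
      where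
      eq : ∀ s z a b → s + a - (1ℤ + (z + b)) ≡ (a - b) + (s - (1ℤ + z))
      eq = solve-∀

    inv-mono : ∀ {s t} → s ≤ t → inv s ≤ inv t
    inv-mono {s} {t} le = inv⇐ {s} {inv t} (≤-trans le (inv⇒ {t} ≤-refl))

    inv-period : ∀ t → inv (t + + (n ℕ.+ k)) ≡ inv t + + n
    inv-period t = ≥-ext
      (λ z le → ≤-by (inv⇐ {t} {z - + n} (≤-by (inv⇒ {t + L} {z} le) (e₁ t z))) (e₂ (inv t) z (+ n)))
      (λ z le → inv⇐ {t + L} {z} (≤-by (inv⇒ {t} {z - + n} (≤-by le (sym (e₂ (inv t) z (+ n))))) (sym (e₁ t z))))
      where
      L : ℤ
      L = + (n ℕ.+ k)
      e₀ : ∀ s L t → s - t ≡ (s + L) - (t + L)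
      e₀ = solve-∀
      unshift : ∀ z n → z - n + n ≡ z
      unshift = solve-∀
      e₁ : ∀ t z → σ (z - + n) - t ≡ σ z - (t + L)
      e₁ t z = trans (e₀ (σ (z - + n)) L t) (cong (_- (t + L))
        (trans (sym (σ-period (z - + n))) (cong σ (unshift z (+ n)))))
      e₂ : ∀ i z n → z - (i + n) ≡ z - n - i
      e₂ = solve-∀

    -- The boundary is a lattice path: the abscissa stays or grows by one, and it can grow only at a
    -- point of the graph of A.
    data Next (t : ℤ) : Set where
      level : inv (1ℤ + t) ≡ inv t → Next t
      rise  : inv (1ℤ + t) ≡ 1ℤ + inv t → σ (inv t) ≡ t → Next t

    next : ∀ t → Next t
    next t with 1ℤ + t ≤? σ (inv t)
    ... | yes p = level (≤-antisym (inv⇐ {1ℤ + t} {inv t} p) (inv-mono (i≤j+i t 1ℤ)))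
    ... | no ¬p = rise
      (≤-antisym (inv⇐ {1ℤ + t} {1ℤ + inv t} (≤-by₂ (mono {inv t} {1ℤ + inv t} (i≤j+i (inv t) 1ℤ)) (inv⇒ {t} {inv t} ≤-refl)
                   (e (inv t) (A (inv t)) (A (1ℤ + inv t)) t)))
                 (<⇒1+≤ (≰⇒> λ le → ¬p (inv⇒ {1ℤ + t} {inv t} le))))
      (≤-antisym (≤-by (≰⇒1+≤ ¬p) (e′ (σ (inv t)) t)) (inv⇒ {t} {inv t} ≤-refl))
      where
      e : ∀ i a b t → (1ℤ + i) + b - (1ℤ + t) ≡ (b - a) + (i + a - t)
      e = solve-∀
      e′ : ∀ s t → t - s ≡ 1ℤ + t - (1ℤ + s)
      e′ = solve-∀

    -- Summation by parts along the path.
    inv-by-parts : ∀ t K → ∃[ h ] (inv (t + + K) ≡ inv t + + h ×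
      Σ (λ j → inv (t + + j)) K + Σ (λ l → σ (inv t + + l) + 1ℤ - t) h ≡ + K * (inv t + + h))
    inv-by-parts t zero = 0 , trans (cong inv (+-identityʳ t)) (sym (+-identityʳ (inv t))) , refl
    inv-by-parts t (suc K) with inv-by-parts t K
    ... | h , at , parts with next (t + + K)
    ...   | level eq = h , trans (cong inv (move t (+ K))) (trans eq at) , (begin
      Σi + i + Σσ              ≡⟨ e₁ Σi i Σσ ⟩
      (Σi + Σσ) + i            ≡⟨ cong₂ _+_ parts at ⟩
      + K * (inv t + + h) + (inv t + + h) ≡⟨ e₂ (+ K) (inv t + + h) ⟩
      + suc K * (inv t + + h)  ∎)
      where
      open ≡-Reasoning
      Σi Σσ i : ℤ
      Σi = Σ (λ j → inv (t + + j)) K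
      Σσ = Σ (λ l → σ (inv t + + l) + 1ℤ - t) h
      i = inv (t + + K)
      move : ∀ t k → t + (1ℤ + k) ≡ 1ℤ + (t + k)
      move = solve-∀
      e₁ : ∀ a i b → a + i + b ≡ a + b + i
      e₁ = solve-∀
      e₂ : ∀ k x → k * x + x ≡ (1ℤ + k) * x
      e₂ = solve-∀
    ...   | rise eq at-σ = suc h , trans (cong inv (move t (+ K))) (trans eq (trans (cong (_+_ 1ℤ) at) (e₀ (inv t) (+ h)))) , (begin
      Σi + i + (Σσ + (σ (inv t + + h) + 1ℤ - t))  ≡⟨ cong₂ (λ a b → Σi + a + (Σσ + (b + 1ℤ - t))) at (trans (cong σ (sym at)) at-σ) ⟩
      Σi + x + (Σσ + (t + + K + 1ℤ - t))          ≡⟨ e₁ Σi x Σσ t (+ K) ⟩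
      (Σi + Σσ) + (x + (1ℤ + + K))                ≡⟨ cong (_+ (x + (1ℤ + + K))) parts ⟩
      + K * x + (x + (1ℤ + + K))                  ≡⟨ e₂ (+ K) (inv t) (+ h) ⟩
      + suc K * (inv t + + suc h)                 ∎)
      where
      open ≡-Reasoning
      Σi Σσ i x : ℤ
      Σi = Σ (λ j → inv (t + + j)) K
      Σσ = Σ (λ l → σ (inv t + + l) + 1ℤ - t) h
      i = inv (t + + K)
      x = inv t + + h
      move : ∀ t k → t + (1ℤ + k) ≡ 1ℤ + (t + k)
      move = solve-∀
      e₀ : ∀ i h → 1ℤ + (i + h) ≡ i + (1ℤ + h)
      e₀ = solve-∀
      e₁ : ∀ a x b t k → a + x + (b + (t + k + 1ℤ - t)) ≡ a + b + (x + (1ℤ + k))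
      e₁ = solve-∀
      e₂ : ∀ k i h → k * (i + h) + (i + h + (1ℤ + k)) ≡ (1ℤ + k) * (i + (1ℤ + h))
      e₂ = solve-∀

  module Vector (n₁ : ℕ) where
    open Floor n₁

    -- Hermite's identity. By `window` it reduces to z = 0, where all the floors are 0.
    hermite : ∀ z → Σ (λ j → ⌊ z + + j ⌋) n ≡ z
    hermite z = trans (window ⌊_⌋ n ⌊⌋-period z) (trans (cong (_+ z * 1ℤ) (trans (Σ-small n ℕ.≤-refl) refl)) (e z))
      where
      e : ∀ z → 0ℤ + z * 1ℤ ≡ z
      e = solve-∀
      Σ-small : ∀ K → K ℕ.≤ n → Σ (λ j → ⌊ + j ⌋) K ≡ 0ℤ
      Σ-small zero    _  = refl
      Σ-small (suc K) lt = cong₂ _+_ (Σ-small K (ℕ.<⇒≤ lt))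
        (⌊⌋-unique 0ℤ (+ K) (0≤+ K) (≤-trans (+≤+ lt) (≤-reflexive (sym (*-identityˡ (+ n))))))

    staircase : ∀ {k} → (Fin k → ℤ) → ℤ → ℤ
    staircase a s = sum (λ i → ⌊ a i + s ⌋)

    abstract
      staircase-isStaircase : ∀ {k} (a : Fin k → ℤ) → Staircase n k (staircase a)
      staircase-isStaircase {k} a = record
        { mono   = λ s≤t → sum-mono (λ i → ⌊⌋-mono (+-monoʳ-≤ (a i) s≤t))
        ; period = λ s → trans (sum-cong-≗ (λ i → trans (cong ⌊_⌋ (sym (+-assoc (a i) s (+ n)))) (⌊⌋-period (a i + s))))
            (trans (∑-distrib-+ (λ i → ⌊ a i + s ⌋) (λ _ → 1ℤ))
              (cong (_+_ (staircase a s)) (trans (sum-const k 1ℤ) (*-identityʳ (+ k)))))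
        }

    staircase-mono : ∀ {k} {a b : Fin k → ℤ} → (∀ i → a i ≤ b i) → ∀ s → staircase a s ≤ staircase b s
    staircase-mono a≤b s = sum-mono (λ i → ⌊⌋-mono (+-monoˡ-≤ s (a≤b i)))

    staircase-cong : ∀ {k} {a b : Fin k → ℤ} → (∀ i → a i ≡ b i) → ∀ s → staircase a s ≡ staircase b s
    staircase-cong eq s = sum-cong-≗ (λ i → cong (λ z → ⌊ z + s ⌋) (eq i))

    staircase-sum : ∀ {k} (a : Fin k → ℤ) s → Σ (λ j → staircase a (s + + j)) n ≡ sum a + + k * s
    staircase-sum {k} a s = trans (Σ-sum (λ i j → ⌊ a i + (s + + j) ⌋) n)
      (trans (sum-cong-≗ (λ i → trans (Σ-cong (λ j → cong ⌊_⌋ (sym (+-assoc (a i) s (+ j)))) n) (hermite (a i + s))))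
        (trans (∑-distrib-+ a (λ _ → s)) (cong (_+_ (sum a)) (sum-const k s))))

    module _ {k : ℕ} (a : Fin k → ℤ) where
      open Staircase (staircase-isStaircase a)

      -- Summation by parts turns the abscissas of a period into values of σ, whose sum is given by
      -- `staircase-sum`. The starting abscissa cancels, so only the sum of the vector remains.
      inv-sum : Σ (λ j → inv (+ j)) (n ℕ.+ k) ≡ + (n ℕ.+ k) * + n - triangle n - + n - sum a
      inv-sum with h , at , parts ← inv-by-parts 0ℤ (n ℕ.+ k) = begin
        Σ (λ j → inv (+ j)) L          ≡⟨ Σ-cong (λ j → cong inv (sym (+-identityˡ (+ j)))) L ⟩
        Σi                             ≡⟨ e₀ Σi Σσ ⟩
        (Σi + Σσ) - Σσ                 ≡⟨ cong₂ _-_ (trans parts (cong (λ h → + L * (i₀ + + h)) h≡n)) Σσ-eq ⟩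
        + L * (i₀ + + n) - ((+ n * i₀ + triangle n) + (sum a + + k * i₀) + + n)
                                       ≡⟨ e₁ (+ n) (+ k) i₀ (triangle n) (sum a) ⟩
        + L * + n - triangle n - + n - sum a ∎
        where
        open ≡-Reasoning
        open import Algebra.Properties.AbelianGroup +-0-abelianGroup using () renaming (∙-cancelˡ to cancelˡ)
        L : ℕ
        L = n ℕ.+ k
        i₀ Σi Σσ : ℤ
        i₀ = inv 0ℤ
        Σi = Σ (λ j → inv (0ℤ + + j)) L
        Σσ = Σ (λ l → σ (i₀ + + l) + 1ℤ - 0ℤ) h
        h≡n : h ≡ n
        h≡n = +-injective (cancelˡ i₀ _ _ (trans (sym at) (inv-period 0ℤ)))
        Σσ-eq : Σσ ≡ (+ n * i₀ + triangle n) + (sum a + + k * i₀) + + n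
        Σσ-eq = trans (cong (Σ _) h≡n) (trans (Σ-cong (λ l → eq (i₀) (+ l) (staircase a (i₀ + + l))) n)
          (trans (Σ-+ (λ l → (i₀ + + l) + staircase a (i₀ + + l)) (λ _ → 1ℤ) n)
            (cong₂ _+_ (trans (Σ-+ (λ l → i₀ + + l) (λ l → staircase a (i₀ + + l)) n)
                (cong₂ _+_ (trans (Σ-+ (λ _ → i₀) (λ l → + l) n) (cong (_+ triangle n) (Σ-const i₀ n))) (staircase-sum a i₀)))
              (trans (Σ-const 1ℤ n) (*-identityʳ (+ n))))))
          where
          eq : ∀ i l a → i + l + a + 1ℤ - 0ℤ ≡ i + l + a + 1ℤ
          eq = solve-∀
        e₀ : ∀ a b → a ≡ a + b - b
        e₀ = solve-∀
        e₁ : ∀ n k i t s → (n + k) * (i + n) - ((n * i + t) + (s + k * i) + n) ≡ (n + k) * n - t - n - s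
        e₁ = solve-∀

  sum-indicator : ∀ {k} (f : Fin k → ℤ) i →
    sum (λ i′ → f i′ * (if does (i′ Fin.≟ i) then 1ℤ else 0ℤ)) ≡ f i
  sum-indicator {suc k} f zero = trans (cong₂ _+_ (*-identityʳ (f zero))
      (trans (sum-cong-≗ (λ i → *-zeroʳ (f (suc i)))) (sum-zero k)))
    (+-identityʳ (f zero))
  sum-indicator {suc k} f (suc i) = trans (cong₂ _+_ (*-zeroʳ (f zero)) (sum-indicator (f ∘ suc) i)) (+-identityˡ (f (suc i)))

  -- The whole excess is taken from the first entry.
  sum-lower : ∀ {k} (f : Fin (suc k) → ℤ) {s} → s ≤ sum f → ∃[ g ] (∀ i → g i ≤ f i) × sum g ≡ s
  sum-lower f {s} le = g , g≤f , eq (f zero) (sum (f ∘ suc)) s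
    where
    g : _ → ℤ
    g zero    = f zero - (sum f - s)
    g (suc i) = f (suc i)
    g≤f : ∀ i → g i ≤ f i
    g≤f zero    = ≤-by le (e (f zero) (sum f) s)
      where
      e : ∀ a b s → a - (a - (b - s)) ≡ b - s
      e = solve-∀
    g≤f (suc i) = ≤-refl
    eq : ∀ a b s → a - (a + b - s) + b ≡ s
    eq = solve-∀


  lastTrue : ∀ {Q : ℤ → Set} → Decidable Q → ∀ hi k → Q (hi - + k) →
    ∃[ s ] Q s × (∀ z → 1ℤ + s ≤ z → z ≤ hi → ¬ Q z)
  lastTrue {Q} Q? hi zero q = hi , subst Q (+-identityʳ hi) q , λ z gt le _ → 1+≤⇒≰ gt le
  lastTrue {Q} Q? hi (suc k) q = decide (Q? hi) (lastTrue Q? (hi - 1ℤ) k (subst Q (e hi (+ k)) q))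
    where
    e : ∀ hi k → hi - (1ℤ + k) ≡ hi - 1ℤ - k
    e = solve-∀
    e′ : ∀ hi z → z - hi ≡ z - (1ℤ + (hi - 1ℤ))
    e′ = solve-∀
    decide : Dec (Q hi) → ∃[ s ] Q s × (∀ z → 1ℤ + s ≤ z → z ≤ hi - 1ℤ → ¬ Q z) →
      ∃[ s ] Q s × (∀ z → 1ℤ + s ≤ z → z ≤ hi → ¬ Q z)
    decide (yes q′) _ = hi , q′ , λ z gt le _ → 1+≤⇒≰ gt le
    decide (no ¬q) (s , qs , none) = s , qs , below
      where
      below : ∀ z → 1ℤ + s ≤ z → z ≤ hi → ¬ Q z
      below z gt le qz with z ≤? hi - 1ℤ
      ... | yes z≤ = none z gt z≤ qz
      ... | no z≰  = ¬q (subst Q (≤-antisym le (≤-by (≰⇒1+≤ z≰) (e′ hi z))) qz)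

  module StaircaseBounds (n₁ : ℕ) where
    open Floor n₁
    open Vector n₁

    private
      sum-scale : ∀ {k} (f : Fin k → ℤ) → sum (λ i → f i * + n) ≡ sum f * + n
      sum-scale {zero}  f = refl
      sum-scale {suc k} f = trans (cong (_+_ (f zero * + n)) (sum-scale (f ∘ suc))) (sym (*-distribʳ-+ (+ n) (f zero) (sum (f ∘ suc))))

      sum-shift : ∀ {k} (a : Fin k → ℤ) s → sum (λ i → a i + s) ≡ sum a + + k * s
      sum-shift {k} a s = trans (∑-distrib-+ a (λ _ → s)) (cong (_+_ (sum a)) (sum-const k s))

    staircase-≤ : ∀ {k} (a : Fin k → ℤ) s → staircase a s * + n ≤ sum a + + k * s
    staircase-≤ a s = ≤-trans (≤-reflexive (sym (sum-scale (λ i → ⌊ a i + s ⌋))))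
      (≤-trans (sum-mono (λ i → ⌊⌋⇒ ⌊ a i + s ⌋ (a i + s) ≤-refl)) (≤-reflexive (sum-shift a s)))

    -- Multiplied by n, each of the k floors falls short by at most n₁ = n - 1.
    staircase-≥ : ∀ {k} (a : Fin k → ℤ) s → sum a + + k * s ≤ staircase a s * + n + + k * + n₁
    staircase-≥ {k} a s = ≤-trans (≤-reflexive (sym (sum-shift a s)))
      (≤-trans (sum-mono (λ i → below (a i + s))) (≤-reflexive (trans
        (∑-distrib-+ (λ i → ⌊ a i + s ⌋ * + n) (λ _ → + n₁)) (cong₂ _+_ (sum-scale (λ i → ⌊ a i + s ⌋)) (sum-const k (+ n₁))))))
      where
      below : ∀ z → z ≤ ⌊ z ⌋ * + n + + n₁
      below z = ≮⇒≥ λ lt → 1+≤⇒≰ {1ℤ + ⌊ z ⌋} {⌊ z ⌋} ≤-refl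
        (⌊⌋⇐ (1ℤ + ⌊ z ⌋) z (≤-by (<⇒1+≤ lt) (e z ⌊ z ⌋ (+ n₁))))
        where
        e : ∀ z f n → z - (1ℤ + f) * (1ℤ + n) ≡ z - (1ℤ + (f * (1ℤ + n) + n))
        e = solve-∀

-- Reduced sorted vectors and their staircases.

module SortedVectors where
  open Staircases
  open import Data.Bool.Base using (Bool; true; false; if_then_else_)
  open import Data.Empty using (⊥-elim)
  open import Data.Fin.Base as Fin using (Fin; zero; suc; toℕ; inject₁; fromℕ)
  import Data.Fin.Properties as Fin
  open import Data.Integer.Base hiding (suc; pred; _⊖_; NonNegative; pos; neg)
  open import Data.Integer.DivMod using (a≡a%ℕn+[a/ℕn]*n; n%ℕd<d)
  open import Data.Integer.Properties
  open import Data.Integer.Tactic.RingSolver using (solve-∀)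
  open import Data.Nat.Base as ℕ using (ℕ; zero; suc; z≤n; s≤s)
  import Data.Nat.Properties as ℕ
  open import Data.Product.Base using (_×_; _,_; proj₁; proj₂; ∃-syntax)
  open import Data.Sum.Base using (_⊎_; inj₁; inj₂)
  open import Relation.Binary.PropositionalEquality hiding ([_])
  open import Relation.Nullary using (¬_; Dec; yes; no; does)
  open import Relation.Nullary.Decidable using (dec-true; dec-false)

  ⟨_⟩ : Bool → ℤ
  ⟨ b ⟩ = if b then 1ℤ else 0ℤ

  0≤⟨⟩ : ∀ b → 0ℤ ≤ ⟨ b ⟩
  0≤⟨⟩ true  = 0≤+ 1
  0≤⟨⟩ false = ≤-refl

  ⟨⟩≤1 : ∀ b → ⟨ b ⟩ ≤ 1ℤ
  ⟨⟩≤1 true  = ≤-refl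
  ⟨⟩≤1 false = 0≤+ 1

  module _ {P : Set} (d : Dec P) where
    ⟨⟩-yes : P → ⟨ does d ⟩ ≡ 1ℤ
    ⟨⟩-yes p = cong ⟨_⟩ (dec-true d p)

    ⟨⟩-no : ¬ P → ⟨ does d ⟩ ≡ 0ℤ
    ⟨⟩-no ¬p = cong ⟨_⟩ (dec-false d ¬p)

  true⇒ : ∀ {P : Set} (d : Dec P) → does d ≡ true → P
  true⇒ (yes p) _ = p

  sum-≥0 : ∀ {k} (f : Fin k → ℤ) → (∀ i → 0ℤ ≤ f i) → 0ℤ ≤ sum f
  sum-≥0 {k} f f≥0 = ≤-trans (≤-reflexive (sym (sum-zero k))) (sum-mono f≥0)

  sum-≡ : ∀ k (f g : Fin k → ℤ) → (∀ i → f i ≡ g i) → sum f ≡ sum g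
  sum-≡ k f g = sum-cong-≗ {k} {f} {g}

  sum-last : ∀ k x → x ℕ.≤ k → sum {k} (λ i → ⟨ does (+ k - + toℕ i ≤? + x) ⟩) ≡ + x
  sum-last-< : ∀ k x → x ℕ.≤ k → sum {suc k} (λ i → ⟨ does (+ suc k - + toℕ i ≤? + x) ⟩) ≡ + x
  sum-last zero    .0 z≤n = refl
  sum-last (suc k) x  x≤ with x ℕ.≟ suc k
  ... | no x≢    = sum-last-< k x (ℕ.≤-pred (ℕ.≤∧≢⇒< x≤ x≢))
  ... | yes refl = trans (sum-≡ (suc k) (λ i → ⟨ does (+ suc k - + toℕ i ≤? + suc k) ⟩) (λ _ → 1ℤ) all)
                     (trans (sum-const (suc k) 1ℤ) (*-identityʳ (+ suc k)))
    where
    e : ∀ k i → k - (k - i) ≡ i - 0ℤ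
    e = solve-∀
    all : ∀ i → ⟨ does (+ suc k - + toℕ i ≤? + suc k) ⟩ ≡ 1ℤ
    all i = ⟨⟩-yes (+ suc k - + toℕ i ≤? + suc k) (≤-by (0≤+ (toℕ i)) (e (+ suc k) (+ toℕ i)))
  sum-last-< k x x≤k = trans (cong₂ _+_ head (trans
      (sum-≡ k (λ i → ⟨ does (+ suc k - + suc (toℕ i) ≤? + x) ⟩) (λ i → ⟨ does (+ k - + toℕ i ≤? + x) ⟩)
        (λ i → cong (λ z → ⟨ does (z ≤? + x) ⟩) (e (+ k) (+ toℕ i))))
      (sum-last k x x≤k)))
    (+-identityˡ (+ x))
    where
    e : ∀ k i → 1ℤ + k - (1ℤ + i) ≡ k - i
    e = solve-∀
    head : ⟨ does (+ suc k - 0ℤ ≤? + x) ⟩ ≡ 0ℤ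
    head = ⟨⟩-no (+ suc k - 0ℤ ≤? + x)
      (λ le → ℕ.<⇒≱ (s≤s x≤k) (drop‿+≤+ (≤-trans (≤-reflexive (sym (+-identityʳ (+ suc k)))) le)))

  private
    does-suc : ∀ a b → does (suc a ℕ.≤? suc b) ≡ does (a ℕ.≤? b)
    does-suc zero    b = refl
    does-suc (suc a) b = refl

  sum-from : ∀ {k} (i : Fin k) → sum {k} (λ l → ⟨ does (toℕ i ℕ.≤? toℕ l) ⟩) ≡ + k - + toℕ i
  sum-from {suc k} zero    = trans (sum-≡ (suc k) (λ l → ⟨ does (0 ℕ.≤? toℕ l) ⟩) (λ _ → 1ℤ) (λ _ → refl))
    (trans (sum-const (suc k) 1ℤ) (e (+ suc k)))
    where
    e : ∀ k → k * 1ℤ ≡ k - 0ℤ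
    e = solve-∀
  sum-from {suc k} (suc i) = trans (+-identityˡ _)
    (trans (sum-≡ k (λ l → ⟨ does (suc (toℕ i) ℕ.≤? suc (toℕ l)) ⟩) (λ l → ⟨ does (toℕ i ℕ.≤? toℕ l) ⟩)
        (λ l → cong ⟨_⟩ (does-suc (toℕ i) (toℕ l))))
      (trans (sum-from i) (e (+ k) (+ toℕ i))))
    where
    e : ∀ k i → k - i ≡ 1ℤ + k - (1ℤ + i)
    e = solve-∀

  sum-after : ∀ {k} (i : Fin k) → 1ℤ + sum {k} (λ l → ⟨ does (suc (toℕ i) ℕ.≤? toℕ l) ⟩) ≡ + k - + toℕ i
  sum-after {suc k} zero    = trans (cong (λ z → 1ℤ + (0ℤ + z))
      (trans (sum-≡ k (λ l → ⟨ does (1 ℕ.≤? suc (toℕ l)) ⟩) (λ _ → 1ℤ) (λ _ → refl)) (sum-const k 1ℤ))) (e (+ k))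
    where
    e : ∀ k → 1ℤ + (0ℤ + k * 1ℤ) ≡ 1ℤ + k - 0ℤ
    e = solve-∀
  sum-after {suc k} (suc i) = trans (cong (_+_ 1ℤ) (+-identityˡ (sum {k} (λ l → ⟨ does (suc (suc (toℕ i)) ℕ.≤? suc (toℕ l)) ⟩))))
    (trans (cong (_+_ 1ℤ) (sum-≡ k (λ l → ⟨ does (suc (suc (toℕ i)) ℕ.≤? suc (toℕ l)) ⟩)
        (λ l → ⟨ does (suc (toℕ i) ℕ.≤? toℕ l) ⟩) (λ l → cong ⟨_⟩ (does-suc (suc (toℕ i)) (toℕ l)))))
      (trans (sum-after i) (e (+ k) (+ toℕ i))))
    where
    e : ∀ k i → k - i ≡ 1ℤ + k - (1ℤ + i)
    e = solve-∀

  module Period (n₁ : ℕ) where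
    n : ℕ
    n = suc n₁

    multiples : ∀ (f : ℤ → ℤ) {c} → (∀ z → f (z + + n) ≡ f z + c) → ∀ z p → f (z + p * + n) ≡ f z + p * c
    multiples f {c} per z = ℤ-induction {λ p → f (z + p * + n) ≡ f z + p * c}
      (trans (cong f (e₀ z (+ n))) (e₀′ (f z) c))
      (λ p eq → trans (cong f (e₁ z p (+ n))) (trans (per (z + p * + n)) (trans (cong (_+ c) eq) (e₁′ (f z) p c))))
      (λ p eq → cancelʳ c _ _ (trans (sym (per (z + p * + n))) (trans (cong f (sym (e₁ z p (+ n)))) (trans eq (sym (e₁′ (f z) p c))))))
      where
      open import Algebra.Properties.AbelianGroup +-0-abelianGroup using () renaming (∙-cancelʳ to cancelʳ)
      e₀ : ∀ z n → z + 0ℤ * n ≡ z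
      e₀ = solve-∀
      e₀′ : ∀ z c → z ≡ z + 0ℤ * c
      e₀′ = solve-∀
      e₁ : ∀ z p n → z + (1ℤ + p) * n ≡ z + p * n + n
      e₁ = solve-∀
      e₁′ : ∀ z p c → z + p * c + c ≡ z + (1ℤ + p) * c
      e₁′ = solve-∀

    agree : ∀ (f g : ℤ → ℤ) {c} → (∀ z → f (z + + n) ≡ f z + c) → (∀ z → g (z + + n) ≡ g z + c) →
      (∀ k → k ℕ.< n → f (+ k) ≡ g (+ k)) → ∀ z → f z ≡ g z
    agree f g {c} perf perg eq z = begin
      f z                          ≡⟨ cong f split ⟩
      f (+ r + p * + n)            ≡⟨ multiples f perf (+ r) p ⟩
      f (+ r) + p * c              ≡⟨ cong (_+ p * c) (eq r (n%ℕd<d z n)) ⟩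
      g (+ r) + p * c              ≡⟨ multiples g perg (+ r) p ⟨
      g (+ r + p * + n)            ≡⟨ cong g split ⟨
      g z                          ∎
      where
      open ≡-Reasoning
      r : ℕ
      r = z %ℕ n
      p : ℤ
      p = z /ℕ n
      split : z ≡ + r + p * + n
      split = a≡a%ℕn+[a/ℕn]*n z n

  module Sorting (n₁ : ℕ) where
    open Floor n₁
    open Vector n₁
    open Period n₁ using (agree)

    ⌊⌋-0 : ∀ {z} → 0ℤ ≤ z → 1ℤ + z ≤ + n → ⌊ z ⌋ ≡ 0ℤ
    ⌊⌋-0 {z} lo hi = ⌊⌋-unique 0ℤ z lo (≤-trans hi (≤-reflexive (sym (*-identityˡ (+ n)))))

    ⌊⌋-1 : ∀ {z} → + n ≤ z → 1ℤ + z ≤ + n + + n → ⌊ z ⌋ ≡ 1ℤ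
    ⌊⌋-1 {z} lo hi = ⌊⌋-unique 1ℤ z (≤-trans (≤-reflexive (*-identityˡ (+ n))) lo) (≤-trans hi (≤-reflexive (e (+ n))))
      where
      e : ∀ n → n + n ≡ (1ℤ + 1ℤ) * n
      e = solve-∀

    Reduced : ℤ → Set
    Reduced z = 0ℤ ≤ z × 1ℤ + z ≤ + n

    -- In this range the floor is 0 or 1, so over the first period a staircase counts the entries
    -- that are at least n - s.
    ⌊⌋-indicator : ∀ z s → 0ℤ ≤ z → 1ℤ + z + s ≤ + n + + n → 0ℤ ≤ s → ⌊ z + s ⌋ ≡ ⟨ does (+ n - s ≤? z) ⟩
    ⌊⌋-indicator z s z≥0 hi s≥0 with + n - s ≤? z
    ... | yes p = ⌊⌋-1 (≤-by p (e₁ (+ n) z s)) (≤-by hi (e₂ (+ n) z s))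
      where
      e₁ : ∀ n z s → z + s - n ≡ z - (n - s)
      e₁ = solve-∀
      e₂ : ∀ n z s → n + n - (1ℤ + (z + s)) ≡ n + n - (1ℤ + z + s)
      e₂ = solve-∀
    ... | no ¬p = ⌊⌋-0 (+-mono-≤ z≥0 s≥0) (≤-by (≰⇒1+≤ ¬p) (e (+ n) z s))
      where
      e : ∀ n z s → n - (1ℤ + (z + s)) ≡ n - s - (1ℤ + z)
      e = solve-∀

    -- Every staircase with value 0 at 0 comes from a reduced sorted vector. An entry a contributes
    -- its unit jump at n - a, so entry i has to be n minus the place where F first reaches k - i.
    module Realize {k : ℕ} {F : ℤ → ℤ} (F-staircase : Staircase n k F) (F₀ : F 0ℤ ≡ 0ℤ) where
      open Staircase F-staircase

      private
        F-n : F (0ℤ + + n) ≡ + k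
        F-n = trans (period 0ℤ) (trans (cong (_+ + k) F₀) (+-identityˡ (+ k)))

        reached : ∀ (i : Fin k) → First (λ s → + k - + toℕ i ≤ F s) 0ℤ (0ℤ + + n)
        reached i = find (λ s → + k - + toℕ i ≤? F s) 0ℤ n
          (1+≤⇒≰ (≤-trans (≤-reflexive (cong (_+_ 1ℤ) F₀)) (≤-by (+≤+ (Fin.toℕ<n i)) (e₁ (+ k) (+ toℕ i)))))
          (≤-trans (≤-by (0≤+ (toℕ i)) (e₂ (+ k) (+ toℕ i))) (≤-reflexive (sym F-n)))
          where
          e₁ : ∀ k i → k - i - (1ℤ + 0ℤ) ≡ k - (1ℤ + i)
          e₁ = solve-∀
          e₂ : ∀ k i → k - (k - i) ≡ i - 0ℤ
          e₂ = solve-∀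

        at : Fin k → ℤ
        at i = First.at (reached i)

        at⇐ : ∀ {i s} → + k - + toℕ i ≤ F s → at i ≤ s
        at⇐ {i} {s} le = ≮⇒≥ λ lt → First.fails (reached i) (≤-trans le (mono (≤-by (<⇒1+≤ lt) (e (at i) s))))
          where
          e : ∀ a s → a - 1ℤ - s ≡ a - (1ℤ + s)
          e = solve-∀

        at⇒ : ∀ {i s} → at i ≤ s → + k - + toℕ i ≤ F s
        at⇒ {i} le = ≤-trans (First.holds (reached i)) (mono le)

      realize : Fin k → ℤ
      realize i = + n - at i

      realize-reduced : ∀ i → Reduced (realize i)
      realize-reduced i = ≤-by (First.upto (reached i)) (e₁ (+ n) (at i)) , ≤-by (First.above (reached i)) (e₂ (+ n) (at i))
        where
        e₁ : ∀ n a → n - a - 0ℤ ≡ 0ℤ + n - a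
        e₁ = solve-∀
        e₂ : ∀ n a → n - (1ℤ + (n - a)) ≡ a - (1ℤ + 0ℤ)
        e₂ = solve-∀

      realize-sorted : ∀ {i j} → i Fin.≤ j → realize i ≤ realize j
      realize-sorted {i} {j} i≤j = ≤-by (at⇐ {j} {at i} (≤-trans (≤-by (+≤+ i≤j) (e (+ k) (+ toℕ i) (+ toℕ j))) (at⇒ {i} {at i} ≤-refl)))
        (e′ (+ n) (at i) (at j))
        where
        e : ∀ k i j → k - i - (k - j) ≡ j - i
        e = solve-∀
        e′ : ∀ n a b → n - b - (n - a) ≡ a - b
        e′ = solve-∀

      realize-staircase : ∀ s → staircase realize s ≡ F s
      realize-staircase = agree (staircase realize) F (Staircase.period (staircase-isStaircase realize)) period on-period
        where
        on-period : ∀ s → s ℕ.< n → staircase realize (+ s) ≡ F (+ s)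
        on-period s s<n = trans (sum-≡ k (λ i → ⌊ realize i + + s ⌋) (λ i → ⟨ does (+ k - + toℕ i ≤? F (+ s)) ⟩) term)
          (trans (sum-≡ k (λ i → ⟨ does (+ k - + toℕ i ≤? F (+ s)) ⟩) (λ i → ⟨ does (+ k - + toℕ i ≤? + ∣ F (+ s) ∣) ⟩) (λ i → cong (λ z → ⟨ does (+ k - + toℕ i ≤? z) ⟩) (sym Fs)))
            (trans (sum-last k ∣ F (+ s) ∣ (drop‿+≤+ (≤-trans (≤-reflexive Fs) (≤-trans (mono (+≤+ (ℕ.<⇒≤ s<n))) (≤-reflexive F-n))))) Fs))
          where
          Fs : + ∣ F (+ s) ∣ ≡ F (+ s)
          Fs = 0≤i⇒+∣i∣≡i (≤-trans (≤-reflexive (sym F₀)) (mono (0≤+ s)))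
          e₁ : ∀ n z s → n + n - (1ℤ + z + s) ≡ n - (1ℤ + z) + (n - s)
          e₁ = solve-∀
          e₂ : ∀ n s a → s - a ≡ n - a - (n - s)
          e₂ = solve-∀
          term : ∀ i → ⌊ realize i + + s ⌋ ≡ ⟨ does (+ k - + toℕ i ≤? F (+ s)) ⟩
          term i = trans (⌊⌋-indicator (realize i) (+ s) (proj₁ (realize-reduced i))
              (≤-by₂ (proj₂ (realize-reduced i)) (+≤+ (ℕ.<⇒≤ s<n)) (e₁ (+ n) (realize i) (+ s))) (0≤+ s))
            (does-⇔ (+ n - + s ≤? realize i) (+ k - + toℕ i ≤? F (+ s))
              (λ le → at⇒ {i} {+ s} (≤-by le (e₂ (+ n) (+ s) (at i)))) (λ le → ≤-by (at⇐ {i} {+ s} le) (sym (e₂ (+ n) (+ s) (at i)))))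
            where
            does-⇔ : ∀ {P Q : Set} (p : Dec P) (q : Dec Q) → (P → Q) → (Q → P) → ⟨ does p ⟩ ≡ ⟨ does q ⟩
            does-⇔ (yes _) (yes _) f g = refl
            does-⇔ (no _)  (no _)  f g = refl
            does-⇔ (yes p) (no ¬q) f g = ⊥-elim (¬q (f p))
            does-⇔ (no ¬p) (yes q) f g = ⊥-elim (¬p (g q))

    module _ {k : ℕ} (a : Fin k → ℤ) (a-reduced : ∀ i → Reduced (a i)) (a-sorted : ∀ {i j} → i Fin.≤ j → a i ≤ a j) where
      private
        fits : ∀ x → 1ℤ ≤ x → x ≤ + n → ∀ l → ⌊ a l + (+ n - x) ⌋ ≡ ⟨ does (x ≤? a l) ⟩
        fits x 1≤x x≤n l = trans (⌊⌋-indicator (a l) (+ n - x) (proj₁ (a-reduced l))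
            (≤-by₂ (proj₂ (a-reduced l)) (≤-trans (0≤+ 1) 1≤x) (e₁ (+ n) (a l) x)) (i≤j⇒0≤j-i x≤n))
          (cong (λ z → ⟨ does (z ≤? a l) ⟩) (e₂ (+ n) x))
          where
          e₁ : ∀ n a x → n + n - (1ℤ + a + (n - x)) ≡ n - (1ℤ + a) + (x - 0ℤ)
          e₁ = solve-∀
          e₂ : ∀ n x → n - (n - x) ≡ x
          e₂ = solve-∀

      -- In a sorted vector the k - i entries from the i-th on are all at least x.
      entry⇒staircase : ∀ i x → 1ℤ ≤ x → x ≤ + n → x ≤ a i → + k - + toℕ i ≤ staircase a (+ n - x)
      entry⇒staircase i x 1≤x x≤n x≤a = ≤-trans (≤-reflexive (sym (sum-from i)))
        (sum-mono (λ l → ≤-trans (bound l) (≤-reflexive (sym (fits x 1≤x x≤n l)))))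
        where
        decide : ∀ l → (d : Dec (toℕ i ℕ.≤ toℕ l)) → ⟨ does d ⟩ ≤ ⟨ does (x ≤? a l) ⟩
        decide l (yes le) = ≤-reflexive (sym (⟨⟩-yes (x ≤? a l) (≤-trans x≤a (a-sorted {i} {l} le))))
        decide l (no _)   = 0≤⟨⟩ (does (x ≤? a l))
        bound : ∀ l → ⟨ does (toℕ i ℕ.≤? toℕ l) ⟩ ≤ ⟨ does (x ≤? a l) ⟩
        bound l = decide l (toℕ i ℕ.≤? toℕ l)

      staircase⇒entry : ∀ i x → 1ℤ ≤ x → x ≤ + n → + k - + toℕ i ≤ staircase a (+ n - x) → x ≤ a i
      staircase⇒entry i x 1≤x x≤n le = ≮⇒≥ λ lt → 1+≤⇒≰ (≤-reflexive (sum-after i)) (≤-trans le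
        (sum-mono (λ l → ≤-trans (≤-reflexive (fits x 1≤x x≤n l)) (bound lt l))))
        where
        decide : a i < x → ∀ l → (d : Dec (suc (toℕ i) ℕ.≤ toℕ l)) → ⟨ does (x ≤? a l) ⟩ ≤ ⟨ does d ⟩
        bound : a i < x → ∀ l → ⟨ does (x ≤? a l) ⟩ ≤ ⟨ does (suc (toℕ i) ℕ.≤? toℕ l) ⟩
        bound lt l = decide lt l (suc (toℕ i) ℕ.≤? toℕ l)
        decide lt l (yes _) = ⟨⟩≤1 (does (x ≤? a l))
        decide lt l (no ¬p) = ≤-reflexive (⟨⟩-no (x ≤? a l) (λ x≤ → <-irrefl refl (≤-<-trans x≤
                (≤-<-trans (a-sorted {l} {i} (ℕ.≤-pred (ℕ.≰⇒> ¬p))) lt))))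

    -- For x between 1 and n the staircase decides whether x ≤ a i; this is used with x the entry
    -- itself, and an entry below 1 is bounded by reducedness.
    sorted-≤ : ∀ {k} {a b : Fin k → ℤ} → (∀ i → Reduced (a i)) → (∀ {i j} → i Fin.≤ j → a i ≤ a j) →
      (∀ i → Reduced (b i)) → (∀ {i j} → i Fin.≤ j → b i ≤ b j) →
      (∀ s → staircase a s ≡ staircase b s) → ∀ i → a i ≤ b i
    sorted-≤ {k} {a} {b} ra sa rb sb eq i with 1ℤ ≤? a i
    ... | no ¬p = ≤-trans (≤-by (≰⇒1+≤ ¬p) (e (a i))) (proj₁ (rb i))
      where
      e : ∀ a → 0ℤ - a ≡ 1ℤ - (1ℤ + a)
      e = solve-∀
    ... | yes 1≤a = staircase⇒entry b rb sb i (a i) 1≤a a≤n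
        (subst (+ k - + toℕ i ≤_) (eq (+ n - a i)) (entry⇒staircase a ra sa i (a i) 1≤a a≤n ≤-refl))
      where
      a≤n : a i ≤ + n
      a≤n = ≤-trans (i≤j+i (a i) 1ℤ) (proj₂ (ra i))

  lastView : ∀ {k} (i : Fin (suc k)) → i ≡ fromℕ k ⊎ ∃[ i′ ] i ≡ inject₁ i′
  lastView {zero}  zero    = inj₁ refl
  lastView {suc k} zero    = inj₂ (zero , refl)
  lastView {suc k} (suc i) with lastView i
  ... | inj₁ refl       = inj₁ refl
  ... | inj₂ (i′ , refl) = inj₂ (suc i′ , refl)

-- Vectors read off from lattice paths.

module PathValues where
  open Words hiding (C)
  open Polyominoes using (stepsE; stepsN)
  open Staircases
  open SortedVectors
  open import Defs using (Step; N; E; Path)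
  open import Data.Bool.Base using (Bool; true; false; if_then_else_)
  open import Data.Empty using (⊥-elim)
  open import Data.Fin.Base as Fin using (Fin; zero; suc; toℕ)
  open import Data.Integer.Base hiding (suc; pred; _⊖_; NonNegative; pos; neg)
  open import Data.Integer.Properties
  open import Data.Integer.Tactic.RingSolver using (solve-∀)
  open import Data.List.Base using ([]; _∷_; length; take; map)
  open import Data.Nat.Base as ℕ using (ℕ; zero; suc; z≤n; s≤s; _∸_)
  import Data.Nat.Properties as ℕ
  open import Data.Product.Base using (proj₂)
  open import Function.Base using (_∘_)
  open import Relation.Binary.PropositionalEquality hiding ([_])
  open import Relation.Nullary using (Dec; yes; no; does)
  open import Relation.Nullary.Decidable using (dec-true; dec-false)

  -- The number of N steps after the i-th E step.
  entry : Path → ℕ → ℕ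
  entry []      i       = 0
  entry (N ∷ p) i       = entry p i
  entry (E ∷ p) zero    = stepsN p
  entry (E ∷ p) (suc i) = entry p i

  entry-≤ : ∀ p i → entry p i ℕ.≤ stepsN p
  entry-≤ []      i       = z≤n
  entry-≤ (N ∷ p) i       = ℕ.m≤n⇒m≤1+n (entry-≤ p i)
  entry-≤ (E ∷ p) zero    = ℕ.≤-refl
  entry-≤ (E ∷ p) (suc i) = entry-≤ p i

  bit : Bool → ℕ
  bit b = if b then 1 else 0

  entries≥ : ℕ → Path → ℕ
  entries≥ x []      = 0
  entries≥ x (N ∷ p) = entries≥ x p
  entries≥ x (E ∷ p) = bit (does (x ℕ.≤? stepsN p)) ℕ.+ entries≥ x p

  entries≥-none : ∀ x p → stepsN p ℕ.< x → entries≥ x p ≡ 0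
  entries≥-none x []      lt = refl
  entries≥-none x (N ∷ p) lt = entries≥-none x p (ℕ.<⇒≤ lt)
  entries≥-none x (E ∷ p) lt rewrite dec-false (x ℕ.≤? stepsN p) (ℕ.<⇒≱ lt) = entries≥-none x p lt

  entries≥-sum : ∀ x p {k} → stepsE p ≡ k → sum {k} (λ i → ⟨ does (x ℕ.≤? entry p (toℕ i)) ⟩) ≡ + entries≥ x p
  entries≥-sum x []      refl = refl
  entries≥-sum x (N ∷ p) eq   = entries≥-sum x p eq
  entries≥-sum x (E ∷ p) refl = cong₂ _+_ (pos-bit (does (x ℕ.≤? stepsN p))) (entries≥-sum x p refl)
    where
    pos-bit : ∀ b → ⟨ b ⟩ ≡ + bit b
    pos-bit true  = refl
    pos-bit false = refl

  -- The E steps with at least `stepsN p ∸ s` steps N after them have at most s before them. With s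
  -- steps N they form the longest prefix containing at most s steps N, which is the adjunction of
  -- `inv` read on the path.
  prefix⇒ : ∀ p s t → s ℕ.≤ stepsN p → t ℕ.≤ length p → t ℕ.≤ s ℕ.+ entries≥ (stepsN p ∸ s) p → stepsN (take t p) ℕ.≤ s
  prefix⇒ p       s       zero    s≤ t≤ le = z≤n
  prefix⇒ (N ∷ p) zero    (suc t) s≤ t≤ le with () ← ℕ.≤-trans le (ℕ.≤-reflexive (entries≥-none (suc (stepsN p)) p ℕ.≤-refl))
  prefix⇒ (N ∷ p) (suc s) (suc t) (s≤s s≤) (s≤s t≤) (s≤s le) = s≤s (prefix⇒ p s t s≤ t≤ le)
  prefix⇒ (E ∷ p) s       (suc t) s≤ (s≤s t≤) le rewrite dec-true (stepsN p ∸ s ℕ.≤? stepsN p) (ℕ.m∸n≤m (stepsN p) s) =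
    prefix⇒ p s t s≤ t≤ (ℕ.≤-pred (ℕ.≤-trans le (ℕ.≤-reflexive (ℕ.+-suc s _))))

  prefix⇐ : ∀ p s t → s ℕ.≤ stepsN p → t ℕ.≤ length p → stepsN (take t p) ℕ.≤ s → t ℕ.≤ s ℕ.+ entries≥ (stepsN p ∸ s) p
  prefix⇐ p       s       zero    s≤ t≤ le = z≤n
  prefix⇐ (N ∷ p) (suc s) (suc t) (s≤s s≤) (s≤s t≤) (s≤s le) = s≤s (prefix⇐ p s t s≤ t≤ le)
  prefix⇐ (E ∷ p) s       (suc t) s≤ (s≤s t≤) le rewrite dec-true (stepsN p ∸ s ℕ.≤? stepsN p) (ℕ.m∸n≤m (stepsN p) s) =
    ℕ.≤-trans (s≤s (prefix⇐ p s t s≤ t≤ le)) (ℕ.≤-reflexive (sym (ℕ.+-suc s _)))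

  stepsN-take : ∀ t p → stepsN (take t p) ℕ.≤ stepsN p
  stepsN-take zero    p       = z≤n
  stepsN-take (suc t) []      = z≤n
  stepsN-take (suc t) (N ∷ p) = s≤s (stepsN-take t p)
  stepsN-take (suc t) (E ∷ p) = stepsN-take t p

  steps-length : ∀ p → stepsN p ℕ.+ stepsE p ≡ length p
  steps-length []      = refl
  steps-length (N ∷ p) = cong suc (steps-length p)
  steps-length (E ∷ p) = trans (ℕ.+-suc (stepsN p) (stepsE p)) (cong suc (steps-length p))

  module FromPath (n₁ k : ℕ) (p : Path) (p-N : stepsN p ≡ suc n₁) (p-E : stepsE p ≡ k) where
    open Floor n₁
    open Vector n₁
    open Sorting n₁ using (⌊⌋-indicator; ⌊⌋-0)

    values : Fin k → ℤ
    values i = + entry p (toℕ i)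

    open Staircase (staircase-isStaircase values)

    private
      values≤n : ∀ i → values i ≤ + n
      values≤n i = +≤+ (ℕ.≤-trans (entry-≤ p (toℕ i)) (ℕ.≤-reflexive p-N))

      does-⇔ : ∀ {P Q : Set} (p : Dec P) (q : Dec Q) → (P → Q) → (Q → P) → ⟨ does p ⟩ ≡ ⟨ does q ⟩
      does-⇔ (yes _) (yes _) f g = refl
      does-⇔ (no _)  (no _)  f g = refl
      does-⇔ (yes p) (no ¬q) f g = ⊥-elim (¬q (f p))
      does-⇔ (no ¬p) (yes q) f g = ⊥-elim (¬p (g q))

    staircase-values : ∀ s → s ℕ.< n → staircase values (+ s) ≡ + entries≥ (stepsN p ∸ s) p
    staircase-values s s<n = trans (sum-cong-≗ (λ i → trans
        (⌊⌋-indicator (values i) (+ s) (0≤+ _) (≤-by₂ (values≤n i) (+≤+ s<n) (e (+ n) (values i) (+ s))) (0≤+ s))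
        (does-⇔ (+ n - + s ≤? values i) (stepsN p ∸ s ℕ.≤? entry p (toℕ i))
          (λ le → drop‿+≤+ (≤-trans (≤-reflexive (sym n-s)) le)) (λ le → ≤-trans (≤-reflexive n-s) (+≤+ le)))))
      (entries≥-sum (stepsN p ∸ s) p p-E)
      where
      e : ∀ n v s → n + n - (1ℤ + v + s) ≡ n - v + (n - (1ℤ + s))
      e = solve-∀
      n-s : + n - + s ≡ + (stepsN p ∸ s)
      n-s = trans (m-n≡m⊖n n s) (trans (⊖-≥ (ℕ.<⇒≤ s<n)) (cong (λ l → + (l ∸ s)) (sym p-N)))

    -- The path of the values is p, repeated.
    inv-values : ∀ t → t ℕ.≤ length p → inv (+ t) ≡ + stepsN (take t p)
    inv-values t t≤ = ≥-ext (λ z le → to z (inv⇒ {+ t} {z} le)) (λ z le → inv⇐ {+ t} {z} (from z le))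
      where
      total≤n : stepsN (take t p) ℕ.≤ n
      total≤n = ℕ.≤-trans (stepsN-take t p) (ℕ.≤-reflexive p-N)
      to : ∀ z → + t ≤ σ z → + stepsN (take t p) ≤ z
      to (+ s) le with s ℕ.<? n
      ... | yes s<n = +≤+ (prefix⇒ p s t (ℕ.≤-trans (ℕ.<⇒≤ s<n) (ℕ.≤-reflexive (sym p-N))) t≤
                        (drop‿+≤+ (≤-trans le (≤-reflexive (cong (_+_ (+ s)) (staircase-values s s<n))))))
      ... | no s≮n  = +≤+ (ℕ.≤-trans total≤n (ℕ.≮⇒≥ s≮n))
      -- Entries are at most n, so at a negative argument no floor exceeds 0 and σ is negative.
      to -[1+ z ] le = ⊥-elim (1+≤⇒≰ {+ t} {σ -[1+ z ]} (≤-trans (+-monoʳ-≤ 1ℤ (+-mono-≤ { -[1+ z ]} { -1ℤ} (-≤- z≤n) nonpos)) (0≤+ t)) le)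
        where
        nonpos : staircase values -[1+ z ] ≤ 0ℤ
        nonpos = ≤-trans (sum-mono (λ i → ≮⇒≥ λ lt → 1+≤⇒≰ {1ℤ * + n} {values i + -[1+ z ]}
            (≤-by₂ (values≤n i) (-≤- {m = z} z≤n) (e (+ n) (values i) -[1+ z ]))
            (⌊⌋⇒ 1ℤ (values i + -[1+ z ]) (<⇒1+≤ lt))))
          (≤-reflexive (sum-zero k))
          where
          e : ∀ n v z → 1ℤ * n - (1ℤ + (v + z)) ≡ n - v + (-1ℤ - z)
          e = solve-∀
      from : ∀ z → + stepsN (take t p) ≤ z → + t ≤ σ z
      from (+ s) (+≤+ le) with s ℕ.<? n
      ... | yes s<n = ≤-trans (+≤+ (prefix⇐ p s t (ℕ.≤-trans (ℕ.<⇒≤ s<n) (ℕ.≤-reflexive (sym p-N))) t≤ le))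
                        (≤-reflexive (cong (_+_ (+ s)) (sym (staircase-values s s<n))))
      -- From s = n on every floor is at least 1, so σ is at least n + k, the length of the path.
      ... | no s≮n  = ≤-trans (+≤+ (ℕ.≤-trans t≤ (ℕ.≤-reflexive (trans (sym (steps-length p)) (cong₂ ℕ._+_ p-N p-E)))))
        (+-mono-≤ (+≤+ (ℕ.≮⇒≥ s≮n)) (≤-trans (≤-reflexive (sym (trans (sum-const k 1ℤ) (*-identityʳ (+ k)))))
          (sum-mono (λ i → ⌊⌋⇐ 1ℤ (values i + + s) (≤-trans (≤-reflexive (*-identityˡ (+ n)))
            (≤-trans (+≤+ (ℕ.≮⇒≥ s≮n)) (i≤j+i (+ s) (values i))))))))

  -- The second path is described by its T coordinate, which advances with E; exchanging the letters
  -- lets `FromPath` apply to it.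
  flip : Step → Step
  flip E = N
  flip N = E

  flipped : Word → Path
  flipped = map (flip ∘ proj₂)

open import Data.Nat.Base using (ℕ)

module Configurations (m₁ n₁ : ℕ) where
  open Staircases
  open SortedVectors
  open PathValues
  open Words hiding (C)
  open Walks using (finish; endsE; isE; closed; countClosed; countConfigs)
  open SeriesIdentity using (swapped; closed-#E; closed-#N; #E+#N)
  open Polyominoes using (lower; stepsE; stepsN; ∧-true⁻; ∧-true⁺; matches⁻; matches⁺)
  open import Defs using (module CompleteBipartite; module ParkingSorted; N; E; HasCardinality)
  open import Data.Bool.Base using (Bool; true; false; if_then_else_; not; _∧_)
  open import Data.Empty using (⊥-elim; ⊥)
  open import Data.Fin.Base as Fin using (Fin; zero; suc; toℕ; inject₁; fromℕ)
  import Data.Fin.Properties as Fin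
  open import Data.Integer.Base hiding (suc; pred; _⊖_; NonNegative; pos; neg)
  open import Data.Integer.Properties
  open import Data.Integer.Tactic.RingSolver using (solve-∀)
  open import Data.Nat.Base as ℕ using (ℕ; zero; suc; z≤n; s≤s)
  import Data.Nat.Properties as ℕ
  open import Data.Product.Base using (_×_; _,_; proj₁; proj₂; ∃-syntax)
  open import Data.Sum.Base using (_⊎_; inj₁; inj₂)
  open import Function.Base using (_∘_; case_of_)
  open import Relation.Binary.PropositionalEquality hiding ([_])
  open import Relation.Nullary using (¬_; Dec; yes; no; does)
  open import Relation.Nullary.Decidable using (dec-true; dec-false)
  open import Data.Sum.Properties using (inj₁-injective)
  open import Data.List.Base using ([]; _∷_; length; take; List; _++_; map)
  import Data.List.Properties as List
  open import Relation.Binary.Definitions using (tri<; tri≈; tri>)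
  open import Algebra.Properties.AbelianGroup +-0-abelianGroup using () renaming (∙-cancelˡ to cancelˡ; ∙-cancelʳ to cancelʳ)
  open import Data.List.Membership.Propositional using (_∈_)
  open import Data.List.Membership.Propositional.Properties using (∈-map⁺; ∈-map⁻; ∈-++⁺ˡ; ∈-++⁺ʳ; ∈-++⁻)
  open import Data.List.Relation.Unary.All as All using (All; []; _∷_)
  import Data.List.Relation.Unary.All.Properties as All
  open import Data.List.Relation.Unary.AllPairs using (AllPairs; []; _∷_)
  open import Data.List.Relation.Unary.Unique.Propositional using (Unique)
  import Data.List.Relation.Unary.Unique.Propositional.Properties as Unique
  open import Function.Bundles using (mk⇔)
  open import Data.List.Relation.Unary.Any as Any using (Any; here; there)

  -- Effectiveness, overlap and rank.

  module Sandpile where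
    open CompleteBipartite (suc m₁) (suc n₁) renaming (e to 𝕖)

    m n L : ℕ
    m = suc m₁
    n = suc n₁
    L = m ℕ.+ n

    module Va = Vector n₁
    module Vb = Vector m₁
    module Fa = Floor n₁
    module Fb = Floor m₁

    rowA : Config → Fin m → ℤ
    rowA u i = u (inj₁ i)
    rowB : Config → Fin n → ℤ
    rowB u j = u (inj₂ j)

    A B : Config → ℤ → ℤ
    A u = Va.staircase (rowA u)
    B u = Vb.staircase (rowB u)

    module SA u = Staircase (Va.staircase-isStaircase (rowA u))
    module SB u = Staircase (Vb.staircase-isStaircase (rowB u))

    -- On a complete bipartite graph a vertex sees the opposite side of a firing script only through
    -- its sum; the two sums become S and T.
    laplacian : (V → ℤ) → Config
    laplacian k (inj₁ i) = k (inj₁ i) * + n - sum (k ∘ inj₂)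
    laplacian k (inj₂ j) = k (inj₂ j) * + m - sum (k ∘ inj₁)

    private
      lap₀ : ∀ k d → k * (d * 0ℤ - 1ℤ) ≡ 0ℤ - k
      lap₀ = solve-∀
      lap₁ : ∀ k d b → k * (d * b - 0ℤ) ≡ (k * d) * b
      lap₁ = solve-∀
      zeros : ∀ k → sum {k} (λ _ → 0ℤ * 0ℤ) ≡ 0ℤ
      zeros k = sum-zero k
      zeros′ : ∀ k → sum {k} (λ _ → 1ℤ * 0ℤ) ≡ 0ℤ
      zeros′ k = sum-zero k
      ones : ∀ k → sum {k} (λ _ → 1ℤ) ≡ + k
      ones k = trans (sum-const k 1ℤ) (*-identityʳ (+ k))
      zeros″ : ∀ {k} (f : Fin k → ℤ) → sum (λ i → 0ℤ * f i) ≡ 0ℤ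
      zeros″ {k} f = trans (sum-cong-≗ (λ i → *-zeroˡ (f i))) (sum-zero k)

    ∑Δ : ∀ k c → ∑ (λ c′ → k c′ * Δ c′ c) ≡ laplacian k c
    ∑Δ k (inj₁ i) = cong₂ _+_
      (trans (sum-cong-≗ (λ i′ → trans
          (cong (λ z → k (inj₁ i′) * (deg (inj₁ i′) * 𝕖 (inj₁ i′) (inj₁ i) - z))
            (cong₂ _+_ (zeros″ (λ i″ → 𝕖 (inj₁ i″) (inj₁ i))) (zeros′ n)))
          (trans (lap₁ (k (inj₁ i′)) (deg (inj₁ i′)) (𝕖 (inj₁ i′) (inj₁ i)))
            (cong (λ d → k (inj₁ i′) * d * 𝕖 (inj₁ i′) (inj₁ i))
              (trans (cong₂ _+_ (sum-zero m) (ones n)) (+-identityˡ (+ n)))))))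
        (sum-indicator (λ i′ → k (inj₁ i′) * + n) i))
      (trans (sum-cong-≗ (λ j → trans
          (cong (λ z → k (inj₂ j) * (deg (inj₂ j) * 0ℤ - z))
            (cong₂ _+_ (sum-indicator (λ _ → 1ℤ) i) (zeros n)))
          (lap₀ (k (inj₂ j)) (deg (inj₂ j)))))
        (trans (sum-minus (λ _ → 0ℤ) (λ j → k (inj₂ j))) (trans (cong (_- sum (k ∘ inj₂)) (sum-zero n)) (+-identityˡ _))))
    ∑Δ k (inj₂ j) = trans (+-comm _ (sum (λ j′ → k (inj₂ j′) * Δ (inj₂ j′) (inj₂ j)))) (cong₂ _+_
      (trans (sum-cong-≗ (λ j′ → trans
          (cong (λ z → k (inj₂ j′) * (deg (inj₂ j′) * 𝕖 (inj₂ j′) (inj₂ j) - z))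
            (cong₂ _+_ (zeros′ m) (zeros″ (λ j″ → 𝕖 (inj₂ j″) (inj₂ j)))))
          (trans (lap₁ (k (inj₂ j′)) (deg (inj₂ j′)) (𝕖 (inj₂ j′) (inj₂ j)))
            (cong (λ d → k (inj₂ j′) * d * 𝕖 (inj₂ j′) (inj₂ j))
              (trans (cong₂ _+_ (ones m) (sum-zero n)) (+-identityʳ (+ m)))))))
        (sum-indicator (λ j′ → k (inj₂ j′) * + m) j))
      (trans (sum-cong-≗ (λ i → trans
          (cong (λ z → k (inj₁ i) * (deg (inj₁ i) * 0ℤ - z))
            (cong₂ _+_ (zeros m) (sum-indicator (λ _ → 1ℤ) j)))
          (lap₀ (k (inj₁ i)) (deg (inj₁ i)))))
        (trans (sum-minus (λ _ → 0ℤ) (λ i → k (inj₁ i))) (trans (cong (_- sum (k ∘ inj₁)) (sum-zero m)) (+-identityˡ _)))))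

    -- A configuration is effective iff the boundary paths of {T ≤ A S} and {S ≤ B T} overlap.
    Overlap : Config → Set
    Overlap u = ∃[ s ] ∃[ t ] t ≤ A u s × s ≤ B u t

    -- With S and T the sums of the script k over the two sides, non-negativity at a vertex bounds
    -- its k by a floor; adding these bounds gives the point of the overlap.
    effective⇒overlap : ∀ u → Effective u → Overlap u
    effective⇒overlap u (v , v≥0 , k , eq) = s , t ,
      sum-mono (λ i → Fa.⌊⌋⇐ (k (inj₁ i)) (rowA u i + s) (≤-by (v≥0 (inj₁ i)) (trans
        (e₂ (u (inj₁ i)) s (k (inj₁ i) * + n)) (trans (cong (_-_ (u (inj₁ i))) (trans (sym (∑Δ k (inj₁ i))) (sym (eq (inj₁ i))))) (e₃ (u (inj₁ i)) (v (inj₁ i))))))) ,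
      sum-mono (λ j → Fb.⌊⌋⇐ (k (inj₂ j)) (rowB u j + t) (≤-by (v≥0 (inj₂ j)) (trans
        (e₂ (u (inj₂ j)) t (k (inj₂ j) * + m)) (trans (cong (_-_ (u (inj₂ j))) (trans (sym (∑Δ k (inj₂ j))) (sym (eq (inj₂ j))))) (e₃ (u (inj₂ j)) (v (inj₂ j)))))))
      where
      s t : ℤ
      s = sum (k ∘ inj₂)
      t = sum (k ∘ inj₁)
      e₂ : ∀ u s z → u + s - z ≡ u - (z - s)
      e₂ = solve-∀
      e₃ : ∀ u v → u - (u - v) ≡ v - 0ℤ
      e₃ = solve-∀

    -- The floors bound the script from above; `sum-lower` brings their sums down to exactly t and
    -- s, the sums that entered the floors.
    overlap⇒effective : ∀ u → Overlap u → Effective u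
    overlap⇒effective u (s , t , t≤A , s≤B) = v , v≥0 , k , λ c → e₄ (u c) (∑ (λ c′ → k c′ * Δ c′ c))
      where
      lowerA = sum-lower (λ i → Fa.⌊ rowA u i + s ⌋) t≤A
      lowerB = sum-lower (λ j → Fb.⌊ rowB u j + t ⌋) s≤B
      ka : Fin m → ℤ
      ka = proj₁ lowerA
      ka≤ : ∀ i → ka i ≤ Fa.⌊ rowA u i + s ⌋
      ka≤ = proj₁ (proj₂ lowerA)
      Σka : sum ka ≡ t
      Σka = proj₂ (proj₂ lowerA)
      kb : Fin n → ℤ
      kb = proj₁ lowerB
      kb≤ : ∀ j → kb j ≤ Fb.⌊ rowB u j + t ⌋
      kb≤ = proj₁ (proj₂ lowerB)
      Σkb : sum kb ≡ s
      Σkb = proj₂ (proj₂ lowerB)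
      k : V → ℤ
      k (inj₁ i) = ka i
      k (inj₂ j) = kb j
      v : Config
      v c = u c - ∑ (λ c′ → k c′ * Δ c′ c)
      e₄ : ∀ u x → u - (u - x) ≡ x
      e₄ = solve-∀
      e₅ : ∀ u z s → u - (z - s) - 0ℤ ≡ u + s - z
      e₅ = solve-∀
      v≥0 : NonNegative v
      v≥0 (inj₁ i) = ≤-by (Fa.⌊⌋⇒ (ka i) (rowA u i + s) (ka≤ i)) (trans
        (cong (λ x → u (inj₁ i) - x - 0ℤ) (trans (∑Δ k (inj₁ i)) (cong (_-_ (ka i * + n)) Σkb))) (e₅ (u (inj₁ i)) (ka i * + n) s))
      v≥0 (inj₂ j) = ≤-by (Fb.⌊⌋⇒ (kb j) (rowB u j + t) (kb≤ j)) (trans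
        (cong (λ x → u (inj₂ j) - x - 0ℤ) (trans (∑Δ k (inj₂ j)) (cong (_-_ (kb j * + m)) Σka))) (e₅ (u (inj₂ j)) (kb j * + m) t))

    -- The number of points of the antidiagonal t in the overlap, or minus the number of points
    -- of the gap.
    level : Config → ℤ → ℤ
    level u t = 1ℤ + t - SA.inv u t - SB.inv u t

    invA-period : ∀ u t → SA.inv u (t + + L) ≡ SA.inv u t + + n
    invA-period u t = trans (cong (λ l → SA.inv u (t + + l)) (ℕ.+-comm m n)) (SA.inv-period u t)

    invB-period : ∀ u t → SB.inv u (t + + L) ≡ SB.inv u t + + m
    invB-period u t = SB.inv-period u t

    level-period : ∀ u t → level u (t + + L) ≡ level u t + 0ℤ
    level-period u t = trans (cong₂ (λ a b → 1ℤ + (t + + L) - a - b) (invA-period u t) (invB-period u t))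
      (e₆ t (+ m) (+ n) (SA.inv u t) (SB.inv u t))
      where
      e₆ : ∀ t m n a b → 1ℤ + (t + (m + n)) - (a + n) - (b + m) ≡ 1ℤ + t - a - b + 0ℤ
      e₆ = solve-∀

    -- By `inv-sum` each path contributes only the sum of its values, and the triangular numbers
    -- combine to a multiple of m and n.
    level-sum : ∀ u → Σ (λ k → level u (+ k)) L ≡ degree u + + L - + m * + n
    level-sum u = begin
      Σ (λ k → level u (+ k)) L
        ≡⟨ Σ-minus (λ k → 1ℤ + + k - SA.inv u (+ k)) (λ k → SB.inv u (+ k)) L ⟩
      Σ (λ k → 1ℤ + + k - SA.inv u (+ k)) L - Σ (λ k → SB.inv u (+ k)) L
        ≡⟨ cong (_- Σ (λ k → SB.inv u (+ k)) L) (Σ-minus (λ k → 1ℤ + + k) (λ k → SA.inv u (+ k)) L) ⟩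
      Σ (λ k → 1ℤ + + k) L - Σ (λ k → SA.inv u (+ k)) L - Σ (λ k → SB.inv u (+ k)) L
        ≡⟨ cong₂ (λ a b → Σ (λ k → 1ℤ + + k) L - a - b) sumA (Vb.inv-sum (rowB u)) ⟩
      Σ (λ k → 1ℤ + + k) L - (+ L * + n - triangle n - + n - sum (rowA u)) - (+ L * + m - triangle m - + m - sum (rowB u))
        ≡⟨ cong (λ x → x - (+ L * + n - triangle n - + n - sum (rowA u)) - (+ L * + m - triangle m - + m - sum (rowB u)))
             (trans (Σ-+ (λ _ → 1ℤ) (λ k → + k) L) (cong₂ _+_ (Σ-const 1ℤ L) (triangle-sum m n))) ⟩
      _ ≡⟨ e₇ (+ m) (+ n) (triangle m) (triangle n) (sum (rowA u)) (sum (rowB u)) ⟩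
      (triangle m + triangle m - (+ m * + m - + m)) + (triangle n + triangle n - (+ n * + n - + n)) + (degree u + + L - + m * + n)
        ≡⟨ cong (_+ (degree u + + L - + m * + n)) (cong₂ (λ a b → (a - (+ m * + m - + m)) + (b - (+ n * + n - + n))) (triangle-+ m) (triangle-+ n)) ⟩
      (+ m * + m - + m - (+ m * + m - + m)) + (+ n * + n - + n - (+ n * + n - + n)) + (degree u + + L - + m * + n)
        ≡⟨ e₈ (+ m * + m - + m) (+ n * + n - + n) (degree u + + L - + m * + n) ⟩
      degree u + + L - + m * + n ∎
      where
      open ≡-Reasoning
      sumA : Σ (λ k → SA.inv u (+ k)) L ≡ + L * + n - triangle n - + n - sum (rowA u)
      sumA = trans (cong (Σ (λ k → SA.inv u (+ k))) (ℕ.+-comm m n))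
        (trans (Va.inv-sum (rowA u)) (cong (λ l → + l * + n - triangle n - + n - sum (rowA u)) (ℕ.+-comm n m)))
      triangle-sum : ∀ m n → triangle (m ℕ.+ n) ≡ triangle m + triangle n + + m * + n
      triangle-sum m zero    = trans (cong triangle (ℕ.+-identityʳ m)) (sym (trans (cong (_+_ (triangle m + 0ℤ)) (*-zeroʳ (+ m))) (e (triangle m))))
        where
        e : ∀ a → a + 0ℤ + 0ℤ ≡ a
        e = solve-∀
      triangle-sum m (suc n) = trans (cong triangle (ℕ.+-suc m n)) (trans (cong (_+ + (m ℕ.+ n)) (triangle-sum m n)) (e (triangle m) (triangle n) (+ m) (+ n)))
        where
        e : ∀ a b m n → a + b + m * n + (m + n) ≡ a + (b + n) + m * (1ℤ + n)
        e = solve-∀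
      e₇ : ∀ m n tm tn a b → (m + n) * 1ℤ + (tm + tn + m * n) - ((m + n) * n - tn - n - a) - ((m + n) * m - tm - m - b)
        ≡ (tm + tm - (m * m - m)) + (tn + tn - (n * n - n)) + (a + b + (m + n) - m * n)
      e₇ = solve-∀
      e₈ : ∀ x y z → x - x + (y - y) + z ≡ z
      e₈ = solve-∀

    overlapArea gapArea : Config → ℤ
    overlapArea u = Σ (λ k → + pos (level u (+ k))) L
    gapArea     u = Σ (λ k → + neg (level u (+ k))) L

    private
      pos-neg-split : ∀ z → z ≡ + pos z - + neg z
      pos-neg-split (+ k)    = sym (+-identityʳ (+ k))
      pos-neg-split -[1+ k ] = refl

      pos-mono : ∀ {y z} → y ≤ z → + pos y ≤ + pos z
      pos-mono (+≤+ le) = +≤+ le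
      pos-mono -≤+      = 0≤+ _
      pos-mono (-≤- _)  = ≤-refl

      ≤-pos : ∀ z → z ≤ + pos z
      ≤-pos (+ k)    = ≤-refl
      ≤-pos -[1+ k ] = -≤+

      pos-least : ∀ {y z} → 0ℤ ≤ y → z ≤ y → + pos z ≤ y
      pos-least {z = + k}    p r = r
      pos-least {z = -[1+ k ]} p r = p

      pos-≥1 : ∀ {z} → 1ℤ ≤ z → + pos z ≡ z
      pos-≥1 {+ k}    _ = refl
      pos-≥1 { -[1+ k ]} ()

    areas-differ : ∀ u → overlapArea u - gapArea u ≡ degree u + + L - + m * + n
    areas-differ u = trans (sym (Σ-minus (λ k → + pos (level u (+ k))) (λ k → + neg (level u (+ k))) L))
      (trans (Σ-cong (λ k → sym (pos-neg-split (level u (+ k)))) L) (level-sum u))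

    shifted-area : ∀ u (f : ℤ → ℕ) t → Σ (λ k → + f (level u (t + + k))) L ≡ Σ (λ k → + f (level u (+ k))) L
    shifted-area u f t = trans (window (λ z → + f (level u z)) L {0ℤ}
        (λ z → trans (cong (λ x → + f x) (trans (level-period u z) (+-identityʳ _))) (sym (+-identityʳ _))) t)
      (trans (cong (_+_ (Σ (λ k → + f (level u (+ k))) L)) (*-zeroʳ t)) (+-identityʳ _))

    private
      first-term : ∀ u t → + pos (level u t) + Σ (λ k → + pos (level u (t + + suc k))) (m₁ ℕ.+ n) ≡ overlapArea u
      first-term u t = trans (cong (λ z → + pos (level u z) + Σ (λ k → + pos (level u (t + + suc k))) (m₁ ℕ.+ n)) (sym (+-identityʳ t)))
        (trans (sym (Σ-head (λ k → + pos (level u (t + + k))) (m₁ ℕ.+ n))) (shifted-area u pos t))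

      Σ-≥0 : ∀ (f : ℕ → ℕ) K → 0ℤ ≤ Σ (λ k → + f k) K
      Σ-≥0 f zero    = ≤-refl
      Σ-≥0 f (suc K) = +-mono-≤ (Σ-≥0 f K) (0≤+ (f K))

    level-overlap : ∀ u s t → t ≤ A u s → s ≤ B u t → 1ℤ ≤ level u (s + t)
    level-overlap u s t t≤ s≤ = ≤-by₂
      (SA.inv⇐ u {s + t} {s} (+-monoʳ-≤ s t≤))
      (SB.inv⇐ u {s + t} {t} (≤-trans (≤-reflexive (+-comm s t)) (+-monoʳ-≤ t s≤)))
      (e₉ s t (SA.inv u (s + t)) (SB.inv u (s + t)))
      where
      e₉ : ∀ s t a b → 1ℤ + (s + t) - a - b - 1ℤ ≡ s - a + (t - b)
      e₉ = solve-∀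

    overlap⇒area : ∀ u → Overlap u → 1ℤ ≤ overlapArea u
    overlap⇒area u (s , t , t≤ , s≤) = ≤-trans
      (≤-trans (≤-trans (level-overlap u s t t≤ s≤) (≤-pos _)) (≤-trans (≤-reflexive (sym (+-identityʳ _)))
         (+-monoʳ-≤ (+ pos (level u (s + t))) (Σ-≥0 (λ k → pos (level u (s + t + + suc k))) (m₁ ℕ.+ n)))))
      (≤-reflexive (first-term u (s + t)))

    private
      positive-term : ∀ (f : ℕ → ℤ) K → 1ℤ ≤ Σ (λ k → + pos (f k)) K → ∃[ k ] 1ℤ ≤ f k
      positive-term f zero    (+≤+ ())
      positive-term f (suc K) le with 1ℤ ≤? f K
      ... | yes p = K , p
      ... | no ¬p = positive-term f K (subst (1ℤ ≤_) (trans (cong (λ p → Σ (λ k → + pos (f k)) K + + p) (zero-pos (f K) ¬p)) (+-identityʳ _)) le)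
        where
        zero-pos : ∀ z → ¬ 1ℤ ≤ z → pos z ≡ 0
        zero-pos (+ zero) _ = refl
        zero-pos +[1+ k ] ¬p = ⊥-elim (¬p (+≤+ (s≤s z≤n)))
        zero-pos -[1+ k ] _ = refl

    -- On an antidiagonal of positive level the point of the first path already lies in the overlap.
    area⇒overlap : ∀ u → 1ℤ ≤ overlapArea u → Overlap u
    area⇒overlap u le with k , p ← positive-term (λ k → level u (+ k)) L le =
      s , t , ≤-by (SA.inv⇒ u {+ k} {s} ≤-refl) (e₁₀ (+ k) s (A u s)) ,
      ≤-by (SB.inv⇒ u {+ k} {t} j≤t) (e₁₁ (+ k) s (B u t))
      where
      s t : ℤ
      s = SA.inv u (+ k)
      t = + k - s
      j≤t : SB.inv u (+ k) ≤ t
      j≤t = ≤-by p (e (+ k) s (SB.inv u (+ k)))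
        where
        e : ∀ k s j → k - s - j ≡ 1ℤ + k - s - j - 1ℤ
        e = solve-∀
      e₁₀ : ∀ k s a → a - (k - s) ≡ s + a - k
      e₁₀ = solve-∀
      e₁₁ : ∀ k s b → b - s ≡ k - s + b - k
      e₁₁ = solve-∀

    module _ (u v : Config) (v≤u : ∀ c → v c ≤ u c) where
      invA-anti : ∀ t → SA.inv u t ≤ SA.inv v t
      invA-anti t = SA.inv⇐ u {t} {SA.inv v t} (≤-trans (SA.inv⇒ v {t} {SA.inv v t} ≤-refl)
        (+-monoʳ-≤ (SA.inv v t) (Va.staircase-mono (v≤u ∘ inj₁) (SA.inv v t))))

      invB-anti : ∀ t → SB.inv u t ≤ SB.inv v t
      invB-anti t = SB.inv⇐ u {t} {SB.inv v t} (≤-trans (SB.inv⇒ v {t} {SB.inv v t} ≤-refl)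
        (+-monoʳ-≤ (SB.inv v t) (Vb.staircase-mono (v≤u ∘ inj₂) (SB.inv v t))))

      level-anti : ∀ t → level v t ≤ level u t
      level-anti t = ≤-by₂ (invA-anti t) (invB-anti t) (e₁₂ t (SA.inv u t) (SA.inv v t) (SB.inv u t) (SB.inv v t))
        where
        e₁₂ : ∀ t a a′ b b′ → 1ℤ + t - a - b - (1ℤ + t - a′ - b′) ≡ a′ - a + (b′ - b)
        e₁₂ = solve-∀

      -- From u to v the levels only fall, in total by the difference of degrees, and a positive
      -- part never falls by more than the level itself.
      area-drop : overlapArea u ≤ overlapArea v + (degree u - degree v)
      area-drop = ≤-trans (Σ-mono bound L) (≤-reflexive (trans (Σ-+ (λ k → + pos (level v (+ k))) (λ k → level u (+ k) - level v (+ k)) L)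
        (cong (_+_ (overlapArea v)) (trans (Σ-minus (λ k → level u (+ k)) (λ k → level v (+ k)) L)
          (trans (cong₂ _-_ (level-sum u) (level-sum v)) (e₁₃ (degree u) (degree v) (+ L) (+ m * + n)))))))
        where
        e₁₃ : ∀ a b l p → a + l - p - (b + l - p) ≡ a - b
        e₁₃ = solve-∀
        bound : ∀ k → + pos (level u (+ k)) ≤ + pos (level v (+ k)) + (level u (+ k) - level v (+ k))
        bound k = pos-least
          (+-mono-≤ (0≤+ (pos (level v (+ k)))) (i≤j⇒0≤j-i (level-anti (+ k))))
          (≤-by (≤-pos (level v (+ k))) (e (level u (+ k)) (level v (+ k)) (+ pos (level v (+ k)))))
          where
          e : ∀ a b p → p + (a - b) - a ≡ p - b
          e = solve-∀

      -- At a time when both paths differ, or one moved inside the overlap.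
      area-drop₁ : ∀ t → 1ℤ ≤ level u t → 1ℤ + SA.inv u t ≤ SA.inv v t → 1ℤ + overlapArea v ≤ overlapArea u
      area-drop₁ t 1≤ moved = subst₂ (λ a b → 1ℤ + a ≤ b) (first-term v t) (first-term u t)
        (≤-by₂ head (Σ-mono (λ k → pos-mono (level-anti (t + + suc k))) (m₁ ℕ.+ n))
          (e (+ pos (level v t)) (Σ (λ k → + pos (level v (t + + suc k))) (m₁ ℕ.+ n))
             (+ pos (level u t)) (Σ (λ k → + pos (level u (t + + suc k))) (m₁ ℕ.+ n))))
        where
        e : ∀ a b c d → c + d - (1ℤ + (a + b)) ≡ c - (1ℤ + a) + (d - b)
        e = solve-∀
        e₁₄ : ∀ t a a′ b b′ → 1ℤ + t - a - b - 1ℤ - (1ℤ + t - a′ - b′) ≡ a′ - (1ℤ + a) + (b′ - b)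
        e₁₄ = solve-∀
        head : 1ℤ + + pos (level v t) ≤ + pos (level u t)
        head = ≤-by (pos-least {level u t - 1ℤ} {level v t} (i≤j⇒0≤j-i 1≤)
            (≤-by₂ moved (invB-anti t) (e₁₄ t (SA.inv u t) (SA.inv v t) (SB.inv u t) (SB.inv v t))))
          (trans (cong (_- (1ℤ + + pos (level v t))) (pos-≥1 1≤)) (e′ (level u t) (+ pos (level v t))))
          where
          e′ : ∀ u p → u - (1ℤ + p) ≡ u - 1ℤ - p
          e′ = solve-∀

    unit : Fin m → Config
    unit i (inj₁ i′) = if does (i′ Fin.≟ i) then 1ℤ else 0ℤ
    unit i (inj₂ j)  = 0ℤ

    unit-degree : ∀ i → degree (unit i) ≡ 1ℤ
    unit-degree i = cong₂ _+_ (trans (sum-cong-≗ (λ i′ → sym (*-identityˡ (unit i (inj₁ i′))))) (sum-indicator (λ _ → 1ℤ) i)) (sum-zero n)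

    unit-≥0 : ∀ i → NonNegative (unit i)
    unit-≥0 i (inj₁ i′) with does (i′ Fin.≟ i)
    ... | true  = 0≤+ 1
    ... | false = ≤-refl
    unit-≥0 i (inj₂ j) = ≤-refl

    minus-≤ : ∀ u f → NonNegative f → ∀ c → (u ⊖ f) c ≤ u c
    minus-≤ u f f≥0 c = ≤-by (f≥0 c) (e (u c) (f c))
      where
      e : ∀ u f → u - (u - f) ≡ f - 0ℤ
      e = solve-∀

    private
      sum-strict : ∀ {k} {f g : Fin k → ℤ} i → (∀ i → f i ≤ g i) → f i < g i → sum f < sum g
      sum-strict zero    f≤g lt = +-mono-<-≤ lt (sum-mono (f≤g ∘ suc))
      sum-strict (suc i) f≤g lt = +-mono-≤-< (f≤g zero) (sum-strict i (f≤g ∘ suc) lt)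

      unit-self : ∀ i → unit i (inj₁ i) ≡ 1ℤ
      unit-self i rewrite dec-true (i Fin.≟ i) refl = refl

      A-drops : ∀ u s i → Fa.⌊ rowA u i + (s - 1ℤ) ⌋ < Fa.⌊ rowA u i + s ⌋ → 1ℤ + A (u ⊖ unit i) s ≤ A u s
      A-drops u s i lt = <⇒1+≤ (sum-strict i (λ i′ → Fa.⌊⌋-mono (+-monoˡ-≤ s (minus-≤ u (unit i) (unit-≥0 i) (inj₁ i′))))
        (≤-<-trans (≤-reflexive (cong Fa.⌊_⌋ (trans (cong (λ d → u (inj₁ i) - d + s) (unit-self i)) (e (u (inj₁ i)) s)))) lt))
        where
        e : ∀ u s → u - 1ℤ + s ≡ u + (s - 1ℤ)
        e = solve-∀

      inv-moves : ∀ u v s → 1ℤ + A v s ≤ A u s → 1ℤ + SA.inv u (s + A u s) ≤ SA.inv v (s + A u s)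
      inv-moves u v s less = ≤-trans (≤-reflexive (cong (_+_ 1ℤ) (SA.inv-σ u s))) (<⇒1+≤ (≰⇒> (λ le →
        1+≤⇒≰ (≤-trans (≤-reflexive (e s (A v s))) (+-monoʳ-≤ s less)) (SA.inv⇒ v {s + A u s} {s} le))))
        where
        e : ∀ s a → 1ℤ + (s + a) ≡ s + (1ℤ + a)
        e = solve-∀

      -- Where A jumps, one of its floors does; taking a chip from that vertex delays this jump, so
      -- A becomes smaller at s and the first path moves inside the overlap.
      corner⇒drop : ∀ u s → s ≤ B u (A u s) → A u (s - 1ℤ) < A u s → ∃[ i ] 1ℤ + overlapArea (u ⊖ unit i) ≤ overlapArea u
      corner⇒drop u s s≤ lt =
        let i , lt′ = sum-< (λ i → Fa.⌊ rowA u i + (s - 1ℤ) ⌋) (λ i → Fa.⌊ rowA u i + s ⌋) lt in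
        i , area-drop₁ u (u ⊖ unit i) (minus-≤ u (unit i) (unit-≥0 i)) (s + A u s)
              (level-overlap u s (A u s) ≤-refl s≤) (inv-moves u (u ⊖ unit i) s (A-drops u s i lt′))

    -- The corner of the first boundary path found by going left inside the overlap.
    overlap⇒drop : ∀ u → Overlap u → ∃[ i ] 1ℤ + overlapArea (u ⊖ unit i) ≤ overlapArea u
    overlap⇒drop u (s₀ , t₀ , t≤ , s≤) = go (find {λ s → A u s₀ ≤ A u s} (λ s → A u s₀ ≤? A u s) (s₀ - + n) n
        -- One period to the left A is smaller by m, which is at least 1, so the search meets a
        -- jump.
        (1+≤⇒≰ (≤-by (0≤+ m₁) (trans (cong (_- (1ℤ + A u (s₀ - + n))) lower-A) (e₁ (A u (s₀ - + n)) (+ m₁)))))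
        (≤-reflexive (cong (A u) (sym (e₂ s₀ (+ n))))))
      where
      e₁ : ∀ a m → a + (1ℤ + m) - (1ℤ + a) ≡ m - 0ℤ
      e₁ = solve-∀
      e₂ : ∀ s n → s - n + n ≡ s
      e₂ = solve-∀
      lower-A : A u s₀ ≡ A u (s₀ - + n) + + m
      lower-A = trans (cong (A u) (sym (e₂ s₀ (+ n)))) (SA.period u (s₀ - + n))
      go : First (λ s → A u s₀ ≤ A u s) (s₀ - + n) (s₀ - + n + + n) → ∃[ i ] 1ℤ + overlapArea (u ⊖ unit i) ≤ overlapArea u
      go (first s holds fails _ upto) = corner⇒drop u s
        (≤-trans (≤-trans upto (≤-reflexive (e₂ s₀ (+ n)))) (≤-trans s≤ (SB.mono u (≤-trans t≤ holds))))
        (<-≤-trans (≰⇒> fails) holds)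

    ¬effective⇒area : ∀ u → ¬ Effective u → overlapArea u ≡ 0ℤ
    ¬effective⇒area u ¬eff = ≤-antisym
      (≤-by (≰⇒1+≤ (λ 1≤ → ¬eff (overlap⇒effective u (area⇒overlap u 1≤)))) (e (overlapArea u)))
      (Σ-≥0 (λ k → pos (level u (+ k))) L)
      where
      e : ∀ a → 0ℤ - a ≡ 1ℤ - (1ℤ + a)
      e = solve-∀

    degree-minus : ∀ u f → degree (u ⊖ f) ≡ degree u - degree f
    degree-minus u f = trans (cong₂ _+_ (sum-minus (rowA u) (rowA f)) (sum-minus (rowB u) (rowB f)))
      (e (sum (rowA u)) (sum (rowA f)) (sum (rowB u)) (sum (rowB f)))
      where
      e : ∀ a b c d → a - b + (c - d) ≡ a + c - (b + d)
      e = solve-∀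

    breaks⇒degree : ∀ u f → BreaksEffectiveness u f → overlapArea u ≤ degree f
    breaks⇒degree u f (f≥0 , ¬eff) = ≤-trans (area-drop u (u ⊖ f) (minus-≤ u f f≥0)) (≤-reflexive
      (trans (cong₂ (λ a d → a + (degree u - d)) (¬effective⇒area (u ⊖ f) ¬eff) (degree-minus u f)) (e (degree u) (degree f))))
      where
      e : ∀ u f → 0ℤ + (u - (u - f)) ≡ f
      e = solve-∀

    private
      pred-bound : ∀ a k → k - a ≡ 1ℤ + k - (1ℤ + a)
      pred-bound = solve-∀

      zero-config : Config
      zero-config _ = 0ℤ

      minus-zero-area : ∀ u → overlapArea (u ⊖ zero-config) ≡ overlapArea u
      minus-zero-area u = ≤-antisym
        (Σ-mono (λ k → pos-mono (level-anti u (u ⊖ zero-config) (λ c → ≤-reflexive (+-identityʳ (u c))) (+ k))) L)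
        (Σ-mono (λ k → pos-mono (level-anti (u ⊖ zero-config) u (λ c → ≤-reflexive (sym (+-identityʳ (u c)))) (+ k))) L)

      degree-+ : ∀ f g → degree (λ c → f c + g c) ≡ degree f + degree g
      degree-+ f g = trans (cong₂ _+_ (∑-distrib-+ (rowA f) (rowA g)) (∑-distrib-+ (rowB f) (rowB g)))
        (e (sum (rowA f)) (sum (rowA g)) (sum (rowB f)) (sum (rowB g)))
        where
        e : ∀ a b c d → a + b + (c + d) ≡ a + c + (b + d)
        e = solve-∀

      effective-cong : ∀ u v → (∀ c → u c ≡ v c) → Effective u → Effective v
      effective-cong u v eq (x , x≥0 , k , lap) = x , x≥0 , k , λ c → trans (cong (_- x c) (sym (eq c))) (lap c)

      Breaking : Config → Set
      Breaking u = ∃[ f ] BreaksEffectiveness u f × degree f ≤ overlapArea u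

      breaking-zero : ∀ u → ¬ 1ℤ ≤ overlapArea u → Breaking u
      breaking-zero u ¬p = zero-config ,
        ((λ _ → ≤-refl) , λ eff → ¬p (≤-trans (overlap⇒area (u ⊖ zero-config) (effective⇒overlap (u ⊖ zero-config) eff))
          (≤-reflexive (minus-zero-area u)))) ,
        ≤-trans (≤-reflexive (cong₂ _+_ (sum-zero m) (sum-zero n))) (Σ-≥0 (λ k → pos (level u (+ k))) L)

      breaking-suc : ∀ u i → 1ℤ + overlapArea (u ⊖ unit i) ≤ overlapArea u → Breaking (u ⊖ unit i) → Breaking u
      breaking-suc u i drop (f , (f≥0 , ¬eff) , small) = g ,
        ((λ c → +-mono-≤ (unit-≥0 i c) (f≥0 c)) ,
          λ eff → ¬eff (effective-cong (u ⊖ g) ((u ⊖ unit i) ⊖ f) (λ c → e (u c) (unit i c) (f c)) eff)) ,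
        ≤-trans (≤-reflexive (trans (degree-+ (unit i) f) (cong (_+ degree f) (unit-degree i)))) (≤-trans (+-monoʳ-≤ 1ℤ small) drop)
        where
        g : Config
        g c = unit i c + f c
        e : ∀ u a f → u - (a + f) ≡ u - a - f
        e = solve-∀

      -- Chips are taken away one at a time, each costing at least one point of overlap, until no
      -- point is left; K bounds the number of rounds.
      breaking : ∀ K u → overlapArea u ≤ + K → Breaking u
      breaking-dec : ∀ K u → overlapArea u ≤ + K → Dec (1ℤ ≤ overlapArea u) → Breaking u
      breaking-drop : ∀ K u → overlapArea u ≤ + suc K → ∃[ i ] 1ℤ + overlapArea (u ⊖ unit i) ≤ overlapArea u → Breaking u
      breaking K u le = breaking-dec K u le (1ℤ ≤? overlapArea u)
      breaking-dec K       u le (no ¬p) = breaking-zero u ¬p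
      breaking-dec zero    u le (yes p) = ⊥-elim (1+≤⇒≰ p le)
      breaking-dec (suc K) u le (yes p) = breaking-drop K u le (overlap⇒drop u (area⇒overlap u p))
      breaking-drop K u le (i , drop) = breaking-suc u i drop
        (breaking K (u ⊖ unit i) (≤-by (≤-trans drop le) (pred-bound (overlapArea (u ⊖ unit i)) (+ K))))

    -- `breaking` supplies an f of degree at most the overlap, and `breaks⇒degree` excludes smaller
    -- degrees.
    rank-area : ∀ u → HasRank u (overlapArea u - 1ℤ)
    rank-area u = (f , breaks , ≤-antisym (≤-trans small (≤-reflexive (sym 1+r))) (≤-trans (≤-reflexive 1+r) (breaks⇒degree u f breaks))) ,
      λ f breaks → ≤-trans (≤-reflexive 1+r) (breaks⇒degree u f breaks)
      where
      1+r : 1ℤ + (overlapArea u - 1ℤ) ≡ overlapArea u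
      1+r = e (overlapArea u)
        where
        e : ∀ a → 1ℤ + (a - 1ℤ) ≡ a
        e = solve-∀
      found : ∃[ f ] BreaksEffectiveness u f × degree f ≤ overlapArea u
      found = breaking ∣ overlapArea u ∣ u (≤-reflexive (sym (0≤i⇒+∣i∣≡i (Σ-≥0 (λ k → pos (level u (+ k))) L))))
      f : Config
      f = proj₁ found
      breaks : BreaksEffectiveness u f
      breaks = proj₁ (proj₂ found)
      small : degree f ≤ overlapArea u
      small = proj₂ (proj₂ found)

    rank-unique : ∀ {u r r′} → HasRank u r → HasRank u r′ → r ≡ r′
    rank-unique {r = r} {r′} ((f , bf , df) , least) ((f′ , bf′ , df′) , least′) = ≤-antisym
      (≤-by (≤-trans (least f′ bf′) (≤-reflexive df′)) (e r r′)) (≤-by (≤-trans (least′ f bf) (≤-reflexive df)) (e r′ r))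
      where
      e : ∀ r r′ → r′ - r ≡ 1ℤ + r′ - (1ℤ + r)
      e = solve-∀

  -- Parking configurations as a normal form of pairs of staircases.

  module NormalForm where
    open Sandpile public
    module PS = ParkingSorted m₁ n₁
    open PS using (sink; Parking; Sorted; V; Config; ΔSet; _⊖_) public
    module Sa = Sorting n₁
    module Sb = Sorting m₁

    rowA° : Config → Fin m₁ → ℤ
    rowA° u i = u (inj₁ (inject₁ i))

    -- The sink is left out because parking does not constrain its value.
    A° : Config → ℤ → ℤ
    A° u = Va.staircase (rowA° u)

    module SA° u = Staircase (Va.staircase-isStaircase (rowA° u))

    A-split : ∀ u s → A u s ≡ A° u s + Fa.⌊ u sink + s ⌋
    A-split u s = sum-init-last (λ i → Fa.⌊ rowA u i + s ⌋)

    inject₁≢sink : ∀ i → inj₁ (inject₁ i) ≢ sink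
    inject₁≢sink i eq = Fin.fromℕ≢inject₁ (sym (inj₁-injective eq))

    -- The boundary paths of {T ≤ A° S} and {S ≤ B T} meet at the origin and not beyond.
    record Normal (u : Config) : Set where
      field
        a-reduced : ∀ i → Sa.Reduced (rowA° u i)
        b-reduced : ∀ j → Sb.Reduced (rowB u j)
        escape    : ∀ s → 1ℤ ≤ s → 1ℤ + B u (A° u s) ≤ s

    private
      members : (V → Bool) → V → ℤ
      members C c = ⟨ C c ⟩

      inA inB : (V → Bool) → ℤ
      inA C = sum (λ i → ⟨ C (inj₁ i) ⟩)
      inB C = sum (λ j → ⟨ C (inj₂ j) ⟩)

      inA-≥0 : ∀ C → 0ℤ ≤ inA C
      inA-≥0 C = sum-≥0 (λ i → ⟨ C (inj₁ i) ⟩) (λ i → 0≤⟨⟩ (C (inj₁ i)))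

      inB-≥0 : ∀ C → 0ℤ ≤ inB C
      inB-≥0 C = sum-≥0 (λ j → ⟨ C (inj₂ j) ⟩) (λ j → 0≤⟨⟩ (C (inj₂ j)))

      fireA : ∀ u C i → (u ⊖ ΔSet C) (inj₁ i) ≡ u (inj₁ i) - (⟨ C (inj₁ i) ⟩ * + n - inB C)
      fireA u C i = cong (_-_ (u (inj₁ i))) (∑Δ (members C) (inj₁ i))

      fireB : ∀ u C j → (u ⊖ ΔSet C) (inj₂ j) ≡ u (inj₂ j) - (⟨ C (inj₂ j) ⟩ * + m - inA C)
      fireB u C j = cong (_-_ (u (inj₂ j))) (∑Δ (members C) (inj₂ j))

      -- Firing C only harms its members.
      Harmed : Config → (V → Bool) → V → Set
      Harmed u C (inj₁ i) = C (inj₁ i) ≡ true × 1ℤ + (u (inj₁ i) + inB C) ≤ + n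
      Harmed u C (inj₂ j) = C (inj₂ j) ≡ true × 1ℤ + (u (inj₂ j) + inA C) ≤ + m

      harm : ∀ x k s b → 0ℤ ≤ x → 0ℤ ≤ s → x - (⟨ b ⟩ * k - s) < 0ℤ → b ≡ true × 1ℤ + (x + s) ≤ k
      harm x k s true  _  _  lt = refl , ≤-by (<⇒1+≤ lt) (e x k s)
        where
        e : ∀ x k s → k - (1ℤ + (x + s)) ≡ 0ℤ - (1ℤ + (x - (1ℤ * k - s)))
        e = solve-∀
      harm x k s false x≥0 s≥0 lt = ⊥-elim (<-irrefl refl (<-≤-trans lt (≤-by₂ x≥0 s≥0 (e x k s))))
        where
        e : ∀ x k s → x - (0ℤ * k - s) - 0ℤ ≡ x - 0ℤ + (s - 0ℤ)
        e = solve-∀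

      harmed : ∀ u C c → 0ℤ ≤ u c → (u ⊖ ΔSet C) c < 0ℤ → Harmed u C c
      harmed u C (inj₁ i) u≥0 lt = harm (u (inj₁ i)) (+ n) (inB C) (C (inj₁ i)) u≥0 (inB-≥0 C) (subst (_< 0ℤ) (fireA u C i) lt)
      harmed u C (inj₂ j) u≥0 lt = harm (u (inj₂ j)) (+ m) (inA C) (C (inj₂ j)) u≥0 (inA-≥0 C) (subst (_< 0ℤ) (fireB u C j) lt)

      only : V → V → Bool
      only v c = does (c PS.≟ v)

    -- Firing one vertex can harm only that vertex, which bounds its value by its degree. A point
    -- violating `escape` would yield a set that can be fired without harm.
    parking⇒normal : ∀ u → Parking u → Normal u
    parking⇒normal u (u≥0 , stuck) = record { a-reduced = a-red ; b-reduced = b-red ; escape = λ s 1≤s → escape ∣ s ∣ s (≤-reflexive (sym (0≤i⇒+∣i∣≡i (≤-trans (0≤+ 1) 1≤s)))) 1≤s }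
      where
      attack : ∀ C → C sink ≡ false → (∃[ c ] C c ≡ true) → ∃[ c ] c ≢ sink × Harmed u C c
      attack C out ne = let c , c≢ , lt = stuck C out ne in c , c≢ , harmed u C c (u≥0 c c≢) lt

      a-red : ∀ i → Sa.Reduced (rowA° u i)
      a-red i = u≥0 v (inject₁≢sink i) , bound (attack (only v) (dec-false (sink PS.≟ v) (inject₁≢sink i ∘ sym)) (v , dec-true (v PS.≟ v) refl))
        where
        v : V
        v = inj₁ (inject₁ i)
        bound : ∃[ c ] c ≢ sink × Harmed u (only v) c → 1ℤ + u v ≤ + n
        bound (inj₁ i′ , _ , is , le) with refl ← true⇒ (inj₁ i′ PS.≟ v) is = ≤-trans (≤-by (inB-≥0 (only v)) (e (u v) (inB (only v)))) le
          where
          e : ∀ u s → 1ℤ + (u + s) - (1ℤ + u) ≡ s - 0ℤ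
          e = solve-∀
        bound (inj₂ j , _ , () , _)

      b-red : ∀ j → Sb.Reduced (rowB u j)
      b-red j = u≥0 v (λ ()) , bound (attack (only v) refl (v , dec-true (v PS.≟ v) refl))
        where
        v : V
        v = inj₂ j
        bound : ∃[ c ] c ≢ sink × Harmed u (only v) c → 1ℤ + u v ≤ + m
        bound (inj₂ j′ , _ , is , le) with refl ← true⇒ (inj₂ j′ PS.≟ v) is = ≤-trans (≤-by (inA-≥0 (only v)) (e (u v) (inA (only v)))) le
          where
          e : ∀ u s → 1ℤ + (u + s) - (1ℤ + u) ≡ s - 0ℤ
          e = solve-∀
        bound (inj₁ i , _ , () , _)

      A°-0 : A° u 0ℤ ≡ 0ℤ
      A°-0 = trans (sum-cong-≗ (λ i → trans (cong Fa.⌊_⌋ (+-identityʳ (rowA° u i))) (Sa.⌊⌋-0 (proj₁ (a-red i)) (proj₂ (a-red i))))) (sum-zero m₁)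

      -- The set C holds the vertices whose floors have reached 1 at s and at t. It has t members on
      -- the first side and B(t) on the second, so if s ≤ B(t) every member receives enough to stay
      -- non-negative.
      near : ∀ s → 1ℤ ≤ s → s ≤ + n → ¬ s ≤ B u (A° u s)
      near s 1≤s s≤n s≤B = contradict (attack C out (nonempty (sum-< (λ _ → 0ℤ) (λ j → ⟨ C (inj₂ j) ⟩)
          (≤-<-trans (≤-reflexive (sum-zero n)) (1+≤⇒< (≤-trans 1≤s (≤-trans s≤B (≤-reflexive (sym inB≡)))))))))
        where
        s≥0 : 0ℤ ≤ s
        s≥0 = ≤-trans (0≤+ 1) 1≤s
        t : ℤ
        t = A° u s
        t≥0 : 0ℤ ≤ t
        t≥0 = ≤-trans (≤-reflexive (sym A°-0)) (SA°.mono u s≥0)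
        t≤m₁ : t ≤ + m₁
        t≤m₁ = ≤-trans (SA°.mono u {s} {0ℤ + + n} s≤n) (≤-reflexive (trans (SA°.period u 0ℤ) (trans (cong (_+ + m₁) A°-0) (+-identityˡ (+ m₁)))))
        C : V → Bool
        C (inj₁ i) = not (does (i Fin.≟ fromℕ m₁)) ∧ does (+ n - s ≤? u (inj₁ i))
        C (inj₂ j) = does (+ m - t ≤? u (inj₂ j))
        out : C sink ≡ false
        out rewrite dec-true (fromℕ m₁ Fin.≟ fromℕ m₁) refl = refl
        C-inject : ∀ i → C (inj₁ (inject₁ i)) ≡ does (+ n - s ≤? rowA° u i)
        C-inject i = cong (λ b → not b ∧ does (+ n - s ≤? rowA° u i)) (dec-false (inject₁ i Fin.≟ fromℕ m₁) (Fin.fromℕ≢inject₁ ∘ sym))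
        inA≡ : inA C ≡ t
        inA≡ = trans (sum-init-last (λ i → ⟨ C (inj₁ i) ⟩)) (trans (cong₂ _+_
            (sum-cong-≗ (λ i → trans (cong ⟨_⟩ (C-inject i)) (sym (Sa.⌊⌋-indicator (rowA° u i) s (proj₁ (a-red i))
              (≤-by₂ (proj₂ (a-red i)) s≤n (e (+ n) (rowA° u i) s)) s≥0))))
            (cong ⟨_⟩ out)) (+-identityʳ t))
          where
          e : ∀ n a s → n + n - (1ℤ + a + s) ≡ n - (1ℤ + a) + (n - s)
          e = solve-∀
        inB≡ : inB C ≡ B u t
        inB≡ = sum-cong-≗ (λ j → sym (Sb.⌊⌋-indicator (rowB u j) t (proj₁ (b-red j))
            (≤-by₂ (proj₂ (b-red j)) (≤-trans t≤m₁ (i≤j+i (+ m₁) 1ℤ)) (e (+ m) (rowB u j) t)) t≥0))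
          where
          e : ∀ n a s → n + n - (1ℤ + a + s) ≡ n - (1ℤ + a) + (n - s)
          e = solve-∀
        nonempty : ∃[ j ] 0ℤ < ⟨ C (inj₂ j) ⟩ → ∃[ c ] C c ≡ true
        nonempty (j , lt) = inj₂ j , pos⇒true (C (inj₂ j)) lt
          where
          pos⇒true : ∀ b → 0ℤ < ⟨ b ⟩ → b ≡ true
          pos⇒true true  _ = refl
          pos⇒true false lt = ⊥-elim (<-irrefl refl lt)
        contradict : ∃[ c ] c ≢ sink × Harmed u C c → ⊥
        contradict (inj₁ i , i≢ , is , le) with lastView i
        ... | inj₁ refl = i≢ refl
        ... | inj₂ (i′ , refl) = 1+≤⇒≰ {+ n} {u (inj₁ (inject₁ i′)) + s}
          (≤-trans (+-monoʳ-≤ 1ℤ (+-monoʳ-≤ (u (inj₁ (inject₁ i′))) (≤-trans s≤B (≤-reflexive (sym inB≡))))) le)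
          (≤-by (true⇒ (+ n - s ≤? rowA° u i′) (trans (sym (C-inject i′)) is)) (e (+ n) (rowA° u i′) s))
          where
          e : ∀ n a s → a + s - n ≡ a - (n - s)
          e = solve-∀
        contradict (inj₂ j , _ , is , le) = 1+≤⇒≰ {+ m} {u (inj₂ j) + t}
          (≤-trans (≤-reflexive (cong (λ z → 1ℤ + (u (inj₂ j) + z)) (sym inA≡))) le)
          (≤-by (true⇒ (+ m - t ≤? u (inj₂ j)) is) (e (+ m) (u (inj₂ j)) t))
          where
          e : ∀ n a s → a + s - n ≡ a - (n - s)
          e = solve-∀

      -- Per period of n places A° grows by m₁, less than m, so the composite with B grows by at
      -- most n and the inequality propagates.
      escape : ∀ K s → s ≤ + K → 1ℤ ≤ s → 1ℤ + B u (A° u s) ≤ s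
      escape K s s≤K 1≤s with s ≤? + n
      ... | yes s≤n = <⇒1+≤ (≰⇒> (near s 1≤s s≤n))
      escape zero s s≤K 1≤s | no ¬p = ⊥-elim (1+≤⇒≰ (≤-trans 1≤s s≤K) ≤-refl)
      escape (suc K) s s≤K 1≤s | no ¬p = ≤-trans (+-monoʳ-≤ 1ℤ (SB.mono u (≤-trans (≤-reflexive A°-shift) (+-monoʳ-≤ (A° u s′) (i≤j+i (+ m₁) 1ℤ)))))
        (≤-trans (≤-reflexive (cong (_+_ 1ℤ) (SB.period u (A° u s′))))
          (≤-by (escape K s′ (≤-by₂ s≤K (0≤+ n₁) (e₁ (+ K) s (+ n₁))) (≤-by (≰⇒1+≤ ¬p) (e₂ s (+ n)))) (e₃ (B u (A° u s′)) s (+ n))))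
        where
        s′ : ℤ
        s′ = s - + n
        e₀ : ∀ s n → s ≡ s - n + n
        e₀ = solve-∀
        e₁ : ∀ k s n → k - (s - (1ℤ + n)) ≡ 1ℤ + k - s + (n - 0ℤ)
        e₁ = solve-∀
        e₂ : ∀ s n → s - n - 1ℤ ≡ s - (1ℤ + n)
        e₂ = solve-∀
        e₃ : ∀ b s n → s - (1ℤ + (b + n)) ≡ s - n - (1ℤ + b)
        e₃ = solve-∀
        A°-shift : A° u s ≡ A° u s′ + + m₁
        A°-shift = trans (cong (A° u) (e₀ s (+ n))) (SA°.period u s′)

    -- A set fired without harm satisfies `inA C ≤ A° u (inB C)` and `inB C ≤ B u (inA C)`. By
    -- `escape` it then has no member on the second side, and a reduced value on the first side
    -- cannot pay for its own firing.
    normal⇒parking : ∀ u → Normal u → Parking u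
    normal⇒parking u nf = u≥0 , stuck
      where
      open Normal nf
      u≥0 : ∀ c → c ≢ sink → 0ℤ ≤ u c
      u≥0 (inj₂ j) _ = proj₁ (b-reduced j)
      u≥0 (inj₁ i) i≢ with lastView i
      ... | inj₁ refl        = ⊥-elim (i≢ refl)
      ... | inj₂ (i′ , refl) = proj₁ (a-reduced i′)
      stuck : ∀ C → C sink ≡ false → (∃[ c ] C c ≡ true) → ∃[ c ] c ≢ sink × (u ⊖ ΔSet C) c < 0ℤ
      stuck C out (c₀ , is₀) with Fin.any? (λ i → (u ⊖ ΔSet C) (inj₁ (inject₁ i)) <? 0ℤ)
      ... | yes (i , lt) = inj₁ (inject₁ i) , inject₁≢sink i , lt
      ... | no okA with Fin.any? (λ j → (u ⊖ ΔSet C) (inj₂ j) <? 0ℤ)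
      ...   | yes (j , lt) = inj₂ j , (λ ()) , lt
      ...   | no okB = ⊥-elim (impossible (1ℤ ≤? inB C))
        where
        full : ∀ x k s b → 0ℤ ≤ x - (⟨ b ⟩ * k - s) → b ≡ true → k ≤ x + s
        full x k s .true le refl = ≤-by le (e x k s)
          where
          e : ∀ x k s → x + s - k ≡ x - (1ℤ * k - s) - 0ℤ
          e = solve-∀
        fullA : ∀ i → C (inj₁ (inject₁ i)) ≡ true → + n ≤ rowA° u i + inB C
        fullA i = full (rowA° u i) (+ n) (inB C) (C (inj₁ (inject₁ i)))
          (≮⇒≥ (λ lt → okA (i , subst (_< 0ℤ) (sym (fireA u C (inject₁ i))) lt)))
        fullB : ∀ j → C (inj₂ j) ≡ true → + m ≤ rowB u j + inA C
        fullB j = full (rowB u j) (+ m) (inA C) (C (inj₂ j))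
          (≮⇒≥ (λ lt → okB (j , subst (_< 0ℤ) (sym (fireB u C j)) lt)))
        boundA : ∀ i b → C (inj₁ (inject₁ i)) ≡ b → ⟨ b ⟩ ≤ Fa.⌊ rowA° u i + inB C ⌋
        boundA i true  eq = Fa.⌊⌋⇐ 1ℤ (rowA° u i + inB C) (≤-trans (≤-reflexive (*-identityˡ (+ n))) (fullA i eq))
        boundA i false eq = Fa.⌊⌋⇐ 0ℤ (rowA° u i + inB C) (+-mono-≤ (proj₁ (a-reduced i)) (inB-≥0 C))
        boundB : ∀ j b → C (inj₂ j) ≡ b → ⟨ b ⟩ ≤ Fb.⌊ rowB u j + inA C ⌋
        boundB j true  eq = Fb.⌊⌋⇐ 1ℤ (rowB u j + inA C) (≤-trans (≤-reflexive (*-identityˡ (+ m))) (fullB j eq))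
        boundB j false eq = Fb.⌊⌋⇐ 0ℤ (rowB u j + inA C) (+-mono-≤ (proj₁ (b-reduced j)) (inA-≥0 C))
        inA≤ : inA C ≤ A° u (inB C)
        inA≤ = ≤-trans (≤-reflexive (trans (sum-init-last (λ i → ⟨ C (inj₁ i) ⟩)) (trans (cong (_+_ (sum (λ i → ⟨ C (inj₁ (inject₁ i)) ⟩))) (cong ⟨_⟩ out)) (+-identityʳ _))))
          (sum-mono (λ i → boundA i (C (inj₁ (inject₁ i))) refl))
        inB≤ : inB C ≤ B u (inA C)
        inB≤ = sum-mono (λ j → boundB j (C (inj₂ j)) refl)
        impossible : Dec (1ℤ ≤ inB C) → ⊥
        impossible (yes 1≤) = 1+≤⇒≰ (escape (inB C) 1≤) (≤-trans inB≤ (SB.mono u inA≤))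
        impossible (no ¬1≤) = contradict c₀ is₀
          where
          inB≡0 : inB C ≡ 0ℤ
          inB≡0 = ≤-antisym (≤-by (≰⇒1+≤ ¬1≤) (e (inB C))) (inB-≥0 C)
            where
            e : ∀ s → 0ℤ - s ≡ 1ℤ - (1ℤ + s)
            e = solve-∀
          contradict : ∀ c → C c ≡ true → ⊥
          contradict (inj₁ i) is with lastView i
          ... | inj₁ refl with () ← trans (sym is) out
          ... | inj₂ (i′ , refl) = 1+≤⇒≰ {+ n} {rowA° u i′} (proj₂ (a-reduced i′))
            (≤-trans (fullA i′ is) (≤-reflexive (trans (cong (_+_ (rowA° u i′)) inB≡0) (+-identityʳ (rowA° u i′)))))
          contradict (inj₂ j) is = ¬1≤ (≤-trans (≤-reflexive (trans (sym (cong ⟨_⟩ is)) refl)) (member j))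
            where
            member : ∀ j → ⟨ C (inj₂ j) ⟩ ≤ inB C
            member j = single (λ j → ⟨ C (inj₂ j) ⟩) (λ j → 0≤⟨⟩ (C (inj₂ j))) j
              where
              single : ∀ {k} (f : Fin k → ℤ) → (∀ i → 0ℤ ≤ f i) → ∀ i → f i ≤ sum f
              single f f≥0 zero    = ≤-trans (≤-reflexive (sym (+-identityʳ (f zero)))) (+-monoʳ-≤ (f zero) (sum-≥0 (f ∘ suc) (f≥0 ∘ suc)))
              single f f≥0 (suc i) = ≤-trans (≤-reflexive (sym (+-identityˡ (f (suc i))))) (+-mono-≤ (f≥0 zero) (single (f ∘ suc) (f≥0 ∘ suc) i))

  -- Parking by translation, and the closed walk of a configuration.

  module Parked where
    open NormalForm public
    private
      module Ba = StaircaseBounds n₁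
      module Bb = StaircaseBounds m₁

    record Meeting (u : Config) : Set where
      field
        S T    : ℤ
        atA    : A° u S ≡ T
        atB    : B u T ≡ S
        latest : ∀ s → 1ℤ + S ≤ s → 1ℤ + B u (A° u s) ≤ s

    abstract
      -- The composite of B and A° has mean slope m₁ / m, below 1, so the inequality Q holds far to
      -- the left and fails far to the right; its last solution is the meeting.
      meeting : ∀ u → Meeting u
      meeting u = record { S = S ; T = A° u S ; atA = refl ; atB = fixed ; latest = λ s gt → <⇒1+≤ (≰⇒> (later s gt)) }
        where
        Q : ℤ → Set
        Q s = s ≤ B u (A° u s)
        a b hi : ℤ
        a = sum (rowA° u)
        b = sum (rowB u)
        -- The upper bounds of the floors turn Q into m s ≤ a + b + m₁ s, that is s ≤ a + b.
        hi = a + b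
        K : ℕ
        -- The possible rounding loss: m₁ floors lose up to n₁ each, and n floors up to m₁ each.
        K = m₁ ℕ.* n₁ ℕ.+ n ℕ.* m₁
        Q⇒ : ∀ s → Q s → s ≤ hi
        Q⇒ s q = ≤-by₂ (*-monoʳ-≤-nonNeg (+ m) q)
          (+-mono-≤ (i≤j⇒0≤j-i (Bb.staircase-≤ (rowB u) (A° u s))) (i≤j⇒0≤j-i (Ba.staircase-≤ (rowA° u) s)))
          (e (+ m₁) (+ n) a b s (A° u s) (B u (A° u s)))
          where
          e : ∀ m₁ n a b s x y → a + b - s ≡
            y * (1ℤ + m₁) - s * (1ℤ + m₁) + (b + n * x - y * (1ℤ + m₁) + (a + m₁ * s - x * n) - 0ℤ)
          e = solve-∀
        Q-low : Q (hi - + K)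
        Q-low = *-cancelʳ-≤-pos s (B u (A° u s)) (+ m) (≤-by₂ (Bb.staircase-≥ (rowB u) (A° u s)) (Ba.staircase-≥ (rowA° u) s)
          (trans (cong (λ k → B u (A° u s) * + m - (hi - k) * + m) K≡) (trans (e (+ m₁) (+ n₁) a b (A° u s) (B u (A° u s)))
            (cong (λ k → B u (A° u s) * + m + + n * + m₁ - (b + + n * A° u s) + (A° u s * + n + + m₁ * + n₁ - (a + + m₁ * (hi - k)))) (sym K≡)))))
          where
          s : ℤ
          s = hi - + K
          K≡ : + K ≡ + m₁ * + n₁ + + n * + m₁
          K≡ = trans (pos-+ (m₁ ℕ.* n₁) (n ℕ.* m₁)) (cong₂ _+_ (pos-* m₁ n₁) (pos-* n m₁))
          e : ∀ m n a b x y → y * (1ℤ + m) - (a + b - (m * n + (1ℤ + n) * m)) * (1ℤ + m) ≡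
            y * (1ℤ + m) + (1ℤ + n) * m - (b + (1ℤ + n) * x) + (x * (1ℤ + n) + m * n - (a + m * (a + b - (m * n + (1ℤ + n) * m))))
          e = solve-∀
        found : ∃[ s ] Q s × (∀ z → 1ℤ + s ≤ z → z ≤ hi → ¬ Q z)
        found = lastTrue (λ s → s ≤? B u (A° u s)) hi K Q-low
        S : ℤ
        S = proj₁ found
        later : ∀ s → 1ℤ + S ≤ s → ¬ Q s
        later s gt q = proj₂ (proj₂ found) s gt (Q⇒ s q) q
        -- By monotonicity the composite value at S satisfies Q as well, so it cannot exceed the
        -- last solution S.
        fixed : B u (A° u S) ≡ S
        fixed = ≤-antisym (≮⇒≥ λ lt → later (B u (A° u S)) (<⇒1+≤ lt)
            (SB.mono u (SA°.mono u (proj₁ (proj₂ found)))))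
          (proj₁ (proj₂ found))

    -- v is u after toppling, up to the order of the values other than the one at the sink.
    record Translated (u v : Config) : Set where
      field
        S T   : ℤ
        onA   : ∀ s → A v s ≡ A u (s + S) - T
        onB   : ∀ t → B v t ≡ B u (t + T) - S
        onSink : v sink ≡ u sink + S

    translate : ∀ {n k F} → Staircase n k F → ∀ S T → Staircase n k (λ s → F (s + S) - T)
    translate {n} {k} {F} st S T = record
      { mono   = λ le → +-monoˡ-≤ (- T) (Staircase.mono st (+-monoˡ-≤ S le))
      ; period = λ s → trans (cong (λ z → F z - T) (e s (+ n) S)) (trans (cong (_- T) (Staircase.period st (s + S))) (e′ (F (s + S)) (+ k) T))
      }
      where
      e : ∀ s n S → s + n + S ≡ s + S + n
      e = solve-∀
      e′ : ∀ f k T → f + k - T ≡ f - T + k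
      e′ = solve-∀

    -- The latest meeting is moved to the origin, which makes both staircases realizable by reduced
    -- sorted vectors; the value of the sink grows by S, so that its corner moves along.
    module Park (u : Config) where
      open Meeting (meeting u)

      private
        FA₀ : A° u (0ℤ + S) - T ≡ 0ℤ
        FA₀ = trans (cong (λ z → A° u z - T) (+-identityˡ S)) (trans (cong (_- T) atA) (+-inverseʳ T))
        FB₀ : B u (0ℤ + T) - S ≡ 0ℤ
        FB₀ = trans (cong (λ z → B u z - S) (+-identityˡ T)) (trans (cong (_- S) atB) (+-inverseʳ S))
        module Ra = Sa.Realize (translate (Va.staircase-isStaircase (rowA° u)) S T) FA₀
        module Rb = Sb.Realize (translate (Vb.staircase-isStaircase (rowB u)) T S) FB₀

        place : ∀ {i : Fin m} → i ≡ fromℕ m₁ ⊎ ∃[ i′ ] i ≡ inject₁ i′ → ℤ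
        place (inj₁ _)        = u sink + S
        place (inj₂ (i′ , _)) = Ra.realize i′

      parked : Config
      parked (inj₁ i) = place (lastView i)
      parked (inj₂ j) = Rb.realize j

      private
        parked-sink : parked sink ≡ u sink + S
        parked-sink = at-sink (lastView (fromℕ m₁))
          where
          at-sink : (v : fromℕ m₁ ≡ fromℕ m₁ ⊎ ∃[ i′ ] fromℕ m₁ ≡ inject₁ i′) → place v ≡ u sink + S
          at-sink (inj₁ _)        = refl
          at-sink (inj₂ (i , eq)) = ⊥-elim (Fin.fromℕ≢inject₁ eq)

        parked-A : ∀ i → rowA° parked i ≡ Ra.realize i
        parked-A i = off-sink (lastView (inject₁ i))
          where
          off-sink : (v : inject₁ i ≡ fromℕ m₁ ⊎ ∃[ i′ ] inject₁ i ≡ inject₁ i′) → place v ≡ Ra.realize i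
          off-sink (inj₁ eq)        = ⊥-elim (Fin.fromℕ≢inject₁ (sym eq))
          off-sink (inj₂ (i′ , eq)) = cong Ra.realize (sym (Fin.inject₁-injective eq))

        A°-parked : ∀ s → A° parked s ≡ A° u (s + S) - T
        A°-parked s = trans (Va.staircase-cong parked-A s) (Ra.realize-staircase s)

      parked-sorted : Sorted parked
      parked-sorted = sortedA , λ i j le → Rb.realize-sorted le
        where
        sortedA : ∀ i j → inj₁ i ≢ sink → inj₁ j ≢ sink → i Fin.≤ j → parked (inj₁ i) ≤ parked (inj₁ j)
        sortedA i j i≢ j≢ le with lastView i | lastView j
        ... | inj₁ refl | _         = ⊥-elim (i≢ refl)
        ... | inj₂ _    | inj₁ refl = ⊥-elim (j≢ refl)
        ... | inj₂ (i′ , refl) | inj₂ (j′ , refl) =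
          Ra.realize-sorted {i′} {j′} (subst₂ ℕ._≤_ (Fin.toℕ-inject₁ i′) (Fin.toℕ-inject₁ j′) le)

      parked-normal : Normal parked
      parked-normal = record
        { a-reduced = λ i → subst Sa.Reduced (sym (parked-A i)) (Ra.realize-reduced i)
        ; b-reduced = Rb.realize-reduced
        ; escape    = λ s 1≤s → ≤-by (latest (s + S) (+-monoˡ-≤ S 1≤s))
            (trans (cong (λ b → s - (1ℤ + b)) (trans (Rb.realize-staircase (A° parked s))
                (cong (λ z → B u z - S) (trans (cong (_+ T) (A°-parked s)) (e (A° u (s + S)) T)))))
              (e′ s (B u (A° u (s + S))) S))
        }
        where
        e : ∀ a t → a - t + t ≡ a
        e = solve-∀
        e′ : ∀ s b S → s - (1ℤ + (b - S)) ≡ s + S - (1ℤ + b)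
        e′ = solve-∀

      parked-translated : Translated u parked
      parked-translated = record
        { S = S ; T = T
        ; onA = λ s → trans (A-split parked s) (trans (cong₂ _+_ (A°-parked s) (cong Fa.⌊_⌋ (trans (cong (_+ s) parked-sink) (e (u sink) S s))))
            (trans (e′ (A° u (s + S)) T Fa.⌊ u sink + (s + S) ⌋) (cong (_- T) (sym (A-split u (s + S))))))
        ; onB = Rb.realize-staircase
        ; onSink = parked-sink
        }
        where
        e : ∀ u S s → u + S + s ≡ u + (s + S)
        e = solve-∀
        e′ : ∀ a t f → a - t + f ≡ a + f - t
        e′ = solve-∀

    -- Both paths run in the plane of S and T, with N an advance of S and E an advance of T. The
    -- first is recorded by its S coordinate and the second by its T coordinate, hence the opposite
    -- letters.
    letterAt : Config → ℤ → Letter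
    letterAt u t = (if does (SA.inv u (1ℤ + t) ≟ SA.inv u t) then E else N)
                 , (if does (SB.inv u (1ℤ + t) ≟ SB.inv u t) then N else E)

    word : Config → ℤ → ℕ → Word
    word u t zero    = []
    word u t (suc K) = letterAt u t ∷ word u (1ℤ + t) K

    -- The corner at which the vertical step of the sink ends.
    base : Config → ℤ
    base u = SA.σ u (- u sink)

    code : Config → ℤ × Word
    code u = level u (base u) , word u (base u) L
      where open import Data.Product.Base using (_×_)

    private
      1+≢ : ∀ {a b} → a ≡ 1ℤ + b → a ≢ b
      1+≢ {a} refl eq = i≢suc[i] (sym eq)

    data Steps (u : Config) (t : ℤ) : Letter → Set where
      steps : ∀ {α β} →
        SA.inv u (1ℤ + t) ≡ (case α of λ { N → 1ℤ ; E → 0ℤ }) + SA.inv u t →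
        SB.inv u (1ℤ + t) ≡ (case β of λ { E → 1ℤ ; N → 0ℤ }) + SB.inv u t →
        Steps u t (α , β)

    letter-steps : ∀ u t → Steps u t (letterAt u t)
    letter-steps u t with SA.next u t | SB.next u t
    ... | Staircase.level p | Staircase.level r
      rewrite dec-true (SA.inv u (1ℤ + t) ≟ SA.inv u t) p | dec-true (SB.inv u (1ℤ + t) ≟ SB.inv u t) r
      = steps (trans p (sym (+-identityˡ _))) (trans r (sym (+-identityˡ _)))
    ... | Staircase.level p | Staircase.rise r _
      rewrite dec-true (SA.inv u (1ℤ + t) ≟ SA.inv u t) p | dec-false (SB.inv u (1ℤ + t) ≟ SB.inv u t) (1+≢ r)
      = steps (trans p (sym (+-identityˡ _))) r
    ... | Staircase.rise p _ | Staircase.level r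
      rewrite dec-false (SA.inv u (1ℤ + t) ≟ SA.inv u t) (1+≢ p) | dec-true (SB.inv u (1ℤ + t) ≟ SB.inv u t) r
      = steps p (trans r (sym (+-identityˡ _)))
    ... | Staircase.rise p _ | Staircase.rise r _
      rewrite dec-false (SA.inv u (1ℤ + t) ≟ SA.inv u t) (1+≢ p) | dec-false (SB.inv u (1ℤ + t) ≟ SB.inv u t) (1+≢ r)
      = steps p r

    level-move : ∀ u t → level u (1ℤ + t) ≡ move (letterAt u t) (level u t)
    level-move u t with letterAt u t | letter-steps u t
    ... | E , E | steps p r = trans (cong₂ (λ a b → 1ℤ + (1ℤ + t) - a - b) p r) (e t (SA.inv u t) (SB.inv u t))
      where
      e : ∀ t a b → 1ℤ + (1ℤ + t) - (0ℤ + a) - (1ℤ + b) ≡ 1ℤ + t - a - b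
      e = solve-∀
    ... | E , N | steps p r = trans (cong₂ (λ a b → 1ℤ + (1ℤ + t) - a - b) p r) (e t (SA.inv u t) (SB.inv u t))
      where
      e : ∀ t a b → 1ℤ + (1ℤ + t) - (0ℤ + a) - (0ℤ + b) ≡ 1ℤ + (1ℤ + t - a - b)
      e = solve-∀
    ... | N , E | steps p r = trans (cong₂ (λ a b → 1ℤ + (1ℤ + t) - a - b) p r) (e t (SA.inv u t) (SB.inv u t))
      where
      e : ∀ t a b → 1ℤ + (1ℤ + t) - (1ℤ + a) - (1ℤ + b) ≡ -1ℤ + (1ℤ + t - a - b)
      e = solve-∀
    ... | N , N | steps p r = trans (cong₂ (λ a b → 1ℤ + (1ℤ + t) - a - b) p r) (e t (SA.inv u t) (SB.inv u t))
      where
      e : ∀ t a b → 1ℤ + (1ℤ + t) - (1ℤ + a) - (0ℤ + b) ≡ 1ℤ + t - a - b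
      e = solve-∀

    private
      suc-shift : ∀ t k → t + (1ℤ + k) ≡ 1ℤ + t + k
      suc-shift = solve-∀

    word-area : ∀ (area : ℤ → Word → ℕ) (f : ℤ → ℕ) → (∀ d → area d [] ≡ 0) →
      (∀ d ℓ ws → area d (ℓ ∷ ws) ≡ f d ℕ.+ area (move ℓ d) ws) →
      ∀ u t K → + area (level u t) (word u t K) ≡ Σ (λ k → + f (level u (t + + k))) K
    word-area area f nil cons u t zero    = cong +_ (nil (level u t))
    word-area area f nil cons u t (suc K) = trans (cong +_ (cons (level u t) (letterAt u t) (word u (1ℤ + t) K)))
      (trans (cong₂ _+_ (cong (λ z → + f (level u z)) (sym (+-identityʳ t)))
          (trans (cong (λ d → + area d (word u (1ℤ + t) K)) (sym (level-move u t)))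
            (trans (word-area area f nil cons u (1ℤ + t) K) (Σ-cong (λ k → cong (λ z → + f (level u z)) (sym (suc-shift t (+ k)))) K))))
        (sym (Σ-head (λ k → + f (level u (t + + k))) K)))

    code-area⁺ : ∀ u → + area⁺ (level u (base u)) (word u (base u) L) ≡ overlapArea u
    code-area⁺ u = trans (word-area area⁺ pos (λ _ → refl) (λ _ _ _ → refl) u (base u) L) (shifted-area u pos (base u))

    code-area⁻ : ∀ u → + area⁻ (level u (base u)) (word u (base u) L) ≡ gapArea u
    code-area⁻ u = trans (word-area area⁻ neg (λ _ → refl) (λ _ _ _ → refl) u (base u) L) (shifted-area u neg (base u))

    word-length : ∀ u t K → length (word u t K) ≡ K
    word-length u t zero    = refl
    word-length u t (suc K) = cong suc (word-length u (1ℤ + t) K)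

    word-#N : ∀ u t K → SA.inv u (t + + K) ≡ SA.inv u t + + #N (word u t K)
    word-#N u t zero    = trans (cong (SA.inv u) (+-identityʳ t)) (sym (+-identityʳ _))
    word-#N u t (suc K) = trans (cong (SA.inv u) (suc-shift t (+ K))) (trans (word-#N u (1ℤ + t) K) (first-letter (letterAt u t) (letter-steps u t)))
      where
      first-letter : ∀ ℓ → Steps u t ℓ → SA.inv u (1ℤ + t) + + #N (word u (1ℤ + t) K) ≡ SA.inv u t + + #N (ℓ ∷ word u (1ℤ + t) K)
      first-letter (E , β) (steps p _) = cong (_+ + #N (word u (1ℤ + t) K)) (trans p (+-identityˡ (SA.inv u t)))
      first-letter (N , β) (steps p _) = trans (cong (_+ + #N (word u (1ℤ + t) K)) p) (e (SA.inv u t) (+ #N (word u (1ℤ + t) K)))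
        where
        e : ∀ a k → 1ℤ + a + k ≡ a + (1ℤ + k)
        e = solve-∀

    code-#N : ∀ u t → #N (word u t L) ≡ n
    code-#N u t = +-injective (cancelˡ (SA.inv u t) _ _ (trans (sym (word-#N u t L)) (invA-period u t)))

    private
      word-endsE : ∀ u c b t K → level u (t + + suc K) ≡ c → proj₁ (letterAt u (t + + K)) ≡ E →
        endsE c b (level u t) (word u t (suc K)) ≡ true
      word-endsE u c b t zero lv is =
        trans (cong₂ (λ x y → x ∧ does (y ≟ c)) (trans (cong (λ z → isE (letterAt u z)) (sym (+-identityʳ t))) (isE-E (letterAt u (t + 0ℤ)) is)) (sym (level-move u t)))
          (dec-true (level u (1ℤ + t) ≟ c) (trans (cong (level u) (+-comm 1ℤ t)) lv))
        where
        isE-E : ∀ ℓ → proj₁ ℓ ≡ E → isE ℓ ≡ true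
        isE-E (E , _) _ = refl
      word-endsE u c b t (suc K) lv is = trans (cong (λ d → endsE c (isE (letterAt u t)) d (word u (1ℤ + t) (suc K))) (sym (level-move u t)))
        (word-endsE u c (isE (letterAt u t)) (1ℤ + t) K (trans (cong (level u) (sym (suc-shift t (+ suc K)))) lv)
          (trans (cong (proj₁ ∘ letterAt u) (sym (suc-shift t (+ K)))) is))

      inv-base : ∀ u → SA.inv u (base u) ≡ - u sink
      inv-base u = SA.inv-σ u (- u sink)

      first-N : ∀ u → proj₁ (letterAt u (base u)) ≡ N
      first-N u = start (letterAt u (base u)) (letter-steps u (base u))
        where
        start : ∀ ℓ → Steps u (base u) ℓ → proj₁ ℓ ≡ N
        start (N , _) _ = refl
        start (E , _) (steps p _) = ⊥-elim (1+≤⇒≰ {base u} {base u}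
          (SA.inv⇒ u {1ℤ + base u} { - u sink} (≤-reflexive (trans p (trans (+-identityˡ _) (inv-base u))))) ≤-refl)

      -- At S = -u(sink) the floor of the sink jumps from -1 to 0, so the first path arrives at the
      -- base by an advance of T.
      before-base : ∀ u → SA.inv u (base u - 1ℤ) ≡ SA.inv u (base u)
      before-base u = ≤-antisym (SA.inv-mono u (≤-by (0≤+ 1) (e (base u))))
        (≤-trans (≤-reflexive (inv-base u)) (≮⇒≥ λ lt → 1+≤⇒≰ {base u - 1ℤ} {SA.σ u (- u sink - 1ℤ)}
          (≤-by drop (e′ (- u sink) (A u (- u sink)) (A u (- u sink - 1ℤ))))
          (SA.inv⇒ u {base u - 1ℤ} { - u sink - 1ℤ} (≤-by (<⇒1+≤ lt) (e″ (- u sink) (SA.inv u (base u - 1ℤ)))))))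
        where
        e : ∀ z → z - (z - 1ℤ) ≡ 1ℤ - 0ℤ
        e = solve-∀
        e′ : ∀ s a b → s + a - 1ℤ - (1ℤ + (s - 1ℤ + b)) ≡ a - (1ℤ + b)
        e′ = solve-∀
        e″ : ∀ s i → s - 1ℤ - i ≡ s - (1ℤ + i)
        e″ = solve-∀
        drop : 1ℤ + A u (- u sink - 1ℤ) ≤ A u (- u sink)
        drop = subst₂ (λ a b → 1ℤ + a ≤ b) (sym (A-split u (- u sink - 1ℤ))) (sym (A-split u (- u sink)))
          (≤-by₂ (SA°.mono u (≤-by (0≤+ 1) (e (- u sink)))) floors (e‴ (A° u (- u sink - 1ℤ)) (A° u (- u sink)) Fa.⌊ u sink + (- u sink - 1ℤ) ⌋ Fa.⌊ u sink + - u sink ⌋))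
          where
          e‴ : ∀ a a′ f f′ → a′ + f′ - (1ℤ + (a + f)) ≡ a′ - a + (f′ - (1ℤ + f))
          e‴ = solve-∀
          floors : 1ℤ + Fa.⌊ u sink + (- u sink - 1ℤ) ⌋ ≤ Fa.⌊ u sink + - u sink ⌋
          floors = ≤-reflexive (trans (cong (_+_ 1ℤ) (trans (cong Fa.⌊_⌋ (e₁ (u sink)))
              (Fa.⌊⌋-unique -1ℤ -1ℤ (≤-trans (≤-reflexive (-1*i≡-i (+ n))) (-≤- z≤n)) ≤-refl)))
            (sym (trans (cong Fa.⌊_⌋ (+-inverseʳ (u sink))) (Fa.⌊⌋-unique 0ℤ 0ℤ ≤-refl (+≤+ (s≤s z≤n))))))
            where
            e₁ : ∀ s → s + (- s - 1ℤ) ≡ -1ℤ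
            e₁ = solve-∀

      last-E : ∀ u → proj₁ (letterAt u (base u + + (m₁ ℕ.+ n))) ≡ E
      last-E u = cong (λ b → if b then E else N) (dec-true (SA.inv u (1ℤ + t) ≟ SA.inv u t) eq)
        where
        t : ℤ
        t = base u + + (m₁ ℕ.+ n)
        e : ∀ b k → 1ℤ + (b + k) ≡ b + (1ℤ + k)
        e = solve-∀
        e′ : ∀ b k → b + k ≡ b - 1ℤ + (1ℤ + k)
        e′ = solve-∀
        eq : SA.inv u (1ℤ + t) ≡ SA.inv u t
        eq = trans (cong (SA.inv u) (e (base u) (+ (m₁ ℕ.+ n)))) (trans (invA-period u (base u))
          (trans (cong (_+ + n) (sym (before-base u))) (trans (sym (invA-period u (base u - 1ℤ))) (cong (SA.inv u) (sym (e′ (base u) (+ (m₁ ℕ.+ n))))))))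

    -- The base lies on the graph of A, so the first path leaves it by N; the E by which it arrives
    -- reappears one period later as the last letter.
    code-closed : ∀ u → closed (level u (base u)) (word u (base u) L) ≡ true
    code-closed u = go (letterAt u (base u)) (first-N u) refl
      where
      c t : ℤ
      c = level u (base u)
      t = 1ℤ + base u
      go : ∀ ℓ → proj₁ ℓ ≡ N → ℓ ≡ letterAt u (base u) → closed c (ℓ ∷ word u t (m₁ ℕ.+ n)) ≡ true
      go (N , β) _ eq = trans (cong₂ (λ d k → endsE c false d (word u t k)) (trans (cong (λ ℓ → move ℓ c) eq) (sym (level-move u (base u)))) (ℕ.+-suc m₁ n₁))
        (word-endsE u c false t (m₁ ℕ.+ n₁)
          (trans (cong (level u) (trans (cong (_+_ t) (cong +_ (sym (ℕ.+-suc m₁ n₁)))) (e (base u) (+ (m₁ ℕ.+ n))))) (trans (level-period u (base u)) (+-identityʳ _)))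
          (trans (cong (proj₁ ∘ letterAt u) (trans (e′ (base u) (+ (m₁ ℕ.+ n₁))) (cong (λ k → base u + + k) (sym (ℕ.+-suc m₁ n₁))))) (last-E u)))
        where
        e : ∀ b k → 1ℤ + b + k ≡ b + (1ℤ + k)
        e = solve-∀
        e′ : ∀ b k → 1ℤ + b + k ≡ b + (1ℤ + k)
        e′ = solve-∀

  -- A parking sorted configuration is determined by its closed walk.

  module Codes where
    open Parked public

    private
      does-≡ : ∀ {a a′ b b′} → a′ - a ≡ b′ - b → does (a′ ≟ a) ≡ does (b′ ≟ b)
      does-≡ {a} {a′} {b} {b′} eq with a′ ≟ a | b′ ≟ b
      ... | yes _    | yes _    = refl
      ... | no _     | no _     = refl
      ... | yes refl | no ≢     = ⊥-elim (≢ (i-j≡0⇒i≡j b′ b (trans (sym eq) (+-inverseʳ a))))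
      ... | no ≢     | yes refl = ⊥-elim (≢ (i-j≡0⇒i≡j a′ a (trans eq (+-inverseʳ b))))

    module _ {u v : Config} (tr : Translated u v) where
      open Translated tr

      private
        inv-translatedA : ∀ t → SA.inv v t ≡ SA.inv u (t + S + T) - S
        inv-translatedA t = ≥-ext
          (λ z le → ≤-by (SA.inv⇐ u {t + S + T} {z + S} (≤-by (SA.inv⇒ v {t} {z} le) (e₁ z))) (e₂ z (SA.inv u (t + S + T)) S))
          (λ z le → SA.inv⇐ v {t} {z} (≤-by (SA.inv⇒ u {t + S + T} {z + S} (≤-by le (sym (e₂ z (SA.inv u (t + S + T)) S)))) (sym (e₁ z))))
          where
          e : ∀ z a S T t → z + S + a - (t + S + T) ≡ z + (a - T) - t
          e = solve-∀
          e₁ : ∀ z → SA.σ u (z + S) - (t + S + T) ≡ SA.σ v z - t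
          e₁ z = trans (e z (A u (z + S)) S T t) (cong (λ a → z + a - t) (sym (onA z)))
          e₂ : ∀ z i S → z - (i - S) ≡ z + S - i
          e₂ = solve-∀

        inv-translatedB : ∀ t → SB.inv v t ≡ SB.inv u (t + S + T) - T
        inv-translatedB t = ≥-ext
          (λ z le → ≤-by (SB.inv⇐ u {t + S + T} {z + T} (≤-by (SB.inv⇒ v {t} {z} le) (e₁ z))) (e₂ z (SB.inv u (t + S + T)) T))
          (λ z le → SB.inv⇐ v {t} {z} (≤-by (SB.inv⇒ u {t + S + T} {z + T} (≤-by le (sym (e₂ z (SB.inv u (t + S + T)) T)))) (sym (e₁ z))))
          where
          e : ∀ z a S T t → z + T + a - (t + S + T) ≡ z + (a - S) - t
          e = solve-∀
          e₁ : ∀ z → SB.σ u (z + T) - (t + S + T) ≡ SB.σ v z - t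
          e₁ z = trans (e z (B u (z + T)) S T t) (cong (λ a → z + a - t) (sym (onB z)))
          e₂ : ∀ z i S → z - (i - S) ≡ z + S - i
          e₂ = solve-∀

        base-translated : base v + S + T ≡ base u
        base-translated = trans (cong₂ (λ s a → s + a + S + T) (cong -_ onSink)
            (trans (onA (- v sink)) (cong (λ z → A u z - T) (trans (cong (λ s → - s + S) onSink) (e₁ (u sink) S)))))
          (e₂ (u sink) S T (A u (- u sink)))
          where
          e₁ : ∀ s S → - (s + S) + S ≡ - s
          e₁ = solve-∀
          e₂ : ∀ s S T a → - (s + S) + (a - T) + S + T ≡ - s + a
          e₂ = solve-∀

        one : ∀ t → 1ℤ + t + S + T ≡ 1ℤ + (t + S + T)
        one t = e t S T
          where
          e : ∀ t S T → 1ℤ + t + S + T ≡ 1ℤ + (t + S + T)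
          e = solve-∀

        letter-translated : ∀ t → letterAt v t ≡ letterAt u (t + S + T)
        letter-translated t = cong₂ _,_
          (cong (if_then E else N) (does-≡ {SA.inv v t} {SA.inv v (1ℤ + t)} {SA.inv u (t + S + T)} {SA.inv u (1ℤ + (t + S + T))}
            (trans (cong₂ _-_ (trans (inv-translatedA (1ℤ + t)) (cong (λ z → SA.inv u z - S) (one t))) (inv-translatedA t))
                   (e (SA.inv u (1ℤ + (t + S + T))) (SA.inv u (t + S + T)) S))))
          (cong (if_then N else E) (does-≡ {SB.inv v t} {SB.inv v (1ℤ + t)} {SB.inv u (t + S + T)} {SB.inv u (1ℤ + (t + S + T))}
            (trans (cong₂ _-_ (trans (inv-translatedB (1ℤ + t)) (cong (λ z → SB.inv u z - T) (one t))) (inv-translatedB t))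
                   (e (SB.inv u (1ℤ + (t + S + T))) (SB.inv u (t + S + T)) T))))
          where
          e : ∀ a b s → a - s - (b - s) ≡ a - b
          e = solve-∀

        word-translated : ∀ t K → word v t K ≡ word u (t + S + T) K
        word-translated t zero    = refl
        word-translated t (suc K) = cong₂ _∷_ (letter-translated t)
          (trans (word-translated (1ℤ + t) K) (cong (λ z → word u z K) (one t)))

        level-translated : ∀ t → level v t ≡ level u (t + S + T)
        level-translated t = trans (cong₂ (λ a b → 1ℤ + t - a - b) (inv-translatedA t) (inv-translatedB t))
          (e t S T (SA.inv u (t + S + T)) (SB.inv u (t + S + T)))
          where
          e : ∀ t S T a b → 1ℤ + t - (a - S) - (b - T) ≡ 1ℤ + (t + S + T) - a - b
          e = solve-∀

      -- Both paths are translated by S and T, and so is the base, because the value of the sink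
      -- changes by S.
      code-translated : code v ≡ code u
      code-translated = cong₂ _,_ (trans (level-translated (base v)) (cong (level u) base-translated))
        (trans (word-translated (base v) L) (cong (λ t → word u t L) base-translated))

    code-parked : ∀ u → code (Park.parked u) ≡ code u
    code-parked u = code-translated {u} {Park.parked u} (Park.parked-translated u)

    normal-A°0 : ∀ {u} → Normal u → A° u 0ℤ ≡ 0ℤ
    normal-A°0 {u} nf = trans (sum-cong-≗ (λ i → trans (cong Fa.⌊_⌋ (+-identityʳ (rowA° u i)))
      (Sa.⌊⌋-0 (proj₁ (Normal.a-reduced nf i)) (proj₂ (Normal.a-reduced nf i))))) (sum-zero m₁)

    normal-B0 : ∀ {u} → Normal u → B u 0ℤ ≡ 0ℤ
    normal-B0 {u} nf = trans (sum-cong-≗ (λ j → trans (cong Fb.⌊_⌋ (+-identityʳ (rowB u j)))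
      (Sb.⌊⌋-0 (proj₁ (Normal.b-reduced nf j)) (proj₂ (Normal.b-reduced nf j))))) (sum-zero n)

    -- The ordinate of the base point, whose abscissa is -u(sink).
    τ : Config → ℤ
    τ u = A u (- u sink)

    -- The two paths, seen from the base point.
    fromBaseA fromBaseB : Config → ℤ → ℤ
    fromBaseA u z = SA.inv u (base u + z) + u sink
    fromBaseB u z = SB.inv u (base u + z) - τ u

    word-#E : ∀ u t K → SB.inv u (t + + K) ≡ SB.inv u t + + #E (swapped (word u t K))
    word-#E u t zero    = trans (cong (SB.inv u) (+-identityʳ t)) (sym (+-identityʳ _))
    word-#E u t (suc K) = trans (cong (SB.inv u) (shift t (+ K))) (trans (word-#E u (1ℤ + t) K) (first-letter (letterAt u t) (letter-steps u t)))
      where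
      shift : ∀ t k → t + (1ℤ + k) ≡ 1ℤ + t + k
      shift = solve-∀
      first-letter : ∀ ℓ → Steps u t ℓ → SB.inv u (1ℤ + t) + + #E (swapped (word u (1ℤ + t) K)) ≡ SB.inv u t + + #E (swapped (ℓ ∷ word u (1ℤ + t) K))
      first-letter (α , N) (steps _ p) = cong (_+ + #E (swapped (word u (1ℤ + t) K))) (trans p (+-identityˡ (SB.inv u t)))
      first-letter (α , E) (steps _ p) = trans (cong (_+ + #E (swapped (word u (1ℤ + t) K))) p) (e (SB.inv u t) (+ #E (swapped (word u (1ℤ + t) K))))
        where
        e : ∀ a k → 1ℤ + a + k ≡ a + (1ℤ + k)
        e = solve-∀

    private
      take-word : ∀ u t {k K} → k ℕ.≤ K → take k (word u t K) ≡ word u t k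
      take-word u t z≤n      = refl
      take-word u t (s≤s le) = cong (letterAt u t ∷_) (take-word u (1ℤ + t) le)

    module SameCode {u v : Config} (same : code u ≡ code v) where
      private
        prefixes : ∀ {k} → k ℕ.< L → word u (base u) k ≡ word v (base v) k
        prefixes {k} lt = trans (sym (take-word u (base u) (ℕ.<⇒≤ lt))) (trans (cong (take k ∘ proj₂) same) (take-word v (base v) (ℕ.<⇒≤ lt)))

        invA-base : ∀ u → SA.inv u (base u) ≡ - u sink
        invA-base u = SA.inv-σ u (- u sink)

        invB-base : ∀ u → SB.inv u (base u) ≡ 1ℤ + τ u - level u (base u)
        invB-base u = trans (e (- u sink + τ u) (SA.inv u (base u)) (SB.inv u (base u)))
          (trans (cong (λ i → 1ℤ + (- u sink + τ u) - i - level u (base u)) (invA-base u)) (e′ (u sink) (τ u) (level u (base u))))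
          where
          e : ∀ t a b → b ≡ 1ℤ + t - a - (1ℤ + t - a - b)
          e = solve-∀
          e′ : ∀ s t l → 1ℤ + (- s + t) - - s - l ≡ 1ℤ + t - l
          e′ = solve-∀

      fromBaseA-same : ∀ z → fromBaseA u z ≡ fromBaseA v z
      fromBaseA-same = Period.agree (m₁ ℕ.+ n) (fromBaseA u) (fromBaseA v) {+ n} (per u) (per v)
        (λ k lt → trans (at u k) (trans (cong (λ ws → + #N ws) (prefixes lt)) (sym (at v k))))
        where
        e : ∀ b z l → b + (z + l) ≡ b + z + l
        e = solve-∀
        e′ : ∀ i n s → i + n + s ≡ i + s + n
        e′ = solve-∀
        e″ : ∀ s k → - s + k + s ≡ k
        e″ = solve-∀
        per : ∀ u z → fromBaseA u (z + + L) ≡ fromBaseA u z + + n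
        per u z = trans (cong (λ t → SA.inv u t + u sink) (e (base u) z (+ L)))
          (trans (cong (_+ u sink) (invA-period u (base u + z))) (e′ (SA.inv u (base u + z)) (+ n) (u sink)))
        at : ∀ u k → fromBaseA u (+ k) ≡ + #N (word u (base u) k)
        at u k = trans (cong (_+ u sink) (trans (word-#N u (base u) k) (cong (_+ + #N (word u (base u) k)) (invA-base u)))) (e″ (u sink) _)

      -- The word fixes the advances only; the level in the code places the second path relative to
      -- the first at the base.
      fromBaseB-same : ∀ z → fromBaseB u z ≡ fromBaseB v z
      fromBaseB-same = Period.agree (m₁ ℕ.+ n) (fromBaseB u) (fromBaseB v) {+ m} (per u) (per v)
        (λ k lt → trans (at u k) (trans (cong₂ (λ l ws → 1ℤ - l + + #E (swapped ws)) (cong proj₁ same) (prefixes lt)) (sym (at v k))))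
        where
        e : ∀ b z l → b + (z + l) ≡ b + z + l
        e = solve-∀
        e′ : ∀ i n s → i + n - s ≡ i - s + n
        e′ = solve-∀
        e″ : ∀ t l k → 1ℤ + t - l + k - t ≡ 1ℤ - l + k
        e″ = solve-∀
        per : ∀ u z → fromBaseB u (z + + L) ≡ fromBaseB u z + + m
        per u z = trans (cong (λ t → SB.inv u t - τ u) (e (base u) z (+ L)))
          (trans (cong (_- τ u) (invB-period u (base u + z))) (e′ (SB.inv u (base u + z)) (+ m) (τ u)))
        at : ∀ u k → fromBaseB u (+ k) ≡ 1ℤ - level u (base u) + + #E (swapped (word u (base u) k))
        at u k = trans (cong (_- τ u) (trans (word-#E u (base u) k) (cong (_+ + #E (swapped (word u (base u) k))) (invB-base u))))
          (e″ (τ u) (level u (base u)) _)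

    private
      A-adjoint⇒ : ∀ u z w → w ≤ A u (z - u sink) - τ u → fromBaseA u (z + w) ≤ z
      A-adjoint⇒ u z w le = ≤-by (SA.inv⇐ u {base u + (z + w)} {z - u sink} (≤-by le (e (u sink) (τ u) z w (A u (z - u sink)))))
        (e′ z (u sink) (SA.inv u (base u + (z + w))))
        where
        e : ∀ s t z w a → z - s + a - (- s + t + (z + w)) ≡ a - t - w
        e = solve-∀
        e′ : ∀ z s i → z - (i + s) ≡ z - s - i
        e′ = solve-∀

      A-adjoint⇐ : ∀ u z w → fromBaseA u (z + w) ≤ z → w ≤ A u (z - u sink) - τ u
      A-adjoint⇐ u z w le = ≤-by (SA.inv⇒ u {base u + (z + w)} {z - u sink} (≤-by le (e′ z (u sink) (SA.inv u (base u + (z + w))))))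
        (e (u sink) (τ u) z w (A u (z - u sink)))
        where
        e : ∀ s t z w a → a - t - w ≡ z - s + a - (- s + t + (z + w))
        e = solve-∀
        e′ : ∀ z s i → z - s - i ≡ z - (i + s)
        e′ = solve-∀

      B-adjoint⇒ : ∀ u z w → w ≤ B u (z + τ u) + u sink → fromBaseB u (z + w) ≤ z
      B-adjoint⇒ u z w le = ≤-by (SB.inv⇐ u {base u + (z + w)} {z + τ u} (≤-by le (e (u sink) (τ u) z w (B u (z + τ u)))))
        (e′ z (τ u) (SB.inv u (base u + (z + w))))
        where
        e : ∀ s t z w b → z + t + b - (- s + t + (z + w)) ≡ b + s - w
        e = solve-∀
        e′ : ∀ z s i → z - (i - s) ≡ z + s - i
        e′ = solve-∀

      B-adjoint⇐ : ∀ u z w → fromBaseB u (z + w) ≤ z → w ≤ B u (z + τ u) + u sink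
      B-adjoint⇐ u z w le = ≤-by (SB.inv⇒ u {base u + (z + w)} {z + τ u} (≤-by le (e′ z (τ u) (SB.inv u (base u + (z + w))))))
        (e (u sink) (τ u) z w (B u (z + τ u)))
        where
        e : ∀ s t z w b → b + s - w ≡ z + t + b - (- s + t + (z + w))
        e = solve-∀
        e′ : ∀ z s i → z + s - i ≡ z - (i - s)
        e′ = solve-∀

      compareA : ∀ u v → code u ≡ code v → ∀ z → A u (z - u sink) - τ u ≡ A v (z - v sink) - τ v
      compareA u v same z = ≤-ext
        (λ w le → A-adjoint⇐ v z w (subst (_≤ z) (fromBaseA-same (z + w)) (A-adjoint⇒ u z w le)))
        (λ w le → A-adjoint⇐ u z w (subst (_≤ z) (sym (fromBaseA-same (z + w))) (A-adjoint⇒ v z w le)))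
        where open SameCode {u} {v} same

      compareB : ∀ u v → code u ≡ code v → ∀ z → B u (z + τ u) + u sink ≡ B v (z + τ v) + v sink
      compareB u v same z = ≤-ext
        (λ w le → B-adjoint⇐ v z w (subst (_≤ z) (fromBaseB-same (z + w)) (B-adjoint⇒ u z w le)))
        (λ w le → B-adjoint⇐ u z w (subst (_≤ z) (sym (fromBaseB-same (z + w))) (B-adjoint⇒ v z w le)))
        where open SameCode {u} {v} same

      -- Seen from the base the sink contributes `Fa.⌊ z ⌋` whatever its value, so it can be removed
      -- on both sides.
      compareA° : ∀ u v → code u ≡ code v → ∀ z → A° u (z - u sink) - τ u ≡ A° v (z - v sink) - τ v
      compareA° u v same z = trans (without u) (trans (cong (_- Fa.⌊ z ⌋) (compareA u v same z)) (sym (without v)))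
        where
        e : ∀ s z → s + (z - s) ≡ z
        e = solve-∀
        e′ : ∀ a f t → a - t ≡ a + f - t - f
        e′ = solve-∀
        without : ∀ u → A° u (z - u sink) - τ u ≡ A u (z - u sink) - τ u - Fa.⌊ z ⌋
        without u = trans (e′ (A° u (z - u sink)) Fa.⌊ z ⌋ (τ u)) (cong (λ a → a - τ u - Fa.⌊ z ⌋)
          (trans (cong (λ x → A° u (z - u sink) + Fa.⌊ x ⌋) (sym (e (u sink) z))) (sym (A-split u (z - u sink)))))

      -- Both sinks are the latest meeting of the same pair of paths.
      sink-≮ : ∀ u v → Normal u → Normal v → code u ≡ code v → ¬ u sink < v sink
      sink-≮ u v nu nv same lt = 1+≤⇒≰ (Normal.escape nu s (≤-by (<⇒1+≤ lt) (e₀ (u sink) (v sink)))) (≤-reflexive (sym BA))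
        where
        e₀ : ∀ a b → b - a - 1ℤ ≡ b - (1ℤ + a)
        e₀ = solve-∀
        s : ℤ
        s = v sink - u sink
        e₁ : ∀ a t → a ≡ a - t + t
        e₁ = solve-∀
        atA : A° u s ≡ - τ v + τ u
        atA = trans (e₁ (A° u s) (τ u)) (cong (_+ τ u) (trans (compareA° u v same (v sink))
          (trans (cong (λ z → A° v z - τ v) (+-inverseʳ (v sink))) (trans (cong (_- τ v) (normal-A°0 nv)) (+-identityˡ (- τ v))))))
        e₂ : ∀ b s → b ≡ b + s - s
        e₂ = solve-∀
        BA : B u (A° u s) ≡ s
        BA = trans (cong (B u) atA) (trans (e₂ (B u (- τ v + τ u)) (u sink)) (cong (_- u sink) (trans (compareB u v same (- τ v))
          (trans (cong (λ z → B v z + v sink) (+-inverseˡ (τ v))) (trans (cong (_+ v sink) (normal-B0 nv)) (+-identityˡ (v sink)))))))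

    -- Once the sinks agree, so do the ordinates τ, because A° vanishes at 0; then the staircases
    -- coincide, and reduced sorted vectors are determined by them.
    code-injective : ∀ {u v} → Normal u → Sorted u → Normal v → Sorted v → code u ≡ code v → ∀ c → u c ≡ v c
    code-injective {u} {v} nu (sortedA , sortedB) nv (sortedA′ , sortedB′) same = equal
      where
      sinks : u sink ≡ v sink
      sinks with <-cmp (u sink) (v sink)
      ... | tri< lt _ _ = ⊥-elim (sink-≮ u v nu nv same lt)
      ... | tri≈ _ eq _ = eq
      ... | tri> _ _ gt = ⊥-elim (sink-≮ v u nv nu (sym same) gt)
      A°-τ : ∀ z → A° u z - τ u ≡ A° v z - τ v
      A°-τ z = trans (cong (λ x → A° u x - τ u) (e z (u sink))) (trans (compareA° u v same (z + u sink))
        (cong (λ x → A° v x - τ v) (trans (cong (λ s → z + s - v sink) sinks) (sym (e z (v sink))))))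
        where
        e : ∀ z s → z ≡ z + s - s
        e = solve-∀
      τs : τ u ≡ τ v
      τs = neg-injective (trans (sym (+-identityˡ (- τ u))) (trans (cong (_- τ u) (sym (normal-A°0 nu)))
        (trans (A°-τ 0ℤ) (trans (cong (_- τ v) (normal-A°0 nv)) (+-identityˡ (- τ v))))))
      A°s : ∀ z → A° u z ≡ A° v z
      A°s z = trans (e (A° u z) (τ u)) (trans (cong₂ _+_ (A°-τ z) τs) (sym (e (A° v z) (τ v))))
        where
        e : ∀ a t → a ≡ a - t + t
        e = solve-∀
      Bs : ∀ z → B u z ≡ B v z
      Bs z = trans (e (B u z) (u sink)) (trans (cong₂ _-_ (trans (cong (λ x → B u x + u sink) (e′ z (τ u)))
          (trans (compareB u v same (z - τ u)) (cong (λ x → B v x + v sink) (trans (cong (λ t → z - t + τ v) τs) (sym (e′ z (τ v))))))) sinks)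
        (sym (e (B v z) (v sink))))
        where
        e : ∀ a t → a ≡ a + t - t
        e = solve-∀
        e′ : ∀ z t → z ≡ z - t + t
        e′ = solve-∀
      rowA°-sorted : ∀ u → (∀ i j → inj₁ i ≢ sink → inj₁ j ≢ sink → i Fin.≤ j → u (inj₁ i) ≤ u (inj₁ j)) →
        ∀ {i j} → i Fin.≤ j → rowA° u i ≤ rowA° u j
      rowA°-sorted u so {i} {j} le = so (inject₁ i) (inject₁ j) (inject₁≢sink i) (inject₁≢sink j)
        (subst₂ ℕ._≤_ (sym (Fin.toℕ-inject₁ i)) (sym (Fin.toℕ-inject₁ j)) le)
      equal : ∀ c → u c ≡ v c
      equal (inj₂ j) = ≤-antisym
        (Sb.sorted-≤ (Normal.b-reduced nu) (λ {i} {j} → sortedB i j) (Normal.b-reduced nv) (λ {i} {j} → sortedB′ i j) Bs j)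
        (Sb.sorted-≤ (Normal.b-reduced nv) (λ {i} {j} → sortedB′ i j) (Normal.b-reduced nu) (λ {i} {j} → sortedB i j) (sym ∘ Bs) j)
      equal (inj₁ i) with lastView i
      ... | inj₁ refl = sinks
      ... | inj₂ (i′ , refl) = ≤-antisym
        (Sa.sorted-≤ (Normal.a-reduced nu) (rowA°-sorted u sortedA) (Normal.a-reduced nv) (rowA°-sorted v sortedA′) A°s i′)
        (Sa.sorted-≤ (Normal.a-reduced nv) (rowA°-sorted v sortedA′) (Normal.a-reduced nu) (rowA°-sorted u sortedA) (sym ∘ A°s) i′)

  -- Every closed walk comes from a configuration.

  module Decode where
    open Codes public

    -- The base is put at the origin, with sink value 0. The second path must start at T = 1 - c to
    -- have level c there: adding c - 1 to all values shifts the argument of B, and (c - 1) m more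
    -- at one vertex raises B by c - 1. The result need not be parking; `Park` mends this without
    -- changing the code.
    decode : ℤ → Word → Config
    decode c ws (inj₁ i)       = + entry (lower ws) (toℕ i)
    decode c ws (inj₂ zero)    = + entry (flipped ws) 0 + (c - 1ℤ) + (c - 1ℤ) * + m
    decode c ws (inj₂ (suc j)) = + entry (flipped ws) (toℕ (suc j)) + (c - 1ℤ)

    steps-letter : ∀ u t {ℓ} → Steps u t ℓ → letterAt u t ≡ ℓ
    steps-letter u t {E , E} (steps p r) = cong₂ _,_
      (cong (if_then E else N) (dec-true (_ ≟ _) (trans p (+-identityˡ _))))
      (cong (if_then N else E) (dec-false (SB.inv u (1ℤ + t) ≟ SB.inv u t) (λ eq → i≢suc[i] (trans (sym eq) r))))
    steps-letter u t {E , N} (steps p r) = cong₂ _,_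
      (cong (if_then E else N) (dec-true (_ ≟ _) (trans p (+-identityˡ _))))
      (cong (if_then N else E) (dec-true (_ ≟ _) (trans r (+-identityˡ _))))
    steps-letter u t {N , E} (steps p r) = cong₂ _,_
      (cong (if_then E else N) (dec-false (SA.inv u (1ℤ + t) ≟ SA.inv u t) (λ eq → i≢suc[i] (trans (sym eq) p))))
      (cong (if_then N else E) (dec-false (SB.inv u (1ℤ + t) ≟ SB.inv u t) (λ eq → i≢suc[i] (trans (sym eq) r))))
    steps-letter u t {N , N} (steps p r) = cong₂ _,_
      (cong (if_then E else N) (dec-false (SA.inv u (1ℤ + t) ≟ SA.inv u t) (λ eq → i≢suc[i] (trans (sym eq) p))))
      (cong (if_then N else E) (dec-true (_ ≟ _) (trans r (+-identityˡ _))))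

    private
      reads : ∀ u ws t a b →
        (∀ k → k ℕ.≤ length ws → SA.inv u (t + + k) ≡ a + + stepsN (take k (lower ws))) →
        (∀ k → k ℕ.≤ length ws → SB.inv u (t + + k) ≡ b + + stepsN (take k (flipped ws))) →
        word u t (length ws) ≡ ws
      reads u []       t a b ia ib = refl
      reads u (ℓ ∷ ws) t a b ia ib = cong₂ _∷_ (steps-letter u t (first-letter ℓ refl))
        (reads u ws (1ℤ + t) (a + + stepsN (proj₁ ℓ ∷ [])) (b + + stepsN (flip (proj₂ ℓ) ∷ []))
          (λ k le → trans (cong (SA.inv u) (shift t (+ k))) (trans (ia (suc k) (s≤s le)) (split a (proj₁ ℓ) (take k (lower ws)))))
          (λ k le → trans (cong (SB.inv u) (shift t (+ k))) (trans (ib (suc k) (s≤s le)) (split b (flip (proj₂ ℓ)) (take k (flipped ws))))))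
        where
        shift : ∀ t k → 1ℤ + t + k ≡ t + (1ℤ + k)
        shift = solve-∀
        split : ∀ a s p → a + + stepsN (s ∷ p) ≡ a + + stepsN (s ∷ []) + + stepsN p
        split a N p = e a (+ stepsN p)
          where
          e : ∀ a k → a + (1ℤ + k) ≡ a + 1ℤ + k
          e = solve-∀
        split a E p = e a (+ stepsN p)
          where
          e : ∀ a k → a + k ≡ a + 0ℤ + k
          e = solve-∀
        nowA : SA.inv u t ≡ a + 0ℤ
        nowA = trans (cong (SA.inv u) (sym (+-identityʳ t))) (ia 0 z≤n)
        nowB : SB.inv u t ≡ b + 0ℤ
        nowB = trans (cong (SB.inv u) (sym (+-identityʳ t))) (ib 0 z≤n)
        nextA : SA.inv u (1ℤ + t) ≡ a + + stepsN (proj₁ ℓ ∷ [])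
        nextA = trans (cong (SA.inv u) (+-comm 1ℤ t)) (ia 1 (s≤s z≤n))
        nextB : SB.inv u (1ℤ + t) ≡ b + + stepsN (flip (proj₂ ℓ) ∷ [])
        nextB = trans (cong (SB.inv u) (+-comm 1ℤ t)) (ib 1 (s≤s z≤n))
        rise : ∀ {x} a → x ≡ a + 0ℤ → a + 1ℤ ≡ 1ℤ + x
        rise a refl = e a
          where
          e : ∀ a → a + 1ℤ ≡ 1ℤ + (a + 0ℤ)
          e = solve-∀
        stay : ∀ {x} a → x ≡ a + 0ℤ → a + 0ℤ ≡ 0ℤ + x
        stay a refl = sym (+-identityˡ _)
        first-letter : ∀ ℓ′ → ℓ′ ≡ ℓ → Steps u t ℓ′
        first-letter (E , E) refl = steps (trans nextA (stay a nowA)) (trans nextB (rise b nowB))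
        first-letter (E , N) refl = steps (trans nextA (stay a nowA)) (trans nextB (stay b nowB))
        first-letter (N , E) refl = steps (trans nextA (rise a nowA)) (trans nextB (rise b nowB))
        first-letter (N , N) refl = steps (trans nextA (rise a nowA)) (trans nextB (stay b nowB))

      -- The first path closes with E and no N follows it, so the last index, that of the sink, gets
      -- the value 0.
      last-entry : ∀ c b d ℓ ws → endsE c b d (ℓ ∷ ws) ≡ true →
        ∃[ k ] stepsE (lower (ℓ ∷ ws)) ≡ suc k × entry (lower (ℓ ∷ ws)) k ≡ 0
      last-entry c b d (E , β) [] eq = 0 , refl , refl
      last-entry c b d (E , β) (ℓ ∷ ws) eq with k , k≡ , e ← last-entry c true (move (E , β) d) ℓ ws eq =
        suc k , cong suc k≡ , e
      last-entry c b d (N , β) (ℓ ∷ ws) eq = last-entry c false (move (N , β) d) ℓ ws eq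

      endsE⇒finish : ∀ c b d ws → endsE c b d ws ≡ true → finish d ws ≡ c
      endsE⇒finish c true d [] eq = true⇒ (d ≟ c) eq
      endsE⇒finish c b d (ℓ ∷ ws) eq = endsE⇒finish c (isE ℓ) (move ℓ d) ws eq

      stepsE-lower : ∀ ws → stepsE (lower ws) ≡ #E ws
      stepsE-lower []             = refl
      stepsE-lower ((E , _) ∷ ws) = cong suc (stepsE-lower ws)
      stepsE-lower ((N , _) ∷ ws) = stepsE-lower ws

      stepsN-lower : ∀ ws → stepsN (lower ws) ≡ #N ws
      stepsN-lower []             = refl
      stepsN-lower ((E , _) ∷ ws) = stepsN-lower ws
      stepsN-lower ((N , _) ∷ ws) = cong suc (stepsN-lower ws)

      stepsE-flipped : ∀ ws → stepsE (flipped ws) ≡ #N (swapped ws)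
      stepsE-flipped []             = refl
      stepsE-flipped ((_ , E) ∷ ws) = stepsE-flipped ws
      stepsE-flipped ((_ , N) ∷ ws) = cong suc (stepsE-flipped ws)

      stepsN-flipped : ∀ ws → stepsN (flipped ws) ≡ #E (swapped ws)
      stepsN-flipped []             = refl
      stepsN-flipped ((_ , E) ∷ ws) = cong suc (stepsN-flipped ws)
      stepsN-flipped ((_ , N) ∷ ws) = stepsN-flipped ws

    closed⇒finish : ∀ c ws → closed c ws ≡ true → finish c ws ≡ c
    closed⇒finish c ((N , β) ∷ ws) eq = endsE⇒finish c false (move (N , β) c) ws eq

    module Decoded (c : ℤ) (ws : Word) (is-closed : closed c ws ≡ true) (ws-E : #E ws ≡ m) (ws-N : #N ws ≡ n) where
      private
        u : Config
        u = decode c ws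

        fin : finish c ws ≡ c
        fin = closed⇒finish c ws is-closed

        module PA = FromPath n₁ m (lower ws) (trans (stepsN-lower ws) ws-N) (trans (stepsE-lower ws) ws-E)
        module PB = FromPath m₁ n (flipped ws) (trans (stepsN-flipped ws) (trans (closed-#E c ws fin) ws-E))
                                               (trans (stepsE-flipped ws) (trans (closed-#N c ws fin) ws-N))

        len : length ws ≡ L
        len = trans (sym (#E+#N ws)) (cong₂ ℕ._+_ ws-E ws-N)

        invA : ∀ t → t ℕ.≤ length ws → SA.inv u (+ t) ≡ + stepsN (take t (lower ws))
        invA t le = PA.inv-values t (ℕ.≤-trans le (ℕ.≤-reflexive (sym (List.length-map proj₁ ws))))

        module SPB = Staircase (Vb.staircase-isStaircase PB.values)

        B-shift : ∀ t → B u t ≡ Vb.staircase PB.values (t + (c - 1ℤ)) + (c - 1ℤ)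
        B-shift t = trans (cong₂ _+_
            (trans (cong Fb.⌊_⌋ (e₁ (+ entry (flipped ws) 0) (c - 1ℤ) ((c - 1ℤ) * + m) t))
              (trans (Period.multiples m₁ Fb.⌊_⌋ Fb.⌊⌋-period (+ entry (flipped ws) 0 + (t + (c - 1ℤ))) (c - 1ℤ))
                (cong (_+_ Fb.⌊ + entry (flipped ws) 0 + (t + (c - 1ℤ)) ⌋) (*-identityʳ (c - 1ℤ)))))
            (sum-≡ n₁ (λ j → Fb.⌊ + entry (flipped ws) (toℕ (suc j)) + (c - 1ℤ) + t ⌋)
              (λ j → Fb.⌊ + entry (flipped ws) (toℕ (suc j)) + (t + (c - 1ℤ)) ⌋)
              (λ j → cong Fb.⌊_⌋ (e₂ (+ entry (flipped ws) (toℕ (suc j))) (c - 1ℤ) t))))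
          (e₃ Fb.⌊ + entry (flipped ws) 0 + (t + (c - 1ℤ)) ⌋ (c - 1ℤ) (sum {n₁} (λ j → Fb.⌊ + entry (flipped ws) (toℕ (suc j)) + (t + (c - 1ℤ)) ⌋)))
          where
          e₁ : ∀ x c z t → x + c + z + t ≡ x + (t + c) + z
          e₁ = solve-∀
          e₂ : ∀ x c t → x + c + t ≡ x + (t + c)
          e₂ = solve-∀
          e₃ : ∀ f c s → f + c + s ≡ f + s + c
          e₃ = solve-∀

        invB-shift : ∀ t → SB.inv u t ≡ SPB.inv t - (c - 1ℤ)
        invB-shift t = ≥-ext
          (λ z le → ≤-by (SPB.inv⇐ {t} {z + (c - 1ℤ)} (≤-by (SB.inv⇒ u {t} {z} le) (e₁ z))) (e₂ z (SPB.inv t) (c - 1ℤ)))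
          (λ z le → SB.inv⇐ u {t} {z} (≤-by (SPB.inv⇒ {t} {z + (c - 1ℤ)} (≤-by le (sym (e₂ z (SPB.inv t) (c - 1ℤ))))) (sym (e₁ z))))
          where
          e : ∀ z c b t → z + c + b - t ≡ z + (b + c) - t
          e = solve-∀
          e₁ : ∀ z → SPB.σ (z + (c - 1ℤ)) - t ≡ SB.σ u z - t
          e₁ z = trans (e z (c - 1ℤ) (Vb.staircase PB.values (z + (c - 1ℤ))) t) (cong (λ b → z + b - t) (sym (B-shift z)))
          e₂ : ∀ z i c → z - (i - c) ≡ z + c - i
          e₂ = solve-∀

        invB : ∀ t → t ℕ.≤ length ws → SB.inv u (+ t) ≡ + stepsN (take t (flipped ws)) - (c - 1ℤ)
        invB t le = trans (invB-shift (+ t)) (cong (_- (c - 1ℤ))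
          (PB.inv-values t (ℕ.≤-trans le (ℕ.≤-reflexive (sym (List.length-map (flip ∘ proj₂) ws))))))

        sink-0 : ∀ ws → closed c ws ≡ true → #E ws ≡ m → entry (lower ws) m₁ ≡ 0
        sink-0 ((N , β) ∷ ℓ ∷ ws) eq wE with k , k≡ , e ← last-entry c false (move (N , β) c) ℓ ws eq
          with refl ← ℕ.suc-injective (trans (sym k≡) (trans (stepsE-lower (ℓ ∷ ws)) wE)) = e

        -- As the word opens with N, no E step has all the N steps after it; hence A vanishes at 0
        -- and the base is the origin.
        first-entries : ∀ ws → closed c ws ≡ true → entries≥ (stepsN (lower ws)) (lower ws) ≡ 0
        first-entries ((N , β) ∷ ws) eq = entries≥-none (suc (stepsN (lower ws))) (lower ws) ℕ.≤-refl

        u-sink : u sink ≡ 0ℤ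
        u-sink = cong +_ (trans (cong (entry (lower ws)) (Fin.toℕ-fromℕ m₁)) (sink-0 ws is-closed ws-E))

        base-0 : base u ≡ 0ℤ
        base-0 = trans (cong (λ s → - s + A u (- s)) u-sink) (trans (+-identityˡ _)
          (trans (PA.staircase-values 0 (s≤s z≤n)) (cong +_ (first-entries ws is-closed))))

      code-decode : code u ≡ (c , ws)
      code-decode = cong₂ _,_
        (trans (cong (level u) base-0) (trans (cong₂ (λ a b → 1ℤ + 0ℤ - a - b) (invA 0 z≤n) (invB 0 z≤n)) (e c)))
        (trans (cong₂ (word u) base-0 (sym len)) (reads u ws 0ℤ 0ℤ (- (c - 1ℤ))
          (λ k le → trans (cong (SA.inv u) (+-identityˡ (+ k))) (trans (invA k le) (sym (+-identityˡ _))))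
          (λ k le → trans (cong (SB.inv u) (+-identityˡ (+ k))) (trans (invB k le) (+-comm _ (- (c - 1ℤ)))))))
        where
        e : ∀ c → 1ℤ + 0ℤ - 0ℤ - (0ℤ - (c - 1ℤ)) ≡ c
        e = solve-∀

  -- The coefficients of K as numbers of closed walks.

  module Counting where
    open Decode

    -- Configurations are compared pointwise; as the trivial translation, pointwise equality
    -- preserves the code.
    ≗-translated : ∀ {u v : Config} → (∀ c → u c ≡ v c) → Translated u v
    ≗-translated {u} {v} eq = record
      { S = 0ℤ ; T = 0ℤ
      ; onA = λ s → trans (Va.staircase-cong (λ i → sym (eq (inj₁ i))) s)
          (trans (cong (A u) (sym (+-identityʳ s))) (sym (+-identityʳ _)))
      ; onB = λ t → trans (Vb.staircase-cong (λ j → sym (eq (inj₂ j))) t)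
          (trans (cong (B u) (sym (+-identityʳ t))) (sym (+-identityʳ _)))
      ; onSink = trans (sym (eq sink)) (sym (+-identityʳ _))
      }

    code-cong : ∀ {u v : Config} → (∀ c → u c ≡ v c) → code u ≡ code v
    code-cong {u} {v} eq = sym (code-translated {u} {v} (≗-translated eq))

    normal-cong : ∀ {u v : Config} → (∀ c → u c ≡ v c) → Normal u → Normal v
    normal-cong {u} {v} eq nf = record
      { a-reduced = λ i → subst Sa.Reduced (eq (inj₁ (Fin.inject₁ i))) (Normal.a-reduced nf i)
      ; b-reduced = λ j → subst Sb.Reduced (eq (inj₂ j)) (Normal.b-reduced nf j)
      ; escape    = λ s 1≤s → subst (λ b → 1ℤ + b ≤ s)
          (trans (Vb.staircase-cong (λ j → eq (inj₂ j)) (A° u s))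
            (cong (B v) (Va.staircase-cong (λ i → eq (inj₁ (Fin.inject₁ i))) s)))
          (Normal.escape nf s 1≤s)
      }

    sorted-cong : ∀ {u v : Config} → (∀ c → u c ≡ v c) → Sorted u → Sorted v
    sorted-cong eq (sortedA , sortedB) =
      (λ i j i≢ j≢ le → subst₂ _≤_ (eq (inj₁ i)) (eq (inj₁ j)) (sortedA i j i≢ j≢ le)) ,
      (λ i j le → subst₂ _≤_ (eq (inj₂ i)) (eq (inj₂ j)) (sortedB i j le))

    x-exponent y-exponent : Config → ℕ
    x-exponent u = area⁻ (proj₁ (code u)) (proj₂ (code u))
    y-exponent u = area⁺ (proj₁ (code u)) (proj₂ (code u))

    private
      gap-exponent : ∀ u → gapArea u ≡ + (m₁ ℕ.* n₁) + (overlapArea u - 1ℤ) - PS.degree u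
      gap-exponent u = trans (e₁ (overlapArea u) (gapArea u)) (trans (cong (_-_ (overlapArea u)) (areas-differ u))
        (trans (e₂ (+ m₁) (+ n₁) (overlapArea u) (PS.degree u)) (cong (λ p → p + (overlapArea u - 1ℤ) - PS.degree u) (sym (pos-* m₁ n₁)))))
        where
        e₁ : ∀ o g → g ≡ o - (o - g)
        e₁ = solve-∀
        e₂ : ∀ m n o d → o - (d + (1ℤ + m + (1ℤ + n)) - (1ℤ + m) * (1ℤ + n)) ≡ m * n + (o - 1ℤ) - d
        e₂ = solve-∀

      back : ∀ o → o ≡ o - 1ℤ + 1ℤ
      back = solve-∀

    monomial : ∀ u → PS.HasMonomial u (x-exponent u) (y-exponent u)
    monomial u = overlapArea u - 1ℤ , rank-area u , trans (code-area⁻ u) (gap-exponent u) , trans (code-area⁺ u) (back (overlapArea u))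

    monomial-unique : ∀ u {a b} → PS.HasMonomial u a b → x-exponent u ≡ a × y-exponent u ≡ b
    monomial-unique u {a} {b} (r , rank , +a , +b) =
      +-injective (trans (code-area⁻ u) (trans (gap-exponent u) (trans (cong (λ r → + (m₁ ℕ.* n₁) + r - PS.degree u) r≡) (sym +a)))) ,
      +-injective (trans (code-area⁺ u) (trans (back (overlapArea u)) (trans (cong (_+ 1ℤ) r≡) (sym +b))))
      where
      r≡ : overlapArea u - 1ℤ ≡ r
      r≡ = rank-unique {u} (rank-area u) rank

    module _ (a b : ℕ) where
      good : ℤ → Word → Bool
      good c ws = matches c m n a b ws ∧ closed c ws

      at : ℤ → List (ℤ × Word)
      at c = map (c ,_) (words (good c) L)

      codes : ℕ → List (ℤ × Word)
      codes zero    = []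
      codes (suc M) = codes M ++ (at +[1+ M ] ++ at (- (+ M)))

      length-codes : ∀ M → length (codes M) ≡ countClosed M m n a b
      length-codes zero    = refl
      length-codes (suc M) = trans (List.length-++ (codes M)) (cong₂ ℕ._+_ (length-codes M)
        (trans (List.length-++ (at +[1+ M ])) (cong₂ ℕ._+_ (List.length-map _ (words (good +[1+ M ]) L))
          (List.length-map _ (words (good (- (+ M))) L)))))

      private
        ∈-at : ∀ {c ω} → ω ∈ at c → proj₁ ω ≡ c × proj₂ ω ∈ words (good c) L
        ∈-at {c} ω∈ with _ , ws∈ , refl ← ∈-map⁻ (c ,_) ω∈ = refl , ws∈

      ∈-codes⁻ : ∀ M {c ws} → (c , ws) ∈ codes M → (neg c ℕ.< M × pos c ℕ.≤ M) × ws ∈ words (good c) L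
      ∈-codes⁻ (suc M) ω∈ with ∈-++⁻ (codes M) ω∈
      ... | inj₁ ω∈M = let (neg< , pos≤) , ws∈ = ∈-codes⁻ M ω∈M in (ℕ.m≤n⇒m≤1+n neg< , ℕ.m≤n⇒m≤1+n pos≤) , ws∈
      ... | inj₂ ω∈′ with ∈-++⁻ (at +[1+ M ]) ω∈′
      ...   | inj₁ ω∈₊ with refl , ws∈ ← ∈-at ω∈₊ = (s≤s z≤n , ℕ.≤-refl) , ws∈
      ...   | inj₂ ω∈₋ with refl , ws∈ ← ∈-at ω∈₋ = (bounds M) , ws∈
        where
        bounds : ∀ M → neg (- (+ M)) ℕ.< suc M × pos (- (+ M)) ℕ.≤ suc M
        bounds zero    = s≤s z≤n , z≤n
        bounds (suc M) = ℕ.≤-refl , z≤n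

      private
        codes-mono : ∀ {M M′} → M ℕ.≤′ M′ → ∀ {ω} → ω ∈ codes M → ω ∈ codes M′
        codes-mono ℕ.≤′-refl      ω∈ = ω∈
        codes-mono (ℕ.≤′-step le) ω∈ = ∈-++⁺ˡ (codes-mono le ω∈)

      ∈-codes⁺ : ∀ M c {ws} → neg c ℕ.< M → pos c ℕ.≤ M → ws ∈ words (good c) L → (c , ws) ∈ codes M
      ∈-codes⁺ M (+ 0)    neg< pos≤ ws∈ = codes-mono (ℕ.≤⇒≤′ neg<) (∈-++⁺ʳ (at +[1+ 0 ]) (∈-map⁺ (+ 0 ,_) ws∈))
      ∈-codes⁺ M +[1+ k ] neg< pos≤ ws∈ = codes-mono (ℕ.≤⇒≤′ pos≤) (∈-++⁺ʳ (codes k) (∈-++⁺ˡ (∈-map⁺ (+[1+ k ] ,_) ws∈)))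
      ∈-codes⁺ M -[1+ k ] neg< pos≤ ws∈ = codes-mono (ℕ.≤⇒≤′ neg<)
        (∈-++⁺ʳ (codes (suc k)) (∈-++⁺ʳ (at +[1+ suc k ]) (∈-map⁺ (-[1+ k ] ,_) ws∈)))

      codes-unique : ∀ M → Unique (codes M)
      codes-unique zero    = []
      codes-unique (suc M) = Unique.++⁺ (codes-unique M)
        (Unique.++⁺ (at-unique +[1+ M ]) (at-unique (- (+ M))) λ (ω∈₊ , ω∈₋) → opposite M (trans (sym (proj₁ (∈-at ω∈₊))) (proj₁ (∈-at ω∈₋))))
        (λ (ω∈ , ω∈′) → outside (proj₁ (∈-codes⁻ M ω∈)) (∈-++⁻ (at +[1+ M ]) ω∈′))
        where
        at-unique : ∀ c → Unique (at c)
        at-unique c = Unique.map⁺ (cong proj₂) (words-unique (good c) L)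
        opposite : ∀ M → +[1+ M ] ≢ - (+ M)
        opposite zero    ()
        opposite (suc M) ()
        neg-neg : ∀ M → neg (- (+ M)) ≡ M
        neg-neg zero    = refl
        neg-neg (suc M) = refl
        outside : ∀ {ω} → neg (proj₁ ω) ℕ.< M × pos (proj₁ ω) ℕ.≤ M → ¬ (ω ∈ at +[1+ M ] ⊎ ω ∈ at (- (+ M)))
        outside (_ , pos≤) (inj₁ ω∈) with refl ← proj₁ (∈-at ω∈) = ℕ.<-irrefl refl pos≤
        outside (neg< , _) (inj₂ ω∈) with refl ← proj₁ (∈-at ω∈) = ℕ.<-irrefl (neg-neg M) neg<

      range : ℕ
      range = suc (a ℕ.+ b)

      config : ℤ × Word → Config
      config (c , ws) = Park.parked (decode c ws)

      code-config : ∀ {ω} → ω ∈ codes range → code (config ω) ≡ ω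
      code-config {c , ws} ω∈ = trans (code-parked (decode c ws)) (code-good (proj₂ (∈-codes⁻ range ω∈)))
        where
        code-good : ws ∈ words (good c) L → code (decode c ws) ≡ (c , ws)
        code-good ws∈ =
          let match , is-closed = ∧-true⁻ (proj₂ (∈-words⁻ (good c) L ws∈))
              #E≡ , #N≡ , _ = matches⁻ c m n a b ws match
          in Decoded.code-decode c ws is-closed #E≡ #N≡

      -- The first letter is read at the level of the code and adds it to one of the areas, so the
      -- level cannot leave `range`.
      code∈ : ∀ u → x-exponent u ≡ a → y-exponent u ≡ b → code u ∈ codes range
      code∈ u x≡ y≡ = ∈-codes⁺ range (proj₁ (code u))
        (s≤s (ℕ.≤-trans (starts⁻ (proj₁ (code u)) (proj₂ (code u)) refl) (ℕ.≤-trans (ℕ.≤-reflexive x≡) (ℕ.m≤m+n a b))))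
        (ℕ.≤-trans (starts⁺ (proj₁ (code u)) (proj₂ (code u)) refl) (ℕ.≤-trans (ℕ.≤-reflexive y≡) (ℕ.≤-trans (ℕ.m≤n+m b a) (ℕ.n≤1+n (a ℕ.+ b)))))
        (subst (λ l → proj₂ (code u) ∈ words (good (proj₁ (code u))) l) (word-length u (base u) L)
          (∈-words⁺ (good (proj₁ (code u))) (proj₂ (code u)) (∧-true⁺
            (matches⁺ (proj₁ (code u)) m n a b (proj₂ (code u)) #E≡ (code-#N u (base u)) x≡ y≡) (code-closed u))))
        where
        #E≡ : #E (word u (base u) L) ≡ m
        #E≡ = ℕ.+-cancelʳ-≡ n _ _ (trans (cong (#E (word u (base u) L) ℕ.+_) (sym (code-#N u (base u))))
          (trans (#E+#N (word u (base u) L)) (word-length u (base u) L)))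
        starts⁻ : ∀ c ws → length ws ≡ length (proj₂ (code u)) → neg c ℕ.≤ area⁻ c ws
        starts⁻ c (ℓ ∷ ws) _ = ℕ.m≤m+n (neg c) (area⁻ (move ℓ c) ws)
        starts⁺ : ∀ c ws → length ws ≡ length (proj₂ (code u)) → pos c ℕ.≤ area⁺ c ws
        starts⁺ c (ℓ ∷ ws) _ = ℕ.m≤m+n (pos c) (area⁺ (move ℓ c) ws)

      private
        unique-map : ∀ ωs → Unique ωs → (∀ {ω ω′} → ω ∈ ωs → ω′ ∈ ωs → (∀ c → config ω c ≡ config ω′ c) → ω ≡ ω′) →
          AllPairs (λ (u v : Config) → ¬ (∀ c → u c ≡ v c)) (map config ωs)
        unique-map []       []         inj = []
        unique-map (ω ∷ ωs) (ω∉ ∷ ωs!) inj =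
          All.map⁺ (All.tabulate (λ ω′∈ eq → All.lookup ω∉ ω′∈ (inj (here refl) (there ω′∈) eq))) ∷
          unique-map ωs ωs! (λ ω∈ ω′∈ → inj (there ω∈) (there ω′∈))

        any-config : ∀ (u : Config) ωs → Any (λ (v : Config) → ∀ c → u c ≡ v c) (map config ωs) → ∃[ ω ] ω ∈ ωs × (∀ c → u c ≡ config ω c)
        any-config u (ω ∷ ωs) (here eq)   = ω , here refl , eq
        any-config u (ω ∷ ωs) (there any) = let ω′ , ω′∈ , eq = any-config u ωs any in ω′ , there ω′∈ , eq

        config-any : ∀ (u : Config) {ω} ωs → ω ∈ ωs → (∀ c → u c ≡ config ω c) → Any (λ (v : Config) → ∀ c → u c ≡ v c) (map config ωs)
        config-any u (ω ∷ ωs) (here refl) eq = here eq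
        config-any u (ω ∷ ωs) (there ω∈)  eq = there (config-any u ωs ω∈ eq)

        sound : ∀ (u : Config) → Any (λ (v : Config) → ∀ c → u c ≡ v c) (map config (codes range)) → PS.ParkingSorted u × PS.HasMonomial u a b
        sound u any = described (any-config u (codes range) any)
          where
          described : (∃[ ω ] ω ∈ codes range × (∀ c → u c ≡ config ω c)) → PS.ParkingSorted u × PS.HasMonomial u a b
          described ((c , ws) , ω∈ , eq) =
            (normal⇒parking u (normal-cong (sym ∘ eq) (Park.parked-normal (decode c ws))) ,
              sorted-cong (sym ∘ eq) (Park.parked-sorted (decode c ws))) ,
            subst₂ (PS.HasMonomial u) x≡ y≡ (monomial u)
            where
            code≡ : code u ≡ (c , ws)
            code≡ = trans (code-cong eq) (code-config ω∈)
            areas : area⁻ c ws ≡ a × area⁺ c ws ≡ b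
            areas = proj₂ (proj₂ (matches⁻ c m n a b ws
              (proj₁ (∧-true⁻ (proj₂ (∈-words⁻ (good c) L (proj₂ (∈-codes⁻ range ω∈))))))))
            x≡ : x-exponent u ≡ a
            x≡ = trans (cong (λ ω → area⁻ (proj₁ ω) (proj₂ ω)) code≡) (proj₁ areas)
            y≡ : y-exponent u ≡ b
            y≡ = trans (cong (λ ω → area⁺ (proj₁ ω) (proj₂ ω)) code≡) (proj₂ areas)

        reconstruct : ∀ u ω → ω ∈ codes range → code u ≡ ω → Normal u → Sorted u → ∀ c → u c ≡ config ω c
        reconstruct u (c , ws) ω∈ eq normal sorted = code-injective {u} {config (c , ws)} normal sorted
          (Park.parked-normal (decode c ws)) (Park.parked-sorted (decode c ws)) (trans eq (sym (code-config ω∈)))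

        complete : ∀ (u : Config) → PS.ParkingSorted u × PS.HasMonomial u a b →
          Any (λ (v : Config) → ∀ c → u c ≡ v c) (map config (codes range))
        complete u ((parking , sorted) , mono) = config-any u (codes range) ω∈
          (reconstruct u (code u) ω∈ refl (parking⇒normal u parking) sorted)
          where
          ω∈ : code u ∈ codes range
          ω∈ = code∈ u (proj₁ (monomial-unique u mono)) (proj₂ (monomial-unique u mono))

      -- `code` and `config` are mutually inverse up to pointwise equality, by `code-config` and
      -- `code-injective`.
      cardinality : HasCardinality (PS.V →-setoid ℤ) (λ u → PS.ParkingSorted u × PS.HasMonomial u a b) (countConfigs m₁ n₁ a b)
      cardinality = map config (codes range) ,
        unique-map (codes range) (codes-unique range)
          (λ ω∈ ω′∈ eq → trans (sym (code-config ω∈)) (trans (code-cong eq) (code-config ω′∈))) ,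
        (λ u → mk⇔ (sound u) (complete u)) ,
        trans (List.length-map config (codes range)) (length-codes range)

open import Defs
open import Data.Product.Base using (∃-syntax; _×_; _,_)

-- The exponents are natural numbers for every configuration, since they are the numbers of points
-- of the gap and of the overlap.
configs-counted : IsKFamily Walks.countConfigs
configs-counted p q = (λ u _ → x-exponent p q u , y-exponent p q u , monomial p q u) , cardinality p q
  where open Configurations.Counting

theorem15p2 : ∃[ K ] ∃[ π ] IsKFamily K × IsP π ×
    (let F  = 𝓕[ K ]
         Px = P⟨x⟩[ π ]
         Py = P⟨y⟩[ π ]
     in F ≈ (1# - x * y) * (h * w - Px * Py)
          / (1# - x) * (1# - y) * (1# - h - w - Px - Py))
theorem15p2 = Walks.countConfigs , Walks.countPolyominoes ,
  configs-counted , Polyominoes.polyominoes-counted , SeriesIdentity.generatingFunction
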